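{- Let $t\geq1$, $k_1\geq k_2\geq t+2$, $n\geq2L(k_1,t)$ where $L(k,t)=(t+1)+(k-t+1)\log_2\big((t+1)(k-t+1)\big)$, and let $\mathcal{F}_1\subseteq\Pi_{k_1}(n)$ and $\mathcal{F}_2\subseteq\Pi_{k_2}(n)$ be non-trivial cross $t$-intersecting families. Then: (i) If $k_2\geq2t+2$ and $n\geq t+1+(k_1-t)(k_2-t)$, then $$|\mathcal{F}_1||\mathcal{F}_2|\leq\left(\sum_{j=1}^{k_2-t}(-1)^{j-1}\binom{k_2-t}{j}S(n-t-j,k_1-t-j)\right)\left(S(n-t,k_2-t)+t\right),$$ with equality if and only if $(\mathcal{F}_1,\mathcal{F}_2)\cong(\mathcal{A}(k_1,k_2,t),\mathcal{B}(k_2,t))$, or $k_1=k_2$ and $(\mathcal{F}_1,\mathcal{F}_2)\cong(\mathcal{B}(k_1,t),\mathcal{A}(k_2,k_1,t))$. (ii) If $k_2\leq2t+1$ and $(k_1,k_2)\notin\{(2t+1,2t+1),(4,3)\}$, then $$|\mathcal{F}_1||\mathcal{F}_2|\leq S(n-t-1,k_1-t-1)\left((t+1)S(n-t,k_2-t)-tS(n-t-1,k_2-t-1)\right),$$ with equality if and only if $(\mathcal{F}_1,\mathcal{F}_2)\cong(\mathcal{C}(k_1,t),\mathcal{D}(k_2,t))$, or $k_1=k_2$ and $(\mathcal{F}_1,\mathcal{F}_2)\cong(\mathcal{D}(k_1,t),\mathcal{C}(k_2,t))$.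
   Context: $[n]=\{1,\ldots,n\}$. A partition is a set of pairwise disjoint non-empty sets (blocks); a $k$-partition has $k$ blocks; $\Pi_k(n)$ is the set of $k$-partitions of $[n]$; $S(n,k)=|\Pi_k(n)|$ is the Stirling number of the second kind, with $S(n,a)=0$ for $a\leq0$. For partitions $P,Q$, $P\cap Q$ is the set of common blocks, $|P|$ the number of blocks, $\cup P$ the union of the blocks. For a family $\mathcal{F}$, $\cap\mathcal{F}$ is the set of blocks common to all members. $\mathcal{F}_1,\mathcal{F}_2$ are cross $t$-intersecting if $|F_1\cap F_2|\geq t$ for all $F_1\in\mathcal{F}_1,F_2\in\mathcal{F}_2$; non-trivial if $|(\cap\mathcal{F}_1)\cap(\cap\mathcal{F}_2)|<t$. $\cong$ means equal up to a single permutation of $[n]$ applied to both families. $[[m]]=\{\{1\},\ldots,\{m\}\}$. For an $\ell$-partition $M$ and $X\subseteq M$ with $|X|=t$: $\mathcal{A}(k,X,M)=\{F\in\Pi_k(n):X\subseteq F,\ F\cap(M\setminus X)\neq\emptyset\}$, $\mathcal{B}(\ell,X,M)=\{F\in\Pi_\ell(n):X\subseteq F\}\cup\{(M\setminus\{B\})\cup\{B\cup([n]\setminus\cup M)\}:B\in X\}$, $\mathcal{A}(k,\ell,t)=\mathcal{A}(k,[[t]],[[\ell]])$, $\mathcal{B}(\ell,t)=\mathcal{B}(\ell,[[t]],[[\ell]])$. For a $(t+1)$-partition $T$: $\mathcal{C}(k,T)=\{F\in\Pi_k(n):T\subseteq F\}$, $\mathcal{D}(\ell,T)=\{F\in\Pi_\ell(n):|T\cap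 F|\geq t\}$, $\mathcal{C}(k,t)=\mathcal{C}(k,[[t+1]])$, $\mathcal{D}(\ell,t)=\mathcal{D}(\ell,[[t+1]])$. -}

module Defs where

open import Data.Nat as ℕ using (ℕ; zero; suc; _+_; _*_; _∸_; _^_; _≤_; _<_)
open import Data.Nat.Combinatorics using (_C_)
open import Data.Integer as ℤ using (ℤ; +_)
open import Data.Bool using (Bool; true; false; _∧_; _∨_; not; _xor_; if_then_else_; T)
open import Data.Fin using (Fin; toℕ; _≟_)
open import Data.Fin.Subset using (Subset; ⁅_⁆)
open import Data.Vec as Vec using (Vec; []; _∷_; lookup; tabulate)
open import Data.List as List using (List; []; _∷_; length; _++_)
open import Data.List.Membership.Propositional using (_∈_)
open import Data.List.Relation.Unary.All using (All)
open import Data.List.Relation.Unary.Unique.Propositional using (Unique)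
open import Data.Fin.Permutation using (Permutation′; _⟨$⟩ʳ_)
open import Data.Product using (Σ; ∃; _×_; _,_)
open import Data.Sum using (_⊎_)
open import Relation.Binary.PropositionalEquality using (_≡_)
open import Relation.Nullary.Decidable using (⌊_⌋)
open import Function.Bundles using (_⇔_)
open import Data.Bool.ListAction renaming (all to allL; any to anyL)

allF : ∀ {n} → (Fin n → Bool) → Bool
allF f = allL f (List.allFin _)

anyF : ∀ {n} → (Fin n → Bool) → Bool
anyF f = anyL f (List.allFin _)

count : ∀ {a} {A : Set a} → (A → Bool) → List A → ℕ
count p xs = length (List.filterᵇ p xs)

_==ᵇ_ : Bool → Bool → Bool
a ==ᵇ b = not (a xor b)

allVecs : ∀ {a} {A : Set a} → List A → (m : ℕ) → List (Vec A m)
allVecs xs zero    = [] ∷ []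
allVecs xs (suc m) = List.concatMap (λ x → List.map (x ∷_) (allVecs xs m)) xs

allSubsets : (n : ℕ) → List (Subset n)
allSubsets n = allVecs (true ∷ false ∷ []) n

-- Partitions of [n].
-- A (candidate) partition of [n] = {0,…,n-1} is encoded by its
-- "same block" Boolean matrix R (R i j = true iff i and j lie in the
-- same block).  It is a genuine partition iff R is an equivalence
-- relation; its set of blocks is then the set of equivalence classes.
-- This encoding is canonical: two partitions are equal as sets of blocks
-- iff their matrices are propositionally equal.

Part : ℕ → Set
Part n = Vec (Vec Bool n) n

rel : ∀ {n} → Part n → Fin n → Fin n → Bool
rel R i j = lookup (lookup R i) j

isPartition : ∀ {n} → Part n → Bool
isPartition R =
  allF λ i → rel R i i ∧
    (allF λ j → (not (rel R i j) ∨ rel R j i) ∧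
      (allF λ k → not (rel R i j ∧ rel R j k) ∨ rel R i k))

isBlock : ∀ {n} → Part n → Subset n → Bool
isBlock R S =
  (anyF λ i → lookup S i) ∧
  (allF λ i → not (lookup S i) ∨ (allF λ j → lookup S j ==ᵇ rel R i j))

nBlocks : ∀ {n} → Part n → ℕ
nBlocks {n} P = count (isBlock P) (allSubsets n)

common : ∀ {n} → Part n → Part n → ℕ
common {n} P Q = count (λ S → isBlock P S ∧ isBlock Q S) (allSubsets n)

InΠ : ∀ {n} → ℕ → Part n → Set
InΠ k P = T (isPartition P) × nBlocks P ≡ k

allParts : (n : ℕ) → List (Part n)
allParts n = allVecs (allSubsets n) n

Stirling : ℕ → ℕ → ℕ
Stirling n zero    = 0
Stirling n (suc k) =
  count (λ P → isPartition P ∧ ⌊ nBlocks P ℕ.≟ suc k ⌋) (allParts n)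

Family : ∀ {n} → ℕ → List (Part n) → Set
Family k 𝓕 = Unique 𝓕 × All (InΠ k) 𝓕

CrossIntersecting : ∀ {n} → ℕ → List (Part n) → List (Part n) → Set
CrossIntersecting t 𝓕₁ 𝓕₂ =
  ∀ {F₁ F₂} → F₁ ∈ 𝓕₁ → F₂ ∈ 𝓕₂ → t ≤ common F₁ F₂

commonAll : ∀ {n} → List (Part n) → List (Part n) → ℕ
commonAll {n} 𝓕₁ 𝓕₂ =
  count (λ S → allL (λ F → isBlock F S) (𝓕₁ ++ 𝓕₂)) (allSubsets n)

NonTrivial : ∀ {n} → ℕ → List (Part n) → List (Part n) → Set
NonTrivial t 𝓕₁ 𝓕₂ = commonAll 𝓕₁ 𝓕₂ < t

act : ∀ {n} → Permutation′ n → Part n → Part n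
act σ R = tabulate λ i → tabulate λ j → rel R (σ ⟨$⟩ʳ i) (σ ⟨$⟩ʳ j)

Iso : ∀ {n} → List (Part n) → List (Part n) → (Part n → Set) → (Part n → Set) → Set
Iso {n} 𝓕₁ 𝓕₂ 𝓐 𝓑 =
  Σ (Permutation′ n) λ σ →
    (∀ P → (P ∈ 𝓕₁) ⇔ 𝓐 (act σ P)) × (∀ P → (P ∈ 𝓕₂) ⇔ 𝓑 (act σ P))

𝓐 : ∀ {n} → ℕ → ℕ → ℕ → Part n → Set
𝓐 {n} k ℓ t F =
  InΠ k F ×
  (∀ (i : Fin n) → toℕ i < t → T (isBlock F ⁅ i ⁆)) ×
  ∃ λ (i : Fin n) → t ≤ toℕ i × toℕ i < ℓ × T (isBlock F ⁅ i ⁆)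

bigBlock : ∀ {n} → ℕ → Fin n → Subset n
bigBlock ℓ b = tabulate λ x → ⌊ x ≟ b ⌋ ∨ ⌊ ℓ ℕ.≤? toℕ x ⌋

InModified : ∀ {n} → ℕ → Fin n → Subset n → Set
InModified {n} ℓ b S =
  (Σ (Fin n) λ i → toℕ i < ℓ × T (not ⌊ i ≟ b ⌋) × S ≡ ⁅ i ⁆) ⊎ S ≡ bigBlock ℓ b

𝓑 : ∀ {n} → ℕ → ℕ → Part n → Set
𝓑 {n} ℓ t F =
  (InΠ ℓ F × (∀ (i : Fin n) → toℕ i < t → T (isBlock F ⁅ i ⁆)))
  ⊎ (T (isPartition F) ×
     Σ (Fin n) λ b → toℕ b < t ×
       (∀ S → T (isBlock F S) ⇔ InModified ℓ b S))

𝓒 : ∀ {n} → ℕ → ℕ → Part n → Set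
𝓒 {n} k t F = InΠ k F × (∀ (i : Fin n) → toℕ i < suc t → T (isBlock F ⁅ i ⁆))

𝓓 : ∀ {n} → ℕ → ℕ → Part n → Set
𝓓 {n} ℓ t F =
  InΠ ℓ F ×
  t ≤ count (λ i → ⌊ toℕ i ℕ.<? suc t ⌋ ∧ isBlock F ⁅ i ⁆) (List.allFin n)

-- n ≥ 2 L(k,t),  L(k,t) = (t+1) + (k-t+1) log₂((t+1)(k-t+1)).
-- Since (t+1)(k-t+1) > 1, this is exactly equivalent to
-- 2(t+1) ≤ n  and  ((t+1)(k-t+1))^(2(k-t+1)) ≤ 2^(n - 2(t+1)).
LargeN : ℕ → ℕ → ℕ → Set
LargeN n k t =
  2 * (t + 1) ≤ n ×
  ((t + 1) * (k ∸ t + 1)) ^ (2 * (k ∸ t + 1)) ≤ 2 ^ (n ∸ 2 * (t + 1))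

sumFrom1 : ℕ → (ℕ → ℤ) → ℤ
sumFrom1 zero    f = + 0
sumFrom1 (suc m) f = sumFrom1 m f ℤ.+ f (suc m)

bound1 : ℕ → ℕ → ℕ → ℕ → ℤ
bound1 n k₁ k₂ t =
  sumFrom1 (k₂ ∸ t) (λ j →
    (ℤ.- + 1) ℤ.^ (j ∸ 1) ℤ.* + ((k₂ ∸ t) C j) ℤ.* + Stirling (n ∸ t ∸ j) (k₁ ∸ t ∸ j))
  ℤ.* (+ Stirling (n ∸ t) (k₂ ∸ t) ℤ.+ + t)

bound2 : ℕ → ℕ → ℕ → ℕ → ℤ
bound2 n k₁ k₂ t =
  + Stirling (n ∸ t ∸ 1) (k₁ ∸ t ∸ 1) ℤ.*
  (+ ((t + 1) * Stirling (n ∸ t) (k₂ ∸ t)) ℤ.- + (t * Stirling (n ∸ t ∸ 1) (k₂ ∸ t ∸ 1)))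

{-# OPTIONS --safe #-}
-- Count first.  Removing the blocks of H from a k-partition of n points leaves a partition of the
-- other points, so at most S(n - |H|, k - |H|) of them contain H; equality holds for singletons, and
-- a block with two points costs a factor k - |H|.  Largeness of n makes each quotient
-- S(m + 1, j) / S(m, j - 1) at least c², where c = (t + 1)(k₁ - t + 1).
--
-- Let T₁, T₂ be smallest covers (sets of blocks of which every member uses t) of F₁ and F₂, of
-- sizes t + x₁ and t + x₂.  A member of F₁ contains t blocks of T₁, and any k₂ - t + 1 blocks of a
-- member of F₂ include one of its blocks, so branching gives
--   |F₁| ≤ (t + 1)^x₁ (k₂ - t + 1)^x₂ S(n - t - x₂, k₁ - t - x₂),
-- and symmetrically.  Unless one family is a star (x₁ = 0 or x₂ = 0) the product is too small.
--
-- If F is a star over X and G₀ in G misses some of X, every F meets Z = G₀ \ X.  Let m count the B in Z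
-- for which X ∪ {B} covers G.  Then |F| is about m S(n - t - 1, k - t - 1), while m ≥ 2 forces
-- all but about S(n - t, l - t) members of G to be negligible.  Only m = 1, giving (C, D), and the largest
-- possible m = l - t, giving (A, B), come near the bound, and only for singletons is it met.  Stars
-- with k = t + 2 are treated apart, since there the quotients above degenerate.

module Submission where

open import Defs
open import Data.Nat hiding (_≟_; _≤ᵇ_; _<ᵇ_; _/_; _%_; NonTrivial)
import Data.Nat as ℕ
open import Data.Nat.Properties hiding (_≟_)
import Data.Nat.DivMod as DivMod
open import Data.Nat.Combinatorics using (_C_; nCk+nC[k+1]≡[n+1]C[k+1]; k>n⇒nCk≡0)
open import Data.Nat.ListAction using (sum)
open import Data.Nat.Tactic.RingSolver using (solve-∀)
import Data.Integer as ℤ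
open ℤ using (ℤ)
import Data.Integer.Properties as ℤₚ
import Data.Integer.Tactic.RingSolver as ℤ-Solver
open import Data.Bool using (Bool; true; false; _∧_; _∨_; not; if_then_else_; T)
open import Data.Bool.Properties using (T?; T-≡; T-∧; T-∨; T-not-≡)
import Data.Bool.Properties as Boolₚ
open import Data.Bool.ListAction renaming (all to allL; any to anyL)
open import Data.Unit using (tt)
open import Data.Empty using (⊥; ⊥-elim)
open import Data.Fin using (Fin; toℕ; fromℕ<; _≟_)
import Data.Fin as Fin
import Data.Fin.Properties as Finₚ
open import Data.Fin.Subset using (Subset; ⁅_⁆)
open import Data.Fin.Permutation using (Permutation′; _⟨$⟩ʳ_; _⟨$⟩ˡ_; permutation; inverseˡ; inverseʳ; flip)
open import Data.Vec as Vec using (Vec; lookup; tabulate)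
import Data.Vec.Properties as Vecₚ
open import Data.List as List using (List; []; _∷_; length; _++_; map; concatMap; filterᵇ; allFin; take)
import Data.List.Properties as Listₚ
open import Data.List.Membership.Propositional using (_∈_; _∉_; find; lose)
open import Data.List.Membership.Propositional.Properties
open import Data.List.Relation.Binary.Subset.Propositional using (_⊆_)
open import Data.List.Relation.Unary.All as All using (All; []; _∷_)
import Data.List.Relation.Unary.All.Properties as Allₚ
open import Data.List.Relation.Unary.Any as Any using (Any; here; there)
import Data.List.Relation.Unary.Any.Properties as Anyₚ
open import Data.List.Relation.Unary.AllPairs as AllPairs using (AllPairs; []; _∷_)
open import Data.List.Relation.Unary.Unique.Propositional using (Unique)
import Data.List.Relation.Unary.Unique.Propositional.Properties as Uniqueₚ
open import Data.Product using (Σ; ∃; _×_; _,_; proj₁; proj₂)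
open import Data.Sum using (_⊎_; inj₁; inj₂; [_,_]′)
open import Function using (_∘_; id; case_of_)
open import Function.Bundles using (_⇔_; mk⇔; Equivalence)
open import Relation.Binary.PropositionalEquality using (_≡_; _≢_; refl; sym; trans; cong; cong₂; subst; subst₂)
open import Relation.Binary using (DecidableEquality)
open import Relation.Nullary using (¬_; Dec; yes; no; contradiction)
open import Relation.Nullary.Decidable using (⌊_⌋; toWitness; fromWitness; _×-dec_; ¬?)
open Equivalence using (to; from)

open ≤-Reasoning

-- Products are measured in units of `φ * ψ`, where `φ` is S(n - t - 1, k₁ - t - 1) and `ψ` is S(n -
-- t, k₂ - t). To leading order (C, D) is worth t + 1 units and (A, B) is worth k₂ - t. With w the
-- larger of the two numbers, every configuration of another kind falls short of w units by more
-- than a quarter of a unit, and that quarter pays for the lower-order terms of the exact bounds.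
-- Two situations resist. If k₁ > k₂ and the star is the second family, the natural unit is a
-- different product, which has to be exchanged for the right one at a controlled rate. If k₂ = 2t +
-- 1, both values are t + 1 and the next order decides; the excluded pairs (2t + 1, 2t + 1) and (4,
-- 3) both belong to this case. A smallest cover is never computed. Each estimate either holds or
-- hands back a smaller cover, and the argument is repeated with that one; this is the origin of the
-- disjunctions in the branching lemmas.

_≡?_ : ∀ {n} → DecidableEquality (Subset n)
_≡?_ = Vecₚ.≡-dec Boolₚ._≟_

_≡ᴾ?_ : ∀ {n} → DecidableEquality (Part n)
_≡ᴾ?_ = Vecₚ.≡-dec _≡?_

-- Boolean reflection, and counting in lists without repetition

T-ext : ∀ {a b} → (T a → T b) → (T b → T a) → a ≡ b
T-ext {false} {false} _ _ = refl
T-ext {false} {true}  _ g = ⊥-elim (g tt)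
T-ext {true}  {false} f _ = ⊥-elim (f tt)
T-ext {true}  {true}  _ _ = refl

T-not⁻ : ∀ {b} → T (not b) → ¬ T b
T-not⁻ {false} _ ()

T-not⁺ : ∀ {b} → ¬ T b → T (not b)
T-not⁺ {false} _ = tt
T-not⁺ {true}  f = f tt

T-imp⁻ : ∀ {a b} → T (not a ∨ b) → T a → T b
T-imp⁻ {true} h _ = h

T-imp⁺ : ∀ {a b} → (T a → T b) → T (not a ∨ b)
T-imp⁺ {false} _ = tt
T-imp⁺ {true}  f = f tt

allF⁻ : ∀ {n} {f : Fin n → Bool} → T (allF f) → ∀ i → T (f i)
allF⁻ {f = f} h i = All.lookup (Allₚ.all⁺ f (allFin _) h) (∈-allFin i)

allF⁺ : ∀ {n} {f : Fin n → Bool} → (∀ i → T (f i)) → T (allF f)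
allF⁺ {f = f} h = Allₚ.all⁻ f {allFin _} (All.tabulate (λ {i} _ → h i))

anyF⁻ : ∀ {n} {f : Fin n → Bool} → T (anyF f) → ∃ λ i → T (f i)
anyF⁻ {f = f} h with find (Anyₚ.any⁻ f (allFin _) h)
... | i , _ , p = i , p

anyF⁺ : ∀ {n} {f : Fin n → Bool} i → T (f i) → T (anyF f)
anyF⁺ {f = f} i p = Anyₚ.any⁺ {xs = allFin _} f (lose (∈-allFin i) p)

sum-map-const : ∀ {A : Set} (K : ℕ) (Z : List A) → sum (map (λ _ → K) Z) ≡ length Z * K
sum-map-const K [] = refl
sum-map-const K (_ ∷ Z) = cong (K +_) (sum-map-const K Z)

≤-if : ∀ {P : Set} (d : Dec P) {x a b} → (P → x ≤ a) → (¬ P → x ≤ b) → x ≤ (if ⌊ d ⌋ then a else b)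
≤-if (yes p) f g = f p
≤-if (no ¬p) f g = g ¬p

module _ {A : Set} where

  allL⁻ : ∀ {p : A → Bool} {xs} → T (allL p xs) → ∀ {x} → x ∈ xs → T (p x)
  allL⁻ {p} h = All.lookup (Allₚ.all⁺ p _ h)

  allL⁺ : ∀ {p : A → Bool} {xs} → (∀ {x} → x ∈ xs → T (p x)) → T (allL p xs)
  allL⁺ {p} h = Allₚ.all⁻ p (All.tabulate h)

  anyL⁻ : ∀ {p : A → Bool} {xs} → T (anyL p xs) → ∃ λ x → x ∈ xs × T (p x)
  anyL⁻ {p} h = find (Anyₚ.any⁻ p _ h)

  anyL⁺ : ∀ {p : A → Bool} {xs x} → x ∈ xs → T (p x) → T (anyL p xs)
  anyL⁺ {p} x∈ h = Anyₚ.any⁺ p (lose x∈ h)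

  ∈-filterᵇ⁺ : ∀ {p : A → Bool} {x xs} → x ∈ xs → T (p x) → x ∈ filterᵇ p xs
  ∈-filterᵇ⁺ {p} = ∈-filter⁺ (T? ∘ p)

  ∈-filterᵇ⁻ : ∀ {p : A → Bool} {x xs} → x ∈ filterᵇ p xs → x ∈ xs × T (p x)
  ∈-filterᵇ⁻ {p} = ∈-filter⁻ (T? ∘ p)

  filterᵇ-unique : ∀ (p : A → Bool) {xs} → Unique xs → Unique (filterᵇ p xs)
  filterᵇ-unique p = Uniqueₚ.filter⁺ (T? ∘ p)

  ∷-unique : ∀ {x : A} {xs} → x ∉ xs → Unique xs → Unique (x ∷ xs)
  ∷-unique x∉ u = All.tabulate (λ { y∈ refl → x∉ y∈ }) ∷ u

  unique-⊆-length : ∀ {xs ys : List A} → Unique xs → xs ⊆ ys → length xs ≤ length ys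
  unique-⊆-length {[]} _ _ = z≤n
  unique-⊆-length {x ∷ xs} {ys} (x# ∷ u) sub with ∈-∃++ (sub (here refl))
  ... | as , bs , refl = begin
      suc (length xs)             ≤⟨ s≤s (unique-⊆-length u sub′) ⟩
      suc (length (as ++ bs))     ≡⟨ cong suc (Listₚ.length-++ as) ⟩
      suc (length as + length bs) ≡⟨ sym (+-suc (length as) (length bs)) ⟩
      length as + suc (length bs) ≡⟨ sym (Listₚ.length-++ as) ⟩
      length (as ++ x ∷ bs)       ∎
    where
    sub′ : xs ⊆ as ++ bs
    sub′ {z} z∈ with ∈-++⁻ as (sub (there z∈))
    ... | inj₁ z∈as = ∈-++⁺ˡ z∈as
    ... | inj₂ (here z≡x) = contradiction (sym z≡x) (All.lookup x# z∈)
    ... | inj₂ (there z∈bs) = ∈-++⁺ʳ as z∈bs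

  unique-≡-length : ∀ {xs ys : List A} → Unique xs → Unique ys → xs ⊆ ys → ys ⊆ xs → length xs ≡ length ys
  unique-≡-length u v s t = ≤-antisym (unique-⊆-length u s) (unique-⊆-length v t)

  unique-⊆-complete : DecidableEquality A → ∀ {xs ys : List A} → Unique xs →
                      xs ⊆ ys → length ys ≤ length xs → ys ⊆ xs
  unique-⊆-complete _≈?_ {xs} {ys} u sub len {y} y∈ with Any.any? (λ x → y ≈? x) xs
  ... | yes y∈xs = y∈xs
  ... | no y∉xs = contradiction (unique-⊆-length (∷-unique y∉xs u) (λ { (here refl) → y∈ ; (there z) → sub z })) (<⇒≱ (s≤s len))

  count-all : ∀ {p : A → Bool} {xs} → (∀ {x} → x ∈ xs → T (p x)) → count p xs ≡ length xs
  count-all {p} {[]} h = refl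
  count-all {p} {x ∷ xs} h with p x in eq
  ... | true  = cong suc (count-all (h ∘ there))
  ... | false = ⊥-elim (subst T eq (h (here refl)))

  count-≤-length : ∀ (p : A → Bool) xs → count p xs ≤ length xs
  count-≤-length p = Listₚ.length-filter (T? ∘ p)

  count-mono : ∀ {p q : A → Bool} xs → (∀ {x} → x ∈ xs → T (p x) → T (q x)) → count p xs ≤ count q xs
  count-mono [] h = z≤n
  count-mono {p} {q} (x ∷ xs) h with p x in eq | q x in eq′
  ... | true  | true  = s≤s (count-mono xs (h ∘ there))
  ... | true  | false = ⊥-elim (subst T eq′ (h (here refl) (subst T (sym eq) tt)))
  ... | false | true  = m≤n⇒m≤1+n (count-mono xs (h ∘ there))
  ... | false | false = count-mono xs (h ∘ there)

  count-cong : ∀ {p q : A → Bool} xs → (∀ {x} → x ∈ xs → T (p x) → T (q x)) →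
               (∀ {x} → x ∈ xs → T (q x) → T (p x)) → count p xs ≡ count q xs
  count-cong xs f g = ≤-antisym (count-mono xs f) (count-mono xs g)

  count-zero : ∀ {p : A → Bool} xs → (∀ {x} → x ∈ xs → ¬ T (p x)) → count p xs ≡ 0
  count-zero [] h = refl
  count-zero {p} (x ∷ xs) h with p x in eq
  ... | true  = ⊥-elim (h (here refl) (subst T (sym eq) tt))
  ... | false = count-zero xs (h ∘ there)

  count-witness : ∀ {p : A → Bool} xs → 1 ≤ count p xs → ∃ λ x → x ∈ xs × T (p x)
  count-witness {p} xs h with filterᵇ p xs in eq
  ... | x ∷ _ = x , ∈-filterᵇ⁻ (subst (x ∈_) (sym eq) (here refl))

  count-split : ∀ (p q : A → Bool) xs →
                count p xs ≡ count (λ x → p x ∧ q x) xs + count (λ x → p x ∧ not (q x)) xs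
  count-split p q [] = refl
  count-split p q (x ∷ xs) with p x | q x
  ... | true  | true  = cong suc (count-split p q xs)
  ... | true  | false = trans (cong suc (count-split p q xs)) (sym (+-suc _ _))
  ... | false | _     = count-split p q xs

  count-complement : ∀ (q : A → Bool) xs → length xs ≡ count q xs + count (not ∘ q) xs
  count-complement q xs = trans (sym (count-all {p = λ _ → true} {xs} (λ _ → tt))) (count-split (λ _ → true) q xs)

  -- The union bound, with a bound that may vary over `Z`. Elements caught by `r b` are split off
  -- before the tail is treated, so the remaining ones still have their witness in the tail.
  count-union : ∀ {B : Set} {p : A → Bool} (Z : List B) (r : B → A → Bool) (K : B → ℕ) xs →
                (∀ {x} → x ∈ xs → T (p x) → ∃ λ b → b ∈ Z × T (r b x)) →
                (∀ {b} → b ∈ Z → count (r b) xs ≤ K b) →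
                count p xs ≤ sum (map K Z)
  count-union [] r K xs h k = ≤-reflexive (count-zero xs (λ x∈ px → case proj₂ (h x∈ px) of λ { (() , _) }))
  count-union {B} {p} (b ∷ Z) r K xs h k = begin
      count p xs ≡⟨ count-split p (r b) xs ⟩
      count (λ x → p x ∧ r b x) xs + count (λ x → p x ∧ not (r b x)) xs
        ≤⟨ +-mono-≤ (≤-trans (count-mono xs (λ _ t → proj₂ (to T-∧ t))) (k (here refl)))
                    (count-union Z r K xs h′ (k ∘ there)) ⟩
      K b + sum (map K Z) ∎
    where
    h′ : ∀ {x} → x ∈ xs → T (p x ∧ not (r b x)) → ∃ λ b′ → b′ ∈ Z × T (r b′ x)
    h′ x∈ t with to T-∧ t
    ... | px , nr with h x∈ px
    ...   | b′ , here refl , q = contradiction q (T-not⁻ nr)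
    ...   | b′ , there m   , q = b′ , m , q

  sum-map-if : ∀ (g : A → Bool) (K L : ℕ) (Z : List A) →
               sum (map (λ b → if g b then K else L) Z) ≡ count g Z * K + count (not ∘ g) Z * L
  sum-map-if g K L [] = refl
  sum-map-if g K L (b ∷ Z) with g b
  ... | true  = trans (cong (K +_) (sum-map-if g K L Z)) (sym (+-assoc K _ _))
  ... | false = begin-equality
      L + sum (map (λ b → if g b then K else L) Z) ≡⟨ cong (L +_) (sum-map-if g K L Z) ⟩
      L + (count g Z * K + count (not ∘ g) Z * L)  ≡⟨ l L (count g Z * K) (count (not ∘ g) Z * L) ⟩
      count g Z * K + (L + count (not ∘ g) Z * L)  ∎
    where
    l : ∀ a b c → a + (b + c) ≡ b + (a + c)
    l = solve-∀

  count-union-const : ∀ {B : Set} {p : A → Bool} (Z : List B) (r : B → A → Bool) (K : ℕ) xs →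
                (∀ {x} → x ∈ xs → T (p x) → ∃ λ b → b ∈ Z × T (r b x)) →
                (∀ {b} → b ∈ Z → count (r b) xs ≤ K) →
                count p xs ≤ length Z * K
  count-union-const Z r K xs h k = ≤-trans (count-union Z r (λ _ → K) xs h k) (≤-reflexive (sum-map-const K Z))

  -- `r` reads off from an element of `h x` the label `g x` of its origin, so distinct labels keep
  -- the pieces apart. Labels are used because lists of blocks will be told apart through the
  -- partitions that they represent.
  concatMap-unique : ∀ {B C : Set} (h : A → List B) (g : A → C) (r : B → C) {xs} →
                     Unique (map g xs) → (∀ {x} → x ∈ xs → Unique (h x)) →
                     (∀ {x} → x ∈ xs → ∀ {y} → y ∈ h x → r y ≡ g x) →
                     Unique (concatMap h xs)
  concatMap-unique h g r {[]} _ _ _ = []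
  concatMap-unique h g r {x ∷ xs} (x# ∷ u) uh e =
    Uniqueₚ.++⁺ (uh (here refl)) (concatMap-unique h g r u (uh ∘ there) (e ∘ there))
      λ { (y∈ , y∈′) → case find (∈-concatMap⁻ h {xs = xs} y∈′) of
          λ { (x′ , x′∈ , y∈h) → All.lookup x# (∈-map⁺ g x′∈) (trans (sym (e (here refl) y∈)) (e (there x′∈) y∈h)) } }

  allVecs-complete : ∀ {xs : List A} {m} (v : Vec A m) → (∀ i → lookup v i ∈ xs) → v ∈ allVecs xs m
  allVecs-complete Vec.[] h = here refl
  allVecs-complete {xs} (x Vec.∷ v) h =
    ∈-concatMap⁺ (λ x → map (x Vec.∷_) (allVecs xs _)) (lose (h Fin.zero) (∈-map⁺ (x Vec.∷_) (allVecs-complete v (h ∘ Fin.suc))))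

  allVecs-unique : ∀ {xs : List A} m → Unique xs → Unique (allVecs xs m)
  allVecs-unique zero u = [] ∷ []
  allVecs-unique {xs} (suc m) u =
    concatMap-unique (λ x → map (x Vec.∷_) (allVecs xs m)) id Vec.head (subst Unique (sym (Listₚ.map-id xs)) u)
      (λ _ → Uniqueₚ.map⁺ Vecₚ.∷-injectiveʳ (allVecs-unique m u))
      (λ _ y∈ → case ∈-map⁻ (_ Vec.∷_) y∈ of λ { (_ , _ , refl) → refl })

count-map : ∀ {A B : Set} (p : B → Bool) (f : A → B) xs → count p (map f xs) ≡ count (p ∘ f) xs
count-map p f [] = refl
count-map p f (x ∷ xs) with p (f x)
... | true  = cong suc (count-map p f xs)
... | false = count-map p f xs

∈-allSubsets : ∀ {n} (S : Subset n) → S ∈ allSubsets n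
∈-allSubsets S = allVecs-complete S (λ i → mem (lookup S i))
  where
  mem : ∀ b → b ∈ true ∷ false ∷ []
  mem true  = here refl
  mem false = there (here refl)

allSubsets-unique : ∀ n → Unique (allSubsets n)
allSubsets-unique n = allVecs-unique n (((λ ()) ∷ []) ∷ [] ∷ [])

∈-allParts : ∀ {n} (P : Part n) → P ∈ allParts n
∈-allParts P = allVecs-complete P (λ i → ∈-allSubsets (lookup P i))

allParts-unique : ∀ n → Unique (allParts n)
allParts-unique n = allVecs-unique n (allSubsets-unique n)

-- Partitions containing given blocks

infix 4 _∋_

-- Wrapping the Boolean tests in records lets their arguments be inferred by unification.
record _∋_ {n} (S : Subset n) (i : Fin n) : Set where
  constructor mk∋
  field un∋ : T (lookup S i)
open _∋_

record Rel {n} (R : Part n) (i j : Fin n) : Set where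
  constructor mkRel
  field unRel : T (rel R i j)
open Rel

record Blk {n} (R : Part n) (S : Subset n) : Set where
  constructor mkBlk
  field unBlk : T (isBlock R S)
open Blk

_∋?_ : ∀ {n} (S : Subset n) i → Dec (S ∋ i)
S ∋? i with T? (lookup S i)
... | yes p = yes (mk∋ p)
... | no ¬p = no (¬p ∘ un∋)

∋-cast : ∀ {n} {S S′ : Subset n} {i j} → lookup S i ≡ lookup S′ j → S ∋ i → S′ ∋ j
∋-cast e (mk∋ p) = mk∋ (subst T e p)

subset-ext : ∀ {n} {S S′ : Subset n} → (∀ i → lookup S i ≡ lookup S′ i) → S ≡ S′
subset-ext {S = S} {S′} h = trans (sym (Vecₚ.tabulate∘lookup S)) (trans (Vecₚ.tabulate-cong h) (Vecₚ.tabulate∘lookup S′))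

part-≡ : ∀ {n} {P Q : Part n} → (∀ i j → rel P i j ≡ rel Q i j) → P ≡ Q
part-≡ {P = P} {Q} h =
  trans (sym (Vecₚ.tabulate∘lookup P)) (trans (Vecₚ.tabulate-cong (λ i → subset-ext (h i))) (Vecₚ.tabulate∘lookup Q))

matrix : ∀ {n} → (Fin n → Fin n → Bool) → Part n
matrix f = tabulate λ i → tabulate λ j → f i j

rel-matrix : ∀ {n} (f : Fin n → Fin n → Bool) i j → rel (matrix f) i j ≡ f i j
rel-matrix f i j = trans (cong (λ v → lookup v j) (Vecₚ.lookup∘tabulate _ i)) (Vecₚ.lookup∘tabulate _ j)

∋-⁅⁆⁺ : ∀ {n} (i : Fin n) → ⁅ i ⁆ ∋ i
∋-⁅⁆⁺ Fin.zero    = mk∋ tt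
∋-⁅⁆⁺ (Fin.suc i) = mk∋ (un∋ (∋-⁅⁆⁺ i))

∋-⁅⁆⁻ : ∀ {n} (i j : Fin n) → ⁅ i ⁆ ∋ j → j ≡ i
∋-⁅⁆⁻ Fin.zero    Fin.zero    _ = refl
∋-⁅⁆⁻ (Fin.suc i) (Fin.suc j) h = cong Fin.suc (∋-⁅⁆⁻ i j (mk∋ (un∋ h)))
∋-⁅⁆⁻ {suc n} Fin.zero (Fin.suc j) h = ⊥-elim (subst T (Vecₚ.lookup-replicate j false) (un∋ h))

⁅⁆-injective : ∀ {n} {i j : Fin n} → ⁅ i ⁆ ≡ ⁅ j ⁆ → i ≡ j
⁅⁆-injective {i = i} {j} e = ∋-⁅⁆⁻ j i (subst (_∋ i) e (∋-⁅⁆⁺ i))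

add : ∀ {n} → Fin n → Subset n → Subset n
add i S = S Vec.[ i ]≔ true

add-same : ∀ {n} i (S : Subset n) → add i S ∋ i
add-same i S = mk∋ (subst T (sym (Vecₚ.lookup∘update i S true)) tt)

add⁺ : ∀ {n} i (S : Subset n) {j} → S ∋ j → add i S ∋ j
add⁺ i S {j} h with j ≟ i
... | yes refl = add-same i S
... | no  j≢i  = ∋-cast (sym (Vecₚ.lookup∘update′ j≢i S true)) h

add⁻ : ∀ {n} i (S : Subset n) {j} → j ≢ i → add i S ∋ j → S ∋ j
add⁻ i S j≢i h = ∋-cast (Vecₚ.lookup∘update′ j≢i S true) h

record Equiv {n} (R : Part n) : Set where
  field
    r-refl  : ∀ i → Rel R i i
    r-sym   : ∀ {i j} → Rel R i j → Rel R j i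
    r-trans : ∀ {i j k} → Rel R i j → Rel R j k → Rel R i k
open Equiv

isPartition⁻ : ∀ {n} {R : Part n} → T (isPartition R) → Equiv R
isPartition⁻ {R = R} h = record
  { r-refl  = λ i → mkRel (proj₁ (to T-∧ (allF⁻ h i)))
  ; r-sym   = λ {i} {j} (mkRel p) → mkRel (T-imp⁻ (proj₁ (to T-∧ (allF⁻ (proj₂ (to T-∧ (allF⁻ h i))) j))) p)
  ; r-trans = λ {i} {j} {k} (mkRel p) (mkRel q) → mkRel
      (T-imp⁻ (allF⁻ (proj₂ (to (T-∧ {not (rel R i j) ∨ rel R j i}) (allF⁻ (proj₂ (to T-∧ (allF⁻ h i))) j))) k) (from T-∧ (p , q)))
  }

isPartition⁺ : ∀ {n} {R : Part n} → Equiv R → T (isPartition R)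
isPartition⁺ {R = R} e = allF⁺ λ i → from T-∧ (unRel (r-refl e i) , allF⁺ λ j →
  from T-∧ (T-imp⁺ (unRel ∘ r-sym e ∘ mkRel) , allF⁺ {f = λ k → not (rel R i j ∧ rel R j k) ∨ rel R i k}
    λ k → T-imp⁺ λ t → let p , q = to (T-∧ {rel R i j}) t in unRel (r-trans e (mkRel p) (mkRel q))))

==ᵇ⁻ : ∀ {a b} → T (a ==ᵇ b) → a ≡ b
==ᵇ⁻ {false} {false} _ = refl
==ᵇ⁻ {true}  {true}  _ = refl

==ᵇ⁺ : ∀ {a b} → a ≡ b → T (a ==ᵇ b)
==ᵇ⁺ {false} refl = tt
==ᵇ⁺ {true}  refl = tt

module _ {n} {R : Part n} {S : Subset n} where

  block-nonempty : Blk R S → ∃ λ i → S ∋ i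
  block-nonempty (mkBlk h) = let i , p = anyF⁻ (proj₁ (to T-∧ h)) in i , mk∋ p

  block-rel : Blk R S → ∀ {i} → S ∋ i → ∀ j → lookup S j ≡ rel R i j
  block-rel (mkBlk h) {i} (mk∋ p) j = ==ᵇ⁻ (allF⁻ (T-imp⁻ (allF⁻ (proj₂ (to (T-∧ {anyF (lookup S)}) h)) i) p) j)

  isBlock⁺ : (∃ λ i → S ∋ i) → (∀ {i} → S ∋ i → ∀ j → lookup S j ≡ rel R i j) → Blk R S
  isBlock⁺ (i , mk∋ p) h = mkBlk (from T-∧ (anyF⁺ i p ,
    allF⁺ {f = λ i → not (lookup S i) ∨ (allF λ j → lookup S j ==ᵇ rel R i j)} λ i → T-imp⁺ λ p →
    allF⁺ {f = λ j → lookup S j ==ᵇ rel R i j} λ j → ==ᵇ⁺ (h (mk∋ p) j)))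

block-unique : ∀ {n} {R : Part n} {S S′ i} → Blk R S → Blk R S′ → S ∋ i → S′ ∋ i → S ≡ S′
block-unique b b′ p p′ = subset-ext λ j → trans (block-rel b p j) (sym (block-rel b′ p′ j))

rowOf : ∀ {n} → Part n → Fin n → Subset n
rowOf R i = lookup R i

row∋⁺ : ∀ {n} {R : Part n} {i j} → Rel R i j → rowOf R i ∋ j
row∋⁺ (mkRel p) = mk∋ p

row∋⁻ : ∀ {n} {R : Part n} {i j} → rowOf R i ∋ j → Rel R i j
row∋⁻ (mk∋ p) = mkRel p

row-block : ∀ {n} {R : Part n} → Equiv R → ∀ i → Blk R (rowOf R i)
row-block {R = R} e i = isBlock⁺ (i , row∋⁺ (r-refl e i)) λ {j} p k →
  T-ext (λ q → unRel (r-trans e (r-sym e (row∋⁻ p)) (mkRel q))) (λ q → unRel (r-trans e (row∋⁻ p) (mkRel q)))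

-- One inclusion is enough: the row of `i` in `P` is a block of `P`, hence of `Q`, and a block of
-- `Q` containing `i` is the row of `i` in `Q`.
part-ext : ∀ {n} {P Q : Part n} → Equiv P → Equiv Q → (∀ S → Blk P S → Blk Q S) → P ≡ Q
part-ext {P = P} {Q} p q h = part-≡ λ i j → block-rel {R = Q} (h (rowOf P i) (row-block p i)) (row∋⁺ (r-refl p i)) j

blocks : ∀ {n} → Part n → List (Subset n)
blocks F = filterᵇ (isBlock F) (allSubsets _)

module _ {n} (F : Part n) where

  blocks-unique : Unique (blocks F)
  blocks-unique = filterᵇ-unique (isBlock F) (allSubsets-unique n)

  ∈-blocks⁺ : ∀ {S} → Blk F S → S ∈ blocks F
  ∈-blocks⁺ {S} (mkBlk h) = ∈-filterᵇ⁺ (∈-allSubsets S) h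

  ∈-blocks⁻ : ∀ {S} → S ∈ blocks F → Blk F S
  ∈-blocks⁻ m = mkBlk (proj₂ (∈-filterᵇ⁻ {xs = allSubsets n} m))

-- Partitions as lists of disjoint blocks, and their enumeration

Nonempty : ∀ {n} → Subset n → Set
Nonempty S = ∃ λ i → S ∋ i

Disj : ∀ {n} → Subset n → Subset n → Set
Disj S S′ = ∀ i → S ∋ i → ¬ S′ ∋ i

Covers : ∀ {n} → List (Subset n) → Fin n → Set
Covers bs i = ∃ λ S → S ∈ bs × S ∋ i

-- Covering all points is left out, so that prescribed blocks and a partition of the remaining
-- points can be handled separately and then appended.
Good : ∀ {n} → List (Subset n) → Set
Good bs = All Nonempty bs × AllPairs Disj bs

good-share : ∀ {n} {bs : List (Subset n)} → AllPairs Disj bs → ∀ {S S′ i} →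
             S ∈ bs → S′ ∈ bs → S ∋ i → S′ ∋ i → S ≡ S′
good-share (d ∷ ds) (here refl) (here refl) p q = refl
good-share (d ∷ ds) (here refl) (there m)   p q = contradiction q (All.lookup d m _ p)
good-share (d ∷ ds) (there m)   (here refl) p q = contradiction p (All.lookup d m _ q)
good-share (d ∷ ds) (there m)   (there m′)  p q = good-share ds m m′ p q

good-unique : ∀ {n} {bs : List (Subset n)} → Good bs → Unique bs
good-unique ([] , []) = []
good-unique ((i , p) ∷ ne , d ∷ ds) = ∷-unique (λ m → All.lookup d m i p p) (good-unique (ne , ds))

toRel : ∀ {n} → List (Subset n) → Fin n → Fin n → Bool
toRel bs i j = anyL (λ S → lookup S i ∧ lookup S j) bs

toPart : ∀ {n} → List (Subset n) → Part n
toPart bs = matrix (toRel bs)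

Joint : ∀ {n} → List (Subset n) → Fin n → Fin n → Set
Joint bs i j = ∃ λ S → S ∈ bs × S ∋ i × S ∋ j

toRel⁻ : ∀ {n} (bs : List (Subset n)) i j → T (toRel bs i j) → Joint bs i j
toRel⁻ bs i j h with anyL⁻ {xs = bs} h
... | S , m , p = let q , r = to (T-∧ {lookup S i}) p in S , m , mk∋ q , mk∋ r

toRel⁺ : ∀ {n} (bs : List (Subset n)) i j → Joint bs i j → T (toRel bs i j)
toRel⁺ bs i j (S , m , mk∋ p , mk∋ q) = anyL⁺ m (from T-∧ (p , q))

module _ {n} {bs : List (Subset n)} where

  toPart-rel : ∀ i j → rel (toPart bs) i j ≡ toRel bs i j
  toPart-rel = rel-matrix (toRel bs)

  toPart-block⁺ : Good bs → ∀ {S} → S ∈ bs → Blk (toPart bs) S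
  toPart-block⁺ (ne , d) {S} m = isBlock⁺ (All.lookup ne m) λ {i} p j →
    trans (T-ext (λ q → toRel⁺ bs i j (S , m , p , mk∋ q))
                 (λ q → case toRel⁻ bs i j q of λ { (S′ , m′ , p′ , q′) → un∋ (subst (_∋ j) (good-share d m′ m p′ p) q′) }))
          (sym (toPart-rel i j))

  toPart-block⁻ : Good bs → ∀ {S} → Blk (toPart bs) S → S ∈ bs
  toPart-block⁻ g {S} b with block-nonempty b
  ... | i , p with toRel⁻ bs i i (subst T (trans (block-rel b p i) (toPart-rel i i)) (un∋ p))
  ...   | S′ , m , p′ , _ = subst (_∈ bs) (sym (block-unique b (toPart-block⁺ g m) p p′)) m

  toPart-nBlocks : Good bs → nBlocks (toPart bs) ≡ length bs
  toPart-nBlocks g = unique-≡-length (blocks-unique (toPart bs)) (good-unique g)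
    (λ m → toPart-block⁻ g (∈-blocks⁻ (toPart bs) m)) (λ m → ∈-blocks⁺ (toPart bs) (toPart-block⁺ g m))

  toPart-Rel⁺ : ∀ {i j} → Joint bs i j → Rel (toPart bs) i j
  toPart-Rel⁺ {i} {j} h = mkRel (subst T (sym (toPart-rel i j)) (toRel⁺ bs i j h))

  toPart-Rel⁻ : ∀ {i j} → Rel (toPart bs) i j → Joint bs i j
  toPart-Rel⁻ {i} {j} (mkRel h) = toRel⁻ bs i j (subst T (toPart-rel i j) h)

  toPart-equiv : Good bs → (∀ i → Covers bs i) → Equiv (toPart bs)
  toPart-equiv (ne , d) c = record
    { r-refl  = λ i → let S , m , p = c i in toPart-Rel⁺ (S , m , p , p)
    ; r-sym   = λ q → let S , m , p , p′ = toPart-Rel⁻ q in toPart-Rel⁺ (S , m , p′ , p)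
    ; r-trans = λ {i} {j} {k} q r →
        let S , m , p , p′ = toPart-Rel⁻ q ; S₂ , m₂ , p₂ , p₂′ = toPart-Rel⁻ r in
        toPart-Rel⁺ (S , m , p , subst (_∋ k) (good-share d m₂ m p₂ p′) p₂′)
    }

-- The recurrence that asks whether the first point is alone in its block. It needs `S2 0 0 = 1`,
-- whereas `Stirling 0 0` is 0; this is the only disagreement between the two functions.
S2 : ℕ → ℕ → ℕ
S2 zero    zero    = 1
S2 zero    (suc k) = 0
S2 (suc m) zero    = 0
S2 (suc m) (suc k) = S2 m k + suc k * S2 m (suc k)

-- One result for each block that may receive `i`; this accounts for the factor `suc k` in the
-- recurrence.
insertions : ∀ {n} → Fin n → List (Subset n) → List (List (Subset n))
insertions i []       = []
insertions i (S ∷ bs) = (add i S ∷ bs) ∷ map (S ∷_) (insertions i bs)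

-- Lists the partitions of the points `is` into k blocks, once each, as lists of blocks.
gen : ∀ {n} → ℕ → List (Fin n) → List (List (Subset n))
gen zero    []       = [] ∷ []
gen (suc k) []       = []
gen zero    (i ∷ is) = []
gen (suc k) (i ∷ is) = map (⁅ i ⁆ ∷_) (gen k is) ++ concatMap (insertions i) (gen (suc k) is)

insertions-length : ∀ {n} (i : Fin n) bs → length (insertions i bs) ≡ length bs
insertions-length i [] = refl
insertions-length i (S ∷ bs) = cong suc (trans (Listₚ.length-map (S ∷_) (insertions i bs)) (insertions-length i bs))

-- The effect of an insertion on the set of blocks, with the position in the list forgotten; `S` is
-- the block that receives `i`.
record InsertedAt {n} (i : Fin n) (bs bs′ : List (Subset n)) (S : Subset n) : Set where
  field
    old∈     : S ∈ bs
    new∈     : add i S ∈ bs′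
    new-from : ∀ {B} → B ∈ bs′ → B ≡ add i S ⊎ B ∈ bs
    old-from : ∀ {B} → B ∈ bs → B ≡ S ⊎ B ∈ bs′
open InsertedAt

inserted-here : ∀ {n} (i : Fin n) S bs → InsertedAt i (S ∷ bs) (add i S ∷ bs) S
inserted-here i S bs = record
  { old∈ = here refl ; new∈ = here refl
  ; new-from = λ { (here e) → inj₁ e ; (there m) → inj₂ (there m) }
  ; old-from = λ { (here e) → inj₁ e ; (there m) → inj₂ (there m) } }

inserted-there : ∀ {n} {i : Fin n} {S bs bs′} S₀ → InsertedAt i bs bs′ S → InsertedAt i (S₀ ∷ bs) (S₀ ∷ bs′) S
inserted-there S₀ I = record
  { old∈ = there (old∈ I) ; new∈ = there (new∈ I)
  ; new-from = λ { (here e) → inj₂ (here e) ; (there m) → [ inj₁ , inj₂ ∘ there ]′ (new-from I m) }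
  ; old-from = λ { (here e) → inj₂ (here e) ; (there m) → [ inj₁ , inj₂ ∘ there ]′ (old-from I m) } }

insertions⁺ : ∀ {n} (i : Fin n) {S bs} → S ∈ bs → ∃ λ bs′ → bs′ ∈ insertions i bs × InsertedAt i bs bs′ S
insertions⁺ i {bs = S ∷ bs} (here refl) = _ , here refl , inserted-here i S bs
insertions⁺ i {bs = S₀ ∷ bs} (there m) with insertions⁺ i m
... | bs′ , m′ , I = _ , there (∈-map⁺ (S₀ ∷_) m′) , inserted-there S₀ I

insertions⁻ : ∀ {n} {i : Fin n} {bs bs′} → bs′ ∈ insertions i bs → ∃ λ S → InsertedAt i bs bs′ S
insertions⁻ {i = i} {bs = S ∷ bs} (here refl) = S , inserted-here i S bs
insertions⁻ {i = i} {bs = S₀ ∷ bs} (there m) with ∈-map⁻ (S₀ ∷_) m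
... | bs′ , m′ , refl with insertions⁻ m′
...   | S , I = S , inserted-there S₀ I

insertions-size : ∀ {n} {i : Fin n} {bs bs′} → bs′ ∈ insertions i bs → length bs′ ≡ length bs
insertions-size {bs = S ∷ bs} (here refl) = refl
insertions-size {i = i} {bs = S ∷ bs} (there m) with ∈-map⁻ (S ∷_) m
... | bs′ , m′ , refl = cong suc (insertions-size m′)

disj-add : ∀ {n} {i : Fin n} {S B} → ¬ B ∋ i → Disj S B → Disj (add i S) B
disj-add {i = i} {S} ¬p d j p q with j ≟ i
... | yes refl = ¬p q
... | no j≢i = d j (add⁻ i S j≢i p) q

insertions-good : ∀ {n} {i : Fin n} {bs bs′} → Good bs → (∀ {B} → B ∈ bs → ¬ B ∋ i) → bs′ ∈ insertions i bs → Good bs′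
insertions-good {i = i} {S ∷ bs} ((j , p) ∷ ne , d ∷ ds) out (here refl) =
  (i , add-same i S) ∷ ne , All.tabulate (λ m → disj-add (out (there m)) (All.lookup d m)) ∷ ds
insertions-good {i = i} {S ∷ bs} (j ∷ ne , d ∷ ds) out (there m) with ∈-map⁻ (S ∷_) m
... | bs′ , m′ , refl with insertions-good (ne , ds) (out ∘ there) m′ | insertions⁻ m′
...   | ne′ , ds′ | S′ , I = j ∷ ne′ , All.tabulate dis ∷ ds′
  where
  dis : ∀ {B} → B ∈ bs′ → Disj S B
  dis B∈ with new-from I B∈
  ... | inj₁ refl = λ k p q → disj-add (out (here refl)) (λ l x y → All.lookup d (old∈ I) l y x) k q p
  ... | inj₂ B∈bs = All.lookup d B∈bs

gen-length : ∀ {n} k (is : List (Fin n)) → length (gen k is) ≡ S2 (length is) k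
gen-size : ∀ {n} k (is : List (Fin n)) {bs} → bs ∈ gen k is → length bs ≡ k

gen-length zero    []       = refl
gen-length (suc k) []       = refl
gen-length zero    (i ∷ is) = refl
gen-length (suc k) (i ∷ is) = begin-equality
  length (map (⁅ i ⁆ ∷_) (gen k is) ++ concatMap (insertions i) (gen (suc k) is))
    ≡⟨ Listₚ.length-++ (map (⁅ i ⁆ ∷_) (gen k is)) ⟩
  length (map (⁅ i ⁆ ∷_) (gen k is)) + length (concatMap (insertions i) (gen (suc k) is))
    ≡⟨ cong₂ _+_ (trans (Listₚ.length-map _ (gen k is)) (gen-length k is)) (l (gen (suc k) is) (gen-size (suc k) is)) ⟩
  S2 (length is) k + length (gen (suc k) is) * suc k
    ≡⟨ cong (S2 (length is) k +_) (trans (*-comm _ (suc k)) (cong (suc k *_) (gen-length (suc k) is))) ⟩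
  S2 (length is) k + suc k * S2 (length is) (suc k) ∎
  where
  open ≤-Reasoning
  l : ∀ L → (∀ {bs} → bs ∈ L → length bs ≡ suc k) → length (concatMap (insertions i) L) ≡ length L * suc k
  l [] h = refl
  l (bs ∷ L) h = trans (Listₚ.length-++ (insertions i bs))
    (cong₂ _+_ (trans (insertions-length i bs) (h (here refl))) (l L (h ∘ there)))

gen-size zero [] (here refl) = refl
gen-size (suc k) (i ∷ is) m with ∈-++⁻ (map (⁅ i ⁆ ∷_) (gen k is)) m
... | inj₁ m₁ with ∈-map⁻ (⁅ i ⁆ ∷_) m₁
...   | bs , m′ , refl = cong suc (gen-size k is m′)
gen-size (suc k) (i ∷ is) m | inj₂ m₂ with find (∈-concatMap⁻ (insertions i) {xs = gen (suc k) is} m₂)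
... | bs , m′ , ins = trans (insertions-size ins) (gen-size (suc k) is m′)

gen-good : ∀ {n} k {is : List (Fin n)} {bs} → Unique is → bs ∈ gen k is →
           Good bs × (∀ j → Covers bs j → j ∈ is) × (∀ {j} → j ∈ is → Covers bs j)
gen-good zero {[]} u (here refl) = ([] , []) , (λ { j (_ , () , _) }) , λ ()
gen-good (suc k) {i ∷ is} (i# ∷ u) m with ∈-++⁻ (map (⁅ i ⁆ ∷_) (gen k is)) m
... | inj₁ m₁ with ∈-map⁻ (⁅ i ⁆ ∷_) m₁
...   | bs , m′ , refl with gen-good k u m′
...     | (ne , d) , c⁻ , c⁺ =
  ((i , ∋-⁅⁆⁺ i) ∷ ne , All.tabulate (λ {B} B∈ j p q → contradiction refl (All.lookup i# (subst (_∈ is) (∋-⁅⁆⁻ i j p) (c⁻ j (B , B∈ , q))))) ∷ d) ,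
  (λ { j (_ , here refl , p) → here (∋-⁅⁆⁻ i j p) ; j (B , there B∈ , p) → there (c⁻ j (B , B∈ , p)) }) ,
  (λ { (here refl) → ⁅ i ⁆ , here refl , ∋-⁅⁆⁺ i ; (there j∈) → let B , B∈ , p = c⁺ j∈ in B , there B∈ , p })
gen-good (suc k) {i ∷ is} (i# ∷ u) m | inj₂ m₂ with find (∈-concatMap⁻ (insertions i) {xs = gen (suc k) is} m₂)
... | bs , m′ , ins with gen-good (suc k) u m′ | insertions⁻ ins
...   | g , c⁻ , c⁺ | S , I =
  insertions-good g (λ B∈ p → contradiction refl (All.lookup i# (c⁻ i (_ , B∈ , p)))) ins , cov⁻ , cov⁺
  where
  cov⁻ : ∀ j → Covers _ j → j ∈ i ∷ is
  cov⁻ j (B , B∈ , p) with j ≟ i | new-from I B∈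
  ... | yes j≡i | _ = here j≡i
  ... | no j≢i | inj₁ refl = there (c⁻ j (S , old∈ I , add⁻ i S j≢i p))
  ... | no j≢i | inj₂ B∈bs = there (c⁻ j (B , B∈bs , p))
  cov⁺ : ∀ {j} → j ∈ i ∷ is → Covers _ j
  cov⁺ (here refl) = add i S , new∈ I , add-same i S
  cov⁺ (there j∈) with c⁺ j∈
  ... | B , B∈ , p with old-from I B∈
  ...   | inj₁ refl = add i S , new∈ I , add⁺ i S p
  ...   | inj₂ B∈′ = B , B∈′ , p

-- `R` is an equivalence relation on `is` and false elsewhere, because the induction removes points
-- from the list while the ambient `Fin n` stays fixed. Deleting the first point `i` gives `R′`;
-- then `i` is either alone or joins the block of any `j` related to it.
gen-complete : ∀ {n} (is : List (Fin n)) → Unique is → (R : Fin n → Fin n → Bool) →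
  (∀ {x} → x ∈ is → T (R x x)) → (∀ {x y} → T (R x y) → x ∈ is) →
  (∀ {x y} → T (R x y) → T (R y x)) → (∀ {x y z} → T (R x y) → T (R y z) → T (R x z)) →
  ∃ λ k → ∃ λ bs → bs ∈ gen k is × (∀ x y → toRel bs x y ≡ R x y)
gen-complete [] u R rf dom sy tr = 0 , [] , here refl , λ x y → T-ext (λ ()) (λ p → case dom p of λ ())
gen-complete {n} (i ∷ is) (i# ∷ u) R rf dom sy tr = extend (Any.any? (λ j → T? (R i j)) is)
  where
  i∉ : i ∉ is
  i∉ m = All.lookup i# m refl
  R′ : Fin n → Fin n → Bool
  R′ x y = R x y ∧ (not ⌊ x ≟ i ⌋ ∧ not ⌊ y ≟ i ⌋)
  ≢⁺ : ∀ {x} → x ≢ i → T (not ⌊ x ≟ i ⌋)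
  ≢⁺ {x} h with x ≟ i
  ... | yes e = contradiction e h
  ... | no _ = tt
  ≢⁻ : ∀ {x} → T (not ⌊ x ≟ i ⌋) → x ≢ i
  ≢⁻ {x} h with x ≟ i
  ... | no e = e
  R′⁺ : ∀ {x y} → T (R x y) → x ≢ i → y ≢ i → T (R′ x y)
  R′⁺ p q r = from T-∧ (p , from T-∧ (≢⁺ q , ≢⁺ r))
  R′⁻ : ∀ {x y} → T (R′ x y) → T (R x y) × x ≢ i × y ≢ i
  R′⁻ {x} {y} p = let a , b = to (T-∧ {R x y}) p ; c , d = to (T-∧ {not ⌊ x ≟ i ⌋}) b in a , ≢⁻ c , ≢⁻ d
  tail∈ : ∀ {x} → x ≢ i → x ∈ i ∷ is → x ∈ is
  tail∈ h (here e) = contradiction e h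
  tail∈ h (there m) = m
  ih = gen-complete is u R′ (λ x∈ → R′⁺ (rf (there x∈)) (λ { refl → i∉ x∈ }) (λ { refl → i∉ x∈ }))
    (λ p → let a , b , c = R′⁻ p in tail∈ b (dom a)) (λ p → let a , b , c = R′⁻ p in R′⁺ (sy a) c b)
    (λ p q → let a , b , c = R′⁻ p ; a′ , _ , c′ = R′⁻ q in R′⁺ (tr a a′) b c′)
  k = proj₁ ih
  bs = proj₁ (proj₂ ih)
  bs∈ = proj₁ (proj₂ (proj₂ ih))
  bsR = proj₂ (proj₂ (proj₂ ih))
  shr : ∀ {S S′ x} → S ∈ bs → S′ ∈ bs → S ∋ x → S′ ∋ x → S ≡ S′
  shr = good-share (proj₂ (proj₁ (gen-good k u bs∈)))
  in-bs : ∀ {x y} → T (R x y) → x ≢ i → y ≢ i → Joint bs x y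
  in-bs {x} {y} p q r = toRel⁻ bs x y (subst T (sym (bsR x y)) (R′⁺ p q r))
  from-bs : ∀ {x y S} → S ∈ bs → S ∋ x → S ∋ y → T (R x y) × x ≢ i × y ≢ i
  from-bs {x} {y} m p q = R′⁻ (subst T (bsR x y) (toRel⁺ bs x y (_ , m , p , q)))
  extend : Dec (Any (λ j → T (R i j)) is) → ∃ λ k → ∃ λ bs → bs ∈ gen k (i ∷ is) × (∀ x y → toRel bs x y ≡ R x y)
  extend (no none) = suc k , ⁅ i ⁆ ∷ bs , ∈-++⁺ˡ (∈-map⁺ (⁅ i ⁆ ∷_) bs∈) , λ x y → T-ext (fwd ∘ toRel⁻ _ x y) (toRel⁺ _ x y ∘ bwd)
    where
    fwd : ∀ {x y} → Joint (⁅ i ⁆ ∷ bs) x y → T (R x y)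
    fwd {x} {y} (_ , here refl , p , q) with ∋-⁅⁆⁻ i x p | ∋-⁅⁆⁻ i y q
    ... | refl | refl = rf (here refl)
    fwd (S , there m , p , q) = proj₁ (from-bs m p q)
    only : ∀ {y} → T (R i y) → y ≡ i
    only {y} p with dom (sy p)
    ... | here e = e
    ... | there m = contradiction (lose m p) none
    bwd : ∀ {x y} → T (R x y) → Joint (⁅ i ⁆ ∷ bs) x y
    bwd {x} {y} h with x ≟ i | y ≟ i
    ... | yes refl | yes refl = ⁅ i ⁆ , here refl , ∋-⁅⁆⁺ i , ∋-⁅⁆⁺ i
    ... | yes refl | no y≢i = contradiction (only h) y≢i
    ... | no x≢i | yes refl = contradiction (only (sy h)) x≢i
    ... | no x≢i | no y≢i = let S , m , p , q = in-bs h x≢i y≢i in S , there m , p , q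
  extend (yes some) with find some
  ... | j , j∈ , Rij with in-bs (rf (there j∈)) (λ { refl → i∉ j∈ }) (λ { refl → i∉ j∈ })
  ...   | S , S∈ , j∈S , _ with insertions⁺ i S∈
  ...     | bs′ , bs′∈ , I = ins-case k bs∈
    where
    toj : ∀ {x} → add i S ∋ x → T (R x j)
    toj {x} p with x ≟ i
    ... | yes refl = Rij
    ... | no x≢i = proj₁ (from-bs S∈ (add⁻ i S x≢i p) j∈S)
    fwd : ∀ {x y} → Joint bs′ x y → T (R x y)
    fwd (B , B∈ , p , q) with new-from I B∈
    ... | inj₁ refl = tr (toj p) (sy (toj q))
    ... | inj₂ B∈bs = proj₁ (from-bs B∈bs p q)
    inS : ∀ {y} → T (R i y) → y ≢ i → S ∋ y
    inS {y} h y≢i with in-bs (tr (sy Rij) h) (λ { refl → i∉ j∈ }) y≢i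
    ... | S′ , m , p , q = subst (_∋ y) (shr m S∈ p j∈S) q
    bwd : ∀ {x y} → T (R x y) → Joint bs′ x y
    bwd {x} {y} h with x ≟ i | y ≟ i
    ... | yes refl | yes refl = _ , new∈ I , (add-same i S) , (add-same i S)
    ... | yes refl | no y≢i = _ , new∈ I , (add-same i S) , (add⁺ i S (inS h y≢i))
    ... | no x≢i | yes refl = _ , new∈ I , (add⁺ i S (inS (sy h) x≢i)) , (add-same i S)
    ... | no x≢i | no y≢i with in-bs h x≢i y≢i
    ...   | B , m , p , q with old-from I m
    ...     | inj₁ refl = _ , new∈ I , (add⁺ i S p) , (add⁺ i S q)
    ...     | inj₂ B∈′ = _ , B∈′ , p , q
    -- The split on `k` lets `gen` unfold; a list that contains `S` does not have length 0.
    ins-case : ∀ k → bs ∈ gen k is → ∃ λ k → ∃ λ bs → bs ∈ gen k (i ∷ is) × (∀ x y → toRel bs x y ≡ R x y)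
    ins-case zero m = contradiction (subst (1 ≤_) (gen-size zero is m) (∈-length S∈)) λ ()
    ins-case (suc k) m = suc k , bs′ ,
      ∈-++⁺ʳ (map (⁅ i ⁆ ∷_) (gen k is)) (∈-concatMap⁺ (insertions i) (lose m bs′∈)) , λ x y → T-ext (fwd ∘ toRel⁻ _ x y) (toRel⁺ _ x y ∘ bwd)

map-unique-via : ∀ {A B C : Set} (h : A → B) (g : A → C) (r : B → C) {xs} →
  (∀ {x} → x ∈ xs → r (h x) ≡ g x) → Unique (map g xs) → Unique (map h xs)
map-unique-via h g r {[]} e u = []
map-unique-via h g r {x ∷ xs} e (x# ∷ u) =
  ∷-unique (λ m → case ∈-map⁻ h m of λ { (y , y∈ , q) →
      All.lookup x# (∈-map⁺ g y∈) (trans (sym (e (here refl))) (trans (cong r q) (e (there y∈)))) })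
    (map-unique-via h g r (e ∘ there) u)

-- A discarded point is not even related to itself, which is also what `toPart` gives for a list of
-- blocks that does not cover it.
restrict : ∀ {n} → (Fin n → Bool) → Part n → Part n
restrict d M = matrix λ x y → rel M x y ∧ (d x ∧ d y)

restrict-toPart : ∀ {n} (d : Fin n → Bool) (bs bs′ : List (Subset n)) →
  (∀ {x y} → Joint bs′ x y → T (d x) → T (d y) → Joint bs x y) →
  (∀ {x y} → Joint bs x y → Joint bs′ x y × T (d x) × T (d y)) →
  restrict d (toPart bs′) ≡ toPart bs
restrict-toPart d bs bs′ f g = part-≡ λ x y → trans (rel-matrix _ x y)
  (trans (T-ext (λ h → let p , q = to (T-∧ {rel (toPart bs′) x y}) h ; q₁ , q₂ = to (T-∧ {d x}) q in
                   toRel⁺ bs x y (f (toPart-Rel⁻ (mkRel p)) q₁ q₂))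
                (λ h → let a , b , c = g (toRel⁻ bs x y h) in from T-∧ (unRel (toPart-Rel⁺ a) , from T-∧ (b , c))))
         (sym (toPart-rel {bs = bs} x y)))

rowOf-toPart : ∀ {n} {bs : List (Subset n)} → Good bs → ∀ {S i} → S ∈ bs → S ∋ i → rowOf (toPart bs) i ≡ S
rowOf-toPart {bs = bs} g {S} {i} m p = subset-ext λ j → sym (block-rel (toPart-block⁺ g m) p j)

≢ᵇ : ∀ {n} → Fin n → Fin n → Bool
≢ᵇ i x = not ⌊ x ≟ i ⌋

≢ᵇ⁺ : ∀ {n} {i x : Fin n} → x ≢ i → T (≢ᵇ i x)
≢ᵇ⁺ {i = i} {x} h with x ≟ i
... | yes e = contradiction e h
... | no _ = tt

≢ᵇ⁻ : ∀ {n} {i x : Fin n} → T (≢ᵇ i x) → x ≢ i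
≢ᵇ⁻ {i = i} {x} h with x ≟ i
... | no e = e

insertions-rows : ∀ {n} (i : Fin n) bs → Good bs → (∀ {B} → B ∈ bs → ¬ B ∋ i) →
  map (λ bs′ → rowOf (toPart bs′) i) (insertions i bs) ≡ map (add i) bs
insertions-rows i [] g out = refl
insertions-rows i (S ∷ bs) g@(_ ∷ ne , _ ∷ ds) out = cong₂ _∷_
  (rowOf-toPart (insertions-good g out (here refl)) (here refl) (add-same i S))
  (trans (sym (Listₚ.map-∘ (insertions i bs)))
    (trans (map-cong-∈ (insertions i bs) λ {bs′} m → let S′ , I = insertions⁻ m in
              trans (rowOf-toPart (insertions-good g out (there (∈-map⁺ (S ∷_) m))) (there (new∈ I)) (add-same i S′))
                (sym (rowOf-toPart (insertions-good (ne , ds) (out ∘ there) m) (new∈ I) (add-same i S′))))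
      (insertions-rows i bs (ne , ds) (out ∘ there))))
  where
  map-cong-∈ : ∀ {A B : Set} {f g : A → B} xs → (∀ {x} → x ∈ xs → f x ≡ g x) → map f xs ≡ map g xs
  map-cong-∈ [] h = refl
  map-cong-∈ (x ∷ xs) h = cong₂ _∷_ (h (here refl)) (map-cong-∈ xs (h ∘ there))

-- Deleting `i` recovers the partition of the other points (`left`, `insert-restrict`), the row of
-- `i` distinguishes the insertions into one list (`children`), and whether that row is `⁅ i ⁆`
-- separates the two kinds of lists (`apart`).
gen-unique : ∀ {n} k (is : List (Fin n)) → Unique is → Unique (map toPart (gen k is))
gen-unique zero [] u = [] ∷ []
gen-unique (suc k) [] u = []
gen-unique zero (i ∷ is) u = []
gen-unique {n} (suc k) (i ∷ is) (i# ∷ u) =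
  subst Unique (sym (Listₚ.map-++ toPart (map (⁅ i ⁆ ∷_) (gen k is)) (concatMap (insertions i) (gen (suc k) is))))
    (Uniqueₚ.++⁺ left right λ { (m , m′) → apart m m′ })
  where
  i∉ : i ∉ is
  i∉ m = All.lookup i# m refl
  fresh : ∀ k {bs} → bs ∈ gen k is → ∀ {B} → B ∈ bs → ¬ B ∋ i
  fresh k m B∈ p = i∉ (proj₁ (proj₂ (gen-good k u m)) i (_ , B∈ , p))
  good : ∀ k {bs} → bs ∈ gen k is → Good bs
  good k m = proj₁ (gen-good k u m)
  ≢i : ∀ {B j} → ¬ B ∋ i → B ∋ j → j ≢ i
  ≢i ¬p q refl = ¬p q
  single-good : ∀ {bs} → bs ∈ gen k is → Good (⁅ i ⁆ ∷ bs)
  single-good m = let ne , ds = good k m in ((i , ∋-⁅⁆⁺ i) ∷ ne) ,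
    (All.tabulate (λ {B} B∈ j p q → fresh k m B∈ (subst (B ∋_) (∋-⁅⁆⁻ i j p) q)) ∷ ds)
  left : Unique (map toPart (map (⁅ i ⁆ ∷_) (gen k is)))
  left = subst Unique (Listₚ.map-∘ (gen k is))
    (map-unique-via (toPart ∘ (⁅ i ⁆ ∷_)) toPart (restrict (≢ᵇ i))
      (λ {bs} m → restrict-toPart (≢ᵇ i) bs (⁅ i ⁆ ∷ bs)
        (λ { {x} (_ , here refl , p , q) d _ → contradiction (∋-⁅⁆⁻ i x p) (≢ᵇ⁻ d)
           ; (B , there m′ , p , q) _ _ → B , m′ , p , q })
        (λ { (B , m′ , p , q) → (B , there m′ , p , q) , ≢ᵇ⁺ (≢i (fresh k m m′) p) , ≢ᵇ⁺ (≢i (fresh k m m′) q) }))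
      (gen-unique k is u))
  insert-restrict : ∀ {bs bs′} → bs ∈ gen (suc k) is → bs′ ∈ insertions i bs → restrict (≢ᵇ i) (toPart bs′) ≡ toPart bs
  insert-restrict {bs} {bs′} m m′ = let S , I = insertions⁻ m′ in restrict-toPart (≢ᵇ i) bs bs′
    (λ { (B , B∈ , p , q) d e → case new-from I B∈ of λ
         { (inj₁ refl) → S , old∈ I , add⁻ i S (≢ᵇ⁻ d) p , add⁻ i S (≢ᵇ⁻ e) q ; (inj₂ B∈′) → B , B∈′ , p , q } })
    (λ { (B , B∈ , p , q) → (case old-from I B∈ of λ
         { (inj₁ refl) → _ , new∈ I , add⁺ i S p , add⁺ i S q ; (inj₂ B∈′) → B , B∈′ , p , q }) ,
         ≢ᵇ⁺ (≢i (fresh (suc k) m B∈) p) , ≢ᵇ⁺ (≢i (fresh (suc k) m B∈) q) })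
  children : ∀ {bs} → bs ∈ gen (suc k) is → Unique (map toPart (insertions i bs))
  children {bs} m = map-unique-via toPart (λ bs′ → rowOf (toPart bs′) i) (λ M → rowOf M i) (λ _ → refl)
    (subst Unique (sym (insertions-rows i bs (good (suc k) m) (fresh (suc k) m))) (adds bs (fresh (suc k) m) (good-unique (good (suc k) m))))
    where
    add-inj : ∀ {S S′} → ¬ S ∋ i → ¬ S′ ∋ i → add i S ≡ add i S′ → S ≡ S′
    add-inj {S} {S′} ¬p ¬q e = subset-ext λ j → T-ext
      (λ p → un∋ (add⁻ i S′ (≢i {S} ¬p (mk∋ p)) (subst (_∋ j) e (add⁺ i S (mk∋ p)))))
      (λ p → un∋ (add⁻ i S (≢i {S′} ¬q (mk∋ p)) (subst (_∋ j) (sym e) (add⁺ i S′ (mk∋ p)))))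
    adds : ∀ bs → (∀ {B} → B ∈ bs → ¬ B ∋ i) → Unique bs → Unique (map (add i) bs)
    adds [] out u = []
    adds (S ∷ bs) out (S# ∷ u) = ∷-unique
      (λ m → case ∈-map⁻ (add i) m of λ { (S′ , m′ , e) → All.lookup S# m′ (add-inj (out (here refl)) (out (there m′)) e) })
      (adds bs (out ∘ there) u)
  right : Unique (map toPart (concatMap (insertions i) (gen (suc k) is)))
  right = subst Unique (sym (Listₚ.map-concatMap toPart (insertions i) (gen (suc k) is)))
    (concatMap-unique (map toPart ∘ insertions i) toPart (restrict (≢ᵇ i)) (gen-unique (suc k) is u) children
      (λ m y∈ → case ∈-map⁻ toPart y∈ of λ { (bs′ , m′ , refl) → insert-restrict m m′ }))
  apart : ∀ {M} → M ∈ map toPart (map (⁅ i ⁆ ∷_) (gen k is)) → M ∈ map toPart (concatMap (insertions i) (gen (suc k) is)) → ⊥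
  apart m m′ with ∈-map⁻ toPart m | ∈-map⁻ toPart m′
  ... | b₁ , n₁ , refl | b₂ , n₂ , e with ∈-map⁻ (⁅ i ⁆ ∷_) n₁ | find (∈-concatMap⁻ (insertions i) {xs = gen (suc k) is} n₂)
  ...   | c₁ , l₁ , refl | c₂ , l₂ , ins with insertions⁻ ins
  ...     | S , I = contradiction (∋-⁅⁆⁻ i j (subst (_∋ j) (sym eq) (add⁺ i S p))) (≢i (fresh (suc k) l₂ (old∈ I)) p)
    where
    j = proj₁ (All.lookup (proj₁ (good (suc k) l₂)) (old∈ I))
    p = proj₂ (All.lookup (proj₁ (good (suc k) l₂)) (old∈ I))
    eq : ⁅ i ⁆ ≡ add i S
    eq = trans (sym (rowOf-toPart (single-good l₁) (here refl) (∋-⁅⁆⁺ i))) (trans (cong (λ M → rowOf M i) e)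
      (rowOf-toPart (insertions-good (good (suc k) l₂) (fresh (suc k) l₂) ins) (new∈ I) (add-same i S)))

hasAll : ∀ {n} → List (Subset n) → Part n → Bool
hasAll H F = allL (isBlock F) H

record Contains {n} (F : Part n) (H : List (Subset n)) : Set where
  constructor mkContains
  field blk : ∀ {B} → B ∈ H → Blk F B
open Contains

contains⁻ : ∀ {n} {F : Part n} H → T (hasAll H F) → Contains F H
contains⁻ H h = mkContains λ m → mkBlk (allL⁻ {xs = H} h m)

contains⁺ : ∀ {n} {F : Part n} H → Contains F H → T (hasAll H F)
contains⁺ H c = allL⁺ λ m → unBlk (blk c m)

cnt : ∀ {n} → List (Part n) → List (Subset n) → ℕ
cnt 𝓕 H = count (hasAll H) 𝓕

record IsΠ {n} (k : ℕ) (F : Part n) : Set where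
  constructor mkΠ
  field
    equiv : Equiv F
    size  : nBlocks F ≡ k
open IsΠ

InΠ⇒IsΠ : ∀ {n k} {F : Part n} → InΠ k F → IsΠ k F
InΠ⇒IsΠ (p , s) = mkΠ (isPartition⁻ p) s

IsΠ⇒InΠ : ∀ {n k} {F : Part n} → IsΠ k F → InΠ k F
IsΠ⇒InΠ f = isPartition⁺ (equiv f) , size f

covered : ∀ {n} → List (Subset n) → Fin n → Bool
covered H x = anyL (λ S → lookup S x) H

covered⁻ : ∀ {n} (H : List (Subset n)) {x} → T (covered H x) → Covers H x
covered⁻ H h = let S , m , p = anyL⁻ {xs = H} h in S , m , mk∋ p

covered⁺ : ∀ {n} (H : List (Subset n)) {x} → Covers H x → T (covered H x)
covered⁺ H (S , m , mk∋ p) = anyL⁺ m p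

outside : ∀ {n} → List (Subset n) → List (Fin n)
outside H = filterᵇ (not ∘ covered H) (allFin _)

∈-outside⁺ : ∀ {n} (H : List (Subset n)) {x} → ¬ Covers H x → x ∈ outside H
∈-outside⁺ H {x} h = ∈-filterᵇ⁺ (∈-allFin x) (T-not⁺ (h ∘ covered⁻ H))

∈-outside⁻ : ∀ {n} (H : List (Subset n)) {x} → x ∈ outside H → ¬ Covers H x
∈-outside⁻ {n} H m c = T-not⁻ (proj₂ (∈-filterᵇ⁻ {xs = allFin n} m)) (covered⁺ H c)

outside-unique : ∀ {n} (H : List (Subset n)) → Unique (outside H)
outside-unique {n} H = filterᵇ-unique (not ∘ covered H) (Uniqueₚ.allFin⁺ n)

contains-good : ∀ {n} {F : Part n} {H} → Unique H → Contains F H → Good H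
contains-good {H = []} u c = [] , []
contains-good {H = S ∷ H} (S# ∷ u) c =
  let ne , ds = contains-good u (mkContains (blk c ∘ there)) in
  block-nonempty (blk c (here refl)) ∷ ne ,
  All.tabulate (λ m i p q → All.lookup S# m (block-unique (blk c (here refl)) (blk c (there m)) p q)) ∷ ds

good-++ : ∀ {n} {bs cs : List (Subset n)} → Good bs → Good cs →
          (∀ {S B} → S ∈ bs → B ∈ cs → Disj S B) → Good (bs ++ cs)
good-++ {bs = []} g g′ d = g′
good-++ {bs = S ∷ bs} {cs} (p ∷ ne , d ∷ ds) g′ dis =
  let ne′ , ds′ = good-++ (ne , ds) g′ (dis ∘ there) in
  p ∷ ne′ , All.tabulate (λ m → [ All.lookup d , dis (here refl) ]′ (∈-++⁻ bs m)) ∷ ds′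

gen-outside-good : ∀ {n} {H : List (Subset n)} {k bs} → Good H → bs ∈ gen k (outside H) →
  Good (H ++ bs) × (∀ i → Covers (H ++ bs) i)
gen-outside-good {n} {H} {k} {bs} gH m with gen-good k (outside-unique H) m
... | g , c⁻ , c⁺ = good-++ gH g (λ {S} {B} S∈ B∈ i p q → ∈-outside⁻ H (c⁻ i (B , B∈ , q)) (S , S∈ , p)) , cov
  where
  cov : ∀ i → Covers (H ++ bs) i
  cov i with T? (covered H i)
  ... | yes c = let S , S∈ , p = covered⁻ H c in S , ∈-++⁺ˡ S∈ , p
  ... | no ¬c = let B , B∈ , p = c⁺ (∈-outside⁺ H (¬c ∘ covered⁺ H)) in B , ∈-++⁺ʳ H B∈ , p

-- The relation of `F` on the points outside `H` is enumerated by `gen-complete` with an unknown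
-- number `k′` of blocks; comparing `nBlocks` on both sides identifies `k′` afterwards.
decompose : ∀ {n k} {F : Part n} {H} → IsΠ k F → Unique H → Contains F H →
  F ∈ map (toPart ∘ (H ++_)) (gen (k ∸ length H) (outside H))
decompose {n} {k} {F} {H} f u c = result (gen-complete (outside H) (outside-unique H) R rf dom sy tr)
  where
  e = equiv f
  R : Fin n → Fin n → Bool
  R x y = rel F x y ∧ (not (covered H x) ∧ not (covered H y))
  R⁺ : ∀ {x y} → Rel F x y → ¬ Covers H x → ¬ Covers H y → T (R x y)
  R⁺ (mkRel p) a b = from T-∧ (p , from T-∧ (T-not⁺ (a ∘ covered⁻ H) , T-not⁺ (b ∘ covered⁻ H)))
  R⁻ : ∀ {x y} → T (R x y) → Rel F x y × ¬ Covers H x × ¬ Covers H y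
  R⁻ {x} {y} h = let p , q = to (T-∧ {rel F x y}) h ; a , b = to (T-∧ {not (covered H x)}) q in
    mkRel p , T-not⁻ a ∘ covered⁺ H , T-not⁻ b ∘ covered⁺ H
  rf : ∀ {x} → x ∈ outside H → T (R x x)
  rf m = R⁺ (r-refl e _) (∈-outside⁻ H m) (∈-outside⁻ H m)
  dom : ∀ {x y} → T (R x y) → x ∈ outside H
  dom h = ∈-outside⁺ H (proj₁ (proj₂ (R⁻ h)))
  sy : ∀ {x y} → T (R x y) → T (R y x)
  sy h = let p , a , b = R⁻ h in R⁺ (r-sym e p) b a
  tr : ∀ {x y z} → T (R x y) → T (R y z) → T (R x z)
  tr h h′ = let p , a , b = R⁻ h ; p′ , a′ , b′ = R⁻ h′ in R⁺ (r-trans e p p′) a b′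
  result : (∃ λ k′ → ∃ λ bs → bs ∈ gen k′ (outside H) × (∀ x y → toRel bs x y ≡ R x y)) →
           F ∈ map (toPart ∘ (H ++_)) (gen (k ∸ length H) (outside H))
  result (k′ , bs , m , eqR) = subst (_∈ _) (sym F≡) (∈-map⁺ (toPart ∘ (H ++_)) (subst (λ j → bs ∈ gen j (outside H)) k′≡ m))
    where
    gH = contains-good u c
    good = gen-outside-good {H = H} {k′} gH m
    fwd : ∀ {x y} → Rel F x y → Joint (H ++ bs) x y
    fwd {x} {y} p with T? (covered H x)
    ... | yes cx = let S , S∈ , q = covered⁻ H cx in S , ∈-++⁺ˡ S∈ , q , mk∋ (subst T (sym (block-rel (blk c S∈) q y)) (unRel p))
    ... | no ¬cx = let B , B∈ , q , r = toRel⁻ bs x y (subst T (sym (eqR x y)) (R⁺ p (¬cx ∘ covered⁺ H) ¬cy)) in B , ∈-++⁺ʳ H B∈ , q , r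
      where
      ¬cy : ¬ Covers H y
      ¬cy (S , S∈ , q) = ¬cx (covered⁺ H (S , S∈ , mk∋ (subst T (sym (block-rel (blk c S∈) q x)) (unRel (r-sym e p)))))
    bwd : ∀ {x y} → Joint (H ++ bs) x y → Rel F x y
    bwd {x} {y} (S , S∈ , p , q) with ∈-++⁻ H S∈
    ... | inj₁ S∈H = mkRel (subst T (block-rel (blk c S∈H) p y) (un∋ q))
    ... | inj₂ S∈bs = proj₁ (R⁻ (subst T (eqR x y) (toRel⁺ bs x y (S , S∈bs , p , q))))
    F≡ : F ≡ toPart (H ++ bs)
    F≡ = part-≡ λ x y → T-ext (λ p → unRel (toPart-Rel⁺ (fwd (mkRel p)))) (λ p → unRel (bwd (toPart-Rel⁻ (mkRel p))))
    k′≡ : k′ ≡ k ∸ length H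
    k′≡ = trans (sym (m+n∸m≡n (length H) k′)) (cong (_∸ length H) (begin-equality
      length H + k′        ≡⟨ cong (length H +_) (sym (gen-size k′ (outside H) m)) ⟩
      length H + length bs ≡⟨ sym (Listₚ.length-++ H) ⟩
      length (H ++ bs)     ≡⟨ sym (toPart-nBlocks (proj₁ good)) ⟩
      nBlocks (toPart (H ++ bs)) ≡⟨ cong nBlocks (sym F≡) ⟩
      nBlocks F            ≡⟨ size f ⟩
      k                    ∎))
      where open ≤-Reasoning

IsFam : ∀ {n} → ℕ → List (Part n) → Set
IsFam k 𝓕 = Unique 𝓕 × (∀ {F} → F ∈ 𝓕 → IsΠ k F)

cnt-outside : ∀ {n k} {𝓕 : List (Part n)} {H} → IsFam k 𝓕 → Unique H → cnt 𝓕 H ≤ S2 (length (outside H)) (k ∸ length H)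
cnt-outside {n} {k} {𝓕} {H} (u𝓕 , fam) u = begin
  cnt 𝓕 H ≤⟨ unique-⊆-length (filterᵇ-unique (hasAll H) u𝓕)
               (λ m → let F∈ , h = ∈-filterᵇ⁻ {xs = 𝓕} m in decompose (fam F∈) u (contains⁻ H h)) ⟩
  length (map (toPart ∘ (H ++_)) (gen (k ∸ length H) (outside H))) ≡⟨ Listₚ.length-map _ (gen (k ∸ length H) (outside H)) ⟩
  length (gen (k ∸ length H) (outside H)) ≡⟨ gen-length (k ∸ length H) (outside H) ⟩
  S2 (length (outside H)) (k ∸ length H) ∎
  where open ≤-Reasoning

-- The points `is` of `S` leave the outside when `S` is added. One point for each block gives
-- `outside-size`; two points for a larger block give `outside-size-multi`.
outside-shrink : ∀ {n} (H : List (Subset n)) {S is} → Unique is →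
  (∀ {i} → i ∈ is → S ∋ i) → (∀ {i} → i ∈ is → ¬ Covers H i) →
  length is + length (outside (S ∷ H)) ≤ length (outside H)
outside-shrink H {S} {is} u inS fresh = subst (_≤ length (outside H)) (Listₚ.length-++ is)
  (unique-⊆-length
    (Uniqueₚ.++⁺ u (outside-unique (S ∷ H)) λ { (m , m′) → ∈-outside⁻ (S ∷ H) m′ (S , here refl , inS m) })
    λ m → case ∈-++⁻ is m of λ
      { (inj₁ m₁) → ∈-outside⁺ H (fresh m₁)
      ; (inj₂ m₂) → ∈-outside⁺ H (λ { (B , B∈ , p) → ∈-outside⁻ (S ∷ H) m₂ (B , there B∈ , p) }) })

outside-size : ∀ {n} {H : List (Subset n)} → Good H → length H + length (outside H) ≤ n
outside-size {n} {[]} g = ≤-trans (count-≤-length _ (allFin n)) (≤-reflexive (Listₚ.length-tabulate id))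
outside-size {n} {S ∷ H} ((i , p) ∷ ne , d ∷ ds) = begin
  suc (length H) + length (outside (S ∷ H)) ≡⟨ sym (+-suc (length H) _) ⟩
  length H + (1 + length (outside (S ∷ H)))
    ≤⟨ +-monoʳ-≤ (length H) (outside-shrink H ([] ∷ []) (λ { (here refl) → p }) (λ { (here refl) (B , B∈ , q) → All.lookup d B∈ i p q })) ⟩
  length H + length (outside H) ≤⟨ outside-size (ne , ds) ⟩
  n ∎
  where open ≤-Reasoning

Multi : ∀ {n} → Subset n → Set
Multi S = ∃ λ i → ∃ λ j → i ≢ j × S ∋ i × S ∋ j

outside-size-multi : ∀ {n} {H : List (Subset n)} → Good H → ∀ {B} → B ∈ H → Multi B → suc (length H + length (outside H)) ≤ n
outside-size-multi {n} {S ∷ H} (_ ∷ ne , d ∷ ds) (here refl) (i , j , i≢j , p , q) = begin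
  suc (suc (length H) + length (outside (S ∷ H))) ≡⟨ l (length H) _ ⟩
  length H + (2 + length (outside (S ∷ H)))
    ≤⟨ +-monoʳ-≤ (length H) (outside-shrink H {is = i ∷ j ∷ []} ((i≢j ∷ []) ∷ [] ∷ [])
         (λ { (here refl) → p ; (there (here refl)) → q })
         (λ { (here refl) (B , B∈ , r) → All.lookup d B∈ i p r ; (there (here refl)) (B , B∈ , r) → All.lookup d B∈ j q r })) ⟩
  length H + length (outside H) ≤⟨ outside-size (ne , ds) ⟩
  n ∎
  where
  open ≤-Reasoning
  l : ∀ a b → suc (suc a + b) ≡ a + (2 + b)
  l = solve-∀
outside-size-multi {n} {S ∷ H} ((i , p) ∷ ne , d ∷ ds) (there m) mul = begin
  suc (suc (length H) + length (outside (S ∷ H))) ≡⟨ l (length H) _ ⟩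
  suc (length H + (1 + length (outside (S ∷ H))))
    ≤⟨ s≤s (+-monoʳ-≤ (length H) (outside-shrink H ([] ∷ []) (λ { (here refl) → p }) (λ { (here refl) (B , B∈ , q) → All.lookup d B∈ i p q }))) ⟩
  suc (length H + length (outside H)) ≤⟨ outside-size-multi (ne , ds) m mul ⟩
  n ∎
  where
  open ≤-Reasoning
  l : ∀ a b → suc (suc a + b) ≡ suc (a + (1 + b))
  l = solve-∀

S2-mult : ∀ m k → suc k * S2 m (suc k) ≤ S2 (suc m) (suc k)
S2-mult m k = m≤n+m _ (S2 m k)

S2-step : ∀ m k → S2 m (suc k) ≤ S2 (suc m) (suc k)
S2-step m k = ≤-trans (m≤m+n (S2 m (suc k)) (k * S2 m (suc k))) (S2-mult m k)

-- Zero blocks must be avoided: `S2 0 0 = 1` but `S2 1 0 = 0`.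
S2-mono : ∀ {m m′} k → m ≤ m′ → S2 m (suc k) ≤ S2 m′ (suc k)
S2-mono k le = go (≤⇒≤′ le)
  where
  go : ∀ {m m′} → m ≤′ m′ → S2 m (suc k) ≤ S2 m′ (suc k)
  go (≤′-reflexive refl) = ≤-refl
  go (≤′-step {n} le) = ≤-trans (go le) (S2-step n k)

-- A k-partition is determined by all its blocks, which S2 m 0 = 0 fails to record for m > 0.
bnd : ℕ → ℕ → ℕ
bnd m zero    = 1
bnd m (suc k) = S2 m (suc k)

S2≤bnd : ∀ {m m′} k → m ≤ m′ → S2 m k ≤ bnd m′ k
S2≤bnd {zero}  zero le = ≤-refl
S2≤bnd {suc m} zero le = z≤n
S2≤bnd (suc k) le = S2-mono k le

cnt-zero : ∀ {n} {𝓕 : List (Part n)} {H} → (∀ {F} → F ∈ 𝓕 → ¬ Contains F H) → cnt 𝓕 H ≡ 0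
cnt-zero {𝓕 = 𝓕} {H} h = count-zero 𝓕 (λ F∈ c → h F∈ (contains⁻ H c))

cnt-cases : ∀ {n} (𝓕 : List (Part n)) H → cnt 𝓕 H ≡ 0 ⊎ ∃ λ F → F ∈ 𝓕 × Contains F H
cnt-cases 𝓕 H with 1 ≤? cnt 𝓕 H
... | yes h = let F , F∈ , c = count-witness 𝓕 h in inj₂ (F , F∈ , contains⁻ H c)
... | no h = inj₁ (n<1⇒n≡0 (≰⇒> h))

module _ {n k} {𝓕 : List (Part n)} (fam : IsFam k 𝓕) where

  -- Only a member that contains `H` shows that the sets in `H` are nonempty and disjoint, and this
  -- is what limits the number of points left over. Hence the separate case in which there is no
  -- such member.
  cnt-bound : ∀ {H} → Unique H → cnt 𝓕 H ≤ bnd (n ∸ length H) (k ∸ length H)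
  cnt-bound {H} u = [ (λ e → subst (_≤ _) (sym e) z≤n)
    , (λ { (F , F∈ , c) → ≤-trans (cnt-outside fam u) (S2≤bnd (k ∸ length H) (out≤ F c)) }) ]′ (cnt-cases 𝓕 H)
    where
    out≤ : ∀ F → Contains F H → length (outside H) ≤ n ∸ length H
    out≤ F c = m+n≤o⇒m≤o∸n (length (outside H)) (subst (_≤ n) (+-comm (length H) _) (outside-size (contains-good u c)))

  -- A block with two points leaves one point fewer for the other blocks, and by `S2-mult` one point
  -- fewer costs a factor equal to the number of those blocks.
  cnt-bound-multi : ∀ {H B} → Unique H → B ∈ H → Multi B →
    (k ∸ length H) * cnt 𝓕 H ≤ bnd (n ∸ length H) (k ∸ length H)
  cnt-bound-multi {H} {B} u B∈ mul = [ (λ e → ≤-trans (≤-reflexive (trans (cong ((k ∸ length H) *_) e) (*-zeroʳ (k ∸ length H)))) z≤n)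
    , (λ { (F , F∈ , c) → step (k ∸ length H) (out≤ F c) (cnt-outside fam u) }) ]′ (cnt-cases 𝓕 H)
    where
    out≤ : ∀ F → Contains F H → suc (length (outside H)) ≤ n ∸ length H
    out≤ F c = m+n≤o⇒m≤o∸n (suc (length (outside H)))
      (subst (_≤ n) (cong suc (+-comm (length H) _)) (outside-size-multi (contains-good u c) B∈ mul))
    step : ∀ r {c o m} → suc o ≤ m → c ≤ S2 o r → r * c ≤ bnd m r
    step zero _ _ = z≤n
    step (suc r) {o = o} le h = ≤-trans (*-monoʳ-≤ (suc r) h) (≤-trans (S2-mult o r) (S2-mono r le))

Πlist : ∀ {n} → ℕ → List (Part n)
Πlist {n} k = filterᵇ (λ P → isPartition P ∧ ⌊ nBlocks P ℕ.≟ k ⌋) (allParts n)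

∈-Πlist⁺ : ∀ {n k} {F : Part n} → IsΠ k F → F ∈ Πlist k
∈-Πlist⁺ {k = k} {F} (mkΠ e s) = ∈-filterᵇ⁺ (∈-allParts F) (from T-∧ (isPartition⁺ e , fromWitness {a? = nBlocks F ℕ.≟ k} s))

∈-Πlist⁻ : ∀ {n k} {F : Part n} → F ∈ Πlist k → IsΠ k F
∈-Πlist⁻ {n} {k} {F} m = let a , b = to (T-∧ {isPartition F}) (proj₂ (∈-filterᵇ⁻ {xs = allParts n} m)) in
  mkΠ (isPartition⁻ a) (toWitness {a? = nBlocks F ℕ.≟ k} b)

Πlist-fam : ∀ {n} k → IsFam k (Πlist {n} k)
Πlist-fam {n} k = filterᵇ-unique _ (allParts-unique n) , ∈-Πlist⁻

singles : ∀ {n} → List (Fin n) → List (Subset n)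
singles = map ⁅_⁆

singles-good : ∀ {n} {xs : List (Fin n)} → Unique xs → Good (singles xs)
singles-good {xs = []} u = [] , []
singles-good {xs = x ∷ xs} (x# ∷ u) = let ne , ds = singles-good u in (x , ∋-⁅⁆⁺ x) ∷ ne ,
  All.tabulate (λ m i p q → case ∈-map⁻ ⁅_⁆ m of λ { (y , y∈ , refl) →
    All.lookup x# y∈ (trans (sym (∋-⁅⁆⁻ x i p)) (∋-⁅⁆⁻ y i q)) }) ∷ ds

covers-singles : ∀ {n} {xs : List (Fin n)} {x} → Covers (singles xs) x → x ∈ xs
covers-singles {xs = xs} {x} (B , B∈ , p) with ∈-map⁻ ⁅_⁆ B∈
... | y , y∈ , refl = subst (_∈ xs) (sym (∋-⁅⁆⁻ y x p)) y∈

outside-singles : ∀ {n} {xs : List (Fin n)} → Unique xs → length (outside (singles xs)) ≡ n ∸ length xs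
outside-singles {n} {xs} u = trans (sym (m+n∸m≡n (length xs) _)) (cong (_∸ length xs) (≤-antisym
  (subst (λ z → z + length (outside (singles xs)) ≤ n) (Listₚ.length-map ⁅_⁆ xs) (outside-size (singles-good u)))
  (subst₂ _≤_ (Listₚ.length-tabulate id) (Listₚ.length-++ xs) (unique-⊆-length (Uniqueₚ.allFin⁺ n) sub))))
  where
  sub : allFin n ⊆ xs ++ outside (singles xs)
  sub {x} _ with Any.any? (x ≟_) xs
  ... | yes x∈ = ∈-++⁺ˡ x∈
  ... | no x∉ = ∈-++⁺ʳ xs (∈-outside⁺ (singles xs) (x∉ ∘ covers-singles))

-- The bound of `cnt-outside` is attained: the singletons together with any enumerated partition of
-- the other points form a `k`-partition, and restriction to those points recovers it.
-- `length xs ≤ k` makes the truncated subtraction exact.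
cnt-singles : ∀ {n} k {xs : List (Fin n)} → Unique xs → length xs ≤ k →
  cnt (Πlist k) (singles xs) ≡ S2 (n ∸ length xs) (k ∸ length xs)
cnt-singles {n} k {xs} u le = ≤-antisym
  (subst₂ (λ a b → cnt (Πlist k) H ≤ S2 a (k ∸ b)) (outside-singles u) len (cnt-outside (Πlist-fam k) (good-unique gH)))
  (begin
    S2 (n ∸ length xs) j ≡⟨ cong (λ z → S2 z j) (sym (outside-singles u)) ⟩
    S2 (length (outside H)) j ≡⟨ sym (gen-length j (outside H)) ⟩
    length (gen j (outside H)) ≡⟨ sym (Listₚ.length-map (toPart ∘ (H ++_)) (gen j (outside H))) ⟩
    length (map (toPart ∘ (H ++_)) (gen j (outside H))) ≤⟨ unique-⊆-length uniq sub ⟩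
    cnt (Πlist k) H ∎)
  where
  open ≤-Reasoning
  H = singles xs
  gH = singles-good u
  j = k ∸ length xs
  len : length H ≡ length xs
  len = Listₚ.length-map ⁅_⁆ xs
  uniq : Unique (map (toPart ∘ (H ++_)) (gen j (outside H)))
  uniq = map-unique-via (toPart ∘ (H ++_)) toPart (restrict (not ∘ covered H))
    (λ {bs} m → restrict-toPart (not ∘ covered H) bs (H ++ bs)
      (λ { (B , B∈ , p , q) d _ → case ∈-++⁻ H B∈ of λ
         { (inj₁ B∈H) → contradiction (covered⁺ H (B , B∈H , p)) (T-not⁻ d) ; (inj₂ B∈bs) → B , B∈bs , p , q } })
      (λ { (B , B∈ , p , q) → (B , ∈-++⁺ʳ H B∈ , p , q) , out m B∈ p , out m B∈ q }))
    (gen-unique j (outside H) (outside-unique H))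
    where
    out : ∀ {bs B x} → bs ∈ gen j (outside H) → B ∈ bs → B ∋ x → T (not (covered H x))
    out {x = x} m B∈ p = T-not⁺ (∈-outside⁻ H (proj₁ (proj₂ (gen-good j (outside-unique H) m)) x (_ , B∈ , p)) ∘ covered⁻ H)
  sub : map (toPart ∘ (H ++_)) (gen j (outside H)) ⊆ filterᵇ (hasAll H) (Πlist k)
  sub m with ∈-map⁻ (toPart ∘ (H ++_)) m
  ... | bs , bs∈ , refl =
    let g , cov = gen-outside-good {H = H} {j} gH bs∈ in
    ∈-filterᵇ⁺ (∈-Πlist⁺ (mkΠ (toPart-equiv g cov) (begin-equality
      nBlocks (toPart (H ++ bs)) ≡⟨ toPart-nBlocks g ⟩
      length (H ++ bs)     ≡⟨ Listₚ.length-++ H ⟩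
      length H + length bs ≡⟨ cong₂ _+_ len (gen-size j (outside H) bs∈) ⟩
      length xs + j        ≡⟨ m+[n∸m]≡n le ⟩
      k                    ∎)))
    (contains⁺ H (mkContains (toPart-block⁺ g ∘ ∈-++⁺ˡ)))

Stirling≡S2 : ∀ n k → Stirling n (suc k) ≡ S2 n (suc k)
Stirling≡S2 n k = trans (sym (count-all {p = hasAll []} {Πlist {n} (suc k)} (λ _ → tt))) (cnt-singles {n} (suc k) {[]} [] z≤n)

-- Estimates for Stirling numbers

slack : ∀ {a b} s → a + s ≡ b → a ≤ b
slack {a} s refl = m≤m+n a s

cancel : ∀ k {x y} → 1 ≤ k → k * x ≤ k * y → x ≤ y
cancel (suc k) _ h = *-cancelˡ-≤ (suc k) h

sumTo : ℕ → (ℕ → ℕ) → ℕ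
sumTo zero    f = f 0
sumTo (suc L) f = sumTo L f + f (suc L)

falling : ℕ → ℕ → ℕ
falling x zero    = 1
falling x (suc j) = falling x j * (x ∸ j)

falling-suc : ∀ x j → falling (suc x) (suc j) ≡ suc x * falling x j
falling-suc x zero    = trans (+-identityʳ (suc x)) (sym (*-identityʳ (suc x)))
falling-suc x (suc j) = trans (cong (_* (x ∸ j)) (falling-suc x j)) (*-assoc (suc x) (falling x j) (x ∸ j))

fact : ℕ → ℕ
fact k = falling k k

fact-suc : ∀ k → fact (suc k) ≡ suc k * fact k
fact-suc k = falling-suc k k

fact≥1 : ∀ k → 1 ≤ fact k
fact≥1 zero = ≤-refl
fact≥1 (suc k) = subst (1 ≤_) (sym (fact-suc k)) (*-mono-≤ {1} {suc k} (s≤s z≤n) (fact≥1 k))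

-- The expansion of `x ^ M` in falling factorials, whose coefficients are the numbers `S2 M j`, cut
-- off after the term `L`. The cut-off is explicit because the estimates for `S2` compare the last
-- term with all the others.
partial : ℕ → ℕ → ℕ → ℕ
partial M x L = sumTo L (λ j → S2 M j * falling x j)

module _ where
  open ≤-Reasoning

  -- Multiplying by `x = j + (x - j)` shifts the terms, and the cut-off leaves a boundary term. For
  -- `x = suc L` this is exactly the last term missing from `x * partial M x x`, whence
  -- `partial-pow`.
  partial-step : ∀ M x L → L ≤ x → partial (suc M) x (suc L) ≡ x * partial M x L + suc L * (S2 M (suc L) * falling x (suc L))
  partial-step M x zero    le = l (S2 M 0) (S2 M 1) x
    where
    l : ∀ s u x → (s + 1 * u) * (1 * x) ≡ x * (s * 1) + 1 * (u * (1 * x))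
    l = solve-∀
  partial-step M x (suc L) le = begin-equality
    partial (suc M) x (suc L) + (S2 M (suc L) + suc (suc L) * S2 M (suc (suc L))) * (f * (x ∸ suc L))
      ≡⟨ cong (_+ (S2 M (suc L) + suc (suc L) * S2 M (suc (suc L))) * (f * (x ∸ suc L))) (partial-step M x L (≤-trans (n≤1+n L) le)) ⟩
    (x * p + suc L * (S2 M (suc L) * f)) + (S2 M (suc L) + suc (suc L) * S2 M (suc (suc L))) * (f * (x ∸ suc L))
      ≡⟨ l (x * p) (suc L) (S2 M (suc L)) f (S2 M (suc (suc L))) (x ∸ suc L) ⟩
    x * p + (suc L + (x ∸ suc L)) * (S2 M (suc L) * f) + suc (suc L) * (S2 M (suc (suc L)) * (f * (x ∸ suc L)))
      ≡⟨ cong (λ z → x * p + z * (S2 M (suc L) * f) + suc (suc L) * (S2 M (suc (suc L)) * (f * (x ∸ suc L)))) (m+[n∸m]≡n le) ⟩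
    x * p + x * (S2 M (suc L) * f) + suc (suc L) * (S2 M (suc (suc L)) * (f * (x ∸ suc L)))
      ≡⟨ cong (_+ suc (suc L) * (S2 M (suc (suc L)) * (f * (x ∸ suc L)))) (sym (*-distribˡ-+ x p (S2 M (suc L) * f))) ⟩
    x * (p + S2 M (suc L) * f) + suc (suc L) * (S2 M (suc (suc L)) * (f * (x ∸ suc L))) ∎
    where
    f = falling x (suc L)
    p = partial M x L
    l : ∀ xp L s f s′ y → (xp + L * (s * f)) + (s + suc L * s′) * (f * y) ≡ xp + (L + y) * (s * f) + suc L * (s′ * (f * y))
    l = solve-∀

  partial-pow : ∀ M k → partial M (suc k) (suc k) ≡ suc k ^ M
  partial-pow zero k = go (suc k)
    where
    go : ∀ L → partial 0 (suc k) L ≡ 1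
    go zero = refl
    go (suc L) = trans (+-identityʳ _) (go L)
  partial-pow (suc M) k = begin-equality
    partial (suc M) (suc k) (suc k) ≡⟨ partial-step M (suc k) k (n≤1+n k) ⟩
    suc k * partial M (suc k) k + suc k * (S2 M (suc k) * falling (suc k) (suc k)) ≡⟨ sym (*-distribˡ-+ (suc k) (partial M (suc k) k) _) ⟩
    suc k * partial M (suc k) (suc k) ≡⟨ cong (suc k *_) (partial-pow M k) ⟩
    suc k * suc k ^ M ∎

  -- Surjections on the left, all maps on the right: a single term of the expansion is kept.
  S2-upper : ∀ M k → fact (suc k) * S2 M (suc k) ≤ suc k ^ M
  S2-upper M k = begin
    fact (suc k) * S2 M (suc k) ≡⟨ *-comm (fact (suc k)) _ ⟩
    S2 M (suc k) * fact (suc k) ≤⟨ m≤n+m _ (partial M (suc k) k) ⟩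
    partial M (suc k) (suc k)   ≡⟨ partial-pow M k ⟩
    suc k ^ M ∎

  falling-grow : ∀ x j → suc j ≤ x → falling x j ≤ falling x (suc j)
  falling-grow x j le = ≤-trans (≤-reflexive (sym (*-identityʳ _))) (*-monoʳ-≤ (falling x j) (m<n⇒0<n∸m le))

  falling-pred : ∀ r j → j ≤ r → falling (suc r) j ≤ suc r * falling r j
  falling-pred r zero le = s≤s z≤n
  falling-pred r (suc j) le = ≤-trans (≤-reflexive (falling-suc r j)) (*-monoʳ-≤ (suc r) (falling-grow r j le))

  -- A map that is not onto misses one of `suc r` values, and at most `r ^ M` maps miss a given one.
  -- In the expansion this becomes the termwise inequality `falling-pred`.
  S2-lower : ∀ M r → 1 ≤ r → suc r ^ M ≤ fact (suc r) * S2 M (suc r) + suc r * r ^ M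
  S2-lower M r@(suc r′) _ = begin
    suc r ^ M ≡⟨ sym (partial-pow M r) ⟩
    partial M (suc r) r + S2 M (suc r) * fact (suc r) ≤⟨ +-monoˡ-≤ (S2 M (suc r) * fact (suc r)) (go r ≤-refl) ⟩
    suc r * partial M r r + S2 M (suc r) * fact (suc r) ≡⟨ cong₂ _+_ (cong (suc r *_) (partial-pow M r′)) (*-comm (S2 M (suc r)) _) ⟩
    suc r * r ^ M + fact (suc r) * S2 M (suc r) ≡⟨ +-comm (suc r * r ^ M) _ ⟩
    fact (suc r) * S2 M (suc r) + suc r * r ^ M ∎
    where
    l : ∀ s k f → s * (k * f) ≡ k * (s * f)
    l = solve-∀
    go : ∀ L → L ≤ r → partial M (suc r) L ≤ suc r * partial M r L
    go zero _ = ≤-trans (m≤n*m (S2 M 0 * 1) (suc r)) ≤-refl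
    go (suc L) le = begin
      partial M (suc r) L + S2 M (suc L) * falling (suc r) (suc L)
        ≤⟨ +-mono-≤ (go L (≤-trans (n≤1+n L) le)) (*-monoʳ-≤ (S2 M (suc L)) (falling-pred r (suc L) le)) ⟩
      suc r * partial M r L + S2 M (suc L) * (suc r * falling r (suc L))
        ≡⟨ cong (suc r * partial M r L +_) (l (S2 M (suc L)) (suc r) (falling r (suc L))) ⟩
      suc r * partial M r L + suc r * (S2 M (suc L) * falling r (suc L)) ≡⟨ sym (*-distribˡ-+ (suc r) (partial M r L) _) ⟩
      suc r * partial M r (suc L) ∎

  S2≥1 : ∀ m k → suc k ≤ m → 1 ≤ S2 m (suc k)
  S2≥1 (suc m) zero _ = go m
    where
    go : ∀ m → 1 ≤ S2 (suc m) 1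
    go zero = ≤-refl
    go (suc m) = ≤-trans (go m) (S2-step (suc m) 0)
  S2≥1 (suc m) (suc k) (s≤s le) = ≤-trans (S2≥1 m k le) (m≤m+n _ _)

  S2-one : ∀ m → S2 (suc m) 1 ≡ 1
  S2-one zero = refl
  S2-one (suc m) = trans (+-identityʳ _) (S2-one m)

  S2-two : ∀ m → suc (S2 (suc m) 2) ≡ 2 ^ m
  S2-two zero = refl
  S2-two (suc m) = begin-equality
    suc (S2 (suc m) 1 + 2 * S2 (suc m) 2) ≡⟨ cong (λ z → suc (z + 2 * S2 (suc m) 2)) (S2-one m) ⟩
    suc (1 + 2 * S2 (suc m) 2) ≡⟨ l (S2 (suc m) 2) ⟩
    2 * suc (S2 (suc m) 2)     ≡⟨ cong (2 *_) (S2-two m) ⟩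
    2 * 2 ^ m ∎
    where
    l : ∀ s → suc (1 + 2 * s) ≡ 2 * suc s
    l = solve-∀

  ^-distrib-* : ∀ m n o → (m * n) ^ o ≡ m ^ o * n ^ o
  ^-distrib-* m n zero = refl
  ^-distrib-* m n (suc o) = trans (cong (m * n *_) (^-distrib-* m n o)) (l m n (m ^ o) (n ^ o))
    where
    l : ∀ m n a b → m * n * (a * b) ≡ m * a * (n * b)
    l = solve-∀

  ^-swap : ∀ m n o → (m ^ n) ^ o ≡ (m ^ o) ^ n
  ^-swap m n o = trans (^-*-assoc m n o) (trans (cong (m ^_) (*-comm n o)) (sym (^-*-assoc m o n)))

  root-≤ : ∀ r {x y} → 1 ≤ r → x ^ r ≤ y ^ r → x ≤ y
  root-≤ r {x} {y} h le with x ≤? y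
  ... | yes p = p
  ... | no ¬p = contradiction le (<⇒≱ (^-monoˡ-< r {{>-nonZero h}} (≰⇒> ¬p)))

  -- Bernoulli's inequality for `1 + d / x`, multiplied by `x ^ (M + 1)` to stay within the natural
  -- numbers.
  bernoulli : ∀ x d M → x ^ M * (x + M * d) ≤ x * (x + d) ^ M
  bernoulli x d zero = ≤-reflexive (l x)
    where
    l : ∀ x → 1 * (x + 0) ≡ x * 1
    l = solve-∀
  bernoulli x d (suc M) = begin
    x * x ^ M * (x + suc M * d) ≤⟨ slack (x ^ M * (M * d * d)) (l x (x ^ M) M d) ⟩
    x ^ M * (x + M * d) * (x + d) ≤⟨ *-monoˡ-≤ (x + d) (bernoulli x d M) ⟩
    x * (x + d) ^ M * (x + d) ≡⟨ l′ x ((x + d) ^ M) (x + d) ⟩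
    x * ((x + d) * (x + d) ^ M) ∎
    where
    l : ∀ x y M d → x * y * (x + suc M * d) + y * (M * d * d) ≡ y * (x + M * d) * (x + d)
    l = solve-∀
    l′ : ∀ x y z → x * y * z ≡ x * (z * y)
    l′ = solve-∀

  -- (1 + 1/c)^r ≤ 1/(1 - r/c)
  pow-suc-upper : ∀ c r → suc c ^ r * (c ∸ r) ≤ c ^ suc r
  pow-suc-upper c zero = ≤-reflexive (trans (+-identityʳ c) (sym (*-identityʳ c)))
  pow-suc-upper c (suc r) = begin
    suc c * suc c ^ r * (c ∸ suc r) ≡⟨ l (suc c) (suc c ^ r) (c ∸ suc r) ⟩
    suc c ^ r * (suc c * (c ∸ suc r)) ≤⟨ *-monoʳ-≤ (suc c ^ r) small ⟩
    suc c ^ r * (c * (c ∸ r)) ≡⟨ l′ (suc c ^ r) c (c ∸ r) ⟩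
    c * (suc c ^ r * (c ∸ r)) ≤⟨ *-monoʳ-≤ c (pow-suc-upper c r) ⟩
    c * c ^ suc r ∎
    where
    l : ∀ a b d → a * b * d ≡ b * (a * d)
    l = solve-∀
    l′ : ∀ a b d → a * (b * d) ≡ b * (a * d)
    l′ = solve-∀
    small : suc c * (c ∸ suc r) ≤ c * (c ∸ r)
    small with suc r ≤? c
    ... | yes le = begin
      suc c * (c ∸ suc r) ≡⟨⟩
      (c ∸ suc r) + c * (c ∸ suc r) ≤⟨ +-monoˡ-≤ (c * (c ∸ suc r)) (m∸n≤m c (suc r)) ⟩
      c + c * (c ∸ suc r) ≡⟨ sym (*-suc c (c ∸ suc r)) ⟩
      c * suc (c ∸ suc r) ≡⟨ cong (c *_) (sym (+-∸-assoc 1 le)) ⟩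
      c * (c ∸ r) ∎
    ... | no ¬le = subst (_≤ c * (c ∸ r)) (sym (trans (cong (suc c *_) (m≤n⇒m∸n≡0 (<⇒≤ (≰⇒> ¬le)))) (*-zeroʳ (suc c)))) z≤n

  -- Bernoulli's inequality with exponent `r` and increment `1 / r`. It fails at `r = 0`, where both
  -- powers are 1.
  two-pow : ∀ r → 2 * r ^ r ≤ suc r ^ r ⊎ r ≡ 0
  two-pow zero = inj₂ refl
  two-pow r@(suc _) = inj₁ (cancel r (s≤s z≤n) (begin
    r * (2 * r ^ r) ≡⟨ l r (r ^ r) ⟩
    r ^ r * (r + r * 1) ≤⟨ bernoulli r 1 r ⟩
    r * (r + 1) ^ r ≡⟨ cong (λ z → r * z ^ r) (+-comm r 1) ⟩
    r * suc r ^ r ∎))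
    where
    l : ∀ r s → r * (2 * s) ≡ s * (r + r * 1)
    l = solve-∀

-- Forces every ratio S2 (M + 1) k / S2 M (k - 1) above c².
record Big (c M k : ℕ) : Set where
  constructor mkBig
  field unBig : c ^ (2 * suc k) ≤ 2 ^ M
open Big

module _ where
  open ≤-Reasoning

  -- After taking `r`-th powers the claim splits into `(c * c + r) ^ r ≤ 2 ^ M` and
  -- `2 * r ^ r ≤ suc r ^ r`. The summand `r` is there for `ratio`, where it absorbs the error term
  -- of `S2-lower`.
  pow-gap : ∀ {c M r} → 1 ≤ r → suc r ≤ c → Big c M (suc r) → (c * c + r) * r ^ M ≤ suc r ^ M
  pow-gap {c} {M} {r} 1≤r r<c big = root-≤ r 1≤r (begin
    ((c * c + r) * r ^ M) ^ r ≡⟨ ^-distrib-* (c * c + r) (r ^ M) r ⟩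
    (c * c + r) ^ r * (r ^ M) ^ r ≤⟨ *-mono-≤ base (≤-reflexive (^-swap r M r)) ⟩
    2 ^ M * (r ^ r) ^ M ≡⟨ sym (^-distrib-* 2 (r ^ r) M) ⟩
    (2 * r ^ r) ^ M ≤⟨ ^-monoˡ-≤ M ([ id , (λ e → contradiction (subst (1 ≤_) e 1≤r) λ ()) ]′ (two-pow r)) ⟩
    (suc r ^ r) ^ M ≡⟨ ^-swap (suc r) r M ⟩
    (suc r ^ M) ^ r ∎)
    where
    -- `c * c + r` is at most `c * suc c`, and `suc c ^ r ≤ c ^ suc r` by `pow-suc-upper`, since
    -- `c ∸ r` is at least 1. The total exponent 2r + 1 stays below the 2(r + 2) of `Big`.
    base : (c * c + r) ^ r ≤ 2 ^ M
    base = begin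
      (c * c + r) ^ r ≤⟨ ^-monoˡ-≤ r (+-monoʳ-≤ (c * c) (≤-trans (n≤1+n r) r<c)) ⟩
      (c * c + c) ^ r ≡⟨ cong (_^ r) (trans (+-comm (c * c) c) (sym (*-suc c c))) ⟩
      (c * suc c) ^ r ≡⟨ ^-distrib-* c (suc c) r ⟩
      c ^ r * suc c ^ r ≤⟨ *-monoʳ-≤ (c ^ r) (≤-trans (≤-reflexive (sym (*-identityʳ (suc c ^ r)))) (*-monoʳ-≤ (suc c ^ r) (m<n⇒0<n∸m r<c))) ⟩
      c ^ r * (suc c ^ r * (c ∸ r)) ≤⟨ *-monoʳ-≤ (c ^ r) (pow-suc-upper c r) ⟩
      c ^ r * c ^ suc r ≡⟨ sym (^-distribˡ-+-* c r (suc r)) ⟩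
      c ^ (r + suc r) ≤⟨ ^-monoʳ-≤ c {{>-nonZero (≤-trans (s≤s z≤n) r<c)}} (slack 3 (l r)) ⟩
      c ^ (2 * suc (suc r)) ≤⟨ unBig big ⟩
      2 ^ M ∎
      where
      l : ∀ r → (r + suc r) + 3 ≡ 2 * suc (suc r)
      l = solve-∀

  -- `S2-upper` for the smaller number, `S2-lower` for the larger one; multiplied by factorials, all
  -- terms share the factor `suc r`, and what remains is `pow-gap`.
  ratio : ∀ {c M r} → 1 ≤ r → suc r ≤ c → Big c M (suc r) → c * c * S2 M r ≤ S2 (suc M) (suc r)
  ratio {c} {M} {r@(suc r′)} 1≤r r<c big = cancel (fact (suc r)) (fact≥1 (suc r)) (+-cancelʳ-≤ (suc r * r ^ suc M) _ _ (begin
    fact (suc r) * (c * c * S2 M r) + suc r * (r * r ^ M)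
      ≡⟨ cong (λ z → z * (c * c * S2 M r) + suc r * (r * r ^ M)) (fact-suc r) ⟩
    suc r * fact r * (c * c * S2 M r) + suc r * (r * r ^ M) ≡⟨ l (suc r) (fact r) (c * c) (S2 M r) r (r ^ M) ⟩
    suc r * (c * c * (fact r * S2 M r) + r * r ^ M) ≤⟨ *-monoʳ-≤ (suc r) (+-monoˡ-≤ (r * r ^ M) (*-monoʳ-≤ (c * c) (S2-upper M r′))) ⟩
    suc r * (c * c * r ^ M + r * r ^ M) ≡⟨ cong (suc r *_) (sym (*-distribʳ-+ (r ^ M) (c * c) r)) ⟩
    suc r * ((c * c + r) * r ^ M) ≤⟨ *-monoʳ-≤ (suc r) (pow-gap 1≤r r<c big) ⟩
    suc r ^ suc M ≤⟨ S2-lower (suc M) r 1≤r ⟩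
    fact (suc r) * S2 (suc M) (suc r) + suc r * r ^ suc M ∎))
    where
    l : ∀ k f c s r y → k * f * (c * s) + k * (r * y) ≡ k * (c * (f * s) + r * y)
    l = solve-∀

  -- `S2-upper` is sharp up to a factor 1 - 1/c; `swap` needs this precision.
  S2-lower′ : ∀ {c M r} → 1 ≤ r → suc r ≤ c → Big c M (suc r) →
    c * suc r ^ M ≤ c * (fact (suc r) * S2 M (suc r)) + suc r ^ M
  S2-lower′ {c} {M} {r} 1≤r r<c big = begin
    c * suc r ^ M ≤⟨ *-monoʳ-≤ c (S2-lower M r 1≤r) ⟩
    c * (fact (suc r) * S2 M (suc r) + suc r * r ^ M) ≡⟨ *-distribˡ-+ c (fact (suc r) * S2 M (suc r)) (suc r * r ^ M) ⟩
    c * (fact (suc r) * S2 M (suc r)) + c * (suc r * r ^ M) ≤⟨ +-monoʳ-≤ (c * (fact (suc r) * S2 M (suc r))) (begin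
      c * (suc r * r ^ M) ≡⟨ sym (*-assoc c (suc r) (r ^ M)) ⟩
      c * suc r * r ^ M ≤⟨ *-monoˡ-≤ (r ^ M) (≤-trans (*-monoʳ-≤ c r<c) (m≤m+n (c * c) r)) ⟩
      (c * c + r) * r ^ M ≤⟨ pow-gap 1≤r r<c big ⟩
      suc r ^ M ∎) ⟩
    c * (fact (suc r) * S2 M (suc r)) + suc r ^ M ∎

  -- One level down divides the left side by `c * c` and the right side only by 2.
  Big-pred : ∀ {c M k} → 2 ≤ c → Big c (suc M) (suc k) → Big c M k
  Big-pred {c} {M} {k} 2≤c big = mkBig (*-cancelˡ-≤ 2 (begin
    2 * c ^ (2 * suc k) ≤⟨ *-monoˡ-≤ (c ^ (2 * suc k)) (≤-trans 2≤c (m≤m*n c c {{>-nonZero (≤-trans (s≤s z≤n) 2≤c)}})) ⟩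
    c * c * c ^ (2 * suc k) ≡⟨ *-assoc c c _ ⟩
    c ^ (2 + 2 * suc k) ≡⟨ cong (c ^_) (sym (*-suc 2 (suc k))) ⟩
    c ^ (2 * suc (suc k)) ≤⟨ unBig big ⟩
    2 * 2 ^ M ∎))

  Big-mono : ∀ {c M M′ k k′} → 1 ≤ c → M ≤ M′ → k′ ≤ k → Big c M k → Big c M′ k′
  Big-mono {c} 1≤c le le′ big = mkBig (≤-trans (^-monoʳ-≤ c {{>-nonZero 1≤c}} (*-monoʳ-≤ 2 (s≤s le′))) (≤-trans (unBig big) (^-monoʳ-≤ 2 le)))

  Big-at : ∀ {c N p} → 2 ≤ c → Big c (N ∸ 1) p → ∀ y → suc y ≤ p → suc y ≤ N → Big c (N ∸ suc y) (p ∸ y)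
  Big-at 2≤c big zero _ _ = big
  Big-at {c} {N} {p} 2≤c big (suc y) lep leN = Big-pred 2≤c (subst₂ (Big c) (+-∸-assoc 1 leN) (+-∸-assoc 1 (≤-trans (n≤1+n _) lep))
    (Big-at 2≤c big y (≤-trans (n≤1+n _) lep) (≤-trans (n≤1+n _) leN)))

  Big-size : ∀ {c M k} → 4 ≤ c → Big c M k → 4 * suc k ≤ M
  Big-size {c} {M} {k} 4≤c big with 4 * suc k ≤? M
  ... | yes p = p
  ... | no ¬p = contradiction (begin
      2 ^ (4 * suc k) ≡⟨ cong (2 ^_) (*-assoc 2 2 (suc k)) ⟩
      2 ^ (2 * (2 * suc k)) ≡⟨ sym (^-*-assoc 2 2 (2 * suc k)) ⟩
      4 ^ (2 * suc k) ≤⟨ ^-monoˡ-≤ (2 * suc k) 4≤c ⟩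
      c ^ (2 * suc k) ≤⟨ unBig big ⟩
      2 ^ M ∎) (<⇒≱ (^-monoʳ-< 2 (s≤s (s≤s z≤n)) (≰⇒> ¬p)))

module _ where
  open ≤-Reasoning

  -- With `e = c - 1`: the loss (1 - 1/c)² incurred by two lower bounds is made good by raising β +
  -- 2d to β + 4d.
  swap-quadratic : ∀ β d e → 1 ≤ d → β + 4 ≤ e → suc e * suc e * (β + 2 * d) ≤ e * e * (β + 4 * d)
  swap-quadratic β d e 1≤d le = begin
    suc e * suc e * (β + 2 * d) ≡⟨ l₁ e β d ⟩
    e * e * (β + 2 * d) + 2 * (1 * (e * β) + (2 * (e * d) + d)) + β
      ≤⟨ +-mono-≤ (+-monoʳ-≤ (e * e * (β + 2 * d)) (*-monoʳ-≤ 2 (+-mono-≤ (*-monoˡ-≤ (e * β) 1≤d) (+-monoʳ-≤ (2 * (e * d)) d≤)))) β≤ ⟩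
    e * e * (β + 2 * d) + 2 * (d * (e * β) + (2 * (e * d) + e * d)) + e * d ≤⟨ slack (e * d) (l₂ (e * e * (β + 2 * d)) d e β) ⟩
    e * e * (β + 2 * d) + 2 * (d * (e * (β + 4))) ≤⟨ +-monoʳ-≤ (e * e * (β + 2 * d)) (*-monoʳ-≤ 2 (*-monoʳ-≤ d (*-monoʳ-≤ e le))) ⟩
    e * e * (β + 2 * d) + 2 * (d * (e * e)) ≡⟨ l₃ (e * e) β d ⟩
    e * e * (β + 4 * d) ∎
    where
    1≤e : 1 ≤ e
    1≤e = ≤-trans (≤-trans (s≤s z≤n) (m≤n+m 4 β)) le
    d≤ : d ≤ e * d
    d≤ = ≤-trans (≤-reflexive (sym (+-identityʳ d))) (*-monoˡ-≤ d 1≤e)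
    β≤ : β ≤ e * d
    β≤ = ≤-trans (≤-trans (m≤m+n β 4) le) (≤-trans (≤-reflexive (sym (*-identityʳ e))) (*-monoʳ-≤ e 1≤d))
    l₁ : ∀ e β d → suc e * suc e * (β + 2 * d) ≡ e * e * (β + 2 * d) + 2 * (1 * (e * β) + (2 * (e * d) + d)) + β
    l₁ = solve-∀
    l₂ : ∀ y d e β → y + 2 * (d * (e * β) + (2 * (e * d) + e * d)) + e * d + e * d ≡ y + 2 * (d * (e * (β + 4)))
    l₂ = solve-∀
    l₃ : ∀ x β d → x * (β + 2 * d) + 2 * (d * x) ≡ x * (β + 4 * d)
    l₃ = solve-∀

  -- With N = M + 1 and b < a this compares S(N-1,a-1) S(N,b) with S(N-1,b-1) S(N,a):
  -- up to the factor (1 - 1/c)² their quotient is ((a-1)b / ((b-1)a))^M, and Bernoulli applies.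
  swap-core : ∀ β d e M → 1 ≤ β → 1 ≤ d → β + 4 ≤ e → 4 * suc (β + d) ≤ M →
    suc e * suc e * (β + 2 * d) * (β * suc (β + d)) ^ M ≤ β * (e * e) * ((β + d) * suc β) ^ M
  swap-core β d e M 1≤β 1≤d le 4a≤M = cancel x 1≤x (begin
    x * (suc e * suc e * (β + 2 * d) * x ^ M) ≡⟨ l₁ β a (suc e * suc e * (β + 2 * d)) (x ^ M) ⟩
    suc e * suc e * (β + 2 * d) * (β * a * x ^ M) ≤⟨ *-monoˡ-≤ (β * a * x ^ M) (swap-quadratic β d e 1≤d le) ⟩
    e * e * (β + 4 * d) * (β * a * x ^ M) ≡⟨ l₂ (e * e) β d a (x ^ M) ⟩
    β * (e * e) * (x ^ M * (x + 4 * a * d)) ≤⟨ *-monoʳ-≤ (β * (e * e)) (*-monoʳ-≤ (x ^ M) (+-monoʳ-≤ x (*-monoˡ-≤ d 4a≤M))) ⟩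
    β * (e * e) * (x ^ M * (x + M * d)) ≤⟨ *-monoʳ-≤ (β * (e * e)) (bernoulli x d M) ⟩
    β * (e * e) * (x * (x + d) ^ M) ≡⟨ cong (λ z → β * (e * e) * (x * z ^ M)) (l₃ β d) ⟩
    β * (e * e) * (x * ((β + d) * suc β) ^ M) ≡⟨ l₄ (β * (e * e)) x (((β + d) * suc β) ^ M) ⟩
    x * (β * (e * e) * ((β + d) * suc β) ^ M) ∎)
    where
    a = suc (β + d)
    x = β * a
    1≤x : 1 ≤ x
    1≤x = *-mono-≤ {1} {β} {1} {a} 1≤β (s≤s z≤n)
    l₁ : ∀ β a k y → β * a * (k * y) ≡ k * (β * a * y)
    l₁ = solve-∀
    l₂ : ∀ e β d a y → e * (β + 4 * d) * (β * a * y) ≡ β * e * (y * (β * a + 4 * a * d))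
    l₂ = solve-∀
    l₃ : ∀ β d → β * suc (β + d) + d ≡ (β + d) * suc β
    l₃ = solve-∀
    l₄ : ∀ k x y → k * (x * y) ≡ x * (k * y)
    l₄ = solve-∀

  -- `S2-upper` on the left and `S2-lower′` on the right reduce this to `swap-core`. The gain (β +
  -- 2d)/β is retained, rather than weakened to 1, because `small-swap` spends it on a coefficient
  -- larger by 2d.
  swap : ∀ {c M} β d → 1 ≤ β → 1 ≤ d → β + 5 ≤ c → suc (β + d) ≤ c → 4 * suc (β + d) ≤ M → Big c M (suc (β + d)) →
    (β + 2 * d) * (S2 M β * S2 (suc M) (suc (β + d))) ≤ β * (S2 M (β + d) * S2 (suc M) (suc β))
  swap {zero} β d _ _ le _ _ _ = contradiction (≤-trans (m≤n+m 5 β) le) λ ()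
  swap {c@(suc e)} {M} (suc β′) d 1≤β 1≤d le le′ 4a≤M big =
    cancel (c * c * (a * fact α * fact b)) (*-mono-≤ {1} {c * c} (s≤s z≤n) (*-mono-≤ {1} {a * fact α} (*-mono-≤ {1} {a} (s≤s z≤n) (fact≥1 α)) (fact≥1 b))) (begin
    c * c * (a * fact α * fact b) * ((β + 2 * d) * (S2 M β * S2 (suc M) a))
      ≡⟨ cong (λ z → c * c * (a * fact α * z) * ((β + 2 * d) * (S2 M β * S2 (suc M) a))) (fact-suc β) ⟩
    c * c * (a * fact α * (b * fact β)) * ((β + 2 * d) * (S2 M β * S2 (suc M) a))
      ≡⟨ l₁ (c * c) a (fact α) b (fact β) (β + 2 * d) (S2 M β) (S2 (suc M) a) ⟩
    c * c * (β + 2 * d) * b * ((fact β * S2 M β) * ((a * fact α) * S2 (suc M) a))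
      ≡⟨ cong (λ z → c * c * (β + 2 * d) * b * ((fact β * S2 M β) * (z * S2 (suc M) a))) (sym (fact-suc α)) ⟩
    c * c * (β + 2 * d) * b * ((fact β * S2 M β) * (fact a * S2 (suc M) a))
      ≤⟨ *-monoʳ-≤ (c * c * (β + 2 * d) * b) (*-mono-≤ (S2-upper M β′) (S2-upper (suc M) α)) ⟩
    c * c * (β + 2 * d) * b * (β ^ M * (a * a ^ M)) ≡⟨ l₂ (c * c * (β + 2 * d)) b (β ^ M) a (a ^ M) ⟩
    b * a * (c * c * (β + 2 * d) * (β ^ M * a ^ M)) ≡⟨ cong (λ z → b * a * (c * c * (β + 2 * d) * z)) (sym (^-distrib-* β a M)) ⟩
    b * a * (c * c * (β + 2 * d) * (β * a) ^ M) ≤⟨ *-monoʳ-≤ (b * a) (swap-core β d e M 1≤β 1≤d (≤-pred (subst (_≤ c) (+-suc β 4) le)) 4a≤M) ⟩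
    b * a * (β * (e * e) * (α * b) ^ M) ≡⟨ cong (λ z → b * a * (β * (e * e) * z)) (^-distrib-* α b M) ⟩
    b * a * (β * (e * e) * (α ^ M * b ^ M)) ≡⟨ l₃ b a β e (α ^ M) (b ^ M) ⟩
    a * β * ((e * α ^ M) * (e * b ^ suc M)) ≤⟨ *-monoʳ-≤ (a * β) (*-mono-≤ lowα lowb) ⟩
    a * β * ((c * (fact α * S2 M α)) * (c * (fact b * S2 (suc M) b)))
      ≡⟨ l₄ a β c (fact α) (S2 M α) (fact b) (S2 (suc M) b) ⟩
    c * c * (a * fact α * fact b) * (β * (S2 M α * S2 (suc M) b)) ∎)
    where
    β = suc β′
    b = suc β
    α = β + d
    a = suc α
    b≤a : b ≤ a
    b≤a = s≤s (m≤m+n β d)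
    drop : ∀ {X A} → c * A ≤ X + A → e * A ≤ X
    drop {X} {A} h = +-cancelˡ-≤ A _ _ (≤-trans h (≤-reflexive (+-comm X A)))
    lowα : e * α ^ M ≤ c * (fact α * S2 M α)
    lowα = drop (S2-lower′ {r = β′ + d} (≤-trans 1≤d (m≤n+m d β′)) (≤-trans (n≤1+n _) le′) (Big-mono (s≤s z≤n) ≤-refl (n≤1+n _) big))
    lowb : e * b ^ suc M ≤ c * (fact b * S2 (suc M) b)
    lowb = drop (S2-lower′ 1≤β (≤-trans b≤a le′) (Big-mono (s≤s z≤n) (n≤1+n M) b≤a big))
    l₁ : ∀ c a f b g h s u → c * (a * f * (b * g)) * (h * (s * u)) ≡ c * h * b * ((g * s) * ((a * f) * u))
    l₁ = solve-∀
    l₂ : ∀ k b x a y → k * b * (x * (a * y)) ≡ b * a * (k * (x * y))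
    l₂ = solve-∀
    l₃ : ∀ b a β e x y → b * a * (β * (e * e) * (x * y)) ≡ a * β * ((e * x) * (e * (b * y)))
    l₃ = solve-∀
    l₄ : ∀ a β c f s g u → a * β * ((c * (f * s)) * (c * (g * u))) ≡ c * c * (a * f * g) * (β * (s * u))
    l₄ = solve-∀

  -- Replacing the top two levels of bnd by c² and 1 keeps every ratio of consecutive levels at least c².
  gam : ℕ → ℕ → ℕ → ℕ
  gam c m zero          = 1
  gam c m (suc zero)    = c * c
  gam c m (suc (suc r)) = S2 m (suc (suc r))

  bnd≤gam : ∀ c m r → 1 ≤ c → bnd m r ≤ gam c m r
  bnd≤gam c m zero _ = ≤-refl
  bnd≤gam c zero (suc zero) _ = z≤n
  bnd≤gam c (suc m) (suc zero) le = subst (_≤ c * c) (sym (S2-one m)) (*-mono-≤ le le)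
  bnd≤gam c m (suc (suc r)) _ = ≤-refl

  -- Level 0 is an equality and the higher levels are `ratio`. The step from one block to two asks
  -- for `c ^ 4 < 2 ^ M`, and `Big` supplies the exponent 6.
  gam-step : ∀ {c M} r → 2 ≤ c → suc r ≤ c → Big c M (suc r) → c * c * gam c M r ≤ gam c (suc M) (suc r)
  gam-step {c} zero _ _ _ = ≤-reflexive (*-identityʳ (c * c))
  gam-step {c} {M} (suc zero) 2≤c _ big = ≤-pred (begin
    suc (c * c * (c * c)) ≤⟨ s≤s (≤-reflexive (l c)) ⟩
    1 + c ^ 4 ≤⟨ +-monoˡ-≤ (c ^ 4) (^-monoˡ-≤ 4 (≤-trans (s≤s z≤n) 2≤c)) ⟩
    c ^ 4 + c ^ 4 ≡⟨ cong (c ^ 4 +_) (sym (+-identityʳ (c ^ 4))) ⟩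
    2 * c ^ 4 ≤⟨ *-monoˡ-≤ (c ^ 4) 2≤c ⟩
    c ^ 5 ≤⟨ ^-monoʳ-≤ c {{>-nonZero (≤-trans (s≤s z≤n) 2≤c)}} (n≤1+n 5) ⟩
    c ^ 6 ≤⟨ unBig big ⟩
    2 ^ M ≡⟨ sym (S2-two M) ⟩
    suc (S2 (suc M) 2) ∎)
    where
    l : ∀ c → c * c * (c * c) ≡ c * (c * (c * (c * 1)))
    l = solve-∀
  gam-step (suc (suc r)) 2≤c le big = ratio (s≤s z≤n) le big

  gam-chain : ∀ {c N p} → 2 ≤ c → p ≤ c → Big c (N ∸ 1) p → ∀ y → y ≤ p → y ≤ N →
    (c * c) ^ y * gam c (N ∸ y) (p ∸ y) ≤ gam c N p
  gam-chain _ _ _ zero _ _ = ≤-reflexive (+-identityʳ _)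
  gam-chain {c} {N} {p} 2≤c p≤c big (suc y) lep leN = begin
    c * c * (c * c) ^ y * gam c (N ∸ suc y) (p ∸ suc y) ≡⟨ l (c * c) ((c * c) ^ y) (gam c (N ∸ suc y) (p ∸ suc y)) ⟩
    (c * c) ^ y * (c * c * gam c (N ∸ suc y) (p ∸ suc y)) ≤⟨ *-monoʳ-≤ ((c * c) ^ y) (gam-step (p ∸ suc y) 2≤c le′ big′) ⟩
    (c * c) ^ y * gam c (suc (N ∸ suc y)) (suc (p ∸ suc y)) ≡⟨ cong₂ (λ u v → (c * c) ^ y * gam c u v) (sym (+-∸-assoc 1 leN)) (sym ep) ⟩
    (c * c) ^ y * gam c (N ∸ y) (p ∸ y) ≤⟨ gam-chain 2≤c p≤c big y (≤-trans (n≤1+n y) lep) (≤-trans (n≤1+n y) leN) ⟩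
    gam c N p ∎
    where
    ep : p ∸ y ≡ suc (p ∸ suc y)
    ep = +-∸-assoc 1 lep
    le′ : suc (p ∸ suc y) ≤ c
    le′ = ≤-trans (≤-reflexive (sym ep)) (≤-trans (m∸n≤m p y) p≤c)
    big′ : Big c (N ∸ suc y) (suc (p ∸ suc y))
    big′ = subst (Big c (N ∸ suc y)) ep (Big-at 2≤c big y lep leN)
    l : ∀ a b g → a * b * g ≡ b * (a * g)
    l = solve-∀

  square-pow : ∀ c y → (c * c) ^ y ≡ c ^ (y + y)
  square-pow c y = trans (^-distrib-* c c y) (sym (^-distribˡ-+-* c y y))

  -- The branching factors amount to at most `c ^ y`, while the descent from level p - 1 to level p
  -- - y earns `c ^ (2 (y - 1))`; `y ≥ 2` makes this enough. With `p ≥ 3` the chain starts at a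
  -- level where `gam` is a Stirling number.
  star-product : ∀ {c M p q t y L₁ L₂ ψ} → 3 ≤ p → 2 ≤ y → y ≤ p → p ≤ c → 2 ≤ c → suc M ≥ p → suc t * suc q ≤ c → Big c (suc M) p →
    L₁ ≤ suc q ^ y * bnd (suc (suc M) ∸ y) (p ∸ y) → L₂ ≤ suc t ^ y * ψ → L₁ * L₂ ≤ S2 (suc M) (p ∸ 1) * ψ
  star-product {c} {M} {p@(suc p₁@(suc (suc p₂)))} {q} {t} {suc y@(suc y′)} {L₁} {L₂} {ψ} (s≤s (s≤s (s≤s z≤n))) (s≤s (s≤s z≤n)) y≤p p≤c 2≤c p≤M tq big h₁ h₂ = begin
    L₁ * L₂ ≤⟨ *-mono-≤ h₁ h₂ ⟩
    suc q ^ suc y * bnd (suc M ∸ y) (p₁ ∸ y) * (suc t ^ suc y * ψ)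
      ≡⟨ l (suc q ^ suc y) (bnd (suc M ∸ y) (p₁ ∸ y)) (suc t ^ suc y) ψ ⟩
    suc t ^ suc y * suc q ^ suc y * bnd (suc M ∸ y) (p₁ ∸ y) * ψ
      ≤⟨ *-monoˡ-≤ ψ (*-mono-≤ pows (bnd≤gam c (suc M ∸ y) (p₁ ∸ y) 1≤c)) ⟩
    (c * c) ^ y * gam c (suc M ∸ y) (p₁ ∸ y) * ψ
      ≤⟨ *-monoˡ-≤ ψ (gam-chain 2≤c (≤-trans (n≤1+n _) p≤c) (Big-pred 2≤c big) y (≤-pred y≤p) (≤-trans (≤-pred y≤p) (≤-trans (n≤1+n _) p≤M))) ⟩
    S2 (suc M) p₁ * ψ ∎
    where
    1≤c : 1 ≤ c
    1≤c = ≤-trans (s≤s z≤n) 2≤c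
    pows : suc t ^ suc y * suc q ^ suc y ≤ (c * c) ^ y
    pows = begin
      suc t ^ suc y * suc q ^ suc y ≡⟨ sym (^-distrib-* (suc t) (suc q) (suc y)) ⟩
      (suc t * suc q) ^ suc y ≤⟨ ^-monoˡ-≤ (suc y) tq ⟩
      c ^ suc y ≤⟨ ^-monoʳ-≤ c {{>-nonZero 1≤c}} (s≤s (m≤n+m y y′)) ⟩
      c ^ (y + y) ≡⟨ sym (square-pow c y) ⟩
      (c * c) ^ y ∎
    l : ∀ a b d e → a * b * (d * e) ≡ d * a * b * e
    l = solve-∀

  -- The branching factors amount to at most `c ^ (x₁ + x₂)`. The bound for the first family lies x₂
  -- - 1 levels below a - 1, that for the second x₁ levels below b, and together these descents earn
  -- `c ^ (2 (x₁ + x₂ - 1))`.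
  neither-product : ∀ {c M a b t x₁ x₂ L₁ L₂} → 2 ≤ b → b ≤ a → 1 ≤ x₁ → x₁ ≤ b → 1 ≤ x₂ → x₂ ≤ a →
    c ≡ suc t * suc a → a ≤ suc M → Big c (suc M) a →
    L₁ ≤ suc t ^ x₁ * (suc b ^ x₂ * bnd (suc (suc M) ∸ x₂) (a ∸ x₂)) →
    L₂ ≤ suc t ^ x₂ * (suc a ^ x₁ * bnd (suc (suc M) ∸ x₁) (b ∸ x₁)) →
    L₁ * L₂ ≤ S2 (suc M) (a ∸ 1) * S2 (suc (suc M)) b
  neither-product {c} {M} {zero} 2≤b b≤a = contradiction (≤-trans 2≤b b≤a) λ ()
  neither-product {c} {M} {suc zero} 2≤b b≤a = contradiction (≤-trans 2≤b b≤a) λ { (s≤s ()) }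
  -- For `a = b = 2` the first factor of the target is `S2 (suc M) 1 = 1`, too low for a chain to
  -- start from. Each family is then bounded by `c * c`, and the second factor alone is at least
  -- `c ^ 4`.
  neither-product {c} {M} {suc (suc zero)} {b} {t} {x₁} {x₂} {L₁} {L₂} 2≤b b≤a 1≤x₁ x₁≤b 1≤x₂ x₂≤a ec a≤M big h₁ h₂ with ≤-antisym b≤a 2≤b
  ... | refl = begin
    L₁ * L₂ ≤⟨ *-mono-≤ (≤-trans h₁ (level 1≤x₂ x₂≤a x₁≤b)) (≤-trans h₂ (level 1≤x₁ x₁≤b x₂≤a)) ⟩
    c * c * (c * c) ≤⟨ gam-step 1 2≤c (≤-trans (n≤1+n 2) 3≤c) big ⟩
    S2 (suc (suc M)) 2 ≡⟨ sym (trans (cong (_* S2 (suc (suc M)) 2) (S2-one M)) (+-identityʳ _)) ⟩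
    S2 (suc M) 1 * S2 (suc (suc M)) 2 ∎
    where
    3≤c : 3 ≤ c
    3≤c = subst (3 ≤_) (sym ec) (m≤m+n 3 (t * 3))
    2≤c : 2 ≤ c
    2≤c = ≤-trans (n≤1+n 2) 3≤c
    bnd≤1 : ∀ {x} → 1 ≤ x → x ≤ 2 → bnd (suc (suc M) ∸ x) (2 ∸ x) ≤ 1
    bnd≤1 {1} _ _ = ≤-reflexive (S2-one M)
    bnd≤1 {2} _ _ = ≤-refl
    bnd≤1 {suc (suc (suc _))} _ (s≤s (s≤s ()))
    level : ∀ {x y} → 1 ≤ x → x ≤ 2 → y ≤ 2 → suc t ^ y * (3 ^ x * bnd (suc (suc M) ∸ x) (2 ∸ x)) ≤ c * c
    level {x} {y} 1≤x x≤2 y≤2 = begin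
      suc t ^ y * (3 ^ x * bnd (suc (suc M) ∸ x) (2 ∸ x)) ≤⟨ *-mono-≤ (^-monoʳ-≤ (suc t) y≤2) (*-mono-≤ (^-monoʳ-≤ 3 x≤2) (bnd≤1 1≤x x≤2)) ⟩
      suc t ^ 2 * 9 ≡⟨ l t ⟩
      suc t * 3 * (suc t * 3) ≡⟨ cong₂ _*_ (sym ec) (sym ec) ⟩
      c * c ∎
      where
      l : ∀ t → suc t * (suc t * 1) * 9 ≡ suc t * 3 * (suc t * 3)
      l = solve-∀
  neither-product {c} {M} {a@(suc a₁@(suc (suc a₂)))} {b@(suc (suc b₂))} {t} {x₁} {suc y} {L₁} {L₂} (s≤s (s≤s z≤n)) b≤a 1≤x₁ x₁≤b _ x₂≤a ec a≤M big h₁ h₂ = begin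
    L₁ * L₂ ≤⟨ *-mono-≤ h₁ h₂ ⟩
    suc t ^ x₁ * (suc b ^ x₂ * A) * (suc t ^ x₂ * (suc a ^ x₁ * B)) ≡⟨ l₁ (suc t ^ x₁) (suc b ^ x₂) A (suc t ^ x₂) (suc a ^ x₁) B ⟩
    (suc t ^ x₁ * suc a ^ x₁) * (suc t ^ x₂ * suc b ^ x₂) * (A * B)
      ≤⟨ *-mono-≤ pows (*-mono-≤ (bnd≤gam c (suc M ∸ y) (a₁ ∸ y) 1≤c) (bnd≤gam c (suc (suc M) ∸ x₁) (b ∸ x₁) 1≤c)) ⟩
    ((c * c) ^ y * (c * c) ^ x₁) * (gam c (suc M ∸ y) (a₁ ∸ y) * gam c (suc (suc M) ∸ x₁) (b ∸ x₁))
      ≡⟨ l₂ ((c * c) ^ y) ((c * c) ^ x₁) (gam c (suc M ∸ y) (a₁ ∸ y)) (gam c (suc (suc M) ∸ x₁) (b ∸ x₁)) ⟩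
    ((c * c) ^ y * gam c (suc M ∸ y) (a₁ ∸ y)) * ((c * c) ^ x₁ * gam c (suc (suc M) ∸ x₁) (b ∸ x₁))
      ≤⟨ *-mono-≤ (gam-chain 2≤c (≤-trans (n≤1+n _) a≤c) (Big-pred 2≤c big) y (≤-pred x₂≤a) (≤-trans (≤-pred x₂≤a) (≤-trans (n≤1+n _) a≤M)))
                  (gam-chain 2≤c (≤-trans b≤a a≤c) (Big-mono 1≤c ≤-refl b≤a big) x₁ x₁≤b (≤-trans x₁≤b (≤-trans b≤a (≤-trans a≤M (n≤1+n _))))) ⟩
    S2 (suc M) a₁ * S2 (suc (suc M)) b ∎
    where
    x₂ = suc y
    A = bnd (suc M ∸ y) (a₁ ∸ y)
    B = bnd (suc (suc M) ∸ x₁) (b ∸ x₁)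
    a≤c : a ≤ c
    a≤c = subst (a ≤_) (sym ec) (≤-trans (n≤1+n a) (m≤m+n (suc a) (t * suc a)))
    2≤c : 2 ≤ c
    2≤c = ≤-trans (s≤s (s≤s z≤n)) a≤c
    1≤c : 1 ≤ c
    1≤c = ≤-trans (s≤s z≤n) 2≤c
    pows : (suc t ^ x₁ * suc a ^ x₁) * (suc t ^ x₂ * suc b ^ x₂) ≤ (c * c) ^ y * (c * c) ^ x₁
    pows = begin
      (suc t ^ x₁ * suc a ^ x₁) * (suc t ^ x₂ * suc b ^ x₂) ≤⟨ *-monoʳ-≤ (suc t ^ x₁ * suc a ^ x₁) (*-monoʳ-≤ (suc t ^ x₂) (^-monoˡ-≤ x₂ (s≤s b≤a))) ⟩
      (suc t ^ x₁ * suc a ^ x₁) * (suc t ^ x₂ * suc a ^ x₂)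
        ≡⟨ cong₂ _*_ (trans (sym (^-distrib-* (suc t) (suc a) x₁)) (cong (_^ x₁) (sym ec))) (trans (sym (^-distrib-* (suc t) (suc a) x₂)) (cong (_^ x₂) (sym ec))) ⟩
      c ^ x₁ * c ^ x₂ ≡⟨ sym (^-distribˡ-+-* c x₁ x₂) ⟩
      c ^ (x₁ + x₂) ≤⟨ ^-monoʳ-≤ c {{>-nonZero 1≤c}} expo ⟩
      c ^ (y + y + (x₁ + x₁)) ≡⟨ ^-distribˡ-+-* c (y + y) (x₁ + x₁) ⟩
      c ^ (y + y) * c ^ (x₁ + x₁) ≡⟨ cong₂ _*_ (sym (square-pow c y)) (sym (square-pow c x₁)) ⟩
      (c * c) ^ y * (c * c) ^ x₁ ∎
      where
      expo : x₁ + suc y ≤ y + y + (x₁ + x₁)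
      expo = ≤-trans (+-mono-≤ (≤-refl {x₁}) (+-monoˡ-≤ y 1≤x₁)) (slack y (l x₁ y))
        where
        l : ∀ x y → x + (x + y) + y ≡ y + y + (x + x)
        l = solve-∀
    l₁ : ∀ p q A r s B → p * (q * A) * (r * (s * B)) ≡ (p * s) * (r * q) * (A * B)
    l₁ = solve-∀
    l₂ : ∀ a b c d → (a * b) * (c * d) ≡ (a * c) * (b * d)
    l₂ = solve-∀

-- The product F G lies below (w - 1/4) φ ψ.
record Small (F G w φ ψ : ℕ) : Set where
  constructor mkSmall
  field unSmall : 4 * (F * G) + φ * ψ < 4 * w * (φ * ψ)

module _ where
  open ≤-Reasoning

  -- `u` counts quarters of `φ`. By `u * s < ψ` the excess `s` contributes less than one more
  -- quarter, and `Small` claims another; hence the 2 in `2 + u ≤ 4 * w`.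
  small-mix : ∀ {F G w φ ψ} u s → 4 * F ≤ u * φ → G ≤ ψ + s → u * s < ψ → 2 + u ≤ 4 * w → 1 ≤ φ → Small F G w φ ψ
  small-mix {F} {G} {w} {φ} {ψ} u s hF hG us<ψ u≤w 1≤φ = mkSmall (begin-strict
    4 * (F * G) + φ * ψ ≡⟨ cong (_+ φ * ψ) (sym (*-assoc 4 F G)) ⟩
    4 * F * G + φ * ψ ≤⟨ +-monoˡ-≤ (φ * ψ) (*-mono-≤ hF hG) ⟩
    u * φ * (ψ + s) + φ * ψ ≡⟨ l₁ u φ ψ s ⟩
    φ * (u * s + (1 + u) * ψ) <⟨ *-monoʳ-< φ {{>-nonZero 1≤φ}} (+-monoˡ-< ((1 + u) * ψ) us<ψ) ⟩
    φ * (ψ + (1 + u) * ψ) ≡⟨ l₂ φ u ψ ⟩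
    (2 + u) * (φ * ψ) ≤⟨ *-monoˡ-≤ (φ * ψ) u≤w ⟩
    4 * w * (φ * ψ) ∎)
    where
    l₁ : ∀ u φ ψ s → u * φ * (ψ + s) + φ * ψ ≡ φ * (u * s + (1 + u) * ψ)
    l₁ = solve-∀
    l₂ : ∀ φ u ψ → φ * (ψ + (1 + u) * ψ) ≡ (2 + u) * (φ * ψ)
    l₂ = solve-∀

  small-≤ : ∀ {F G w φ ψ} → F * G ≤ φ * ψ → 2 ≤ w → 1 ≤ φ → 1 ≤ ψ → Small F G w φ ψ
  small-≤ {F} {G} {w} {φ} {ψ} h 2≤w 1≤φ 1≤ψ = mkSmall (begin-strict
    4 * (F * G) + φ * ψ ≤⟨ +-monoˡ-≤ (φ * ψ) (*-monoʳ-≤ 4 h) ⟩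
    4 * (φ * ψ) + φ * ψ ≡⟨ l (φ * ψ) ⟩
    5 * (φ * ψ) <⟨ *-monoˡ-< (φ * ψ) {{>-nonZero (*-mono-≤ {1} {φ} 1≤φ 1≤ψ)}} (≤-trans (s≤s (s≤s (s≤s (s≤s (s≤s (s≤s z≤n)))))) (*-monoʳ-≤ 4 2≤w)) ⟩
    4 * w * (φ * ψ) ∎)
    where
    l : ∀ x → 4 * x + x ≡ 5 * x
    l = solve-∀

  -- The main term 1 + t/2 lies t/2 ≥ 1/2 below t + 1. Half of that margin is the quarter of
  -- `Small`; the other half exceeds the contribution of `r`.
  small-half : ∀ {F G w φ ψ t} r → F ≤ φ → 2 * G ≤ (2 + t) * ψ + r → 2 * r < ψ → suc t ≤ w → 1 ≤ t → 1 ≤ φ → Small F G w φ ψ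
  small-half {F} {G} {w} {φ} {ψ} {t} r hF hG r<ψ t<w 1≤t 1≤φ = mkSmall (begin-strict
    4 * (F * G) + φ * ψ ≡⟨ l₁ F G (φ * ψ) ⟩
    2 * (F * (2 * G)) + φ * ψ ≤⟨ +-monoˡ-≤ (φ * ψ) (*-monoʳ-≤ 2 (*-mono-≤ hF hG)) ⟩
    2 * (φ * ((2 + t) * ψ + r)) + φ * ψ ≡⟨ l₂ φ t ψ r ⟩
    φ * (2 * r + (5 + 2 * t) * ψ) <⟨ *-monoʳ-< φ {{>-nonZero 1≤φ}} (+-monoˡ-< ((5 + 2 * t) * ψ) r<ψ) ⟩
    φ * (ψ + (5 + 2 * t) * ψ) ≡⟨ l₃ φ t ψ ⟩
    (4 + 2 * 1 + 2 * t) * (φ * ψ) ≤⟨ *-monoˡ-≤ (φ * ψ) (+-monoˡ-≤ (2 * t) (+-monoʳ-≤ 4 (*-monoʳ-≤ 2 1≤t))) ⟩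
    (4 + 2 * t + 2 * t) * (φ * ψ) ≡⟨ cong (_* (φ * ψ)) (l₄ t) ⟩
    4 * suc t * (φ * ψ) ≤⟨ *-monoˡ-≤ (φ * ψ) (*-monoʳ-≤ 4 t<w) ⟩
    4 * w * (φ * ψ) ∎)
    where
    l₁ : ∀ F G x → 4 * (F * G) + x ≡ 2 * (F * (2 * G)) + x
    l₁ = solve-∀
    l₂ : ∀ φ t ψ r → 2 * (φ * ((2 + t) * ψ + r)) + φ * ψ ≡ φ * (2 * r + (5 + 2 * t) * ψ)
    l₂ = solve-∀
    l₃ : ∀ φ t ψ → φ * (ψ + (5 + 2 * t) * ψ) ≡ (4 + 2 * 1 + 2 * t) * (φ * ψ)
    l₃ = solve-∀
    l₄ : ∀ t → 4 + 2 * t + 2 * t ≡ 4 * suc t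
    l₄ = solve-∀

  -- Write w for `suc β + g`. As w - 1/4 is at least `β`, raising it by 2d multiplies it by at most
  -- (β + 2d)/β, and that is the rate at which `M′` is exchanged for `M`.
  small-swap : ∀ {F G β g d M M′} → 1 ≤ β → (β + 2 * d) * M′ ≤ β * M → Small F G (suc β + g + 2 * d) 1 M′ → Small F G (suc β + g) 1 M
  small-swap {F} {G} {β} {g} {d} {M} {M′} 1≤β swp (mkSmall h) = mkSmall (begin-strict
    4 * (F * G) + 1 * M ≡⟨ cong (4 * (F * G) +_) (+-identityʳ M) ⟩
    4 * (F * G) + M <⟨ +-monoˡ-< M lt ⟩
    v * M + M ≡⟨ l₃ β g M ⟩
    4 * (suc β + g) * (1 * M) ∎)
    where
    v = 3 + 4 * β + 4 * g
    lt₁ : 4 * (F * G) < (v + 8 * d) * M′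
    lt₁ = +-cancelʳ-< (1 * M′) _ _ (subst (4 * (F * G) + 1 * M′ <_) (l β g d M′) h)
      where
      l : ∀ β g d m → 4 * (suc β + g + 2 * d) * (1 * m) ≡ (3 + 4 * β + 4 * g + 8 * d) * m + 1 * m
      l = solve-∀
    lt : 4 * (F * G) < v * M
    lt = *-cancelˡ-< β _ _ (begin-strict
      β * (4 * (F * G)) <⟨ *-monoʳ-< β {{>-nonZero 1≤β}} lt₁ ⟩
      β * ((v + 8 * d) * M′) ≤⟨ slack ((6 * d + 8 * d * g) * M′) (l₁ β g d M′) ⟩
      v * ((β + 2 * d) * M′) ≤⟨ *-monoʳ-≤ v swp ⟩
      v * (β * M) ≡⟨ l₂ v β M ⟩
      β * (v * M) ∎)
      where
      l₁ : ∀ β g d m → β * ((3 + 4 * β + 4 * g + 8 * d) * m) + (6 * d + 8 * d * g) * m ≡ (3 + 4 * β + 4 * g) * ((β + 2 * d) * m)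
      l₁ = solve-∀
      l₂ : ∀ v β m → v * (β * m) ≡ β * (v * m)
      l₂ = solve-∀
    l₃ : ∀ β g m → (3 + 4 * β + 4 * g) * m + m ≡ 4 * (suc β + g) * (1 * m)
    l₃ = solve-∀

  small-assoc : ∀ {F G w φ ψ} → Small F G w φ ψ → Small F G w 1 (φ * ψ)
  small-assoc {F} {G} {w} {φ} {ψ} (mkSmall h) = mkSmall (subst (λ z → 4 * (F * G) + z < 4 * w * z) (sym (+-identityʳ (φ * ψ))) h)

  small-comm : ∀ {F G w φ ψ} → Small F G w φ ψ → Small G F w φ ψ
  small-comm {F} {G} {w} {φ} {ψ} (mkSmall h) = mkSmall (subst (λ z → 4 * z + φ * ψ < 4 * w * (φ * ψ)) (*-comm F G) h)

  -- `A` is known from below through the first two orders of inclusion and exclusion. The correction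
  -- `b * b * φ₂` is at most a quarter of `φ₁`, which is the reserve held by `Small`.
  below-A : ∀ {F G b φ₁ φ₂ ψ A c} t → Small F G b 1 (φ₁ * ψ) → b * φ₁ ≤ A + b * b * φ₂ → 4 * (b * b) ≤ c → c * φ₂ ≤ φ₁ → F * G < A * (ψ + t)
  below-A {F} {G} {b} {φ₁} {φ₂} {ψ} {A} {c} t (mkSmall h) hA hb hφ = *-cancelˡ-< 4 _ _ (+-cancelʳ-< (1 * (φ₁ * ψ)) _ _ (begin-strict
    4 * (F * G) + 1 * (φ₁ * ψ) <⟨ h ⟩
    4 * b * (1 * (φ₁ * ψ)) ≡⟨ l₁ b φ₁ ψ ⟩
    4 * (b * φ₁) * ψ ≤⟨ *-monoˡ-≤ ψ (*-monoʳ-≤ 4 hA) ⟩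
    4 * (A + b * b * φ₂) * ψ ≡⟨ l₂ A b φ₂ ψ ⟩
    4 * (A * ψ) + 4 * (b * b) * φ₂ * ψ ≤⟨ +-mono-≤ (*-monoʳ-≤ 4 (*-monoʳ-≤ A (m≤m+n ψ t))) (≤-trans (*-monoˡ-≤ ψ (≤-trans (*-monoˡ-≤ φ₂ hb) hφ)) (≤-reflexive (sym (+-identityʳ (φ₁ * ψ))))) ⟩
    4 * (A * (ψ + t)) + 1 * (φ₁ * ψ) ∎))
    where
    l₁ : ∀ b φ ψ → 4 * b * (1 * (φ * ψ)) ≡ 4 * (b * φ) * ψ
    l₁ = solve-∀
    l₂ : ∀ A b φ ψ → 4 * (A + b * b * φ) * ψ ≡ 4 * (A * ψ) + 4 * (b * b) * φ * ψ
    l₂ = solve-∀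

  -- The term subtracted in the size of D is at most a quarter of `ψ₀`, so the reserve of `Small`
  -- pays for it. It stands on the left to avoid subtraction.
  below-C : ∀ {F G t φ ψ₀ ψ₁} → Small F G (suc t) 1 (φ * ψ₀) → 4 * (t * ψ₁) ≤ ψ₀ → F * G + φ * (t * ψ₁) < φ * (suc t * ψ₀)
  below-C {F} {G} {t} {φ} {ψ₀} {ψ₁} (mkSmall h) hψ = *-cancelˡ-< 4 _ _ (begin-strict
    4 * (F * G + φ * (t * ψ₁)) ≡⟨ l₁ (F * G) φ (t * ψ₁) ⟩
    4 * (F * G) + φ * (4 * (t * ψ₁)) ≤⟨ +-monoʳ-≤ (4 * (F * G)) (≤-trans (*-monoʳ-≤ φ hψ) (≤-reflexive (sym (+-identityʳ (φ * ψ₀))))) ⟩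
    4 * (F * G) + 1 * (φ * ψ₀) <⟨ h ⟩
    4 * suc t * (1 * (φ * ψ₀)) ≡⟨ l₂ t φ ψ₀ ⟩
    4 * (φ * (suc t * ψ₀)) ∎)
    where
    l₁ : ∀ x φ y → 4 * (x + φ * y) ≡ 4 * x + φ * (4 * y)
    l₁ = solve-∀
    l₂ : ∀ t φ ψ → 4 * suc t * (1 * (φ * ψ)) ≡ 4 * (φ * (suc t * ψ))
    l₂ = solve-∀

  -- For k₂ = 2t + 1 the products |A||B| and |C||D| agree to first order; this settles the second-order comparison.
  second-order : ∀ {c M a} t → 1 ≤ t → t + 2 ≤ a → (t ≡ 1 → 4 ≤ a) → a + 4 ≤ c → suc t * suc a ≤ c → Big c (suc M) a →
    S2 (suc M) (a ∸ 1) * (S2 (suc M) t + suc t) < S2 M (a ∸ 2) * (S2 (suc (suc M)) (suc t) + t)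
  second-order {c} {M} {a} t@(suc t′) 1≤t t+2≤a t≡1 a≤c ta≤c big with m≤n⇒∃[o]m+o≡n t+2≤a
  ... | d , refl = result
    where
    α = t + d
    a₁≡ : t + 2 + d ≡ suc (suc α)
    a₁≡ = l t d
      where
      l : ∀ t d → t + 2 + d ≡ suc (suc (t + d))
      l = solve-∀
    v = S2 (suc M) (suc t)
    s = S2 M t
    φ₁ = S2 (suc M) (suc α)
    φ₂ = S2 M α
    big₁ : Big c (suc M) (suc (suc α))
    big₁ = subst (Big c (suc M)) a₁≡ big
    a≤c′ : suc (suc α) + 4 ≤ c
    a≤c′ = subst (λ z → z + 4 ≤ c) a₁≡ a≤c
    4≤c : 4 ≤ c
    4≤c = ≤-trans (m≤n+m 4 (suc (suc α))) a≤c′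
    2≤c : 2 ≤ c
    2≤c = ≤-trans (s≤s (s≤s z≤n)) 4≤c
    1≤c : 1 ≤ c
    1≤c = ≤-trans (s≤s z≤n) 2≤c
    big₀ : Big c M (suc α)
    big₀ = Big-pred 2≤c big₁
    size₁ : 4 * suc (suc α) ≤ M
    size₁ = Big-size 4≤c big₀
    t≤c : t ≤ c
    t≤c = ≤-trans (≤-trans (m≤m+n t d) (≤-trans (m≤n+m α 2) (m≤m+n _ 4))) a≤c′
    cmp : 1 ≤ d → (t + 2 * d) * (s * φ₁) ≤ t * (φ₂ * v)
    cmp 1≤d = swap t d 1≤t 1≤d (≤-trans (+-monoˡ-≤ 5 (m≤m+n t d)) (≤-trans (≤-trans (≤-reflexive (l α)) (n≤1+n _)) a≤c′)) (≤-trans (≤-trans (n≤1+n _) (m≤m+n _ 4)) a≤c′)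
      (≤-trans (*-monoʳ-≤ 4 (n≤1+n (suc α))) size₁) big₀
      where
      l : ∀ α → α + 5 ≡ suc (α + 4)
      l = solve-∀
    -- `swap` with its gain dropped; for `d = 0` the two sides are equal.
    main : ∀ d → (1 ≤ d → (t + 2 * d) * (s * S2 (suc M) (suc (t + d))) ≤ t * (S2 M (t + d) * v)) → s * S2 (suc M) (suc (t + d)) ≤ S2 M (t + d) * v
    main zero _ = ≤-reflexive (cong₂ (λ x y → S2 M x * S2 (suc M) (suc y)) (sym (+-identityʳ t)) (+-identityʳ t))
    main (suc d) h = cancel t 1≤t (≤-trans (*-monoˡ-≤ _ (m≤m+n t (2 * suc d))) (h (s≤s z≤n)))
    1≤φ₁ : 1 ≤ φ₁
    1≤φ₁ = S2≥1 (suc M) α (≤-trans (≤-trans (n≤1+n (suc α)) (m≤m+n _ (3 * suc (suc α)))) (≤-trans size₁ (n≤1+n M)))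
    combine : S2 (suc M) t + suc t < suc t * s → s * φ₁ ≤ φ₂ * v → φ₁ * (S2 (suc M) t + suc t) < φ₂ * (S2 (suc (suc M)) (suc t) + t)
    combine lt le = begin-strict
      φ₁ * (S2 (suc M) t + suc t) <⟨ *-monoʳ-< φ₁ {{>-nonZero 1≤φ₁}} lt ⟩
      φ₁ * (suc t * s) ≡⟨ l φ₁ (suc t) s ⟩
      suc t * (s * φ₁) ≤⟨ *-monoʳ-≤ (suc t) le ⟩
      suc t * (φ₂ * v) ≡⟨ l′ (suc t) φ₂ v ⟩
      φ₂ * (suc t * v) ≤⟨ *-monoʳ-≤ φ₂ (≤-trans (m≤n+m (suc t * v) (S2 (suc M) t)) (m≤m+n _ t)) ⟩
      φ₂ * (S2 (suc (suc M)) (suc t) + t) ∎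
      where
      l : ∀ φ t s → φ * (t * s) ≡ t * (s * φ)
      l = solve-∀
      l′ : ∀ t φ v → t * (φ * v) ≡ φ * (t * v)
      l′ = solve-∀
    case-t : ∀ t′ → t ≡ suc t′ → φ₁ * (S2 (suc M) t + suc t) < φ₂ * (S2 (suc (suc M)) (suc t) + t)
    -- For `t = 1` the number `s` is merely a count of one-block partitions and leaves no room for
    -- `lt`. The gain 1 + 2d ≥ 3 of `swap` is used instead, and `d ≥ 1` is what excluding the pair
    -- (4, 3) provides.
    case-t zero refl = begin-strict
      φ₁ * (S2 (suc M) 1 + 2) ≡⟨ cong (λ z → φ₁ * (z + 2)) (S2-one M) ⟩
      φ₁ * 3 <⟨ *-monoʳ-< φ₁ {{>-nonZero 1≤φ₁}} (s≤s (s≤s (s≤s (s≤s z≤n)))) ⟩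
      φ₁ * 6 ≡⟨ l₁ φ₁ ⟩
      2 * (3 * (1 * φ₁)) ≤⟨ *-monoʳ-≤ 2 (*-mono-≤ 3≤ (*-monoˡ-≤ φ₁ (S2≥1 M 0 (≤-trans (s≤s z≤n) size₁)))) ⟩
      2 * ((1 + 2 * d) * (s * φ₁)) ≤⟨ *-monoʳ-≤ 2 (cmp 1≤d) ⟩
      2 * (1 * (φ₂ * v)) ≡⟨ l₂ φ₂ v ⟩
      φ₂ * (2 * v) ≤⟨ *-monoʳ-≤ φ₂ (≤-trans (m≤n+m (2 * v) (S2 (suc M) 1)) (m≤m+n _ 1)) ⟩
      φ₂ * (S2 (suc (suc M)) 2 + 1) ∎
      where
      1≤d : 1 ≤ d
      1≤d = ≤-pred (≤-pred (≤-pred (t≡1 refl)))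
      3≤ : 3 ≤ 1 + 2 * d
      3≤ = s≤s (*-monoʳ-≤ 2 1≤d)
      l₁ : ∀ φ → φ * 6 ≡ 2 * (3 * (1 * φ))
      l₁ = solve-∀
      l₂ : ∀ φ v → 2 * (1 * (φ * v)) ≡ φ * (2 * v)
      l₂ = solve-∀
    case-t (suc t″) refl = combine lt (main d cmp)
      where
      u = S2 M (suc t″)
      Mpos : ∃ λ M′ → M ≡ suc M′
      Mpos = pos M (≤-trans (s≤s z≤n) size₁)
        where
        pos : ∀ m → 1 ≤ m → ∃ λ m′ → m ≡ suc m′
        pos (suc m) _ = m , refl
      3+2t≤c : 3 + 2 * t ≤ c
      3+2t≤c = ≤-trans (slack (t * (t + d) + 2 * t + d) (l t d)) (subst (λ z → suc t * suc z ≤ c) a₁≡ ta≤c)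
        where
        l : ∀ t d → 3 + 2 * t + (t * (t + d) + 2 * t + d) ≡ suc t * suc (suc (suc (t + d)))
        l = solve-∀
      u-small : 2 * u ≤ s
      u-small = cancel t (s≤s z≤n) (+-cancelˡ-≤ u (t * (2 * u)) (t * s) (begin
        u + t * (2 * u) ≡⟨ l₀ t u ⟩
        (1 + 2 * t) * u ≤⟨ *-monoˡ-≤ u (≤-trans (≤-trans (m≤n+m (1 + 2 * t) 2) 3+2t≤c) (m≤m*n c c {{>-nonZero 1≤c}})) ⟩
        c * c * u ≤⟨ ratio (s≤s z≤n) t≤c (Big-mono 1≤c ≤-refl (≤-trans (m≤m+n t d) (n≤1+n α)) big₀) ⟩
        u + t * s ∎))
        where
        l₀ : ∀ t u → u + t * (2 * u) ≡ (1 + 2 * t) * u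
        l₀ = solve-∀
      s-big : 2 * suc t < s
      s-big = begin
        suc (2 * suc t) ≡⟨ l t ⟩
        3 + 2 * t ≤⟨ ≤-trans 3+2t≤c (m≤m*n c c {{>-nonZero 1≤c}}) ⟩
        c * c ≡⟨ sym (*-identityʳ (c * c)) ⟩
        c * c * 1 ≤⟨ *-monoʳ-≤ (c * c) (S2≥1 M′ t″ (≤-trans t≤M (≤-pred (subst (4 * suc (suc α) ≤_) M≡ size₁)))) ⟩
        c * c * S2 M′ (suc t″) ≤⟨ ratio (s≤s z≤n) t≤c (Big-mono 1≤c ≤-refl (m≤m+n t d) (Big-pred 2≤c (subst (λ z → Big c z (suc α)) M≡ big₀))) ⟩
        S2 (suc M′) t ≡⟨ cong (λ z → S2 z t) (sym M≡) ⟩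
        s ∎
        where
        M′ = proj₁ Mpos
        M≡ = proj₂ Mpos
        l : ∀ t → suc (2 * suc t) ≡ 3 + 2 * t
        l = solve-∀
        t≤M : suc t″ ≤ pred (4 * suc (suc α))
        t≤M = ≤-trans (≤-trans (n≤1+n _) (m≤m+n t d)) (≤-trans (n≤1+n α) (m≤m+n (suc α) (3 * suc (suc α))))
      -- This amounts to `u + suc t < s`, and each of the two summands is at most half of `s`, the
      -- second strictly less.
      lt : S2 (suc M) t + suc t < suc t * s
      lt = *-cancelˡ-< 2 _ _ (begin-strict
        2 * (u + t * s + suc t) ≡⟨ l₁ u t s ⟩
        2 * u + 2 * t * s + 2 * suc t <⟨ +-mono-≤-< (+-monoˡ-≤ (2 * t * s) u-small) s-big ⟩
        s + 2 * t * s + s ≡⟨ l₂ s t ⟩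
        2 * (suc t * s) ∎)
        where
        l₁ : ∀ u t s → 2 * (u + t * s + suc t) ≡ 2 * u + 2 * t * s + 2 * suc t
        l₁ = solve-∀
        l₂ : ∀ s t → s + 2 * t * s + s ≡ 2 * (suc t * s)
        l₂ = solve-∀
    result : S2 (suc M) (t + 2 + d ∸ 1) * (S2 (suc M) t + suc t) < S2 M (t + 2 + d ∸ 2) * (S2 (suc (suc M)) (suc t) + t)
    result = subst (λ z → S2 (suc M) (z ∸ 1) * (S2 (suc M) t + suc t) < S2 M (z ∸ 2) * (S2 (suc (suc M)) (suc t) + t)) (sym a₁≡) (case-t t′ refl)

-- Covers and branching

hits : ∀ {n} → Part n → List (Subset n) → ℕ
hits F T = count (isBlock F) T

memᵇ : ∀ {n} → List (Subset n) → Subset n → Bool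
memᵇ H S = ⌊ Any.any? (S ≡?_) H ⌋

memᵇ⁻ : ∀ {n} (H : List (Subset n)) {S} → T (memᵇ H S) → S ∈ H
memᵇ⁻ H {S} h = toWitness {a? = Any.any? (S ≡?_) H} h

memᵇ⁺ : ∀ {n} (H : List (Subset n)) {S} → S ∈ H → T (memᵇ H S)
memᵇ⁺ H {S} h = fromWitness {a? = Any.any? (S ≡?_) H} h

fresh : ∀ {n} → List (Subset n) → Part n → List (Subset n)
fresh H G = filterᵇ (not ∘ memᵇ H) (blocks G)

module _ {n} (H : List (Subset n)) (G : Part n) where

  fresh-unique : Unique (fresh H G)
  fresh-unique = filterᵇ-unique (not ∘ memᵇ H) (blocks-unique G)

  ∈-fresh⁻ : ∀ {S} → S ∈ fresh H G → Blk G S × S ∉ H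
  ∈-fresh⁻ m = let m′ , h = ∈-filterᵇ⁻ {xs = blocks G} m in ∈-blocks⁻ G m′ , T-not⁻ h ∘ memᵇ⁺ H

  ∈-fresh⁺ : ∀ {S} → Blk G S → S ∉ H → S ∈ fresh H G
  ∈-fresh⁺ b S∉ = ∈-filterᵇ⁺ (∈-blocks⁺ G b) (T-not⁺ (S∉ ∘ memᵇ⁻ H))

  fresh-length : Unique H → hits G H + length (fresh H G) ≡ nBlocks G
  fresh-length u = sym (trans (count-complement (memᵇ H) (blocks G)) (cong (_+ length (fresh H G))
    (unique-≡-length (filterᵇ-unique (memᵇ H) (blocks-unique G)) (filterᵇ-unique (isBlock G) u)
      (λ m → let m′ , h = ∈-filterᵇ⁻ {xs = blocks G} m in ∈-filterᵇ⁺ (memᵇ⁻ H h) (unBlk (∈-blocks⁻ G m′)))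
      (λ m → let m′ , h = ∈-filterᵇ⁻ {xs = H} m in ∈-filterᵇ⁺ (∈-blocks⁺ G (mkBlk h)) (memᵇ⁺ H m′)))))

hits-mono : ∀ {n} (G : Part n) {S T : List (Subset n)} → Unique S → S ⊆ T → hits G S ≤ hits G T
hits-mono G {S} {T} u sub = unique-⊆-length {ys = filterᵇ (isBlock G) T} (filterᵇ-unique (isBlock G) u)
  (λ m → let m′ , h = ∈-filterᵇ⁻ {p = isBlock G} {xs = S} m in ∈-filterᵇ⁺ {p = isBlock G} (sub m′) h)

hits-full : ∀ {n} {G : Part n} {T : List (Subset n)} → length T ≤ hits G T → Contains G T
hits-full {G = G} {T} le = mkContains λ m → mkBlk (go T le m)
  where
  go : ∀ T → length T ≤ hits G T → ∀ {S} → S ∈ T → Data.Bool.T (isBlock G S)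
  go (B ∷ T) le m with isBlock G B in eq
  go (B ∷ T) le (here refl) | true = from T-≡ eq
  go (B ∷ T) (s≤s le) (there m) | true = go T le m
  go (B ∷ T) le m | false = contradiction (count-≤-length (isBlock G) T) (<⇒≱ le)

contains-hits : ∀ {n} {G : Part n} {T : List (Subset n)} → Contains G T → hits G T ≡ length T
contains-hits {T = T} c = count-all {xs = T} (λ m → unBlk (blk c m))

Common : ∀ {n} → Part n → Part n → List (Subset n)
Common {n} F G = filterᵇ (λ S → isBlock F S ∧ isBlock G S) (allSubsets n)

module _ {n} {F G : Part n} where

  ∈-Common⁻ : ∀ {S} → S ∈ Common F G → Blk F S × Blk G S
  ∈-Common⁻ {S} m = let a , b = to (T-∧ {isBlock F S}) (proj₂ (∈-filterᵇ⁻ {xs = allSubsets n} m)) in mkBlk a , mkBlk b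

  common-sym : common F G ≡ common G F
  common-sym = count-cong (allSubsets n) (λ {S} _ → swp (isBlock F S)) (λ {S} _ → swp (isBlock G S))
    where
    swp : ∀ a {b} → T (a ∧ b) → T (b ∧ a)
    swp a h = let x , y = to (T-∧ {a}) h in from T-∧ (y , x)

  common-outside : ∀ {X} t → t ≤ common F G → hits G X < t → ∃ λ B → Blk F B × Blk G B × B ∉ X
  common-outside {X} t le lt with Any.any? (λ S → ¬? (Any.any? (S ≡?_) X)) (Common F G)
  ... | yes a = let S , m , S∉ = find a ; bF , bG = ∈-Common⁻ m in S , bF , bG , S∉
  ... | no ¬a = contradiction (unique-⊆-length (filterᵇ-unique _ (allSubsets-unique n)) sub) (<⇒≱ (≤-trans lt le))
    where
    sub : Common F G ⊆ filterᵇ (isBlock G) X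
    sub {S} m with Any.any? (S ≡?_) X
    ... | yes S∈ = ∈-filterᵇ⁺ S∈ (unBlk (proj₂ (∈-Common⁻ m)))
    ... | no S∉ = contradiction (lose m S∉) ¬a

  -- Pigeonhole inside `G`: the blocks shared with `F` and the blocks in `Z` are together too many
  -- to be disjoint.
  common-pick : ∀ {Z} t → t ≤ common F G → Unique Z → (∀ {B} → B ∈ Z → Blk G B) → nBlocks G < t + length Z →
    ∃ λ B → B ∈ Z × Blk F B
  common-pick {Z} t le u inG lt with Any.any? (λ S → T? (isBlock F S)) Z
  ... | yes a = let S , m , h = find a in S , m , mkBlk h
  ... | no ¬a = contradiction
    (≤-trans (+-monoˡ-≤ (length Z) le) (subst (_≤ nBlocks G) (Listₚ.length-++ (Common F G)) (unique-⊆-length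
      (Uniqueₚ.++⁺ (filterᵇ-unique _ (allSubsets-unique n)) u λ { (m , m′) → ¬a (lose m′ (unBlk (proj₁ (∈-Common⁻ m)))) })
      (λ m → [ (λ m₁ → ∈-blocks⁺ G (proj₂ (∈-Common⁻ m₁))) , (λ m₂ → ∈-blocks⁺ G (inG m₂)) ]′ (∈-++⁻ (Common F G) m)))))
    (<⇒≱ lt)

record Cover {n} (t : ℕ) (𝓖 : List (Part n)) (H : List (Subset n)) : Set where
  constructor mkCover
  field hit : ∀ {G} → G ∈ 𝓖 → t ≤ hits G H
open Cover

cover? : ∀ {n} t (𝓖 : List (Part n)) H → Cover t 𝓖 H ⊎ ∃ λ G → G ∈ 𝓖 × hits G H < t
cover? t 𝓖 H with All.all? (λ G → t ≤? hits G H) 𝓖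
... | yes a = inj₁ (mkCover (All.lookup a))
... | no ¬a = let G , m , h = find (Allₚ.¬All⇒Any¬ (λ G → t ≤? hits G H) 𝓖 ¬a) in inj₂ (G , m , ≰⇒> h)

Cross : ∀ {n} → ℕ → List (Part n) → List (Part n) → Set
Cross t 𝓕 𝓖 = ∀ {F G} → F ∈ 𝓕 → G ∈ 𝓖 → t ≤ common F G

cross-sym : ∀ {n t} {𝓕 𝓖 : List (Part n)} → Cross t 𝓕 𝓖 → Cross t 𝓖 𝓕
cross-sym {t = t} x {G} {F} m m′ = subst (t ≤_) (common-sym {F = F} {G}) (x m′ m)

cnt-⊆ : ∀ {n} (𝓕 : List (Part n)) {H H′} → H ⊆ H′ → cnt 𝓕 H′ ≤ cnt 𝓕 H
cnt-⊆ 𝓕 {H} {H′} sub = count-mono 𝓕 λ {F} _ h → contains⁺ {F = F} H (mkContains (blk (contains⁻ {F = F} H′ h) ∘ sub))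

-- Either one branch produces the exceptional outcome `E`, such as a smaller cover, or the estimate
-- is available on all branches at once.
choose-all : ∀ {A E : Set} {P : A → Set} xs → (∀ {x} → x ∈ xs → E ⊎ P x) → E ⊎ (∀ {x} → x ∈ xs → P x)
choose-all [] h = inj₂ λ ()
choose-all (x ∷ xs) h with h (here refl) | choose-all xs (h ∘ there)
... | inj₁ e | _ = inj₁ e
... | inj₂ p | inj₁ e = inj₁ e
... | inj₂ p | inj₂ ps = inj₂ λ { (here refl) → p ; (there m) → ps m }

-- The number of ways to choose `r` of the r + x blocks of `T` is a binomial coefficient, bounded by
-- `suc r ^ x`; the recursion, with or without the first block of `T`, is Pascal's rule. `H`
-- collects the chosen blocks, and `Q` is an exceptional outcome that is passed on.
cover-base : ∀ {n} {Q : Set} (𝓕 : List (Part n)) K T r x H → Unique T → length T ≡ r + x →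
  (∀ S → Unique S → S ⊆ T → length S ≡ r → Q ⊎ cnt 𝓕 (S ++ H) ≤ K) →
  Q ⊎ count (λ F → hasAll H F ∧ ⌊ r ≤? hits F T ⌋) 𝓕 ≤ suc r ^ x * K
cover-base 𝓕 K T zero x H u e h with h [] [] (λ ()) refl
... | inj₁ q = inj₁ q
... | inj₂ le = inj₂ (≤-trans (count-mono 𝓕 (λ {F} _ p → proj₁ (to (T-∧ {hasAll H F}) p)))
  (≤-trans le (≤-reflexive (sym (trans (cong (_* K) (^-zeroˡ x)) (+-identityʳ K))))))
cover-base {Q = Q} 𝓕 K (B ∷ T) (suc r) x H (B# ∷ u) e h = combine first (second x e)
  where
  open ≤-Reasoning
  p : Part _ → Bool
  p F = hasAll H F ∧ ⌊ suc r ≤? hits F (B ∷ T) ⌋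
  first : Q ⊎ count (λ F → hasAll (B ∷ H) F ∧ ⌊ r ≤? hits F T ⌋) 𝓕 ≤ suc r ^ x * K
  first = cover-base 𝓕 K T r x (B ∷ H) u (suc-injective e) λ S uS S⊆ len →
    [ inj₁ , (λ le → inj₂ (≤-trans (cnt-⊆ 𝓕 (λ { (here refl) → ∈-++⁺ʳ S (here refl) ; (there m) →
         [ ∈-++⁺ˡ , (λ m′ → ∈-++⁺ʳ S (there m′)) ]′ (∈-++⁻ S m) })) le)) ]′
    (h (B ∷ S) (∷-unique (λ m → All.lookup B# (S⊆ m) refl) uS) (λ { (here refl) → here refl ; (there m) → there (S⊆ m) }) (cong suc len))
  second : ∀ x → suc (length T) ≡ suc (r + x) →
           Q ⊎ count (λ F → hasAll H F ∧ ⌊ suc r ≤? hits F T ⌋) 𝓕 + suc r ^ x * K ≤ suc (suc r) ^ x * K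
  -- With no spare block all of `T` is required, so the first block cannot be left out.
  second zero e = inj₂ (≤-reflexive (cong (_+ 1 * K) (count-zero 𝓕 λ {F} _ t →
    <⇒≱ (≤-trans (toWitness {a? = suc r ≤? hits F T} (proj₂ (to (T-∧ {hasAll H F}) t))) (count-≤-length (isBlock F) T))
        (≤-reflexive (trans (suc-injective e) (+-identityʳ r))))))
  second (suc x) e with cover-base 𝓕 K T (suc r) x H u (trans (suc-injective e) (+-suc r x))
                          (λ S uS S⊆ len → h S uS (there ∘ S⊆) len)
  ... | inj₁ q = inj₁ q
  ... | inj₂ le = inj₂ (begin
    count (λ F → hasAll H F ∧ ⌊ suc r ≤? hits F T ⌋) 𝓕 + suc r ^ suc x * K
      ≤⟨ +-mono-≤ le (*-monoˡ-≤ K (*-monoʳ-≤ (suc r) (^-monoˡ-≤ x (n≤1+n (suc r))))) ⟩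
    suc (suc r) ^ x * K + suc r * suc (suc r) ^ x * K ≡⟨ sym (*-distribʳ-+ K (suc (suc r) ^ x) (suc r * suc (suc r) ^ x)) ⟩
    suc (suc r) ^ suc x * K ∎)
  combine : Q ⊎ count (λ F → hasAll (B ∷ H) F ∧ ⌊ r ≤? hits F T ⌋) 𝓕 ≤ suc r ^ x * K →
            Q ⊎ count (λ F → hasAll H F ∧ ⌊ suc r ≤? hits F T ⌋) 𝓕 + suc r ^ x * K ≤ suc (suc r) ^ x * K →
            Q ⊎ count p 𝓕 ≤ suc (suc r) ^ x * K
  combine (inj₁ q) _ = inj₁ q
  combine (inj₂ _) (inj₁ q) = inj₁ q
  combine (inj₂ a) (inj₂ b) = inj₂ (begin
    count p 𝓕 ≡⟨ count-split p (λ F → isBlock F B) 𝓕 ⟩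
    count (λ F → p F ∧ isBlock F B) 𝓕 + count (λ F → p F ∧ not (isBlock F B)) 𝓕
      ≤⟨ +-mono-≤ (≤-trans (count-mono 𝓕 λ {F} _ → with-B F) a) (count-mono 𝓕 λ {F} _ → without-B F) ⟩
    suc r ^ x * K + count (λ F → hasAll H F ∧ ⌊ suc r ≤? hits F T ⌋) 𝓕 ≡⟨ +-comm (suc r ^ x * K) _ ⟩
    count (λ F → hasAll H F ∧ ⌊ suc r ≤? hits F T ⌋) 𝓕 + suc r ^ x * K ≤⟨ b ⟩
    suc (suc r) ^ x * K ∎)
    where
    with-B : ∀ F → Data.Bool.T (p F ∧ isBlock F B) → Data.Bool.T (hasAll (B ∷ H) F ∧ ⌊ r ≤? hits F T ⌋)
    with-B F t with to (T-∧ {p F}) t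
    ... | pF , b with to (T-∧ {hasAll H F}) pF
    ...   | hH , hr with isBlock F B
    ...     | true = from (T-∧ {hasAll H F}) (hH , fromWitness (≤-pred (toWitness {a? = suc r ≤? suc (hits F T)} hr)))
    without-B : ∀ F → Data.Bool.T (p F ∧ not (isBlock F B)) → Data.Bool.T (hasAll H F ∧ ⌊ suc r ≤? hits F T ⌋)
    without-B F t with to (T-∧ {p F}) t
    ... | pF , b with isBlock F B
    ...   | false = pF

length-cover : ∀ {n} (𝓕 : List (Part n)) {t T} → Cover t 𝓕 T →
  length 𝓕 ≡ count (λ F → hasAll [] F ∧ ⌊ t ≤? hits F T ⌋) 𝓕
length-cover 𝓕 {t} {T} c = sym (count-all {p = λ F → hasAll [] F ∧ ⌊ t ≤? hits F T ⌋} λ {F} m → fromWitness {a? = t ≤? hits F T} (hit c m))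

module Branching {n} (t q : ℕ) {𝓕 𝓖 : List (Part n)} (fam𝓖 : ∀ {G} → G ∈ 𝓖 → IsΠ (t + q) G) (cross : Cross t 𝓕 𝓖) where

  open ≤-Reasoning

  -- F shares t of the t + q blocks of G, so it meets any q + 1 of them.
  branch : ∀ {H G} K → G ∈ 𝓖 → hits G H < t → Unique H → (∀ {B} → Blk G B → B ∉ H → cnt 𝓕 (B ∷ H) ≤ K) → cnt 𝓕 H ≤ suc q * K
  branch {H} {G} K G∈ lt u bound = subst (λ z → cnt 𝓕 H ≤ z * K) len
    (count-union-const Z (λ B → hasAll (B ∷ H)) K 𝓕
      (λ {F} F∈ h → let B , B∈ , b = common-pick {F = F} {G} t (cross F∈ G∈) uZ (λ m → proj₁ (∈-fresh⁻ H G (sub m)))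
                                       (subst₂ _<_ (sym (size (fam𝓖 G∈))) (cong (_+_ t) (sym len)) (+-monoʳ-< t (n<1+n q))) in
         B , B∈ , from (T-∧ {isBlock F B}) (unBlk b , h))
      (λ m → let b , B∉ = ∈-fresh⁻ H G (sub m) in bound b B∉))
    where
    Z = take (suc q) (fresh H G)
    enough : suc q ≤ length (fresh H G)
    enough = +-cancelˡ-≤ (hits G H) (suc q) _ (begin
      hits G H + suc q ≡⟨ +-suc (hits G H) q ⟩
      suc (hits G H) + q ≤⟨ +-monoˡ-≤ q lt ⟩
      t + q ≡⟨ sym (trans (fresh-length H G u) (size (fam𝓖 G∈))) ⟩
      hits G H + length (fresh H G) ∎)
    len : length Z ≡ suc q
    len = trans (Listₚ.length-take (suc q) (fresh H G)) (m≤n⇒m⊓n≡m enough)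
    sub : Z ⊆ fresh H G
    sub {S} m = subst (S ∈_) (Listₚ.take++drop≡id (suc q) (fresh H G)) (∈-++⁺ˡ m)
    uZ : Unique Z
    uZ = Uniqueₚ.take⁺ (suc q) (fresh-unique H G)

  SmallerCover : List (Subset n) → ℕ → Set
  SmallerCover H s = ∃ λ T → Unique T × H ⊆ T × length T < s × Cover t 𝓖 T

  widen : ∀ {B H d} → SmallerCover (B ∷ H) (suc (length H) + d) → SmallerCover H (length H + suc d)
  widen {H = H} {d} (T , uT , sub , l , c) = T , uT , (λ m → sub (there m)) , subst (length T <_) (sym (+-suc (length H) d)) l , c

  -- A round adds to `H` one of `suc q` blocks of some `G` that meets `H` in fewer than `t` blocks.
  -- If there is no such `G`, then `H` already covers 𝓖 with fewer blocks than intended, and that is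
  -- the alternative returned.
  branch-deep : ∀ f → (∀ {H} → Unique H → cnt 𝓕 H ≤ f (length H)) → ∀ d {H} → Unique H →
    SmallerCover H (length H + d) ⊎ cnt 𝓕 H ≤ suc q ^ d * f (length H + d)
  branch-deep f bound zero {H} u = inj₂ (≤-trans (bound u) (≤-reflexive (sym (trans (+-identityʳ _) (cong f (+-identityʳ (length H)))))))
  branch-deep f bound (suc d) {H} u with cover? t 𝓖 H
  ... | inj₁ c = inj₁ (H , u , id , m<m+n (length H) (s≤s z≤n) , c)
  ... | inj₂ (G , G∈ , lt) with choose-all {E = SmallerCover H (length H + suc d)} {P = λ B → cnt 𝓕 (B ∷ H) ≤ suc q ^ d * f (length H + suc d)} (fresh H G)
      (λ {B} m → [ (λ s → inj₁ (widen s))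
                 , (λ le → inj₂ (subst (λ z → cnt 𝓕 (B ∷ H) ≤ suc q ^ d * f z) (sym (+-suc (length H) d)) le)) ]′
          (branch-deep f bound d (∷-unique (proj₂ (∈-fresh⁻ H G m)) u)))
  ...   | inj₁ e = inj₁ e
  ...   | inj₂ all = inj₂ (≤-trans (branch (suc q ^ d * f (length H + suc d)) G∈ lt u (λ b B∉ → all (∈-fresh⁺ H G b B∉)))
                                   (≤-reflexive (sym (*-assoc (suc q) (suc q ^ d) _))))

  -- A smaller cover above `X` returned by the branching becomes the next target. In the end the
  -- same excess `y′` belongs to a cover and to a valid estimate; `fuel` bounds the number of
  -- rounds.
  star-descent : ∀ f → (∀ {H} → Unique H → cnt 𝓕 H ≤ f (length H)) → ∀ {X} → Unique X → length X ≡ t →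
    ∀ fuel y T → y ≤ fuel → Unique T → X ⊆ T → length T ≡ t + y → Cover t 𝓖 T →
    ∃ λ y′ → ∃ λ T′ → y′ ≤ y × Unique T′ × X ⊆ T′ × length T′ ≡ t + y′ × Cover t 𝓖 T′ × cnt 𝓕 X ≤ suc q ^ y′ * f (t + y′)
  star-descent f bound {X} uX lX fuel y T y≤ uT sub lT c with branch-deep f bound y {X} uX
  ... | inj₂ le = y , T , ≤-refl , uT , sub , lT , c , subst (λ z → cnt 𝓕 X ≤ suc q ^ y * f (z + y)) lX le
  ... | inj₁ (T′ , uT′ , sub′ , l′ , c′) with m≤n⇒∃[o]m+o≡n (subst (_≤ length T′) lX (unique-⊆-length uX sub′))
  ...   | y′ , e with +-cancelˡ-< t y′ y (subst₂ _<_ (sym e) (cong (_+ y) lX) l′)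
  ...     | y′<y with fuel | y≤
  ...       | zero | z≤n = contradiction y′<y λ ()
  ...       | suc fuel | le with star-descent f bound uX lX fuel y′ T′ (≤-pred (≤-trans y′<y le)) uT′ sub′ (sym e) c′
  ...         | z , T″ , z≤ , rest = z , T″ , ≤-trans z≤ (<⇒≤ y′<y) , rest

  -- Each member of 𝓕 contains `t` blocks of `T`, and from each such choice `y` rounds of branching
  -- over 𝓖 are made. A cover of 𝓖 of excess below `y` is the only thing that can stop them.
  cover-bound : ∀ f → (∀ {H} → Unique H → cnt 𝓕 H ≤ f (length H)) → ∀ x y T → Unique T → length T ≡ t + x → Cover t 𝓕 T →
    (∃ λ y′ → ∃ λ T′ → y′ < y × Unique T′ × length T′ ≡ t + y′ × Cover t 𝓖 T′) ⊎
    length 𝓕 ≤ suc t ^ x * (suc q ^ y * f (t + y))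
  cover-bound f bound x y T uT lT c with cover-base 𝓕 (suc q ^ y * f (t + y)) T t x [] uT lT step
    where
    step : ∀ S → Unique S → S ⊆ T → length S ≡ t → (∃ λ y′ → ∃ λ T′ → y′ < y × Unique T′ × length T′ ≡ t + y′ × Cover t 𝓖 T′) ⊎
           cnt 𝓕 (S ++ []) ≤ suc q ^ y * f (t + y)
    step S uS S⊆ lS with branch-deep f bound y uS
    ... | inj₂ le = inj₂ (subst₂ (λ a b → cnt 𝓕 a ≤ suc q ^ y * f (b + y)) (sym (Listₚ.++-identityʳ S)) lS le)
    ... | inj₁ (T′ , uT′ , sub′ , l′ , c′) with m≤n⇒∃[o]m+o≡n (subst (_≤ length T′) lS (unique-⊆-length uS sub′))
    ...   | y′ , e = inj₁ (y′ , T′ , +-cancelˡ-< t y′ y (subst₂ _<_ (sym e) (cong (_+ y) lS) l′) , uT′ , sym e , c′)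
  ... | inj₁ s = inj₁ s
  ... | inj₂ le = inj₂ (subst (_≤ suc t ^ x * (suc q ^ y * f (t + y))) (sym (length-cover 𝓕 c)) le)

-- Stars

del : ∀ {n} → Subset n → List (Subset n) → List (Subset n)
del x X = filterᵇ (λ S → not ⌊ S ≡? x ⌋) X

module _ {n} (x : Subset n) (X : List (Subset n)) where

  ∈-del⁻ : ∀ {S} → S ∈ del x X → S ∈ X × S ≢ x
  ∈-del⁻ {S} m = let m′ , h = ∈-filterᵇ⁻ {p = λ S → not ⌊ S ≡? x ⌋} {xs = X} m in
    m′ , λ e → T-not⁻ h (fromWitness {a? = S ≡? x} e)

  ∈-del⁺ : ∀ {S} → S ∈ X → S ≢ x → S ∈ del x X
  ∈-del⁺ {S} m ne = ∈-filterᵇ⁺ {p = λ S → not ⌊ S ≡? x ⌋} m (T-not⁺ (ne ∘ toWitness {a? = S ≡? x}))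

  del-unique : Unique X → Unique (del x X)
  del-unique = filterᵇ-unique _

  count-self : Unique X → x ∈ X → count (λ S → ⌊ S ≡? x ⌋) X ≡ 1
  count-self u m = unique-≡-length {ys = x ∷ []} (filterᵇ-unique (λ S → ⌊ S ≡? x ⌋) u) ([] ∷ [])
    (λ {S} m′ → here (toWitness {a? = S ≡? x} (proj₂ (∈-filterᵇ⁻ {p = λ S → ⌊ S ≡? x ⌋} {xs = X} m′))))
    (λ { (here refl) → ∈-filterᵇ⁺ {p = λ S → ⌊ S ≡? x ⌋} m (fromWitness {a? = x ≡? x} refl) })

  del-length : Unique X → x ∈ X → length X ≡ suc (length (del x X))
  del-length u m = trans (count-complement (λ S → ⌊ S ≡? x ⌋) X) (cong (_+ length (del x X)) (count-self u m))

blk? : ∀ {n} (G : Part n) S → Dec (Blk G S)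
blk? G S with T? (isBlock G S)
... | yes h = yes (mkBlk h)
... | no ¬h = no (¬h ∘ unBlk)

contains? : ∀ {n} (G : Part n) X → Dec (Contains G X)
contains? G X with T? (hasAll X G)
... | yes h = yes (contains⁻ X h)
... | no ¬h = no (¬h ∘ contains⁺ X)

contains-++ : ∀ {n} {G : Part n} {H H′} → Contains G H → Contains G H′ → Contains G (H ++ H′)
contains-++ {H = H} c c′ = mkContains λ m → [ blk c , blk c′ ]′ (∈-++⁻ H m)

contains-∷ : ∀ {n} {G : Part n} {B H} → Blk G B → Contains G H → Contains G (B ∷ H)
contains-∷ b c = mkContains λ { (here refl) → b ; (there m) → blk c m }

missing : ∀ {n} {G : Part n} {X} → ¬ Contains G X → ∃ λ x → x ∈ X × ¬ Blk G x
missing {G = G} {X} ¬c with Any.any? (λ S → ¬? (blk? G S)) X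
... | yes a = find a
... | no ¬a = contradiction (mkContains λ {S} m → has S m) ¬c
  where
  has : ∀ S → S ∈ X → Blk G S
  has S m with blk? G S
  ... | yes b = b
  ... | no ¬b = contradiction (lose m ¬b) ¬a

hits-miss : ∀ {n} {G : Part n} {X} → ¬ Contains G X → hits G X < length X
hits-miss {G = G} {X} ¬c with suc (hits G X) ≤? length X
... | yes p = p
... | no ¬p = contradiction (hits-full {G = G} {X} (≤-pred (≰⇒> ¬p))) ¬c

miss-one : ∀ {n} {G : Part n} {X} → Unique X → length X ≤ suc (hits G X) → ¬ Contains G X →
  ∃ λ x → x ∈ X × ¬ Blk G x × Contains G (del x X)
miss-one {G = G} {X} u le ¬c with missing {G = G} {X} ¬c
... | x , x∈ , ¬b = x , x∈ , ¬b , hits-full {G = G} {del x X}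
    (≤-pred (≤-trans (≤-reflexive (sym (del-length x X u x∈))) (≤-trans le (s≤s sub))))
  where
  sub : hits G X ≤ hits G (del x X)
  sub = unique-⊆-length {ys = filterᵇ (isBlock G) (del x X)} (filterᵇ-unique (isBlock G) u)
    (λ m → let m′ , h = ∈-filterᵇ⁻ {p = isBlock G} {xs = X} m in
      ∈-filterᵇ⁺ {p = isBlock G} (∈-del⁺ x X m′ (λ { refl → ¬b (mkBlk h) })) h)

hits-∷ : ∀ {n} (G : Part n) B H → hits G (B ∷ H) ≤ suc (hits G H)
hits-∷ G B H with isBlock G B
... | true = ≤-refl
... | false = n≤1+n _

hits-∷-no : ∀ {n} (G : Part n) B H → ¬ Blk G B → hits G (B ∷ H) ≡ hits G H
hits-∷-no G B H ¬b with isBlock G B in eq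
... | true = contradiction (mkBlk (from T-≡ eq)) ¬b
... | false = refl

single-or-multi : ∀ {n} {B : Subset n} → Nonempty B → Multi B ⊎ ∃ λ i → B ≡ ⁅ i ⁆
single-or-multi {n} {B} (i , p) with Finₚ.any? (λ j → ¬? (i ≟ j) ×-dec (B ∋? j))
... | yes (j , ne , q) = inj₁ (i , j , ne , p , q)
... | no ¬a = inj₂ (i , subset-ext λ j → T-ext
  (λ h → case i ≟ j of λ { (yes refl) → un∋ (∋-⁅⁆⁺ i) ; (no ne) → contradiction (j , ne , mk∋ h) ¬a })
  (λ h → un∋ (subst (B ∋_) (sym (∋-⁅⁆⁻ i j (mk∋ h))) p)))

singles-or-multi : ∀ {n} (H : List (Subset n)) → (∀ {B} → B ∈ H → Nonempty B) →
  (∃ λ B → B ∈ H × Multi B) ⊎ ∃ λ xs → H ≡ singles xs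
singles-or-multi [] ne = inj₂ ([] , refl)
singles-or-multi (B ∷ H) ne with single-or-multi (ne (here refl)) | singles-or-multi H (ne ∘ there)
... | inj₁ m | _ = inj₁ (B , here refl , m)
... | inj₂ _ | inj₁ (S , S∈ , m) = inj₁ (S , there S∈ , m)
... | inj₂ (i , refl) | inj₂ (xs , refl) = inj₂ (i ∷ xs , refl)

singles-unique⁻ : ∀ {n} {xs : List (Fin n)} → Unique (singles xs) → Unique xs
singles-unique⁻ {xs = []} u = []
singles-unique⁻ {xs = x ∷ xs} (x# ∷ u) = ∷-unique (λ m → All.lookup x# (∈-map⁺ ⁅_⁆ m) refl) (singles-unique⁻ u)

length-cartesianProduct : ∀ {A B : Set} (xs : List A) (ys : List B) →
  length (List.cartesianProduct xs ys) ≡ length xs * length ys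
length-cartesianProduct [] ys = refl
length-cartesianProduct (x ∷ xs) ys = trans (Listₚ.length-++ (map (x ,_) ys))
  (cong₂ _+_ (Listₚ.length-map (x ,_) ys) (length-cartesianProduct xs ys))

-- The two extremal configurations, up to renaming of points: (C, D) and (A, B).
record TypeC {n} (t : ℕ) (𝓕 𝓖 : List (Part n)) : Set where
  field
    ts      : List (Fin n)
    ts-uniq : Unique ts
    ts-len  : length ts ≡ suc t
    inF     : ∀ {F} → F ∈ 𝓕 → Contains F (singles ts)
    inG     : Cover t 𝓖 (singles ts)

record TypeA {n} (t q : ℕ) (𝓕 𝓖 : List (Part n)) : Set where
  field
    xs zs  : List (Fin n)
    uniq   : Unique (xs ++ zs)
    xs-len : length xs ≡ t
    zs-len : length zs ≡ q
    inF    : ∀ {F} → F ∈ 𝓕 → Contains F (singles xs) × ∃ λ z → z ∈ zs × Blk F ⁅ z ⁆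
    inG    : ∀ {G} → G ∈ 𝓖 → Contains G (singles xs) ⊎
             ∃ λ x → x ∈ xs × ¬ Blk G ⁅ x ⁆ × Contains G (singles zs) × (∀ {y} → y ∈ xs → y ≢ x → Blk G ⁅ y ⁆)

-- The conditions on `w` say when an extremal configuration can still reach `w` units: (C, D) is
-- worth t + 1 of them and (A, B) is worth `q`.
data Outcome {n} (t q w φ ψ : ℕ) (𝓕 𝓖 : List (Part n)) : Set where
  small : Small (length 𝓕) (length 𝓖) w φ ψ → Outcome t q w φ ψ 𝓕 𝓖
  typeC : w ≤ suc t → TypeC t 𝓕 𝓖 → Outcome t q w φ ψ 𝓕 𝓖
  typeA : w ≡ q → TypeA t q 𝓕 𝓖 → Outcome t q w φ ψ 𝓕 𝓖

module _ where
  open ≤-Reasoning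

  small-cover : ∀ {F G w φ ψ t} → F ≤ φ → G ≤ suc t ^ 1 * ψ → 2 + t ≤ w → 1 ≤ φ → 1 ≤ ψ → Small F G w φ ψ
  small-cover {F} {G} {w} {φ} {ψ} {t} hF hG t<w 1≤φ 1≤ψ = mkSmall (begin-strict
    4 * (F * G) + φ * ψ ≤⟨ +-monoˡ-≤ (φ * ψ) (*-monoʳ-≤ 4 (*-mono-≤ hF hG)) ⟩
    4 * (φ * (suc t * 1 * ψ)) + φ * ψ ≡⟨ l φ t ψ ⟩
    (5 + 4 * t) * (φ * ψ) <⟨ *-monoˡ-< (φ * ψ) {{>-nonZero (*-mono-≤ {1} {φ} 1≤φ 1≤ψ)}} {5 + 4 * t} {4 * (2 + t)} (slack 2 (l′ t)) ⟩
    4 * (2 + t) * (φ * ψ) ≤⟨ *-monoˡ-≤ (φ * ψ) (*-monoʳ-≤ 4 t<w) ⟩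
    4 * w * (φ * ψ) ∎)
    where
    l : ∀ φ t ψ → 4 * (φ * (suc t * 1 * ψ)) + φ * ψ ≡ (5 + 4 * t) * (φ * ψ)
    l = solve-∀
    l′ : ∀ t → suc (5 + 4 * t) + 2 ≡ 4 * (2 + t)
    l′ = solve-∀

  square-≤ : ∀ {a c} → a ≤ c → a * a ≤ c * c
  square-≤ h = *-mono-≤ h h

  four-squares : ∀ {t q c} → 1 ≤ t → suc t * suc q ≤ c → 4 * (suc q * suc q) ≤ c * c
  four-squares {suc t} {q} {c} _ h = ≤-trans (slack (t * (4 + t) * (suc q * suc q)) (l t q)) (square-≤ h)
    where
    l : ∀ t q → 4 * (suc q * suc q) + t * (4 + t) * (suc q * suc q) ≡ suc (suc t) * suc q * (suc (suc t) * suc q)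
    l = solve-∀

  cover-squares : ∀ {t q c} → suc t * suc q ≤ c → suc t * (suc q * suc q) ≤ c * c
  cover-squares {t} {q} {c} h = ≤-trans (slack (t * suc t * (suc q * suc q)) (l t q)) (square-≤ h)
    where
    l : ∀ t q → suc t * (suc q * suc q) + t * suc t * (suc q * suc q) ≡ suc t * suc q * (suc t * suc q)
    l = solve-∀

  -- From 4t ≤ (t + 1)² and 4q < (q + 1)². The multiple 16 is the largest that occurs among the
  -- corrections in the star cases.
  sixteen : ∀ {t q c} → 1 ≤ t → 2 ≤ q → suc t * suc q ≤ c → 16 * (t * q) < c * c
  sixteen {t} {q} {c} 1≤t 2≤q h = ≤-trans (begin
    suc (16 * (t * q)) ≡⟨ cong suc (l₁ t q) ⟩
    suc (4 * t * (4 * q)) ≤⟨ +-monoˡ-≤ (4 * t * (4 * q)) (≤-trans (s≤s z≤n) (*-monoʳ-≤ 4 1≤t)) ⟩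
    4 * t + 4 * t * (4 * q) ≡⟨ sym (*-suc (4 * t) (4 * q)) ⟩
    4 * t * suc (4 * q) ≤⟨ *-mono-≤ (four t 1≤t) (four′ q 2≤q) ⟩
    suc t * suc t * (suc q * suc q) ≡⟨ l₂ t q ⟩
    suc t * suc q * (suc t * suc q) ∎) (square-≤ h)
    where
    l₁ : ∀ t q → 16 * (t * q) ≡ 4 * t * (4 * q)
    l₁ = solve-∀
    l₂ : ∀ t q → suc t * suc t * (suc q * suc q) ≡ suc t * suc q * (suc t * suc q)
    l₂ = solve-∀
    four : ∀ t → 1 ≤ t → 4 * t ≤ suc t * suc t
    four (suc t) _ = slack (t * t) (l t)
      where
      l : ∀ t → 4 * suc t + t * t ≡ suc (suc t) * suc (suc t)
      l = solve-∀
    four′ : ∀ q → 2 ≤ q → suc (4 * q) ≤ suc q * suc q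
    four′ (suc (suc q)) (s≤s (s≤s z≤n)) = slack (q * q + 2 * q) (l q)
      where
      l : ∀ q → suc (4 * suc (suc q)) + (q * q + 2 * q) ≡ suc (suc (suc q)) * suc (suc (suc q))
      l = solve-∀

module Star {n} (t q : ℕ) {k} {𝓕 𝓖 : List (Part n)} (fam𝓕 : IsFam k 𝓕) (fam𝓖 : IsFam (t + q) 𝓖) (cross : Cross t 𝓕 𝓖)
  {X} (uX : Unique X) (lX : length X ≡ t) (starX : ∀ {F} → F ∈ 𝓕 → Contains F X)
  {F₀ G₀} (F₀∈ : F₀ ∈ 𝓕) (G₀∈ : G₀ ∈ 𝓖) (G₀∌X : ¬ Contains G₀ X)
  (ψ₀ : ℕ) (cnt𝓖-t : ∀ {H} → Unique H → length H ≡ t → cnt 𝓖 H ≤ ψ₀) where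

  open ≤-Reasoning
  open Branching {n} t q (proj₂ fam𝓖) cross public

  -- `ψ₀` is the main term. In each later case the task is to find few sets `E i`, each of them
  -- large, that catch the members of 𝓖 not containing `X`.
  nonstar-bound : ∀ {A : Set} (I : List A) (E : A → List (Subset n)) K →
    (∀ {G} → G ∈ 𝓖 → ¬ Contains G X → ∃ λ i → i ∈ I × Contains G (E i)) → (∀ {i} → i ∈ I → cnt 𝓖 (E i) ≤ K) →
    length 𝓖 ≤ ψ₀ + length I * K
  nonstar-bound I E K h bound = begin
    length 𝓖 ≡⟨ count-complement (hasAll X) 𝓖 ⟩
    cnt 𝓖 X + count (not ∘ hasAll X) 𝓖 ≤⟨ +-mono-≤ (cnt𝓖-t uX lX) (count-union-const I (hasAll ∘ E) K 𝓖
      (λ {G} G∈ nh → let i , i∈ , c = h G∈ (λ c → T-not⁻ nh (contains⁺ {F = G} X c)) in i , i∈ , contains⁺ (E i) c) bound) ⟩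
    ψ₀ + length I * K ∎

  length-𝓕 : length 𝓕 ≡ cnt 𝓕 X
  length-𝓕 = sym (count-all λ {F} F∈ → contains⁺ {F = F} X (starX F∈))

  cover-length : ∀ {T} → Unique T → length T ≡ suc t → Cover t 𝓖 T → length 𝓖 ≤ suc t ^ 1 * ψ₀
  cover-length {T} uT lT c with cover-base {Q = ⊥} 𝓖 ψ₀ T t 1 [] uT (trans lT (+-comm 1 t))
    (λ S uS _ lS → inj₂ (subst (λ z → cnt 𝓖 z ≤ ψ₀) (sym (Listₚ.++-identityʳ S)) (cnt𝓖-t uS lS)))
  ... | inj₂ le = subst (_≤ suc t ^ 1 * ψ₀) (sym (length-cover 𝓖 c)) le

  hits<t : ∀ {G} → ¬ Contains G X → hits G X < t
  hits<t {G} ¬c = subst (hits G X <_) lX (hits-miss {G = G} {X} ¬c)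

  -- With `near`, the member `G₀` lacks exactly one block of `X`. It therefore has exactly q + 1
  -- blocks outside `X`, and each member of 𝓕 contains one of those.
  module NearStar (near : t ≤ suc (hits G₀ X)) where

    Z : List (Subset n)
    Z = fresh X G₀

    Z-length : length Z ≡ suc q
    Z-length = +-cancelˡ-≡ (hits G₀ X) (length Z) (suc q) (trans (fresh-length X G₀ uX) (trans (size (proj₂ fam𝓖 G₀∈))
      (trans (cong (_+ q) (≤-antisym near (hits<t {G₀} G₀∌X))) (sym (+-suc (hits G₀ X) q)))))

    Z-hit : ∀ {F} → F ∈ 𝓕 → ∃ λ B → B ∈ Z × Blk F B
    Z-hit {F} F∈ = common-pick {F = F} {G₀} t (cross F∈ G₀∈) (fresh-unique X G₀) (λ m → proj₁ (∈-fresh⁻ X G₀ m))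
      (subst₂ _<_ (sym (size (proj₂ fam𝓖 G₀∈))) (cong (_+_ t) (sym Z-length)) (+-monoʳ-< t (n<1+n q)))

    private
      x₀ = proj₁ (missing {G = G₀} {X} G₀∌X)
      x₀∈ = proj₁ (proj₂ (missing {G = G₀} {X} G₀∌X))
      x₀∉ = proj₂ (proj₂ (missing {G = G₀} {X} G₀∌X))
      i₀ = proj₁ (block-nonempty (blk (starX F₀∈) x₀∈))
      i₀∈ = proj₂ (block-nonempty (blk (starX F₀∈) x₀∈))
      eG₀ = equiv (proj₂ fam𝓖 G₀∈)

    -- The block of G₀ through a point of a missing block of X meets X, so no F contains it.
    N : Subset n
    N = rowOf G₀ i₀

    N-block : Blk G₀ N
    N-block = row-block eG₀ i₀

    i₀∈N : N ∋ i₀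
    i₀∈N = row∋⁺ (r-refl eG₀ i₀)

    N∉ : ∀ {F} → F ∈ 𝓕 → ¬ Blk F N
    N∉ F∈ b = x₀∉ (subst (Blk G₀) (block-unique b (blk (starX F∈) x₀∈) i₀∈N i₀∈) N-block)

    N∈Z : N ∈ Z
    N∈Z = ∈-fresh⁺ X G₀ N-block (λ m → N∉ F₀∈ (blk (starX F₀∈) m))

  -- Of the t + 1 ways to omit one block of `T`, only the omission of `B` counts in full; the other
  -- `t` keep the block with two points and count half.
  D-multi : ∀ {T B} → Unique T → length T ≡ suc t → B ∈ T → Multi B →
    (∀ {H B} → Unique H → length H ≡ t → B ∈ H → Multi B → 2 * cnt 𝓖 H ≤ ψ₀) →
    2 * count (λ G → ⌊ t ≤? hits G T ⌋) 𝓖 ≤ (2 + t) * ψ₀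
  D-multi {T} {B} uT lT B∈ mul multi = begin
    2 * count (λ G → ⌊ t ≤? hits G T ⌋) 𝓖 ≤⟨ *-monoʳ-≤ 2 (count-union T (λ y → hasAll (del y T)) K 𝓖 near bound) ⟩
    2 * sum (map K T) ≡⟨ cong (2 *_) (sum-map-if (λ y → ⌊ y ≡? B ⌋) ψ₀ h T) ⟩
    2 * (count (λ y → ⌊ y ≡? B ⌋) T * ψ₀ + length (del B T) * h)
      ≡⟨ cong₂ (λ a b → 2 * (a * ψ₀ + b * h)) (count-self B T uT B∈) (suc-injective (trans (sym (del-length B T uT B∈)) lT)) ⟩
    2 * (1 * ψ₀ + t * h) ≡⟨ l ψ₀ t h ⟩
    2 * ψ₀ + t * (h + h) ≤⟨ +-monoʳ-≤ (2 * ψ₀) (*-monoʳ-≤ t (≤-trans (+-monoʳ-≤ h (⌊n/2⌋≤⌈n/2⌉ ψ₀)) (≤-reflexive (⌊n/2⌋+⌈n/2⌉≡n ψ₀)))) ⟩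
    2 * ψ₀ + t * ψ₀ ≡⟨ sym (*-distribʳ-+ ψ₀ 2 t) ⟩
    (2 + t) * ψ₀ ∎
    where
    h = ⌊ ψ₀ /2⌋
    K : Subset n → ℕ
    K y = if ⌊ y ≡? B ⌋ then ψ₀ else h
    l : ∀ ψ t h → 2 * (1 * ψ + t * h) ≡ 2 * ψ + t * (h + h)
    l = solve-∀
    near : ∀ {G} → G ∈ 𝓖 → Data.Bool.T ⌊ t ≤? hits G T ⌋ → ∃ λ y → y ∈ T × Data.Bool.T (hasAll (del y T) G)
    near {G} _ le with contains? G T
    ... | yes c = B , B∈ , contains⁺ {F = G} (del B T) (mkContains (blk c ∘ proj₁ ∘ ∈-del⁻ B T))
    ... | no ¬c = let y , y∈ , _ , c = miss-one {G = G} uT (≤-trans (≤-reflexive lT) (s≤s (toWitness {a? = t ≤? hits G T} le))) ¬c in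
      y , y∈ , contains⁺ {F = G} (del y T) c
    len : ∀ {y} → y ∈ T → length (del y T) ≡ t
    len {y} y∈ = suc-injective (trans (sym (del-length y T uT y∈)) lT)
    half : ∀ {m} → 2 * m ≤ ψ₀ → m ≤ h
    half {m} le = ≤-trans (≤-reflexive (n≡⌊n+n/2⌋ m)) (⌊n/2⌋-mono (≤-trans (≤-reflexive (cong (m +_) (sym (+-identityʳ m)))) le))
    bound : ∀ {y} → y ∈ T → cnt 𝓖 (del y T) ≤ K y
    bound {y} y∈ = ≤-if (y ≡? B) (λ _ → cnt𝓖-t (del-unique y T uT) (len y∈))
      (λ y≢B → half (multi (del-unique y T uT) (len y∈) (∈-del⁺ y T B∈ (y≢B ∘ sym)) mul))

-- A family of k-partitions containing X, against a family with a cover of size t + 1 above X.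
module StarCover {n} (t q : ℕ) {k} {𝓕 𝓖 : List (Part n)} (fam𝓕 : IsFam k 𝓕) (fam𝓖 : IsFam (t + q) 𝓖) (cross : Cross t 𝓕 𝓖)
  {X} (uX : Unique X) (lX : length X ≡ t) (starX : ∀ {F} → F ∈ 𝓕 → Contains F X)
  {F₀ G₀} (F₀∈ : F₀ ∈ 𝓕) (G₀∈ : G₀ ∈ 𝓖) (G₀∌X : ¬ Contains G₀ X)
  (ψ₀ ψ₁ φ₁ φ₂ c w p : ℕ)
  (cnt𝓖-t : ∀ {H} → Unique H → length H ≡ t → cnt 𝓖 H ≤ ψ₀)
  (cnt𝓖-t-multi : ∀ {H B} → Unique H → length H ≡ t → B ∈ H → Multi B → 2 * cnt 𝓖 H ≤ ψ₀)
  (cnt𝓖-suc-t : ∀ {H} → Unique H → length H ≡ suc t → cnt 𝓖 H ≤ ψ₁)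
  (cnt𝓖-all : ∀ {H} → Unique H → suc (length H) ≡ t + q → cnt 𝓖 H ≤ 1)
  (cnt𝓕-suc-t : ∀ {H} → Unique H → length H ≡ suc t → cnt 𝓕 H ≤ φ₁)
  (cnt𝓕-suc-t-multi : ∀ {H B} → Unique H → length H ≡ suc t → B ∈ H → Multi B → 2 * cnt 𝓕 H ≤ φ₁)
  (cnt𝓕-2+t : ∀ {H} → Unique H → length H ≡ suc (suc t) → cnt 𝓕 H ≤ φ₂)
  (k≡ : k ≡ t + p) (1≤t : 1 ≤ t) (2≤q : 2 ≤ q) (2≤p : 2 ≤ p) (tq≤c : suc t * suc q ≤ c) (tp≤c : suc t * suc p ≤ c)
  (cφ : c * c * φ₂ ≤ φ₁) (cψ : c * c * ψ₁ ≤ ψ₀) (1≤φ₁ : 1 ≤ φ₁) (1≤ψ₁ : 1 ≤ ψ₁) (t<w : suc t ≤ w) (q≤w : q ≤ w)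
  {T} (uT : Unique T) (X⊆T : X ⊆ T) (lT : length T ≡ suc t) (coverT : Cover t 𝓖 T) where

  open ≤-Reasoning
  open Star t q fam𝓕 fam𝓖 cross uX lX starX F₀∈ G₀∈ G₀∌X ψ₀ cnt𝓖-t

  private
    Result : Set
    Result = Outcome t q w φ₁ ψ₀ 𝓕 𝓖

    2≤w : 2 ≤ w
    2≤w = ≤-trans (s≤s 1≤t) t<w

    1≤ψ₀ : 1 ≤ ψ₀
    1≤ψ₀ = ≤-trans (*-mono-≤ {1} {c * c} (≤-trans (s≤s z≤n) (sixteen 1≤t 2≤q tq≤c)) 1≤ψ₁) cψ

    scale : ∀ {r} → r < c * c → r * ψ₁ < ψ₀
    scale {r} h = ≤-trans (*-monoˡ-< ψ₁ {{>-nonZero 1≤ψ₁}} h) cψ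

    extra : ∃ λ B → B ∈ T × B ∉ X
    extra with Any.any? (λ S → ¬? (Any.any? (S ≡?_) X)) T
    ... | yes a = find a
    ... | no ¬a = contradiction (unique-⊆-length uT sub) (<⇒≱ (≤-reflexive (trans (cong suc lX) (sym lT))))
      where
      sub : T ⊆ X
      sub {S} m with Any.any? (S ≡?_) X
      ... | yes S∈ = S∈
      ... | no S∉ = contradiction (lose m S∉) ¬a

    T⊆ : T ⊆ proj₁ extra ∷ X
    T⊆ = unique-⊆-complete _≡?_ (∷-unique (proj₂ (proj₂ extra)) uX)
      (λ { (here refl) → proj₁ (proj₂ extra) ; (there m) → X⊆T m }) (≤-reflexive (trans lT (cong suc (sym lX))))

    -- `T` has just one block more than `X`, so a member that meets `T` in `t` blocks lacks at most
    -- one block of `X`.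
    near : ∀ {G} → G ∈ 𝓖 → t ≤ suc (hits G X)
    near {G} G∈ = ≤-trans (hit coverT G∈) (≤-trans (hits-mono G uT T⊆) (hits-∷ G (proj₁ extra) X))

    without : ∀ {G} → G ∈ 𝓖 → ¬ Contains G X → ∃ λ x → x ∈ X × ¬ Blk G x × Contains G (del x X)
    without {G} G∈ ¬c = miss-one {G = G} uX (subst (_≤ suc (hits G X)) (sym lX) (near G∈)) ¬c

    cover-blk : ∀ {B G} → Cover t 𝓖 (B ∷ X) → G ∈ 𝓖 → ¬ Contains G X → Blk G B
    cover-blk {B} {G} cov G∈ ¬c with blk? G B
    ... | yes b = b
    ... | no ¬b = contradiction (subst (t ≤_) (hits-∷-no G B X ¬b) (hit cov G∈)) (<⇒≱ (hits<t {G} ¬c))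

    del-len : ∀ {x} → x ∈ X → suc (length (del x X)) ≡ t
    del-len {x} x∈ = trans (sym (del-length x X uX x∈)) lX

    coverᵇ : Subset n → Bool
    coverᵇ B = allL (λ G → ⌊ t ≤? hits G (B ∷ X) ⌋) 𝓖

  open NearStar (near G₀∈)

  private
    -- Good blocks are those whose addition to `X` gives a cover of 𝓖. `N` is ruled out explicitly:
    -- it lies in no member of 𝓕 and must not be charged `φ₁`.
    good : Subset n → Bool
    good B = coverᵇ B ∧ not ⌊ B ≡? N ⌋

    good⁻ : ∀ {B} → Data.Bool.T (good B) → Cover t 𝓖 (B ∷ X) × B ≢ N
    good⁻ {B} h = let a , b = to (T-∧ {coverᵇ B}) h in
      mkCover (λ {G} m → toWitness {a? = t ≤? hits G (B ∷ X)} (allL⁻ {xs = 𝓖} a m)) , λ e → T-not⁻ b (fromWitness {a? = B ≡? N} e)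

    good⁺ : ∀ {B} → Cover t 𝓖 (B ∷ X) → B ≢ N → Data.Bool.T (good B)
    good⁺ {B} cov ne = from (T-∧ {coverᵇ B}) (allL⁺ (λ {G} m → fromWitness {a? = t ≤? hits G (B ∷ X)} (hit cov m)) ,
      T-not⁺ (ne ∘ toWitness {a? = B ≡? N}))

    Zg : List (Subset n)
    Zg = filterᵇ good Z

    uZ : Unique Z
    uZ = fresh-unique X G₀

    Zg⁻ : ∀ {B} → B ∈ Zg → Blk G₀ B × B ∉ X × Cover t 𝓖 (B ∷ X) × B ≢ N
    Zg⁻ m = let m′ , h = ∈-filterᵇ⁻ {p = good} {xs = Z} m ; b , B∉ = ∈-fresh⁻ X G₀ m′ ; cov , ne = good⁻ h in b , B∉ , cov , ne

    uZg : Unique Zg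
    uZg = filterᵇ-unique good uZ

    Z-split : length Zg + count (not ∘ good) Z ≡ suc q
    Z-split = trans (sym (count-complement good Z)) Z-length

    uBX : ∀ {B} → B ∉ X → Unique (B ∷ X)
    uBX B∉ = ∷-unique B∉ uX

    weight : Subset n → ℕ
    weight B = if good B then φ₁ else suc q * φ₂

    -- If `B ∷ X` is no cover, some `G` meets it in fewer than `t` blocks and one further round of
    -- branching is possible.
    bad-bound : ∀ {B} → B ∈ Z → ¬ Data.Bool.T (good B) → cnt 𝓕 (B ∷ X) ≤ suc q * φ₂
    bad-bound {B} B∈ ¬g = go (B ≡? N)
      where
      B∉ : B ∉ X
      B∉ = proj₂ (∈-fresh⁻ X G₀ B∈)
      uncovered : ∀ {G} → G ∈ 𝓖 → hits G (B ∷ X) < t → cnt 𝓕 (B ∷ X) ≤ suc q * φ₂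
      uncovered G∈ lt = branch φ₂ G∈ lt (uBX B∉) (λ _ C∉ → cnt𝓕-2+t (∷-unique C∉ (uBX B∉)) (cong (suc ∘ suc) lX))
      go : Dec (B ≡ N) → cnt 𝓕 (B ∷ X) ≤ suc q * φ₂
      go (yes e) = ≤-trans (≤-reflexive (cnt-zero {H = B ∷ X} (λ {F} F∈ c → N∉ F∈ (subst (Blk F) e (blk c (here refl)))))) z≤n
      go (no B≢N) = [ (λ cov → ⊥-elim (¬g (good⁺ cov B≢N))) , (λ { (G , G∈ , lt) → uncovered G∈ lt }) ]′ (cover? t 𝓖 (B ∷ X))

    weight-bound : ∀ {B} → B ∈ Z → cnt 𝓕 (B ∷ X) ≤ weight B
    weight-bound {B} B∈ with T? (good B)
    ... | yes g = ≤-trans (cnt𝓕-suc-t (uBX (proj₂ (∈-fresh⁻ X G₀ B∈))) (cong suc lX)) (≤-reflexive (sym (cong (λ b → if b then φ₁ else suc q * φ₂) (to T-≡ g))))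
    ... | no ¬g = ≤-trans (bad-bound B∈ ¬g) (≤-reflexive (sym (cong (λ b → if b then φ₁ else suc q * φ₂) (to T-not-≡ (T-not⁺ ¬g)))))

    𝓕-bound : length 𝓕 ≤ length Zg * φ₁ + count (not ∘ good) Z * (suc q * φ₂)
    𝓕-bound = begin
      length 𝓕 ≡⟨ length-𝓕 ⟩
      cnt 𝓕 X ≤⟨ count-union Z (λ B → hasAll (B ∷ X)) weight 𝓕
        (λ {F} F∈ h → let B , B∈ , b = Z-hit F∈ in B , B∈ , from (T-∧ {isBlock F B}) (unBlk b , h)) weight-bound ⟩
      sum (map weight Z) ≡⟨ sum-map-if good φ₁ (suc q * φ₂) Z ⟩
      length Zg * φ₁ + count (not ∘ good) Z * (suc q * φ₂) ∎

    four-φ : 4 * (suc q * (suc q * φ₂)) ≤ φ₁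
    four-φ = ≤-trans (≤-reflexive (l q φ₂)) (≤-trans (*-monoˡ-≤ φ₂ (four-squares 1≤t tq≤c)) cφ)
      where
      l : ∀ q φ → 4 * (suc q * (suc q * φ)) ≡ 4 * (suc q * suc q) * φ
      l = solve-∀

    -- Counted in quarters of `φ₁`: four for each good block, and a single one for all bad blocks
    -- together.
    four-𝓕 : 4 * length 𝓕 ≤ suc (4 * length Zg) * φ₁
    four-𝓕 = begin
      4 * length 𝓕 ≤⟨ *-monoʳ-≤ 4 (≤-trans 𝓕-bound (+-monoʳ-≤ (length Zg * φ₁) (*-monoˡ-≤ (suc q * φ₂) (m+n≤o⇒n≤o (length Zg) (≤-reflexive Z-split))))) ⟩
      4 * (length Zg * φ₁ + suc q * (suc q * φ₂)) ≡⟨ l₁ (length Zg) φ₁ (suc q * (suc q * φ₂)) ⟩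
      4 * length Zg * φ₁ + 4 * (suc q * (suc q * φ₂)) ≤⟨ +-monoʳ-≤ (4 * length Zg * φ₁) four-φ ⟩
      4 * length Zg * φ₁ + φ₁ ≡⟨ +-comm _ φ₁ ⟩
      suc (4 * length Zg) * φ₁ ∎
      where
      l₁ : ∀ m φ x → 4 * (m * φ + x) ≡ 4 * m * φ + 4 * x
      l₁ = solve-∀

    -- Without good blocks 𝓕 is so small, at most (q + 1)² `φ₂`, that the crude bound (t + 1) `ψ₀`
    -- for 𝓖 suffices.
    case-none : length Zg ≡ 0 → Result
    case-none e = small (small-≤ (begin
      length 𝓕 * length 𝓖 ≤⟨ *-mono-≤ 𝓕-bound (cover-length uT lT coverT) ⟩
      (length Zg * φ₁ + count (not ∘ good) Z * (suc q * φ₂)) * (suc t ^ 1 * ψ₀)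
        ≡⟨ cong₂ (λ a b → (a * φ₁ + b * (suc q * φ₂)) * (suc t ^ 1 * ψ₀)) e (trans (cong (_+ count (not ∘ good) Z) (sym e)) Z-split) ⟩
      suc q * (suc q * φ₂) * (suc t * 1 * ψ₀) ≡⟨ l q φ₂ t ψ₀ ⟩
      suc t * (suc q * suc q) * φ₂ * ψ₀ ≤⟨ *-monoˡ-≤ ψ₀ (≤-trans (*-monoˡ-≤ φ₂ (cover-squares {t} {q} tq≤c)) cφ) ⟩
      φ₁ * ψ₀ ∎) 2≤w 1≤φ₁ 1≤ψ₀)
      where
      l : ∀ q φ t ψ → suc q * (suc q * φ) * (suc t * 1 * ψ) ≡ suc t * (suc q * suc q) * φ * ψ
      l = solve-∀

    -- Every member of 𝓕 now contains the cover `B ∷ X`. If this consists of singletons, the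
    -- configuration is (C, D), or still a unit short when `w` exceeds t + 1; if a block has two
    -- points, `D-multi` gives the loss.
    case-all-in : ∀ {B} → B ∈ Zg → (∀ {F} → F ∈ 𝓕 → Blk F B) → Result
    case-all-in {B} B∈ allB = [ multi , singl ]′ (singles-or-multi (B ∷ X) (λ m → block-nonempty (blk (inB F₀∈) m)))
      where
      B∉ = proj₁ (proj₂ (Zg⁻ B∈))
      cov = proj₁ (proj₂ (proj₂ (Zg⁻ B∈)))
      inB : ∀ {F} → F ∈ 𝓕 → Contains F (B ∷ X)
      inB F∈ = contains-∷ (allB F∈) (starX F∈)
      len : length (B ∷ X) ≡ suc t
      len = cong suc lX
      𝓕≤ : length 𝓕 ≤ φ₁
      𝓕≤ = ≤-trans (≤-reflexive (sym (count-all {p = hasAll (B ∷ X)} λ {F} F∈ → contains⁺ {F = F} (B ∷ X) (inB F∈)))) (cnt𝓕-suc-t (uBX B∉) len)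
      multi : (∃ λ S → S ∈ B ∷ X × Multi S) → Result
      multi (S , S∈ , mul) = small (small-half 0 𝓕≤ (begin
        2 * length 𝓖 ≡⟨ cong (2 *_) (length-cover 𝓖 cov) ⟩
        2 * count (λ G → ⌊ t ≤? hits G (B ∷ X) ⌋) 𝓖 ≤⟨ D-multi (uBX B∉) len S∈ mul cnt𝓖-t-multi ⟩
        (2 + t) * ψ₀ ≡⟨ sym (+-identityʳ _) ⟩
        (2 + t) * ψ₀ + 0 ∎) 1≤ψ₀ t<w 1≤t 1≤φ₁)
      singl : (∃ λ ts → B ∷ X ≡ singles ts) → Result
      singl (ts , e) with w ≤? suc t
      ... | yes w≤ = typeC w≤ (record
        { ts = ts ; ts-uniq = singles-unique⁻ (subst Unique e (uBX B∉))
        ; ts-len = trans (sym (Listₚ.length-map ⁅_⁆ ts)) (trans (cong length (sym e)) len)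
        ; inF = λ {F} F∈ → subst (Contains F) e (inB F∈) ; inG = subst (Cover t 𝓖) e cov })
      ... | no w≰ = small (small-cover 𝓕≤ (cover-length (uBX B∉) len cov) (≰⇒> w≰) 1≤φ₁ 1≤ψ₀)

    -- A member of 𝓖 that lacks some `x` contains `B`, the rest of `X`, and a block outside `X`
    -- shared with `F₁`, which differs from `B` because `F₁` avoids `B`. That leaves `t * p` sets of
    -- size t + 1. The coefficient 5 is `suc (4 * 1)` from `four-𝓕`.
    case-avoid : ∀ {B F₁} → B ∈ Zg → length Zg ≡ 1 → F₁ ∈ 𝓕 → ¬ Blk F₁ B → Result
    case-avoid {B} {F₁} B∈ e F₁∈ ¬b = small (small-mix 5 (t * p * ψ₁) (subst (λ m → 4 * length 𝓕 ≤ suc (4 * m) * φ₁) e four-𝓕)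
      𝓖≤ (subst (_< ψ₀) (*-assoc 5 (t * p) ψ₁) (scale (≤-trans (s≤s (*-monoˡ-≤ (t * p) (m≤m+n 5 11))) (sixteen 1≤t 2≤p tp≤c)))) (≤-trans (n≤1+n 7) (*-monoʳ-≤ 4 2≤w)) 1≤φ₁)
      where
      B∉ : B ∉ X
      B∉ = proj₁ (proj₂ (Zg⁻ B∈))
      cov : Cover t 𝓖 (B ∷ X)
      cov = proj₁ (proj₂ (proj₂ (Zg⁻ B∈)))
      Y : List (Subset n)
      Y = fresh X F₁
      lenY : length Y ≡ p
      lenY = +-cancelˡ-≡ t (length Y) p (trans (cong (_+ length Y) (sym (trans (contains-hits (starX F₁∈)) lX)))
        (trans (fresh-length X F₁ uX) (trans (size (proj₂ fam𝓕 F₁∈)) k≡)))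
      E : Subset n × Subset n → List (Subset n)
      E (x , C) = C ∷ B ∷ del x X
      I : List (Subset n × Subset n)
      I = List.cartesianProduct X Y
      choice : ∀ {G} → G ∈ 𝓖 → ¬ Contains G X → ∃ λ i → i ∈ I × Contains G (E i)
      choice {G} G∈ ¬c =
        let x , x∈ , _ , cd = without G∈ ¬c
            C , bF , bG , C∉ = common-outside {F = F₁} {G} t (cross F₁∈ G∈) (hits<t {G} ¬c)
        in (x , C) , ∈-cartesianProduct⁺ x∈ (∈-fresh⁺ X F₁ bF C∉) , contains-∷ bG (contains-∷ (cover-blk cov G∈ ¬c) cd)
      uE : ∀ {x C} → Blk F₁ C → C ∉ X → Unique (E (x , C))
      uE {x} bC C∉ = ∷-unique (λ { (here refl) → ¬b bC ; (there m) → C∉ (proj₁ (∈-del⁻ x X m)) })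
        (∷-unique (λ m → B∉ (proj₁ (∈-del⁻ x X m))) (del-unique x X uX))
      bound : ∀ i → proj₁ i ∈ X × proj₂ i ∈ Y → cnt 𝓖 (E i) ≤ ψ₁
      bound (x , C) (x∈ , C∈) = cnt𝓖-suc-t (uE (proj₁ (∈-fresh⁻ X F₁ C∈)) (proj₂ (∈-fresh⁻ X F₁ C∈))) (cong suc (del-len x∈))
      𝓖≤ : length 𝓖 ≤ ψ₀ + t * p * ψ₁
      𝓖≤ = subst (λ z → length 𝓖 ≤ ψ₀ + z * ψ₁) (trans (length-cartesianProduct X Y) (cong₂ _*_ lX lenY))
        (nonstar-bound I E ψ₁ choice (λ {i} i∈ → bound i (∈-cartesianProduct⁻ X Y i∈)))

    case-one : ∀ {B} → B ∈ Zg → length Zg ≡ 1 → Result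
    case-one {B} B∈ e = go (All.all? (λ F → blk? F B) 𝓕)
      where
      go : Dec (All (λ F → Blk F B) 𝓕) → Result
      go (yes all) = case-all-in B∈ (All.lookup all)
      go (no ¬all) = let F₁ , F₁∈ , ¬b = find (Allₚ.¬All⇒Any¬ (λ F → blk? F B) 𝓕 ¬all) in case-avoid B∈ e F₁∈ ¬b

    module TwoGood {B₁ B₂} (B₁∈ : B₁ ∈ Zg) (B₂∈ : B₂ ∈ Zg) (B₁≢B₂ : B₁ ≢ B₂) where

      ψ-large : ∀ r → r ≤ 16 * (t * q) → r * ψ₁ < ψ₀
      ψ-large r le = scale (≤-trans (s≤s le) (sixteen 1≤t 2≤q tq≤c))

      -- A member of 𝓖 that lacks some `x` contains both `B₁` and `B₂` besides the rest of `X`, so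
      -- `t` sets of size t + 1 catch all of these members.
      case-few : length Zg < q → Result
      case-few m<q = small (small-mix (suc (4 * length Zg)) (t * ψ₁) four-𝓕 𝓖≤ us (≤-trans mw (*-monoʳ-≤ 4 (≤-trans m<q q≤w))) 1≤φ₁)
        where
        E : Subset n → List (Subset n)
        E x = B₁ ∷ B₂ ∷ del x X
        𝓖≤ : length 𝓖 ≤ ψ₀ + t * ψ₁
        𝓖≤ = subst (λ z → length 𝓖 ≤ ψ₀ + z * ψ₁) lX (nonstar-bound X E ψ₁
          (λ {G} G∈ ¬c → let x , x∈ , _ , cd = without G∈ ¬c in x , x∈ ,
            contains-∷ (cover-blk (proj₁ (proj₂ (proj₂ (Zg⁻ B₁∈)))) G∈ ¬c) (contains-∷ (cover-blk (proj₁ (proj₂ (proj₂ (Zg⁻ B₂∈)))) G∈ ¬c) cd))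
          (λ {x} x∈ → cnt𝓖-suc-t
            (∷-unique (λ { (here e) → B₁≢B₂ e ; (there m) → proj₁ (proj₂ (Zg⁻ B₁∈)) (proj₁ (∈-del⁻ x X m)) })
              (∷-unique (proj₁ (proj₂ (Zg⁻ B₂∈)) ∘ proj₁ ∘ ∈-del⁻ x X) (del-unique x X uX))) (cong suc (del-len x∈))))
        mw : 2 + suc (4 * length Zg) ≤ 4 * suc (length Zg)
        mw = slack 1 (l (length Zg))
          where
          l : ∀ m → 2 + suc (4 * m) + 1 ≡ 4 * suc m
          l = solve-∀
        us : suc (4 * length Zg) * (t * ψ₁) < ψ₀
        us = subst (_< ψ₀) (*-assoc (suc (4 * length Zg)) t ψ₁) (ψ-large (suc (4 * length Zg) * t) (begin
          suc (4 * length Zg) * t ≤⟨ *-monoˡ-≤ t (≤-trans (≤-trans (m≤n+m _ 2) mw) (*-monoʳ-≤ 4 m<q)) ⟩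
          4 * q * t ≤⟨ slack (12 * (t * q)) (l q t) ⟩
          16 * (t * q) ∎))
          where
          l : ∀ q t → 4 * q * t + 12 * (t * q) ≡ 16 * (t * q)
          l = solve-∀

      -- Every block of `Z` other than `N` is good. A member of 𝓖 that lacks some `x` contains the
      -- `q` good blocks and the other t - 1 blocks of `X`; only one of its blocks is left open, so
      -- there is at most one such member for each `x`.
      module AllGood (m≡q : length Zg ≡ q) where

        bad-one : count (not ∘ good) Z ≡ 1
        bad-one = +-cancelˡ-≡ q _ 1 (trans (cong (_+ count (not ∘ good) Z) (sym m≡q)) (trans Z-split (+-comm 1 q)))

        only-N : ∀ {B} → B ∈ Z → ¬ Data.Bool.T (good B) → B ≡ N
        only-N {B} B∈ ¬g = go (B ≡? N)
          where
          sub : B ∷ N ∷ [] ⊆ filterᵇ (not ∘ good) Z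
          sub (here refl) = ∈-filterᵇ⁺ {p = not ∘ good} B∈ (T-not⁺ ¬g)
          sub (there (here refl)) = ∈-filterᵇ⁺ {p = not ∘ good} N∈Z (T-not⁺ (λ g → proj₂ (good⁻ {N} g) refl))
          go : Dec (B ≡ N) → B ≡ N
          go (yes e) = e
          go (no ne) = ⊥-elim (<⇒≱ (s≤s (≤-reflexive bad-one)) (unique-⊆-length {xs = B ∷ N ∷ []} ((ne ∷ []) ∷ [] ∷ []) sub))

        Zg-hit : ∀ {F} → F ∈ 𝓕 → ∃ λ B → B ∈ Zg × Blk F B
        Zg-hit {F} F∈ = let B , B∈ , b = Z-hit F∈ in go B B∈ b (T? (good B))
          where
          go : ∀ B → B ∈ Z → Blk F B → Dec (Data.Bool.T (good B)) → ∃ λ B → B ∈ Zg × Blk F B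
          go B B∈ b (yes g) = B , ∈-filterᵇ⁺ {p = good} B∈ g , b
          go B B∈ b (no ¬g) = ⊥-elim (N∉ F∈ (subst (Blk F) (only-N B∈ ¬g) b))

        𝓖-cases : ∀ {G} → G ∈ 𝓖 → ¬ Contains G X → ∃ λ x → x ∈ X × ¬ Blk G x × Contains G Zg × Contains G (del x X)
        𝓖-cases {G} G∈ ¬c = let x , x∈ , x∉ , cd = without G∈ ¬c in
          x , x∈ , x∉ , mkContains (λ m → cover-blk (proj₁ (proj₂ (proj₂ (Zg⁻ m)))) G∈ ¬c) , cd

        𝓖≤ : length 𝓖 ≤ ψ₀ + t * 1
        𝓖≤ = subst (λ z → length 𝓖 ≤ ψ₀ + z * 1) lX (nonstar-bound X (λ x → Zg ++ del x X) 1
          (λ G∈ ¬c → let x , x∈ , _ , cz , cd = 𝓖-cases G∈ ¬c in x , x∈ , contains-++ cz cd)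
          (λ {x} x∈ → cnt𝓖-all
            (Uniqueₚ.++⁺ uZg (del-unique x X uX) (λ { (m , m′) → proj₁ (proj₂ (Zg⁻ m)) (proj₁ (∈-del⁻ x X m′)) }))
            (trans (cong suc (trans (Listₚ.length-++ Zg) (cong (_+ length (del x X)) m≡q)))
              (trans (sym (+-suc q _)) (trans (cong (_+_ q) (del-len x∈)) (+-comm q t))))))

        us : ∀ r → r ≤ 4 * q → r * (t * 1) < ψ₀
        us r le = begin-strict
          r * (t * 1) ≡⟨ l₁ r t ⟩
          r * t * 1 ≤⟨ *-monoʳ-≤ (r * t) 1≤ψ₁ ⟩
          r * t * ψ₁ <⟨ ψ-large (r * t) (≤-trans (*-monoˡ-≤ t le) (slack (12 * (t * q)) (l₂ q t))) ⟩
          ψ₀ ∎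
          where
          l₁ : ∀ r t → r * (t * 1) ≡ r * t * 1
          l₁ = solve-∀
          l₂ : ∀ q t → 4 * q * t + 12 * (t * q) ≡ 16 * (t * q)
          l₂ = solve-∀

        𝓕-union : ∀ K → (∀ {B} → B ∈ Zg → cnt 𝓕 (B ∷ X) ≤ K B) → length 𝓕 ≤ sum (map K Zg)
        𝓕-union K bound = ≤-trans (≤-reflexive length-𝓕) (count-union Zg (λ B → hasAll (B ∷ X)) K 𝓕
          (λ {F} F∈ h → let B , B∈ , b = Zg-hit F∈ in B , B∈ , from (T-∧ {isBlock F B}) (unBlk b , h)) bound)

        h = ⌊ φ₁ /2⌋

        2h≤ : h + h ≤ φ₁
        2h≤ = ≤-trans (+-monoʳ-≤ h (⌊n/2⌋≤⌈n/2⌉ φ₁)) (≤-reflexive (⌊n/2⌋+⌈n/2⌉≡n φ₁))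

        half : ∀ {m} → 2 * m ≤ φ₁ → m ≤ h
        half {m} le = ≤-trans (≤-reflexive (n≡⌊n+n/2⌋ m)) (⌊n/2⌋-mono (≤-trans (≤-reflexive (cong (m +_) (sym (+-identityʳ m)))) le))

        len-BX : ∀ {B : Subset n} → length (B ∷ X) ≡ suc t
        len-BX = cong suc lX

        -- The premise expresses a loss of half of `φ₁`, that is, of two quarters: one for the
        -- excess of 𝓖, one for `Small`.
        conclude-multi : w ≡ q → 4 * length 𝓕 + 2 * φ₁ ≤ 4 * q * φ₁ → Result
        conclude-multi w≡q le = small (small-mix (4 * q ∸ 2) (t * 1) (begin
            4 * length 𝓕 ≤⟨ m+n≤o⇒m≤o∸n (4 * length 𝓕) le ⟩
            4 * q * φ₁ ∸ 2 * φ₁ ≡⟨ sym (*-distribʳ-∸ φ₁ (4 * q) 2) ⟩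
            (4 * q ∸ 2) * φ₁ ∎) 𝓖≤ (us (4 * q ∸ 2) (m∸n≤m (4 * q) 2))
          (≤-reflexive (trans (m+[n∸m]≡n (≤-trans 2≤q (m≤n*m q 4))) (cong (4 *_) (sym w≡q)))) 1≤φ₁)

        multi-X : w ≡ q → (∃ λ S → S ∈ X × Multi S) → Result
        multi-X w≡q (S , S∈ , mul) = conclude-multi w≡q (begin
          4 * length 𝓕 + 2 * φ₁ ≤⟨ +-mono-≤ (*-monoʳ-≤ 4 (≤-trans (𝓕-union (λ _ → h) (λ {B} m → half (cnt𝓕-suc-t-multi (uBX (proj₁ (proj₂ (Zg⁻ m)))) (len-BX {B}) (there S∈) mul)))
                                              (≤-reflexive (trans (sum-map-const h Zg) (cong (_* h) m≡q))))) (*-monoˡ-≤ φ₁ 2≤q) ⟩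
          4 * (q * h) + q * φ₁ ≡⟨ l q h φ₁ ⟩
          q * (2 * (h + h) + φ₁) ≤⟨ *-monoʳ-≤ q (+-monoˡ-≤ φ₁ (*-monoʳ-≤ 2 2h≤)) ⟩
          q * (2 * φ₁ + φ₁) ≤⟨ slack (q * φ₁) (l′ q φ₁) ⟩
          4 * q * φ₁ ∎)
          where
          l : ∀ q h φ → 4 * (q * h) + q * φ ≡ q * (2 * (h + h) + φ)
          l = solve-∀
          l′ : ∀ q φ → q * (2 * φ + φ) + q * φ ≡ 4 * q * φ
          l′ = solve-∀

        multi-Zg : w ≡ q → (∃ λ S → S ∈ Zg × Multi S) → Result
        multi-Zg w≡q (S , S∈ , mul) = conclude-multi w≡q (begin
          4 * length 𝓕 + 2 * φ₁ ≤⟨ +-monoˡ-≤ (2 * φ₁) (*-monoʳ-≤ 4 (≤-trans (𝓕-union K bound) (≤-reflexive (sum-map-if (λ B → ⌊ B ≡? S ⌋) h φ₁ Zg)))) ⟩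
          4 * (count (λ B → ⌊ B ≡? S ⌋) Zg * h + length (del S Zg) * φ₁) + 2 * φ₁
            ≡⟨ cong (λ z → 4 * (z * h + length (del S Zg) * φ₁) + 2 * φ₁) (count-self S Zg uZg S∈) ⟩
          4 * (1 * h + length (del S Zg) * φ₁) + 2 * φ₁ ≡⟨ l h (length (del S Zg)) φ₁ ⟩
          2 * (h + h) + 2 * φ₁ + 4 * length (del S Zg) * φ₁ ≤⟨ +-monoˡ-≤ (4 * length (del S Zg) * φ₁) (+-monoˡ-≤ (2 * φ₁) (*-monoʳ-≤ 2 2h≤)) ⟩
          2 * φ₁ + 2 * φ₁ + 4 * length (del S Zg) * φ₁ ≡⟨ l′ φ₁ (length (del S Zg)) ⟩
          4 * suc (length (del S Zg)) * φ₁ ≡⟨ cong (λ z → 4 * z * φ₁) (trans (sym (del-length S Zg uZg S∈)) m≡q) ⟩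
          4 * q * φ₁ ∎)
          where
          K : Subset n → ℕ
          K B = if ⌊ B ≡? S ⌋ then h else φ₁
          bound : ∀ {B} → B ∈ Zg → cnt 𝓕 (B ∷ X) ≤ K B
          bound {B} m = ≤-if (B ≡? S)
            (λ e → half (cnt𝓕-suc-t-multi (uBX (proj₁ (proj₂ (Zg⁻ m)))) (len-BX {B}) (here (sym e)) mul))
            (λ _ → cnt𝓕-suc-t (uBX (proj₁ (proj₂ (Zg⁻ m)))) (len-BX {B}))
          l : ∀ h d φ → 4 * (1 * h + d * φ) + 2 * φ ≡ 2 * (h + h) + 2 * φ + 4 * d * φ
          l = solve-∀
          l′ : ∀ φ d → 2 * φ + 2 * φ + 4 * d * φ ≡ 4 * suc d * φ
          l′ = solve-∀

        singles-case : w ≡ q → (∃ λ xs → X ≡ singles xs) → (∃ λ zs → Zg ≡ singles zs) → Result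
        singles-case w≡q (xs , eX) (zs , eZ) = typeA w≡q (record
          { xs = xs ; zs = zs
          ; uniq = singles-unique⁻ (subst Unique (trans (cong₂ _++_ eX eZ) (sym (Listₚ.map-++ ⁅_⁆ xs zs)))
              (Uniqueₚ.++⁺ uX uZg (λ { (m , m′) → proj₁ (proj₂ (Zg⁻ m′)) m })))
          ; xs-len = trans (sym (Listₚ.length-map ⁅_⁆ xs)) (trans (cong length (sym eX)) lX)
          ; zs-len = trans (sym (Listₚ.length-map ⁅_⁆ zs)) (trans (cong length (sym eZ)) m≡q)
          ; inF = λ {F} F∈ → subst (Contains F) eX (starX F∈) , hitF (Zg-hit F∈)
          ; inG = inG })
          where
          hitF : ∀ {F} → (∃ λ B → B ∈ Zg × Blk F B) → ∃ λ z → z ∈ zs × Blk F ⁅ z ⁆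
          hitF (B , B∈ , b) with ∈-map⁻ ⁅_⁆ (subst (B ∈_) eZ B∈)
          ... | z , z∈ , refl = z , z∈ , b
          away : ∀ {G} → (∃ λ S → S ∈ X × ¬ Blk G S × Contains G Zg × Contains G (del S X)) →
            ∃ λ x → x ∈ xs × ¬ Blk G ⁅ x ⁆ × Contains G (singles zs) × (∀ {y} → y ∈ xs → y ≢ x → Blk G ⁅ y ⁆)
          away {G} (S , S∈ , S∉ , cz , cd) = let x , x∈ , e = ∈-map⁻ ⁅_⁆ (subst (S ∈_) eX S∈) in
            x , x∈ , (λ b → S∉ (subst (Blk G) (sym e) b)) , subst (Contains G) eZ cz ,
            λ {y} y∈ y≢x → blk cd (∈-del⁺ S X (subst (⁅ y ⁆ ∈_) (sym eX) (∈-map⁺ ⁅_⁆ y∈)) (λ e′ → y≢x (⁅⁆-injective (trans e′ e))))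
          inG : ∀ {G} → G ∈ 𝓖 → Contains G (singles xs) ⊎
             ∃ λ x → x ∈ xs × ¬ Blk G ⁅ x ⁆ × Contains G (singles zs) × (∀ {y} → y ∈ xs → y ≢ x → Blk G ⁅ y ⁆)
          inG {G} G∈ = go (contains? G X)
            where
            go : Dec (Contains G X) → Contains G (singles xs) ⊎
              ∃ λ x → x ∈ xs × ¬ Blk G ⁅ x ⁆ × Contains G (singles zs) × (∀ {y} → y ∈ xs → y ≢ x → Blk G ⁅ y ⁆)
            go (yes c) = inj₁ (subst (Contains G) eX c)
            go (no ¬c) = inj₂ (away (𝓖-cases G∈ ¬c))

        -- Even the full `q` units stay a whole unit below `w`, so the shape of the blocks does not
        -- matter.
        case-slack : suc q ≤ w → Result
        case-slack q<w = small (small-mix (4 * q) (t * 1)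
            (≤-trans (*-monoʳ-≤ 4 (≤-trans (𝓕-union (λ _ → φ₁) (λ {B} m → cnt𝓕-suc-t (uBX (proj₁ (proj₂ (Zg⁻ m)))) (len-BX {B})))
              (≤-reflexive (trans (sum-map-const φ₁ Zg) (cong (_* φ₁) m≡q))))) (≤-reflexive (sym (*-assoc 4 q φ₁))))
            𝓖≤ (us (4 * q) ≤-refl) (≤-trans (slack 2 (l q)) (*-monoʳ-≤ 4 q<w)) 1≤φ₁)
          where
          l : ∀ q → 2 + 4 * q + 2 ≡ 4 * suc q
          l = solve-∀

        case-tight : w ≡ q → Result
        case-tight w≡q = [ multi-X w≡q , (λ sX → [ multi-Zg w≡q , singles-case w≡q sX ]′
              (singles-or-multi Zg (λ m → block-nonempty (proj₁ (Zg⁻ m))))) ]′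
            (singles-or-multi X (λ m → block-nonempty (blk (starX F₀∈) m)))

        conclude : Result
        conclude = go (suc q ≤? w)
          where
          go : Dec (suc q ≤ w) → Result
          go (yes q<w) = case-slack q<w
          go (no q≮w) = case-tight (≤-antisym (≤-pred (≰⇒> q≮w)) q≤w)

      case-two : Result
      case-two = go (length Zg <? q)
        where
        has-bad : 1 ≤ count (not ∘ good) Z
        has-bad = ∈-length (∈-filterᵇ⁺ {p = not ∘ good} N∈Z (T-not⁺ (λ g → proj₂ (good⁻ {N} g) refl)))
        m≤q : length Zg ≤ q
        m≤q = ≤-pred (subst (suc (length Zg) ≤_) Z-split (≤-trans (≤-reflexive (+-comm 1 (length Zg))) (+-monoʳ-≤ (length Zg) has-bad)))
        go : Dec (length Zg < q) → Result
        go (yes lt) = case-few lt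
        go (no ¬lt) = AllGood.conclude (≤-antisym m≤q (≮⇒≥ ¬lt))

  star-cover : Result
  star-cover = go Zg refl
    where
    go : ∀ L → L ≡ Zg → Result
    go [] e = case-none (cong length (sym e))
    go (B ∷ []) e = case-one (subst (B ∈_) e (here refl)) (cong length (sym e))
    go (B₁ ∷ B₂ ∷ L) e = TwoGood.case-two (subst (B₁ ∈_) e (here refl)) (subst (B₂ ∈_) e (there (here refl)))
      (λ e′ → All.lookup (AllPairs.head (subst Unique (sym e) uZg)) (here refl) e′)

-- Stars of partitions into t + 2 blocks

points : ∀ {n} → Subset n → List (Fin n)
points S = filterᵇ (lookup S) (allFin _)

∈-points⁺ : ∀ {n} {S : Subset n} {i} → S ∋ i → i ∈ points S
∈-points⁺ {S = S} {i} (mk∋ h) = ∈-filterᵇ⁺ {p = lookup S} (∈-allFin i) h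

∈-points⁻ : ∀ {n} {S : Subset n} {i} → i ∈ points S → S ∋ i
∈-points⁻ {n} {S} m = mk∋ (proj₂ (∈-filterᵇ⁻ {p = lookup S} {xs = allFin n} m))

argmax : ∀ {A : Set} (f : A → ℕ) x xs → ∃ λ m → m ∈ x ∷ xs × (∀ {y} → y ∈ x ∷ xs → f y ≤ f m)
argmax f x [] = x , here refl , λ { (here refl) → ≤-refl }
argmax f x (y ∷ ys) with argmax f y ys
... | m , m∈ , max with ≤-total (f x) (f m)
...   | inj₁ le = m , there m∈ , λ { (here refl) → le ; (there z∈) → max z∈ }
...   | inj₂ ge = x , here refl , λ { (here refl) → ≤-refl ; (there z∈) → ≤-trans (max z∈) ge }

two-of : ∀ {A : Set} {xs : List A} → 2 ≤ length xs → Unique xs → ∃ λ a → ∃ λ b → a ∈ xs × b ∈ xs × a ≢ b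
two-of {xs = a ∷ b ∷ xs} _ ((a≢b ∷ _) ∷ _) = a , b , here refl , there (here refl) , a≢b
two-of {xs = _ ∷ []} (s≤s ()) _

common-split : ∀ {n} (F G : Part n) X → common F G ≤ hits G X + hits G (fresh X F)
common-split F G X = ≤-trans
  (unique-⊆-length {ys = filterᵇ (isBlock G) X ++ filterᵇ (isBlock G) (fresh X F)} (filterᵇ-unique _ (allSubsets-unique _)) sub)
  (≤-reflexive (Listₚ.length-++ (filterᵇ (isBlock G) X)))
  where
  sub : Common F G ⊆ filterᵇ (isBlock G) X ++ filterᵇ (isBlock G) (fresh X F)
  sub {S} m = go (Any.any? (S ≡?_) X)
    where
    bF = proj₁ (∈-Common⁻ {F = F} {G} m)
    bG = proj₂ (∈-Common⁻ {F = F} {G} m)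
    go : Dec (S ∈ X) → S ∈ filterᵇ (isBlock G) X ++ filterᵇ (isBlock G) (fresh X F)
    go (yes S∈) = ∈-++⁺ˡ (∈-filterᵇ⁺ {p = isBlock G} S∈ (unBlk bG))
    go (no S∉) = ∈-++⁺ʳ (filterᵇ (isBlock G) X) (∈-filterᵇ⁺ {p = isBlock G} (∈-fresh⁺ X F bF S∉) (unBlk bG))

module _ where
  open ≤-Reasoning

  S2-double : ∀ j u r → 2 ^ j * S2 u (suc (suc r)) ≤ S2 (j + u) (suc (suc r))
  S2-double zero u r = ≤-reflexive (+-identityʳ _)
  S2-double (suc j) u r = begin
    2 * 2 ^ j * S2 u (suc (suc r)) ≡⟨ *-assoc 2 (2 ^ j) _ ⟩
    2 * (2 ^ j * S2 u (suc (suc r))) ≤⟨ *-mono-≤ {2} {suc (suc r)} (s≤s (s≤s z≤n)) (S2-double j u r) ⟩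
    suc (suc r) * S2 (j + u) (suc (suc r)) ≤⟨ S2-mult (j + u) (suc r) ⟩
    S2 (suc (j + u)) (suc (suc r)) ∎

  -- `v` will be the size of a largest block and `u` the number of points left when it and some
  -- others are removed. Then W = N + 1 - u is at least a third of N + 1, whence C ≤ 2 ^ W, and each
  -- further point at least doubles the Stirling number because `q ≥ 2`. One doubling is missing
  -- between N + 1 and N; it is the factor 2 on the right.
  tail-bound : ∀ {C N u v q} → 2 ≤ C → 2 ≤ q → v + u ≤ suc N → u ≤ 2 * v → C ^ 3 ≤ 2 ^ suc N → C * S2 u q ≤ 2 * S2 N q
  tail-bound {C} {N} {u} {v} {suc (suc r)} 2≤C (s≤s (s≤s z≤n)) vu u≤2v big = go (suc N ∸ u) (sym (m∸n+n≡m (m+n≤o⇒n≤o v vu))) (m+n≤o⇒m≤o∸n v vu)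
    where
    C≤ : ∀ W → suc N ≡ W + u → v ≤ W → C ≤ 2 ^ W
    C≤ W e v≤W = root-≤ 3 (s≤s z≤n) (begin
      C ^ 3 ≤⟨ big ⟩
      2 ^ suc N ≡⟨ cong (2 ^_) e ⟩
      2 ^ (W + u) ≤⟨ ^-monoʳ-≤ 2 (+-monoʳ-≤ W (≤-trans u≤2v (*-monoʳ-≤ 2 v≤W))) ⟩
      2 ^ (W + 2 * W) ≡⟨ cong (2 ^_) (l W) ⟩
      2 ^ (W * 3) ≡⟨ sym (^-*-assoc 2 W 3) ⟩
      (2 ^ W) ^ 3 ∎)
      where
      l : ∀ W → W + 2 * W ≡ W * 3
      l = solve-∀
    go : ∀ W → suc N ≡ W + u → v ≤ W → C * S2 u (suc (suc r)) ≤ 2 * S2 N (suc (suc r))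
    go zero e v≤W = contradiction (≤-trans 2≤C (C≤ zero e v≤W)) λ { (s≤s ()) }
    go (suc j) e v≤W = begin
      C * S2 u (suc (suc r)) ≤⟨ *-monoˡ-≤ (S2 u (suc (suc r))) (C≤ (suc j) e v≤W) ⟩
      2 * 2 ^ j * S2 u (suc (suc r)) ≡⟨ *-assoc 2 (2 ^ j) _ ⟩
      2 * (2 ^ j * S2 u (suc (suc r))) ≤⟨ *-monoʳ-≤ 2 (S2-double j u r) ⟩
      2 * S2 (j + u) (suc (suc r)) ≡⟨ cong (λ z → 2 * S2 z (suc (suc r))) (sym (suc-injective e)) ⟩
      2 * S2 N (suc (suc r)) ∎

-- When k = t + 2 a member of the star is X together with one way of cutting the rest in two.
module StarTwo {n} (t q : ℕ) {k} {𝓕 𝓖 : List (Part n)} (fam𝓕 : IsFam k 𝓕) (fam𝓖 : IsFam (t + q) 𝓖) (cross : Cross t 𝓕 𝓖)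
  {X} (uX : Unique X) (lX : length X ≡ t) (starX : ∀ {F} → F ∈ 𝓕 → Contains F X)
  {F₀ G₀} (F₀∈ : F₀ ∈ 𝓕) (G₀∈ : G₀ ∈ 𝓖) (G₀∌X : ¬ Contains G₀ X)
  (ψ₀ ψ₁ c w N : ℕ)
  (cnt𝓖-t : ∀ {H} → Unique H → length H ≡ t → cnt 𝓖 H ≤ ψ₀)
  (cnt𝓖-t-multi : ∀ {H B} → Unique H → length H ≡ t → B ∈ H → Multi B → 2 * cnt 𝓖 H ≤ ψ₀)
  (cnt𝓖-suc-t : ∀ {H} → Unique H → length H ≡ suc t → cnt 𝓖 H ≤ ψ₁)
  (cnt𝓕-suc-t : ∀ {H} → Unique H → length H ≡ suc t → cnt 𝓕 H ≤ 1)
  (k≡ : k ≡ t + 2) (1≤t : 1 ≤ t) (2≤q : 2 ≤ q) (tq≤c : suc t * suc q ≤ c)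
  (cψ : c * c * ψ₁ ≤ ψ₀) (1≤ψ₁ : 1 ≤ ψ₁) (t<w : suc t ≤ w) (q<w : suc q ≤ w)
  (ψ₀≡ : ψ₀ ≡ S2 N q) (n≡ : n ≡ t + N) (big : (c * c) ^ 3 ≤ 2 ^ suc N) where

  open ≤-Reasoning
  open Star t q fam𝓕 fam𝓖 cross uX lX starX F₀∈ G₀∈ G₀∌X ψ₀ cnt𝓖-t

  private
    Result : Set
    Result = Outcome t q w 1 ψ₀ 𝓕 𝓖

    1≤ψ₀ : 1 ≤ ψ₀
    1≤ψ₀ = ≤-trans (*-mono-≤ {1} {c * c} (≤-trans (s≤s z≤n) (sixteen 1≤t 2≤q tq≤c)) 1≤ψ₁) cψ

    fresh-two : ∀ {F} → F ∈ 𝓕 → length (fresh X F) ≡ 2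
    fresh-two {F} F∈ = +-cancelˡ-≡ t (length (fresh X F)) 2 (trans (cong (_+ length (fresh X F)) (sym (trans (contains-hits (starX F∈)) lX)))
        (trans (fresh-length X F uX) (trans (size (proj₂ fam𝓕 F∈)) k≡)))

    -- `X` together with `B` makes t + 1 of t + 2 blocks and so determines the partition.
    share : ∀ {F F′ B} → F ∈ 𝓕 → F′ ∈ 𝓕 → F ≢ F′ → B ∉ X → Blk F B → ¬ Blk F′ B
    share {F} {F′} {B} F∈ F′∈ ne B∉ b b′ = <⇒≱ ≤-refl (≤-trans (unique-⊆-length {xs = F ∷ F′ ∷ []} ((ne ∷ []) ∷ [] ∷ []) sub)
      (cnt𝓕-suc-t (∷-unique B∉ uX) (cong suc lX)))
      where
      sub : F ∷ F′ ∷ [] ⊆ filterᵇ (hasAll (B ∷ X)) 𝓕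
      sub (here refl) = ∈-filterᵇ⁺ {p = hasAll (B ∷ X)} F∈ (contains⁺ {F = F} (B ∷ X) (contains-∷ b (starX F∈)))
      sub (there (here refl)) = ∈-filterᵇ⁺ {p = hasAll (B ∷ X)} F′∈ (contains⁺ {F = F′} (B ∷ X) (contains-∷ b′ (starX F′∈)))

    module TwoMembers {F₁ F₂} (F₁∈ : F₁ ∈ 𝓕) (F₂∈ : F₂ ∈ 𝓕) (F₁≢F₂ : F₁ ≢ F₂) where

      both-fresh : ∀ {F G} → F ∈ 𝓕 → G ∈ 𝓖 → suc (suc (hits G X)) ≤ t → Contains G (fresh X F)
      both-fresh {F} {G} F∈ G∈ le = hits-full {G = G} {fresh X F} (≤-trans (≤-reflexive (fresh-two F∈))
        (+-cancelˡ-≤ (hits G X) 2 (hits G (fresh X F)) (begin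
          hits G X + 2 ≡⟨ +-comm (hits G X) 2 ⟩
          suc (suc (hits G X)) ≤⟨ le ⟩
          t ≤⟨ cross F∈ G∈ ⟩
          common F G ≤⟨ common-split F G X ⟩
          hits G X + hits G (fresh X F) ∎)))

      -- A member lacking two blocks of `X` would contain both further blocks of `F₁` and both of
      -- `F₂`. A point of one of the former lies in one of the latter, so these two blocks of `G`
      -- would coincide, against `share`.
      near : ∀ {G} → G ∈ 𝓖 → t ≤ suc (hits G X)
      near {G} G∈ = go (t ≤? suc (hits G X))
        where
        absurd : suc (suc (hits G X)) ≤ t → ⊥
        absurd le =
          let P , _ , P∈ , _ , _ = two-of (≤-reflexive (sym (fresh-two F₁∈))) (fresh-unique X F₁)
              bP , P∉ = ∈-fresh⁻ X F₁ P∈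
              i , i∈ = block-nonempty bP
              e₂ = equiv (proj₂ fam𝓕 F₂∈)
              i∈E = row∋⁺ (r-refl e₂ i)
              E∉ = λ m → P∉ (subst (_∈ X) (block-unique (blk (starX F₁∈) m) bP i∈E i∈) m)
              E≡P = block-unique (blk (both-fresh F₂∈ G∈ le) (∈-fresh⁺ X F₂ (row-block e₂ i) E∉)) (blk (both-fresh F₁∈ G∈ le) P∈) i∈E i∈
          in share F₁∈ F₂∈ F₁≢F₂ P∉ bP (subst (Blk F₂) E≡P (row-block e₂ i))
        go : Dec (t ≤ suc (hits G X)) → t ≤ suc (hits G X)
        go (yes p) = p
        go (no ¬p) = ⊥-elim (absurd (≰⇒> ¬p))

      open NearStar (near G₀∈)

      -- Each of the q + 1 blocks in `Z` lies in at most one member of the star, and `N` lies in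
      -- none.
      𝓕≤ : length 𝓕 ≤ q
      𝓕≤ = begin
        length 𝓕 ≡⟨ length-𝓕 ⟩
        cnt 𝓕 X ≤⟨ count-union Z (λ B → hasAll (B ∷ X)) K 𝓕 (λ {F} F∈ h → let B , B∈ , b = Z-hit F∈ in B , B∈ , from (T-∧ {isBlock F B}) (unBlk b , h)) bound ⟩
        sum (map K Z) ≡⟨ sum-map-if (λ B → ⌊ B ≡? N′ ⌋) 0 1 Z ⟩
        count (λ B → ⌊ B ≡? N′ ⌋) Z * 0 + length (del N′ Z) * 1 ≡⟨ cong₂ _+_ (*-zeroʳ (count (λ B → ⌊ B ≡? N′ ⌋) Z)) (*-identityʳ _) ⟩
        length (del N′ Z) ≡⟨ suc-injective (trans (sym (del-length N′ Z (fresh-unique X G₀) N∈Z)) Z-length) ⟩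
        q ∎
        where
        N′ = NearStar.N (near G₀∈)
        K : Subset n → ℕ
        K B = if ⌊ B ≡? N′ ⌋ then 0 else 1
        bound : ∀ {B} → B ∈ Z → cnt 𝓕 (B ∷ X) ≤ K B
        bound {B} B∈ = ≤-if (B ≡? N′)
          (λ e → ≤-reflexive (cnt-zero {H = B ∷ X} (λ {F} F∈ c → N∉ F∈ (subst (Blk F) e (blk c (here refl))))))
          (λ _ → cnt𝓕-suc-t (∷-unique (proj₂ (∈-fresh⁻ X G₀ B∈)) uX) (cong suc lX))

      Y₁ = fresh X F₁
      Y₂ = fresh X F₂

      E : Subset n × Subset n × Subset n → List (Subset n)
      E (x , B , C) = B ∷ C ∷ del x X

      I : List (Subset n × Subset n × Subset n)
      I = List.cartesianProduct X (List.cartesianProduct Y₁ Y₂)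

      -- A member lacking some `x` shares a block outside `X` with `F₁` and another with `F₂`; they
      -- differ by `share`. With two candidates for each, `t * 4` sets of size t + 1 result.
      choice : ∀ {G} → G ∈ 𝓖 → ¬ Contains G X → ∃ λ i → i ∈ I × Contains G (E i)
      choice {G} G∈ ¬c =
        let x , x∈ , _ , cd = miss-one {G = G} uX (subst (_≤ suc (hits G X)) (sym lX) (near G∈)) ¬c
            B , bF , bG , B∉ = common-outside {F = F₁} {G} t (cross F₁∈ G∈) (hits<t {G} ¬c)
            C , cF , cG , C∉ = common-outside {F = F₂} {G} t (cross F₂∈ G∈) (hits<t {G} ¬c)
        in (x , B , C) , ∈-cartesianProduct⁺ x∈ (∈-cartesianProduct⁺ (∈-fresh⁺ X F₁ bF B∉) (∈-fresh⁺ X F₂ cF C∉)) ,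
           contains-∷ bG (contains-∷ cG cd)

      bound : ∀ i → proj₁ i ∈ X × proj₁ (proj₂ i) ∈ Y₁ × proj₂ (proj₂ i) ∈ Y₂ → cnt 𝓖 (E i) ≤ ψ₁
      bound (x , B , C) (x∈ , B∈ , C∈) = cnt𝓖-suc-t
        (∷-unique apart (∷-unique (λ m → proj₂ (∈-fresh⁻ X F₂ C∈) (proj₁ (∈-del⁻ x X m))) (del-unique x X uX)))
        (cong suc (trans (sym (del-length x X uX x∈)) lX))
        where
        B∉ : B ∉ X
        B∉ = proj₂ (∈-fresh⁻ X F₁ B∈)
        B≢C : B ≢ C
        B≢C e = share F₁∈ F₂∈ F₁≢F₂ B∉ (proj₁ (∈-fresh⁻ X F₁ B∈)) (subst (Blk F₂) (sym e) (proj₁ (∈-fresh⁻ X F₂ C∈)))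
        apart : B ∉ C ∷ del x X
        apart (here e) = B≢C e
        apart (there m) = B∉ (proj₁ (∈-del⁻ x X m))

      𝓖≤ : length 𝓖 ≤ ψ₀ + t * 4 * ψ₁
      𝓖≤ = subst (λ z → length 𝓖 ≤ ψ₀ + z * ψ₁)
        (trans (length-cartesianProduct X _) (cong₂ _*_ lX (trans (length-cartesianProduct Y₁ Y₂) (cong₂ _*_ (fresh-two F₁∈) (fresh-two F₂∈)))))
        (nonstar-bound I E ψ₁ choice (λ {i} i∈ → let x∈ , j∈ = ∈-cartesianProduct⁻ X (List.cartesianProduct Y₁ Y₂) i∈ in
          bound i (x∈ , ∈-cartesianProduct⁻ Y₁ Y₂ j∈)))

      result : Result
      result = small (small-mix (4 * q) (t * 4 * ψ₁) (≤-trans (*-monoʳ-≤ 4 𝓕≤) (≤-reflexive (sym (*-identityʳ (4 * q))))) 𝓖≤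
        (begin-strict
          4 * q * (t * 4 * ψ₁) ≡⟨ l q t ψ₁ ⟩
          16 * (t * q) * ψ₁ <⟨ *-monoˡ-< ψ₁ {{>-nonZero 1≤ψ₁}} (sixteen 1≤t 2≤q tq≤c) ⟩
          c * c * ψ₁ ≤⟨ cψ ⟩
          ψ₀ ∎) (≤-trans (slack 2 (l′ q)) (*-monoʳ-≤ 4 q<w)) ≤-refl)
        where
        l : ∀ q t ψ → 4 * q * (t * 4 * ψ) ≡ 16 * (t * q) * ψ
        l = solve-∀
        l′ : ∀ q → 2 + 4 * q + 2 ≡ 4 * suc q
        l′ = solve-∀

    module OneMember (only : ∀ {F} → F ∈ 𝓕 → F ≡ F₀) where

      𝓕≤1 : length 𝓕 ≤ 1
      𝓕≤1 = unique-⊆-length {ys = F₀ ∷ []} (proj₁ fam𝓕) (λ m → here (only m))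

      Bs : List (Subset n)
      Bs = blocks F₀

      e₀ : Equiv F₀
      e₀ = equiv (proj₂ fam𝓕 F₀∈)

      Bs-length : length Bs ≡ suc (suc t)
      Bs-length = trans (size (proj₂ fam𝓕 F₀∈)) (trans k≡ (+-comm t 2))

      vol : Subset n → ℕ
      vol S = length (points S)

      -- A largest block is set apart because few members of 𝓖 can use it together with t - 1 of the
      -- others: it takes up too many points (`far`).
      largest : ∃ λ L → L ∈ Bs × (∀ {B} → B ∈ Bs → vol B ≤ vol L)
      largest = go Bs Bs-length
        where
        go : ∀ xs → length xs ≡ suc (suc t) → ∃ λ L → L ∈ xs × (∀ {B} → B ∈ xs → vol B ≤ vol L)
        go (x ∷ xs) _ = argmax vol x xs

      L : Subset n
      L = proj₁ largest

      L∈ : L ∈ Bs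
      L∈ = proj₁ (proj₂ largest)

      Ts : List (Subset n)
      Ts = del L Bs

      uT : Unique Ts
      uT = del-unique L Bs (blocks-unique F₀)

      T-length : length Ts ≡ suc t
      T-length = suc-injective (trans (sym (del-length L Bs (blocks-unique F₀) L∈)) Bs-length)

      T-block : ∀ {B} → B ∈ Ts → Blk F₀ B
      T-block m = ∈-blocks⁻ F₀ (proj₁ (∈-del⁻ L Bs m))

      L-block : Blk F₀ L
      L-block = ∈-blocks⁻ F₀ L∈

      row-T : ∀ i → ¬ L ∋ i → rowOf F₀ i ∈ Ts
      row-T i ¬p = ∈-del⁺ L Bs (∈-blocks⁺ F₀ (row-block e₀ i)) (λ e → ¬p (subst (_∋ i) e (row∋⁺ (r-refl e₀ i))))

      LT-hits : ∀ {G} → G ∈ 𝓖 → t ≤ hits G (L ∷ Ts)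
      LT-hits {G} G∈ = ≤-trans (cross F₀∈ G∈) (unique-⊆-length {ys = filterᵇ (isBlock G) (L ∷ Ts)} (filterᵇ-unique _ (allSubsets-unique n)) sub)
        where
        sub : Common F₀ G ⊆ filterᵇ (isBlock G) (L ∷ Ts)
        sub {S} m = ∈-filterᵇ⁺ {p = isBlock G} (go (S ≡? L)) (unBlk (proj₂ (∈-Common⁻ {F = F₀} {G} m)))
          where
          go : Dec (S ≡ L) → S ∈ L ∷ Ts
          go (yes e) = here e
          go (no ne) = there (∈-del⁺ L Bs (∈-blocks⁺ F₀ (proj₁ (∈-Common⁻ {F = F₀} {G} m))) ne)

      near : ∀ {G} → G ∈ 𝓖 → t ≤ suc (hits G Ts)
      near {G} G∈ = ≤-trans (LT-hits G∈) (hits-∷ G L Ts)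

      uses-L : ∀ {G} → G ∈ 𝓖 → hits G Ts < t → Blk G L
      uses-L {G} G∈ lt = go (blk? G L)
        where
        go : Dec (Blk G L) → Blk G L
        go (yes b) = b
        go (no ¬b) = ⊥-elim (<⇒≱ lt (subst (t ≤_) (hits-∷-no G L Ts ¬b) (LT-hits G∈)))

      module Singles {ts} (T≡ : Ts ≡ singles ts) where

        off-L : ∀ {G E i} → G ∈ 𝓖 → hits G Ts < t → Blk G E → E ∉ L ∷ Ts → E ∋ i → ⁅ i ⁆ ∈ Ts × ¬ Blk G ⁅ i ⁆
        off-L {G} {E} {i} G∈ lt bE E∉ i∈ = i∈T , (λ b → E∉ (there (subst (_∈ Ts) (block-unique b bE (∋-⁅⁆⁺ i) i∈) i∈T)))
          where
          ¬L : ¬ L ∋ i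
          ¬L p = E∉ (here (block-unique bE (uses-L G∈ lt) i∈ p))
          i∈T : ⁅ i ⁆ ∈ Ts
          i∈T = let y , _ , e = ∈-map⁻ ⁅_⁆ (subst (rowOf F₀ i ∈_) T≡ (row-T i ¬L))
                    i≡y = ∋-⁅⁆⁻ y i (subst (_∋ i) e (row∋⁺ (r-refl e₀ i)))
                in subst (_∈ Ts) (trans e (cong ⁅_⁆ (sym i≡y))) (row-T i ¬L)

        -- Such a `G` contains `L` and lacks exactly two of the singletons in `Ts`. It has two
        -- further blocks `A` and `B`, made of points whose singletons are lacking. `A` cannot be a
        -- singleton, so it has two such points and `B` has a third: one too many.
        absurd : ∀ {G} → G ∈ 𝓖 → ¬ hits G Ts < t
        absurd {G} G∈ lt = contra (two-of enough (fresh-unique (L ∷ Ts) G))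
          where
          uLT : Unique (L ∷ Ts)
          uLT = ∷-unique (λ m → proj₂ (∈-del⁻ L Bs m) refl) uT
          enough : 2 ≤ length (fresh (L ∷ Ts) G)
          enough = ≤-trans 2≤q (+-cancelˡ-≤ t q _ (begin
            t + q ≡⟨ sym (trans (fresh-length (L ∷ Ts) G uLT) (size (proj₂ fam𝓖 G∈))) ⟩
            hits G (L ∷ Ts) + length (fresh (L ∷ Ts) G) ≤⟨ +-monoˡ-≤ _ (≤-trans (hits-∷ G L Ts) lt) ⟩
            t + length (fresh (L ∷ Ts) G) ∎))
          three : ∀ {i j l} → i ≢ j → i ≢ l → j ≢ l → ⁅ i ⁆ ∈ Ts × ¬ Blk G ⁅ i ⁆ → ⁅ j ⁆ ∈ Ts × ¬ Blk G ⁅ j ⁆ → ⁅ l ⁆ ∈ Ts × ¬ Blk G ⁅ l ⁆ → ⊥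
          three {i} {j} {l} i≢j i≢l j≢l (i∈ , ¬i) (j∈ , ¬j) (l∈ , ¬l) = <⇒≱ (s≤s (s≤s (near G∈)))
            (≤-trans (unique-⊆-length uniq sub) (≤-reflexive T-length))
            where
            hitT = filterᵇ (isBlock G) Ts
            ∉hit : ∀ {x} → ¬ Blk G ⁅ x ⁆ → ⁅ x ⁆ ∉ hitT
            ∉hit ¬b m = ¬b (mkBlk (proj₂ (∈-filterᵇ⁻ {p = isBlock G} {xs = Ts} m)))
            uniq : Unique (⁅ i ⁆ ∷ ⁅ j ⁆ ∷ ⁅ l ⁆ ∷ hitT)
            uniq = ∷-unique (λ { (here e) → i≢j (⁅⁆-injective e) ; (there (here e)) → i≢l (⁅⁆-injective e) ; (there (there m)) → ∉hit ¬i m })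
              (∷-unique (λ { (here e) → j≢l (⁅⁆-injective e) ; (there m) → ∉hit ¬j m }) (∷-unique (∉hit ¬l) (filterᵇ-unique (isBlock G) uT)))
            sub : ⁅ i ⁆ ∷ ⁅ j ⁆ ∷ ⁅ l ⁆ ∷ hitT ⊆ Ts
            sub (here refl) = i∈
            sub (there (here refl)) = j∈
            sub (there (there (here refl))) = l∈
            sub (there (there (there m))) = proj₁ (∈-filterᵇ⁻ {p = isBlock G} {xs = Ts} m)
          contra : (∃ λ A → ∃ λ B → A ∈ fresh (L ∷ Ts) G × B ∈ fresh (L ∷ Ts) G × A ≢ B) → ⊥
          contra (A , B , A∈ , B∈ , A≢B) = [ multi , single ]′ (single-or-multi (block-nonempty bA))
            where
            bA = proj₁ (∈-fresh⁻ (L ∷ Ts) G A∈)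
            A∉ = proj₂ (∈-fresh⁻ (L ∷ Ts) G A∈)
            bB = proj₁ (∈-fresh⁻ (L ∷ Ts) G B∈)
            B∉ = proj₂ (∈-fresh⁻ (L ∷ Ts) G B∈)
            l = proj₁ (block-nonempty bB)
            l∈ = proj₂ (block-nonempty bB)
            ≢l : ∀ {i} → A ∋ i → i ≢ l
            ≢l p refl = A≢B (block-unique bA bB p l∈)
            multi : Multi A → ⊥
            multi (i , j , i≢j , p , p′) = three i≢j (≢l p) (≢l p′) (off-L G∈ lt bA A∉ p) (off-L G∈ lt bA A∉ p′) (off-L G∈ lt bB B∉ l∈)
            single : (∃ λ i → A ≡ ⁅ i ⁆) → ⊥
            single (i , refl) = A∉ (there (proj₁ (off-L G∈ lt bA A∉ (∋-⁅⁆⁺ i))))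

        cov : Cover t 𝓖 Ts
        cov = mkCover λ {G} G∈ → ≮⇒≥ (absurd G∈)

        inT : ∀ {F} → F ∈ 𝓕 → Contains F Ts
        inT F∈ = subst (λ F → Contains F Ts) (sym (only F∈)) (mkContains T-block)

        result : Result
        result = go (w ≤? suc t)
          where
          go : Dec (w ≤ suc t) → Result
          go (yes w≤) = typeC w≤ (record
            { ts = ts ; ts-uniq = singles-unique⁻ (subst Unique T≡ uT)
            ; ts-len = trans (sym (Listₚ.length-map ⁅_⁆ ts)) (trans (cong length (sym T≡)) T-length)
            ; inF = λ {F} F∈ → subst (Contains F) T≡ (inT F∈) ; inG = subst (Cover t 𝓖) T≡ cov })
          go (no w≰) = small (small-cover 𝓕≤1 (cover-length uT T-length cov) (≰⇒> w≰) ≤-refl 1≤ψ₀)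

      module Multis {M} (M∈ : M ∈ Ts) (mul : Multi M) where

        cc : ℕ
        cc = c * c

        2≤cc : 2 ≤ cc
        2≤cc = ≤-trans (s≤s (≤-trans (≤-trans 1≤t (m≤m*n t q {{>-nonZero (≤-trans (s≤s z≤n) 2≤q)}})) (m≤n*m (t * q) 16))) (sixteen 1≤t 2≤q tq≤c)

        instance
          cc≢0 : NonZero cc
          cc≢0 = >-nonZero (≤-trans (s≤s z≤n) 2≤cc)

        -- Bounds the number of members of 𝓖 through `L` and t - 1 given blocks of `Ts`. Rounding
        -- down loses nothing, as only `K-upper` and `K-lower` are needed.
        K : ℕ
        K = (2 * ψ₀) ℕ./ cc

        K-upper : cc * K ≤ 2 * ψ₀
        K-upper = ≤-trans (≤-reflexive (*-comm cc K)) (DivMod.m/n*n≤m (2 * ψ₀) cc)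

        K-lower : ∀ {m} → cc * m ≤ 2 * ψ₀ → m ≤ K
        K-lower {m} le = ≤-trans (≤-reflexive (sym (DivMod.m*n/n≡m m cc))) (DivMod./-monoˡ-≤ cc (≤-trans (≤-reflexive (*-comm m cc)) le))

        t′ : ℕ
        t′ = pred t

        t≡ : t ≡ suc t′
        t≡ = sym (suc-pred t {{>-nonZero 1≤t}})

        far : ∀ S → Unique S → S ⊆ Ts → length S ≡ t′ → cnt 𝓖 (S ++ L ∷ []) ≤ K
        far S uS S⊆ lS = K-lower (begin
          cc * cnt 𝓖 (S ++ L ∷ []) ≤⟨ *-monoʳ-≤ cc (≤-trans (cnt-⊆ 𝓖 swp) (cnt-outside fam𝓖 uLS)) ⟩
          cc * S2 u ((t + q) ∸ suc (length S)) ≡⟨ cong (λ z → cc * S2 u z) (trans (cong (λ z → (t + q) ∸ suc z) lS) (trans (cong (t + q ∸_) (sym t≡)) (m+n∸m≡n t q))) ⟩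
          cc * S2 u q ≤⟨ tail-bound 2≤cc 2≤q vol-sum vol-max big ⟩
          2 * S2 N q ≡⟨ cong (2 *_) (sym ψ₀≡) ⟩
          2 * ψ₀ ∎)
          where
          swp : L ∷ S ⊆ S ++ L ∷ []
          swp (here refl) = ∈-++⁺ʳ S (here refl)
          swp (there m) = ∈-++⁺ˡ m
          L∉S : L ∉ S
          L∉S m = proj₂ (∈-del⁻ L Bs (S⊆ m)) refl
          uLS : Unique (L ∷ S)
          uLS = ∷-unique L∉S uS
          u : ℕ
          u = length (outside (L ∷ S))
          gS : Good S
          gS = contains-good {F = F₀} uS (mkContains (λ m → T-block (S⊆ m)))
          vol-sum : vol L + u ≤ suc N
          vol-sum = +-cancelˡ-≤ t′ (vol L + u) (suc N) (begin
            t′ + (vol L + u) ≤⟨ +-monoʳ-≤ t′ (outside-shrink S {L} {points L} (filterᵇ-unique (lookup L) (Uniqueₚ.allFin⁺ n)) ∈-points⁻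
              (λ { i∈ (B , B∈ , p) → L∉S (subst (_∈ S) (block-unique (T-block (S⊆ B∈)) L-block p (∈-points⁻ i∈)) B∈) })) ⟩
            t′ + length (outside S) ≤⟨ subst (λ z → z + length (outside S) ≤ n) lS (outside-size gS) ⟩
            n ≡⟨ trans n≡ (trans (cong (_+ N) t≡) (sym (+-suc t′ N))) ⟩
            t′ + suc N ∎)
          D : List (Subset n)
          D = filterᵇ (not ∘ memᵇ S) Ts
          D-length : length D ≡ 2
          D-length = +-cancelˡ-≡ t′ (length D) 2 (begin-equality
            t′ + length D ≡⟨ cong (_+ length D) (sym (trans same lS)) ⟩
            count (memᵇ S) Ts + length D ≡⟨ sym (count-complement (memᵇ S) Ts) ⟩
            length Ts ≡⟨ T-length ⟩
            suc t ≡⟨ cong suc t≡ ⟩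
            suc (suc t′) ≡⟨ +-comm 2 t′ ⟩
            t′ + 2 ∎)
            where
            same : count (memᵇ S) Ts ≡ length S
            same = unique-≡-length (filterᵇ-unique (memᵇ S) uT) uS (λ m → memᵇ⁻ S (proj₂ (∈-filterᵇ⁻ {p = memᵇ S} {xs = Ts} m)))
              (λ m → ∈-filterᵇ⁺ {p = memᵇ S} (S⊆ m) (memᵇ⁺ S m))
          vol-D : ∀ xs → (∀ {B} → B ∈ xs → vol B ≤ vol L) → length (concatMap points xs) ≤ length xs * vol L
          vol-D [] h = z≤n
          vol-D (B ∷ xs) h = ≤-trans (≤-reflexive (Listₚ.length-++ (points B))) (+-mono-≤ (h (here refl)) (vol-D xs (h ∘ there)))
          cover-D : outside (L ∷ S) ⊆ concatMap points D
          cover-D {i} i∈ = ∈-concatMap⁺ points (lose (∈-filterᵇ⁺ {p = not ∘ memᵇ S}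
              (row-T i (λ p → ∈-outside⁻ (L ∷ S) i∈ (L , here refl , p)))
              (T-not⁺ (λ h → ∈-outside⁻ (L ∷ S) i∈ (rowOf F₀ i , there (memᵇ⁻ S h) , row∋⁺ (r-refl e₀ i)))))
            (∈-points⁺ (row∋⁺ (r-refl e₀ i))))
          vol-max : u ≤ 2 * vol L
          vol-max = ≤-trans (unique-⊆-length (outside-unique (L ∷ S)) cover-D)
            (≤-trans (vol-D D (λ m → proj₂ (proj₂ largest) (proj₁ (∈-del⁻ L Bs (proj₁ (∈-filterᵇ⁻ {p = not ∘ memᵇ S} {xs = Ts} m))))))
              (≤-reflexive (cong (_* vol L) D-length)))

        -- A member with fewer than `t` blocks of `Ts` contains `L` and t - 1 of the t + 1 blocks of
        -- `Ts`. `cover-base` with `x = 2` allows for t² choices of these.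
        rest : count (λ G → not ⌊ t ≤? hits G Ts ⌋) 𝓖 ≤ t * (t * 1) * K
        rest = ≤-trans (count-mono 𝓖 into) (subst (λ z → count (λ G → hasAll (L ∷ []) G ∧ ⌊ t′ ≤? hits G Ts ⌋) 𝓖 ≤ z ^ 2 * K) (sym t≡) base)
          where
          base : count (λ G → hasAll (L ∷ []) G ∧ ⌊ t′ ≤? hits G Ts ⌋) 𝓖 ≤ suc t′ ^ 2 * K
          base = [ ⊥-elim , id ]′ (cover-base {Q = ⊥} 𝓖 K Ts t′ 2 (L ∷ []) uT (trans T-length (trans (cong suc t≡) (+-comm 2 t′)))
            (λ S uS S⊆ lS → inj₂ (far S uS S⊆ lS)))
          into : ∀ {G} → G ∈ 𝓖 → Data.Bool.T (not ⌊ t ≤? hits G Ts ⌋) → Data.Bool.T (hasAll (L ∷ []) G ∧ ⌊ t′ ≤? hits G Ts ⌋)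
          into {G} G∈ h = from (T-∧ {hasAll (L ∷ []) G}) (contains⁺ {F = G} (L ∷ []) (contains-∷ (uses-L G∈ lt) (mkContains λ ())) ,
            fromWitness {a? = t′ ≤? hits G Ts} (≤-pred (subst (_≤ suc (hits G Ts)) t≡ (near G∈))))
            where
            lt : hits G Ts < t
            lt = ≰⇒> (λ le → T-not⁻ h (fromWitness {a? = t ≤? hits G Ts} le))

        result : Result
        result = small (small-half (2 * (t * (t * 1) * K)) 𝓕≤1 (begin
            2 * length 𝓖 ≡⟨ cong (2 *_) (count-complement (λ G → ⌊ t ≤? hits G Ts ⌋) 𝓖) ⟩
            2 * (count (λ G → ⌊ t ≤? hits G Ts ⌋) 𝓖 + count (λ G → not ⌊ t ≤? hits G Ts ⌋) 𝓖) ≡⟨ *-distribˡ-+ 2 (count (λ G → ⌊ t ≤? hits G Ts ⌋) 𝓖) _ ⟩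
            2 * count (λ G → ⌊ t ≤? hits G Ts ⌋) 𝓖 + 2 * count (λ G → not ⌊ t ≤? hits G Ts ⌋) 𝓖
              ≤⟨ +-mono-≤ (D-multi uT T-length M∈ mul cnt𝓖-t-multi) (*-monoʳ-≤ 2 rest) ⟩
            (2 + t) * ψ₀ + 2 * (t * (t * 1) * K) ∎) (tail K K-upper) t<w 1≤t ≤-refl)
          where
          -- As `q ≥ 2`, `c` is at least 3(t + 1), and 9(t + 1)² exceeds 8t².
          8t²<cc : 8 * (t * t) < cc
          8t²<cc = ≤-trans (s≤s (slack (t * t + 18 * t + 8) (l t))) (≤-trans (m∸n+n≡m′ t) (square-≤ (≤-trans (*-monoʳ-≤ (suc t) (s≤s 2≤q)) tq≤c)))
            where
            l : ∀ t → 8 * (t * t) + (t * t + 18 * t + 8) ≡ 8 + 18 * t + 9 * (t * t)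
            l = solve-∀
            m∸n+n≡m′ : ∀ t → suc (8 + 18 * t + 9 * (t * t)) ≤ suc t * 3 * (suc t * 3)
            m∸n+n≡m′ t = ≤-reflexive (l′ t)
              where
              l′ : ∀ t → suc (8 + 18 * t + 9 * (t * t)) ≡ suc t * 3 * (suc t * 3)
              l′ = solve-∀
          tail : ∀ K → cc * K ≤ 2 * ψ₀ → 2 * (2 * (t * (t * 1) * K)) < ψ₀
          tail zero _ = ≤-trans (s≤s (≤-reflexive (trans (cong (λ z → 2 * (2 * z)) (*-zeroʳ (t * (t * 1)))) refl))) 1≤ψ₀
          tail K@(suc _) le = *-cancelˡ-< 2 _ _ (begin-strict
            2 * (2 * (2 * (t * (t * 1) * K))) ≡⟨ l t K ⟩
            8 * (t * t) * K <⟨ *-monoˡ-< K 8t²<cc ⟩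
            cc * K ≤⟨ le ⟩
            2 * ψ₀ ∎)
            where
            l : ∀ t K → 2 * (2 * (2 * (t * (t * 1) * K))) ≡ 8 * (t * t) * K
            l = solve-∀

      conclude : Result
      conclude = [ (λ { (M , M∈ , mul) → Multis.result M∈ mul }) , (λ { (ts , e) → Singles.result e }) ]′
        (singles-or-multi Ts (λ m → block-nonempty (T-block m)))

  star-two : Result
  star-two = go (All.all? (λ F → F ≡ᴾ? F₀) 𝓕)
    where
    go : Dec (All (_≡ F₀) 𝓕) → Result
    go (yes all) = OneMember.conclude (All.lookup all)
    go (no ¬all) = let F , F∈ , ne = find (Allₚ.¬All⇒Any¬ (λ F → F ≡ᴾ? F₀) 𝓕 ¬all) in TwoMembers.result F∈ F₀∈ ne

-- Combining the cases

module _ {n N t : ℕ} (n≡ : n ≡ t + N) where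

  level : ∀ {p j} {H : List (Subset n)} → length H ≡ t + j → n ∸ length H ≡ N ∸ j × (t + p) ∸ length H ≡ p ∸ j
  level {p} {j} e = trans (cong₂ _∸_ n≡ e) ([m+n]∸[m+o]≡n∸o t N j) , trans (cong (t + p ∸_) e) ([m+n]∸[m+o]≡n∸o t p j)

  level-bound : ∀ {p} {𝓕 : List (Part n)} → IsFam (t + p) 𝓕 → ∀ j {H} → Unique H → length H ≡ t + j → cnt 𝓕 H ≤ bnd (N ∸ j) (p ∸ j)
  level-bound {p} {𝓕} fam j {H} u e = let e₁ , e₂ = level {p} {j} {H} e in subst₂ (λ x y → cnt 𝓕 H ≤ bnd x y) e₁ e₂ (cnt-bound fam u)

  level-multi : ∀ {p} {𝓕 : List (Part n)} → IsFam (t + p) 𝓕 → ∀ j {H B} → Unique H → length H ≡ t + j → B ∈ H → Multi B →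
    (p ∸ j) * cnt 𝓕 H ≤ bnd (N ∸ j) (p ∸ j)
  level-multi {p} {𝓕} fam j {H} u e B∈ mul = let e₁ , e₂ = level {p} {j} {H} e in
    subst₂ (λ x y → y * cnt 𝓕 H ≤ bnd x y) e₁ e₂ (cnt-bound-multi fam u B∈ mul)

-- The blocks of a single member of 𝓕 form a cover of 𝓖: the starting point of each descent to
-- smaller covers.
blocks-cover : ∀ {n t} {𝓕 𝓖 : List (Part n)} {F} → Cross t 𝓕 𝓖 → F ∈ 𝓕 → Cover t 𝓖 (blocks F)
blocks-cover {n} {𝓖 = 𝓖} {F} cross F∈ = mkCover λ {G} G∈ → ≤-trans (cross F∈ G∈)
  (unique-⊆-length {ys = filterᵇ (isBlock G) (blocks F)} (filterᵇ-unique _ (allSubsets-unique n))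
    (λ m → ∈-filterᵇ⁺ {p = isBlock G} (∈-blocks⁺ F (proj₁ (∈-Common⁻ {F = F} {G} m))) (unBlk (proj₂ (∈-Common⁻ {F = F} {G} m)))))

cover-star : ∀ {n t} {𝓕 : List (Part n)} {T} → length T ≡ t → Cover t 𝓕 T → ∀ {F} → F ∈ 𝓕 → Contains F T
cover-star {T = T} lT c {F} F∈ = hits-full {G = F} {T} (subst (_≤ hits F T) (sym lT) (hit c F∈))

-- `a` stands for k₁ - t and `M` for n - t - 2, so that n - t and n - t - 1 are visibly successors,
-- as `ratio` and `S2-one` want them.
module Bounds {n t a M : ℕ} (n≡ : n ≡ t + suc (suc M)) (1≤t : 1 ≤ t) (2≤a : 2 ≤ a) (big : Big (suc t * suc a) (suc M) a) where

  open ≤-Reasoning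

  c : ℕ
  c = suc t * suc a

  1+a≤c : suc a ≤ c
  1+a≤c = m≤m+n (suc a) (t * suc a)

  double≤c : suc a + suc a ≤ c
  double≤c = ≤-trans (+-monoʳ-≤ (suc a) (≤-reflexive (sym (+-identityʳ (suc a))))) (*-monoˡ-≤ (suc a) (s≤s 1≤t))

  4≤c : 4 ≤ c
  4≤c = ≤-trans (≤-trans (s≤s (s≤s (s≤s (s≤s z≤n)))) (+-mono-≤ (s≤s 2≤a) (s≤s 2≤a))) double≤c

  2≤c : 2 ≤ c
  2≤c = ≤-trans (s≤s (s≤s z≤n)) 4≤c

  1≤c : 1 ≤ c
  1≤c = ≤-trans (s≤s z≤n) 2≤c

  4a≤M : 4 * suc a ≤ suc M
  4a≤M = Big-size 4≤c big

  a≤M : suc a ≤ suc M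
  a≤M = ≤-trans (m≤n*m (suc a) 4) 4a≤M

  big-p : ∀ {p} → p ≤ a → Big c (suc M) p
  big-p p≤a = Big-mono 1≤c ≤-refl p≤a big

  top-ratio : ∀ {p} → 2 ≤ p → p ≤ a → c * c * S2 (suc M) (p ∸ 1) ≤ S2 (suc (suc M)) p
  top-ratio {suc (suc p)} _ p≤a = ratio (s≤s z≤n) (≤-trans p≤a (≤-trans (n≤1+n a) 1+a≤c)) (big-p p≤a)
  top-ratio {suc zero} (s≤s ())

  next-ratio : ∀ {p} → 3 ≤ p → p ≤ a → c * c * bnd M (p ∸ 2) ≤ S2 (suc M) (p ∸ 1)
  next-ratio {suc (suc (suc p))} _ p≤a = ratio (s≤s z≤n) (≤-trans (n≤1+n _) (≤-trans p≤a (≤-trans (n≤1+n a) 1+a≤c))) (Big-pred 2≤c (big-p p≤a))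
  next-ratio {suc (suc zero)} (s≤s (s≤s ()))
  next-ratio {suc zero} (s≤s ())

  positive : ∀ {p} → 2 ≤ p → p ≤ a → 1 ≤ S2 (suc M) (p ∸ 1)
  positive {suc (suc p)} _ p≤a = S2≥1 (suc M) p (≤-trans (n≤1+n (suc p)) (≤-trans p≤a (≤-trans (n≤1+n a) a≤M)))
  positive {suc zero} (s≤s ())

  -- Either family may be the star, so `p` and `q` are not ordered. For `p = 2` the argument with
  -- two members bounds 𝓕 by `q` units without recognising (A, B), and `slack-w` asks for one more
  -- unit in exchange.
  module StarCase {p q : ℕ} {𝓕 𝓖 : List (Part n)} (fam𝓕 : IsFam (t + p) 𝓕) (fam𝓖 : IsFam (t + q) 𝓖) (cross : Cross t 𝓕 𝓖)
    {X} (uX : Unique X) (lX : length X ≡ t) (starX : ∀ {F} → F ∈ 𝓕 → Contains F X)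
    {F₀ G₀} (F₀∈ : F₀ ∈ 𝓕) (G₀∈ : G₀ ∈ 𝓖) (G₀∌X : ¬ Contains G₀ X)
    (2≤p : 2 ≤ p) (p≤a : p ≤ a) (2≤q : 2 ≤ q) (q≤a : q ≤ a) {w} (t<w : suc t ≤ w) (q≤w : q ≤ w) (slack-w : p ≡ 2 → suc q ≤ w) where

    ψ₀ = S2 (suc (suc M)) q
    ψ₁ = S2 (suc M) (q ∸ 1)
    φ₁ = S2 (suc M) (p ∸ 1)

    Result : Set
    Result = Outcome t q w φ₁ ψ₀ 𝓕 𝓖

    bnd-top : ∀ {p} → 2 ≤ p → bnd (suc (suc M)) p ≡ S2 (suc (suc M)) p
    bnd-top {suc p} _ = refl

    bnd-next : ∀ {p} → 2 ≤ p → bnd (suc M) (p ∸ 1) ≡ S2 (suc M) (p ∸ 1)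
    bnd-next {suc (suc p)} _ = refl
    bnd-next {suc zero} (s≤s ())

    plus0 : ∀ {H : List (Subset n)} → length H ≡ t → length H ≡ t + 0
    plus0 e = trans e (sym (+-identityʳ t))

    plus1 : ∀ {H : List (Subset n)} → length H ≡ suc t → length H ≡ t + 1
    plus1 e = trans e (sym (+-comm t 1))

    cnt𝓖-t : ∀ {H} → Unique H → length H ≡ t → cnt 𝓖 H ≤ ψ₀
    cnt𝓖-t {H} u e = subst (cnt 𝓖 H ≤_) (bnd-top 2≤q) (level-bound n≡ fam𝓖 0 u (plus0 {H} e))

    cnt𝓖-t-multi : ∀ {H B} → Unique H → length H ≡ t → B ∈ H → Multi B → 2 * cnt 𝓖 H ≤ ψ₀
    cnt𝓖-t-multi {H} u e B∈ mul = ≤-trans (*-monoˡ-≤ (cnt 𝓖 H) 2≤q) (subst (q * cnt 𝓖 H ≤_) (bnd-top 2≤q) (level-multi n≡ fam𝓖 0 u (plus0 {H} e) B∈ mul))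

    cnt𝓖-suc-t : ∀ {H} → Unique H → length H ≡ suc t → cnt 𝓖 H ≤ ψ₁
    cnt𝓖-suc-t {H} u e = subst (cnt 𝓖 H ≤_) (bnd-next 2≤q) (level-bound n≡ fam𝓖 1 u (plus1 {H} e))

    cnt𝓖-all : ∀ {H} → Unique H → suc (length H) ≡ t + q → cnt 𝓖 H ≤ 1
    cnt𝓖-all {H} u e = ≤-trans (level-bound n≡ fam𝓖 (q ∸ 1) u (trans (suc-injective (trans e (trans (cong (_+_ t) (sym q≡)) (+-suc t (q ∸ 1))))) refl))
      (subst (λ z → bnd (suc (suc M) ∸ (q ∸ 1)) z ≤ 1) (sym (trans (cong (_∸ (q ∸ 1)) (sym q≡)) (m+n∸n≡m 1 (q ∸ 1)))) (one (suc (suc M) ∸ (q ∸ 1))))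
      where
      q≡ : suc (q ∸ 1) ≡ q
      q≡ = m+[n∸m]≡n (≤-trans (s≤s z≤n) 2≤q)
      one : ∀ m → S2 m 1 ≤ 1
      one zero = z≤n
      one (suc m) = ≤-reflexive (S2-one m)

    cnt𝓕-suc-t : ∀ {H} → Unique H → length H ≡ suc t → cnt 𝓕 H ≤ φ₁
    cnt𝓕-suc-t {H} u e = subst (cnt 𝓕 H ≤_) (bnd-next 2≤p) (level-bound n≡ fam𝓕 1 u (plus1 {H} e))

    tq≤c : suc t * suc q ≤ c
    tq≤c = *-monoʳ-≤ (suc t) (s≤s q≤a)

    p≤c : p ≤ c
    p≤c = ≤-trans p≤a (≤-trans (n≤1+n a) 1+a≤c)

    cψ : c * c * ψ₁ ≤ ψ₀
    cψ = top-ratio 2≤q q≤a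

    1≤ψ₁ : 1 ≤ ψ₁
    1≤ψ₁ = positive 2≤q q≤a

    1≤ψ₀ : 1 ≤ ψ₀
    1≤ψ₀ = ≤-trans (*-mono-≤ {1} {c * c} (*-mono-≤ 1≤c 1≤c) 1≤ψ₁) cψ

    2≤w : 2 ≤ w
    2≤w = ≤-trans (s≤s 1≤t) t<w

    f : ℕ → ℕ
    f j = bnd (n ∸ j) (t + p ∸ j)

    f-level : ∀ j → f (t + j) ≡ bnd (suc (suc M) ∸ j) (p ∸ j)
    f-level j = cong₂ bnd (trans (cong (_∸ (t + j)) n≡) ([m+n]∸[m+o]≡n∸o t (suc (suc M)) j)) ([m+n]∸[m+o]≡n∸o t p j)

    -- The blocks of `F₀` give a cover above `X` of excess `p`. The descent cannot end at excess 0,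
    -- because of `G₀`; excess 1 is the case of `StarCover`, and from 2 on `star-product` is enough.
    big-case : 3 ≤ p → Result
    big-case 3≤p = go (Branching.star-descent t q {𝓕} {𝓖} (proj₂ fam𝓖) cross f (cnt-bound fam𝓕) uX lX p p (blocks F₀) ≤-refl
        (blocks-unique F₀) (λ m → ∈-blocks⁺ F₀ (blk (starX F₀∈) m)) (size (proj₂ fam𝓕 F₀∈)) (blocks-cover {𝓕 = 𝓕} cross F₀∈))
      where
      cnt𝓕-multi : ∀ {H B} → Unique H → length H ≡ suc t → B ∈ H → Multi B → 2 * cnt 𝓕 H ≤ φ₁
      cnt𝓕-multi {H} u e B∈ mul = ≤-trans (*-monoˡ-≤ (cnt 𝓕 H) (∸-monoˡ-≤ 1 3≤p))
        (subst ((p ∸ 1) * cnt 𝓕 H ≤_) (bnd-next 2≤p) (level-multi n≡ fam𝓕 1 u (plus1 {H} e) B∈ mul))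
      go : (∃ λ y → ∃ λ T → y ≤ p × Unique T × X ⊆ T × length T ≡ t + y × Cover t 𝓖 T × cnt 𝓕 X ≤ suc q ^ y * f (t + y)) → Result
      go (zero , T , _ , uT , X⊆T , lT , cov , _) = ⊥-elim (G₀∌X (mkContains λ m → blk (cover-star (trans lT (+-identityʳ t)) cov G₀∈) (X⊆T m)))
      go (suc zero , T , _ , uT , X⊆T , lT , cov , _) =
        StarCover.star-cover t q {t + p} {𝓕} {𝓖} fam𝓕 fam𝓖 cross uX lX starX F₀∈ G₀∈ G₀∌X ψ₀ ψ₁ φ₁ (bnd M (p ∸ 2)) c w p
          cnt𝓖-t cnt𝓖-t-multi cnt𝓖-suc-t cnt𝓖-all cnt𝓕-suc-t cnt𝓕-multi
          (λ {H} u e → level-bound n≡ fam𝓕 2 u (trans e (+-comm 2 t))) refl 1≤t 2≤q 2≤p tq≤c (*-monoʳ-≤ (suc t) (s≤s p≤a))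
          (next-ratio 3≤p p≤a) cψ (positive 2≤p p≤a) 1≤ψ₁ t<w q≤w uT X⊆T (trans lT (+-comm t 1)) cov
      go (y@(suc (suc _)) , T , y≤p , uT , X⊆T , lT , cov , bound) = small (small-≤
        (star-product {p = p} {q} {t} {y} 3≤p (s≤s (s≤s z≤n)) y≤p p≤c 2≤c (≤-trans p≤a (≤-trans (n≤1+n a) a≤M)) tq≤c (big-p p≤a)
          (subst₂ (λ u v → u ≤ suc q ^ y * v) (sym len𝓕) (f-level y) bound) len𝓖) 2≤w (positive 2≤p p≤a) 1≤ψ₀)
        where
        len𝓕 : length 𝓕 ≡ cnt 𝓕 X
        len𝓕 = sym (count-all λ {F} F∈ → contains⁺ {F = F} X (starX F∈))
        len𝓖 : length 𝓖 ≤ suc t ^ y * ψ₀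
        len𝓖 = [ ⊥-elim , (λ le → subst (_≤ suc t ^ y * ψ₀) (sym (length-cover 𝓖 cov)) le) ]′
          (cover-base {Q = ⊥} 𝓖 ψ₀ T t y [] uT lT (λ S uS _ lS → inj₂ (subst (λ z → cnt 𝓖 z ≤ ψ₀) (sym (Listₚ.++-identityʳ S)) (cnt𝓖-t uS lS))))

    two-case : p ≡ 2 → Result
    two-case p≡2 = subst (λ φ → Outcome t q w φ ψ₀ 𝓕 𝓖) (sym φ₁≡1)
      (StarTwo.star-two t q {t + p} {𝓕} {𝓖} fam𝓕 fam𝓖 cross uX lX starX F₀∈ G₀∈ G₀∌X ψ₀ ψ₁ c w (suc (suc M))
        cnt𝓖-t cnt𝓖-t-multi cnt𝓖-suc-t (λ {H} u e → subst (cnt 𝓕 H ≤_) φ₁≡1 (cnt𝓕-suc-t u e)) (cong (_+_ t) p≡2) 1≤t 2≤q tq≤c cψ 1≤ψ₁ t<w (slack-w p≡2)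
        refl n≡ (begin
          (c * c) ^ 3 ≡⟨ square-pow c 3 ⟩
          c ^ 6 ≤⟨ ^-monoʳ-≤ c {{>-nonZero 1≤c}} (*-monoʳ-≤ 2 (s≤s 2≤a)) ⟩
          c ^ (2 * suc a) ≤⟨ unBig big ⟩
          2 ^ suc M ≤⟨ ^-monoʳ-≤ 2 (≤-trans (n≤1+n (suc M)) (n≤1+n _)) ⟩
          2 ^ suc (suc (suc M)) ∎))
      where
      φ₁≡1 : φ₁ ≡ 1
      φ₁≡1 = trans (cong (λ z → S2 (suc M) (z ∸ 1)) p≡2) (S2-one M)

    star-case : Result
    star-case = go (3 ≤? p)
      where
      go : Dec (3 ≤ p) → Result
      go (yes 3≤p) = big-case 3≤p
      go (no ¬3) = two-case (≤-antisym (≤-pred (≰⇒> ¬3)) 2≤p)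

  module Assemble {b : ℕ} (2≤b : 2 ≤ b) (b≤a : b ≤ a) {𝓕₁ 𝓕₂ : List (Part n)} (fam₁ : IsFam (t + a) 𝓕₁) (fam₂ : IsFam (t + b) 𝓕₂)
    (cross : Cross t 𝓕₁ 𝓕₂)
    (nontrivial : ∀ {X} → Unique X → length X ≡ t → (∀ {F} → F ∈ 𝓕₁ → Contains F X) → (∀ {G} → G ∈ 𝓕₂ → Contains G X) → ⊥)
    {F₁ G₁} (F₁∈ : F₁ ∈ 𝓕₁) (G₁∈ : G₁ ∈ 𝓕₂)
    {w} (t<w : suc t ≤ w) (b≤w : b ≤ w) (w≡b⇒ : w ≡ b → 3 ≤ a) where

    main : ℕ
    main = S2 (suc M) (a ∸ 1) * S2 (suc (suc M)) b

    -- The primed cases have the roles of the families exchanged. They occur only for `a ≡ b`;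
    -- otherwise `star₂-less` excludes them.
    data Verdict : Set where
      below : Small (length 𝓕₁) (length 𝓕₂) w 1 main → Verdict
      isC   : w ≤ suc t → TypeC t 𝓕₁ 𝓕₂ → Verdict
      isA   : w ≡ b → TypeA t b 𝓕₁ 𝓕₂ → Verdict
      isC′  : a ≡ b → w ≤ suc t → TypeC t 𝓕₂ 𝓕₁ → Verdict
      isA′  : a ≡ b → w ≡ b → TypeA t b 𝓕₂ 𝓕₁ → Verdict

    stray : ∀ {𝓖 : List (Part n)} {X} → ¬ (∀ {G} → G ∈ 𝓖 → Contains G X) → ∃ λ G → G ∈ 𝓖 × ¬ Contains G X
    stray {𝓖} {X} ¬all = go (All.all? (λ G → contains? G X) 𝓖)
      where
      go : Dec (All (λ G → Contains G X) 𝓖) → ∃ λ G → G ∈ 𝓖 × ¬ Contains G X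
      go (yes all) = ⊥-elim (¬all (All.lookup all))
      go (no ¬a) = find (Allₚ.¬All⇒Any¬ (λ G → contains? G X) 𝓖 ¬a)

    star₁ : ∀ {X} → Unique X → length X ≡ t → (∀ {F} → F ∈ 𝓕₁ → Contains F X) → Verdict
    star₁ {X} uX lX starX = let G , G∈ , ¬c = stray (nontrivial uX lX starX) in
      read (StarCase.star-case fam₁ fam₂ cross uX lX starX F₁∈ G∈ ¬c 2≤a ≤-refl 2≤b b≤a t<w b≤w
        (λ a≡2 → ≤∧≢⇒< b≤w (λ e → <⇒≱ (w≡b⇒ (sym e)) (≤-reflexive a≡2))))
      where
      read : Outcome t b w (S2 (suc M) (a ∸ 1)) (S2 (suc (suc M)) b) 𝓕₁ 𝓕₂ → Verdict
      read (small s) = below (small-assoc s)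
      read (typeC h s) = isC h s
      read (typeA h s) = isA h s

    star₂-equal : a ≡ b → ∀ {X} → Unique X → length X ≡ t → (∀ {G} → G ∈ 𝓕₂ → Contains G X) → ∀ {F} → F ∈ 𝓕₁ → ¬ Contains F X → Verdict
    star₂-equal a≡b uX lX starX F∈ ¬c =
      read (StarCase.star-case fam₂ fam₁ (cross-sym cross) uX lX starX G₁∈ F∈ ¬c 2≤b b≤a 2≤a ≤-refl t<w (subst (_≤ w) (sym a≡b) b≤w)
        (λ b≡2 → ≤∧≢⇒< (subst (_≤ w) (sym a≡b) b≤w) (λ e → <⇒≱ (w≡b⇒ (trans (sym e) a≡b)) (≤-reflexive (trans a≡b b≡2)))))
      where
      read : Outcome t a w (S2 (suc M) (b ∸ 1)) (S2 (suc (suc M)) a) 𝓕₂ 𝓕₁ → Verdict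
      read (small s) = below (subst (Small (length 𝓕₁) (length 𝓕₂) w 1)
        (cong₂ (λ x y → S2 (suc M) (x ∸ 1) * S2 (suc (suc M)) y) (sym a≡b) a≡b) (small-assoc (small-comm s)))
      read (typeC h s) = isC′ a≡b h s
      read (typeA h s) = isA′ a≡b (trans h a≡b) (subst (λ z → TypeA t z 𝓕₂ 𝓕₁) a≡b s)

    -- The star is the family with the smaller number of blocks, and its natural unit `main′` is
    -- smaller than `main`. This permits the larger coefficient w + 2d, which neither extremal
    -- configuration can reach since both t + 1 and `a` lie below it; `small-swap` then returns to
    -- `w` and `main`.
    star₂-less : ∀ d → 1 ≤ d → b + d ≡ a → ∀ {X} → Unique X → length X ≡ t → (∀ {G} → G ∈ 𝓕₂ → Contains G X) →
      ∀ {F} → F ∈ 𝓕₁ → ¬ Contains F X → Verdict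
    star₂-less d 1≤d b+d≡a uX lX starX F∈ ¬c =
      read (StarCase.star-case fam₂ fam₁ (cross-sym cross) uX lX starX G₁∈ F∈ ¬c 2≤b b≤a 2≤a ≤-refl {w′} (≤-trans t<w (m≤m+n w (2 * d))) (<⇒≤ a<w′) (λ _ → a<w′))
      where
      w′ : ℕ
      w′ = w + 2 * d
      a<w′ : suc a ≤ w′
      a<w′ = begin
        suc a ≡⟨ cong suc (sym b+d≡a) ⟩
        suc (b + d) ≡⟨ l b d ⟩
        b + (d + 1) ≤⟨ +-mono-≤ b≤w (+-monoʳ-≤ d 1≤d) ⟩
        w + (d + d) ≡⟨ l′ w d ⟩
        w + 2 * d ∎
        where
        l : ∀ b d → suc (b + d) ≡ b + (d + 1)
        l = solve-∀
        l′ : ∀ w d → w + (d + d) ≡ w + 2 * d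
        l′ = solve-∀
      β : ℕ
      β = b ∸ 1
      1≤β : 1 ≤ β
      1≤β = ∸-monoˡ-≤ 1 2≤b
      b≡ : suc β ≡ b
      b≡ = m+[n∸m]≡n (≤-trans (s≤s z≤n) 2≤b)
      a≡ : a ≡ suc (β + d)
      a≡ = trans (sym b+d≡a) (cong (_+ d) (sym b≡))
      g : ℕ
      g = w ∸ b
      w≡ : w ≡ suc β + g
      w≡ = trans (sym (m+[n∸m]≡n b≤w)) (cong (_+ g) (sym b≡))
      main′ : ℕ
      main′ = S2 (suc M) (b ∸ 1) * S2 (suc (suc M)) a
      β+5≤c : β + 5 ≤ c
      β+5≤c = ≤-trans (subst (λ z → β + 5 ≤ suc z + suc z) (sym a≡) (begin
        β + 5 ≤⟨ slack (β + 1 + 2 * (d ∸ 1)) (trans (l β (d ∸ 1)) (cong (λ z → suc (suc (β + z)) + suc (suc (β + z))) (m+[n∸m]≡n 1≤d))) ⟩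
        suc (suc (β + d)) + suc (suc (β + d)) ∎)) double≤c
        where
        l : ∀ β e → β + 5 + (β + 1 + 2 * e) ≡ suc (suc (β + (1 + e))) + suc (suc (β + (1 + e)))
        l = solve-∀
      exchange : (β + 2 * d) * main′ ≤ β * main
      exchange = subst₂ (λ x y → (β + 2 * d) * (S2 (suc M) β * S2 (suc (suc M)) x) ≤ β * (S2 (suc M) (x ∸ 1) * S2 (suc (suc M)) y)) (sym a≡) b≡
        (swap β d 1≤β 1≤d β+5≤c (subst (_≤ c) a≡ (≤-trans (n≤1+n a) 1+a≤c)) (≤-trans (*-monoʳ-≤ 4 (≤-trans (≤-reflexive (sym a≡)) (n≤1+n a))) 4a≤M) (subst (Big c (suc M)) a≡ big))
      read : Outcome t a w′ (S2 (suc M) (b ∸ 1)) (S2 (suc (suc M)) a) 𝓕₂ 𝓕₁ → Verdict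
      read (small s) = below (subst (λ z → Small (length 𝓕₁) (length 𝓕₂) z 1 main) (sym w≡)
        (small-swap {g = g} {d} 1≤β exchange (subst (λ z → Small (length 𝓕₁) (length 𝓕₂) (z + 2 * d) 1 main′) w≡ (small-assoc (small-comm s)))))
      read (typeC h _) = ⊥-elim (<⇒≱ (≤-trans (s≤s t<w) (≤-trans (≤-reflexive (+-comm 1 w)) (+-monoʳ-≤ w (≤-trans 1≤d (m≤n*m d 2))))) h)
      read (typeA h _) = ⊥-elim (<⇒≱ a<w′ (≤-reflexive h))

    star₂ : ∀ {X} → Unique X → length X ≡ t → (∀ {G} → G ∈ 𝓕₂ → Contains G X) → Verdict
    star₂ {X} uX lX starX = let F , F∈ , ¬c = stray (λ starF → nontrivial uX lX starF starX) in
      go F F∈ ¬c (a ∸ b) (m+[n∸m]≡n b≤a)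
      where
      go : ∀ F → F ∈ 𝓕₁ → ¬ Contains F X → ∀ d → b + d ≡ a → Verdict
      go F F∈ ¬c zero e = star₂-equal (trans (sym e) (+-identityʳ b)) uX lX starX F∈ ¬c
      go F F∈ ¬c (suc d) e = star₂-less (suc d) (s≤s z≤n) e uX lX starX F∈ ¬c

    g₁ g₂ : ℕ → ℕ
    g₁ j = bnd (n ∸ j) (t + a ∸ j)
    g₂ j = bnd (n ∸ j) (t + b ∸ j)

    g-level : ∀ k j → bnd (n ∸ (t + j)) (t + k ∸ (t + j)) ≡ bnd (suc (suc M) ∸ j) (k ∸ j)
    g-level k j = cong₂ bnd (trans (cong (_∸ (t + j)) n≡) ([m+n]∸[m+o]≡n∸o t (suc (suc M)) j)) ([m+n]∸[m+o]≡n∸o t k j)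

    finish : ∀ x₁ x₂ {T₁ T₂} → x₁ ≤ b → x₂ ≤ a → Unique T₁ → length T₁ ≡ t + x₁ → Cover t 𝓕₁ T₁ → Unique T₂ → length T₂ ≡ t + x₂ → Cover t 𝓕₂ T₂ →
      length 𝓕₁ ≤ suc t ^ x₁ * (suc b ^ x₂ * g₁ (t + x₂)) → length 𝓕₂ ≤ suc t ^ x₂ * (suc a ^ x₁ * g₂ (t + x₁)) → Verdict
    finish zero x₂ _ _ u₁ l₁ c₁ _ _ _ _ _ = star₁ u₁ (trans l₁ (+-identityʳ t)) (cover-star (trans l₁ (+-identityʳ t)) c₁)
    finish (suc x₁) zero _ _ _ _ _ u₂ l₂ c₂ _ _ = star₂ u₂ (trans l₂ (+-identityʳ t)) (cover-star (trans l₂ (+-identityʳ t)) c₂)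
    finish (suc x₁) (suc x₂) x₁≤b x₂≤a _ _ _ _ _ _ h₁ h₂ = below (small-≤ {φ = 1} {main}
      (≤-trans (neither-product 2≤b b≤a (s≤s z≤n) x₁≤b (s≤s z≤n) x₂≤a refl (≤-trans (n≤1+n a) a≤M) big
        (subst (λ z → length 𝓕₁ ≤ suc t ^ suc x₁ * (suc b ^ suc x₂ * z)) (g-level a (suc x₂)) h₁)
        (subst (λ z → length 𝓕₂ ≤ suc t ^ suc x₂ * (suc a ^ suc x₁ * z)) (g-level b (suc x₁)) h₂)) (≤-reflexive (sym (+-identityʳ main))))
      (≤-trans (s≤s 1≤t) t<w) ≤-refl (*-mono-≤ (positive 2≤a ≤-refl) (≤-trans (*-mono-≤ {1} {c * c} (*-mono-≤ 1≤c 1≤c) (positive 2≤b b≤a)) (top-ratio 2≤b b≤a))))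

    -- An estimate that fails returns a cover of smaller excess for one of the families, so
    -- `x₁ + x₂` decreases. The process stops when both estimates hold for the same pair of covers.
    descend : ∀ fuel x₁ x₂ T₁ T₂ → x₁ + x₂ ≤ fuel → x₁ ≤ b → x₂ ≤ a → Unique T₁ → length T₁ ≡ t + x₁ → Cover t 𝓕₁ T₁ →
      Unique T₂ → length T₂ ≡ t + x₂ → Cover t 𝓕₂ T₂ → Verdict
    descend fuel x₁ x₂ T₁ T₂ le x₁≤b x₂≤a u₁ l₁ c₁ u₂ l₂ c₂ =
      try₁ (Branching.cover-bound t b {𝓕₁} {𝓕₂} (proj₂ fam₂) cross g₁ (cnt-bound fam₁) x₁ x₂ T₁ u₁ l₁ c₁)
      where
      again : ∀ fuel y₁ y₂ T₁ T₂ → x₁ + x₂ ≤ fuel → y₁ + y₂ < x₁ + x₂ → y₁ ≤ b → y₂ ≤ a → Unique T₁ → length T₁ ≡ t + y₁ → Cover t 𝓕₁ T₁ →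
        Unique T₂ → length T₂ ≡ t + y₂ → Cover t 𝓕₂ T₂ → Verdict
      again zero _ _ _ _ z lt = ⊥-elim (<⇒≱ lt (≤-trans z z≤n))
      again (suc fuel) y₁ y₂ T₁ T₂ z lt = descend fuel y₁ y₂ T₁ T₂ (≤-pred (≤-trans lt z))
      try₂ : length 𝓕₁ ≤ suc t ^ x₁ * (suc b ^ x₂ * g₁ (t + x₂)) →
        (∃ λ y → ∃ λ T → y < x₁ × Unique T × length T ≡ t + y × Cover t 𝓕₁ T) ⊎ length 𝓕₂ ≤ suc t ^ x₂ * (suc a ^ x₁ * g₂ (t + x₁)) → Verdict
      try₂ h₁ (inj₁ (y , T , lt , u , l , c)) = again fuel y x₂ T T₂ le (+-monoˡ-< x₂ lt) (≤-trans (<⇒≤ lt) x₁≤b) x₂≤a u l c u₂ l₂ c₂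
      try₂ h₁ (inj₂ h₂) = finish x₁ x₂ x₁≤b x₂≤a u₁ l₁ c₁ u₂ l₂ c₂ h₁ h₂
      try₁ : (∃ λ y → ∃ λ T → y < x₂ × Unique T × length T ≡ t + y × Cover t 𝓕₂ T) ⊎ length 𝓕₁ ≤ suc t ^ x₁ * (suc b ^ x₂ * g₁ (t + x₂)) → Verdict
      try₁ (inj₁ (y , T , lt , u , l , c)) = again fuel x₁ y T₁ T le (+-monoʳ-< x₁ lt) x₁≤b (≤-trans (<⇒≤ lt) x₂≤a) u₁ l₁ c₁ u l c
      try₁ (inj₂ h₁) = try₂ h₁ (Branching.cover-bound t a {𝓕₂} {𝓕₁} (proj₂ fam₁) (cross-sym cross) g₂ (cnt-bound fam₂) x₂ x₁ T₂ u₂ l₂ c₂)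

    -- The blocks of a member of 𝓕₂ cover 𝓕₁ and conversely; this is why `x₁` is limited by `b` and
    -- `x₂` by `a`.
    verdict : Verdict
    verdict = descend (b + a) b a (blocks G₁) (blocks F₁) ≤-refl ≤-refl ≤-refl
      (blocks-unique G₁) (size (proj₂ fam₂ G₁∈)) (blocks-cover {𝓕 = 𝓕₂} (cross-sym cross) G₁∈)
      (blocks-unique F₁) (size (proj₂ fam₁ F₁∈)) (blocks-cover {𝓕 = 𝓕₁} cross F₁∈)

-- Relabelling points

-- The preimage under `σ`, to match `act`, which also pulls the relation back.
pull : ∀ {n} → Permutation′ n → Subset n → Subset n
pull σ S = tabulate λ i → lookup S (σ ⟨$⟩ʳ i)

module _ {n} (σ : Permutation′ n) where

  pull-lookup : ∀ S i → lookup (pull σ S) i ≡ lookup S (σ ⟨$⟩ʳ i)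
  pull-lookup S i = Vecₚ.lookup∘tabulate _ i

  act-rel : ∀ R i j → rel (act σ R) i j ≡ rel R (σ ⟨$⟩ʳ i) (σ ⟨$⟩ʳ j)
  act-rel R = rel-matrix (λ i j → rel R (σ ⟨$⟩ʳ i) (σ ⟨$⟩ʳ j))

  act-equiv : ∀ {R} → Equiv R → Equiv (act σ R)
  act-equiv {R} e = record
    { r-refl = λ i → up (r-refl e (σ ⟨$⟩ʳ i)) ; r-sym = λ p → up (r-sym e (down p)) ; r-trans = λ p q → up (r-trans e (down p) (down q)) }
    where
    up : ∀ {i j} → Rel R (σ ⟨$⟩ʳ i) (σ ⟨$⟩ʳ j) → Rel (act σ R) i j
    up {i} {j} (mkRel p) = mkRel (subst T (sym (act-rel R i j)) p)
    down : ∀ {i j} → Rel (act σ R) i j → Rel R (σ ⟨$⟩ʳ i) (σ ⟨$⟩ʳ j)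
    down {i} {j} (mkRel p) = mkRel (subst T (act-rel R i j) p)

  act-block : ∀ {R S} → Blk R S → Blk (act σ R) (pull σ S)
  act-block {R} {S} b = let i , p = block-nonempty b in isBlock⁺
    (σ ⟨$⟩ˡ i , ∋-cast (trans (cong (lookup S) (sym (inverseʳ σ))) (sym (pull-lookup S _))) p)
    (λ {i} p j → trans (pull-lookup S j) (trans (block-rel b (∋-cast (pull-lookup S i) p) (σ ⟨$⟩ʳ j)) (sym (act-rel R i j))))

  pull-single : ∀ i → pull σ ⁅ σ ⟨$⟩ʳ i ⁆ ≡ ⁅ i ⁆
  pull-single i = subset-ext λ j → trans (pull-lookup ⁅ σ ⟨$⟩ʳ i ⁆ j) (T-ext
    (λ h → un∋ (subst (⁅ i ⁆ ∋_) (back j (mk∋ h)) (∋-⁅⁆⁺ i)))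
    (λ h → un∋ (subst (λ z → ⁅ σ ⟨$⟩ʳ i ⁆ ∋ (σ ⟨$⟩ʳ z)) (sym (∋-⁅⁆⁻ i j (mk∋ h))) (∋-⁅⁆⁺ (σ ⟨$⟩ʳ i)))))
    where
    back : ∀ j → ⁅ σ ⟨$⟩ʳ i ⁆ ∋ (σ ⟨$⟩ʳ j) → i ≡ j
    back j p = trans (sym (inverseˡ σ)) (trans (cong (σ ⟨$⟩ˡ_) (sym (∋-⁅⁆⁻ (σ ⟨$⟩ʳ i) (σ ⟨$⟩ʳ j) p))) (inverseˡ σ))

act-inverse : ∀ {n} (σ τ : Permutation′ n) → (∀ i → σ ⟨$⟩ʳ (τ ⟨$⟩ʳ i) ≡ i) → ∀ R → act τ (act σ R) ≡ R
act-inverse σ τ inv R = part-≡ λ i j → trans (act-rel τ (act σ R) i j) (trans (act-rel σ R _ _) (cong₂ (rel R) (inv i) (inv j)))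

pull-inverse : ∀ {n} (σ τ : Permutation′ n) → (∀ i → σ ⟨$⟩ʳ (τ ⟨$⟩ʳ i) ≡ i) → ∀ S → pull τ (pull σ S) ≡ S
pull-inverse σ τ inv S = subset-ext λ i → trans (pull-lookup τ (pull σ S) i) (trans (pull-lookup σ S _) (cong (lookup S) (inv i)))

module _ {n} (σ : Permutation′ n) where

  private
    τ : Permutation′ n
    τ = flip σ

  act-flip : ∀ R → act σ (act τ R) ≡ R
  act-flip = act-inverse τ σ (λ i → inverseˡ σ)

  flip-act : ∀ R → act τ (act σ R) ≡ R
  flip-act = act-inverse σ τ (λ i → inverseʳ σ)

  act-injective : ∀ {P Q} → act σ P ≡ act σ Q → P ≡ Q
  act-injective {P} {Q} e = trans (sym (flip-act P)) (trans (cong (act τ) e) (flip-act Q))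

  act-nBlocks : ∀ R → nBlocks (act σ R) ≡ nBlocks R
  act-nBlocks R = sym (trans (sym (Listₚ.length-map (pull σ) (blocks R)))
    (unique-≡-length (Uniqueₚ.map⁺ (λ {S} {S′} e → trans (sym (back S)) (trans (cong (pull τ) e) (back S′))) (blocks-unique R))
      (blocks-unique (act σ R))
      (λ m → case ∈-map⁻ (pull σ) m of λ { (S , S∈ , refl) → ∈-blocks⁺ (act σ R) (act-block σ (∈-blocks⁻ R S∈)) })
      (λ {S} m → subst (_∈ map (pull σ) (blocks R)) (pull-inverse τ σ (λ i → inverseˡ σ) S)
        (∈-map⁺ (pull σ) (∈-blocks⁺ R (subst (λ Q → Blk Q (pull τ S)) (flip-act R) (act-block τ (∈-blocks⁻ (act σ R) m))))))))
    where
    back : ∀ S → pull τ (pull σ S) ≡ S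
    back = pull-inverse σ τ (λ i → inverseʳ σ)

  act-Π : ∀ {k F} → IsΠ k F → IsΠ k (act σ F)
  act-Π {F = F} (mkΠ e s) = mkΠ (act-equiv σ e) (trans (act-nBlocks F) s)

  act-single : ∀ {F i} → Blk F ⁅ σ ⟨$⟩ʳ i ⁆ → Blk (act σ F) ⁅ i ⁆
  act-single {F} {i} b = subst (Blk (act σ F)) (pull-single σ i) (act-block σ b)

  act-single⁻ : ∀ {F i} → Blk (act σ F) ⁅ i ⁆ → Blk F ⁅ σ ⟨$⟩ʳ i ⁆
  act-single⁻ {F} {i} b = subst₂ Blk (flip-act F) (trans (cong (λ z → pull τ ⁅ z ⁆) (sym (inverseˡ σ))) (pull-single τ (σ ⟨$⟩ʳ i))) (act-block τ b)

lookup-unique : ∀ {A : Set} {xs : List A} → Unique xs → ∀ i j → List.lookup xs i ≡ List.lookup xs j → i ≡ j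
lookup-unique (_ ∷ _) Fin.zero Fin.zero _ = refl
lookup-unique (x# ∷ _) Fin.zero (Fin.suc j) e = contradiction e (All.lookup x# (∈-lookup j))
lookup-unique (x# ∷ _) (Fin.suc i) Fin.zero e = contradiction (sym e) (All.lookup x# (∈-lookup i))
lookup-unique (_ ∷ u) (Fin.suc i) (Fin.suc j) e = cong Fin.suc (lookup-unique u i j e)

lookup-++ : ∀ {A : Set} (xs ys : List A) (i : Fin (length (xs ++ ys))) →
  (toℕ i < length xs × List.lookup (xs ++ ys) i ∈ xs) ⊎
  (∃ λ j → toℕ i ≡ length xs + toℕ j × List.lookup (xs ++ ys) i ≡ List.lookup ys j)
lookup-++ [] ys i = inj₂ (i , refl , refl)
lookup-++ (x ∷ xs) ys Fin.zero = inj₁ (s≤s z≤n , here refl)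
lookup-++ (x ∷ xs) ys (Fin.suc i) with lookup-++ xs ys i
... | inj₁ (lt , m) = inj₁ (s≤s lt , there m)
... | inj₂ (j , e , e′) = inj₂ (j , cong suc e , e′)

-- All points are listed with `xs` first, then `zs`, then the others, and the permutation sends a
-- position to the point found there. After `act`, the prescribed singletons occupy the initial
-- positions, as in the standard families.
module Arrange {n} {xs zs : List (Fin n)} (u : Unique (xs ++ zs)) where

  rest : List (Fin n)
  rest = outside (singles (xs ++ zs))

  private
    full : List (Fin n)
    full = xs ++ (zs ++ rest)

    full-unique : Unique full
    full-unique = subst Unique (Listₚ.++-assoc xs zs rest) (Uniqueₚ.++⁺ u (outside-unique (singles (xs ++ zs)))
      λ { (m , m′) → ∈-outside⁻ (singles (xs ++ zs)) m′ (_ , ∈-map⁺ ⁅_⁆ m , ∋-⁅⁆⁺ _) })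

    full-complete : ∀ x → x ∈ full
    full-complete x = subst (x ∈_) (Listₚ.++-assoc xs zs rest) (go (Any.any? (x ≟_) (xs ++ zs)))
      where
      go : Dec (x ∈ xs ++ zs) → x ∈ (xs ++ zs) ++ rest
      go (yes m) = ∈-++⁺ˡ m
      go (no ¬m) = ∈-++⁺ʳ (xs ++ zs) (∈-outside⁺ (singles (xs ++ zs)) (¬m ∘ covers-singles))

    full-length : length full ≡ n
    full-length = trans (unique-≡-length full-unique (Uniqueₚ.allFin⁺ n) (λ {x} _ → ∈-allFin x) (λ {x} _ → full-complete x))
      (Listₚ.length-tabulate id)

    f : Fin n → Fin n
    f i = List.lookup full (Fin.cast (sym full-length) i)

    g : Fin n → Fin n
    g x = Fin.cast full-length (Any.index (full-complete x))

    fg : ∀ x → f (g x) ≡ x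
    fg x = trans (cong (List.lookup full) (Finₚ.cast-involutive (sym full-length) full-length (Any.index (full-complete x))))
      (sym (Anyₚ.lookup-index (full-complete x)))

    gf : ∀ i → g (f i) ≡ i
    gf i = trans (cong (Fin.cast full-length) (lookup-unique full-unique _ _ (sym (Anyₚ.lookup-index (full-complete (f i))))))
      (Finₚ.cast-involutive full-length (sym full-length) i)

    locate : ∀ i → (toℕ i < length xs × f i ∈ xs) ⊎ (length xs ≤ toℕ i × toℕ i < length xs + length zs × f i ∈ zs) ⊎ (length xs + length zs ≤ toℕ i × f i ∈ rest)
    locate i = go (lookup-++ xs (zs ++ rest) i′)
      where
      i′ = Fin.cast (sym full-length) i
      ti : toℕ i′ ≡ toℕ i
      ti = Finₚ.toℕ-cast (sym full-length) i
      go₂ : ∀ j → toℕ i′ ≡ length xs + toℕ j → f i ≡ List.lookup (zs ++ rest) j →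
        (toℕ j < length zs × List.lookup (zs ++ rest) j ∈ zs) ⊎ (∃ λ l → toℕ j ≡ length zs + toℕ l × List.lookup (zs ++ rest) j ≡ List.lookup rest l) →
        (length xs ≤ toℕ i × toℕ i < length xs + length zs × f i ∈ zs) ⊎ (length xs + length zs ≤ toℕ i × f i ∈ rest)
      go₂ j e e′ (inj₁ (lt , m)) = inj₁ (subst (length xs ≤_) (trans (sym e) ti) (m≤m+n (length xs) (toℕ j)) ,
        subst (_< length xs + length zs) (trans (sym e) ti) (+-monoʳ-< (length xs) lt) , subst (_∈ zs) (sym e′) m)
      go₂ j e e′ (inj₂ (l , el , e″)) = inj₂ (≤-trans (+-monoʳ-≤ (length xs) (≤-trans (m≤m+n (length zs) (toℕ l)) (≤-reflexive (sym el)))) (≤-reflexive (trans (sym e) ti)) ,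
        subst (_∈ rest) (sym (trans e′ e″)) (∈-lookup l))
      go : _ → _
      go (inj₁ (lt , m)) = inj₁ (subst (_< length xs) ti lt , m)
      go (inj₂ (j , e , e′)) = inj₂ (go₂ j e e′ (lookup-++ zs rest j))

    ∉rest : ∀ {x} → x ∈ xs ++ zs → x ∉ rest
    ∉rest m m′ = ∈-outside⁻ (singles (xs ++ zs)) m′ (_ , ∈-map⁺ ⁅_⁆ m , ∋-⁅⁆⁺ _)

    xs∉zs : ∀ {x} → x ∈ xs → x ∉ zs
    xs∉zs m m′ = apart xs u m m′
      where
      apart : ∀ xs → Unique (xs ++ zs) → ∀ {x} → x ∈ xs → x ∉ zs
      apart (x ∷ xs) (x# ∷ u) (here refl) m′ = All.lookup x# (∈-++⁺ʳ xs m′) refl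
      apart (x ∷ xs) (x# ∷ u) (there m) m′ = apart xs u m m′

  arrange : Permutation′ n
  arrange = permutation f g fg gf

  at-xs : ∀ i → toℕ i < length xs → arrange ⟨$⟩ʳ i ∈ xs
  at-xs i lt = [ proj₂ , [ (λ { (ge , _) → contradiction lt (≤⇒≯ ge) }) , (λ { (ge , _) → contradiction lt (≤⇒≯ (≤-trans (m≤m+n _ _) ge)) }) ]′ ]′ (locate i)

  at-zs : ∀ i → length xs ≤ toℕ i → toℕ i < length xs + length zs → arrange ⟨$⟩ʳ i ∈ zs
  at-zs i ge lt = [ (λ { (l , _) → contradiction l (≤⇒≯ ge) }) , [ (λ { (_ , _ , m) → m }) , (λ { (g , _) → contradiction lt (≤⇒≯ g) }) ]′ ]′ (locate i)

  find-xs : ∀ {x} → x ∈ xs → ∃ λ i → toℕ i < length xs × arrange ⟨$⟩ʳ i ≡ x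
  find-xs {x} m = g x , [ proj₁ , [ (λ { (_ , _ , m′) → contradiction (subst (_∈ zs) (fg x) m′) (xs∉zs m) }) ,
    (λ { (_ , m′) → contradiction (subst (_∈ rest) (fg x) m′) (∉rest (∈-++⁺ˡ m)) }) ]′ ]′ (locate (g x)) , fg x

  find-zs : ∀ {z} → z ∈ zs → ∃ λ i → length xs ≤ toℕ i × toℕ i < length xs + length zs × arrange ⟨$⟩ʳ i ≡ z
  find-zs {z} m = g z , let a , b = place in a , b , fg z
    where
    place : length xs ≤ toℕ (g z) × toℕ (g z) < length xs + length zs
    place = [ (λ { (_ , m′) → contradiction m (xs∉zs (subst (_∈ xs) (fg z) m′)) }) , [ (λ { (a , b , _) → a , b }) ,
      (λ { (_ , m′) → contradiction (subst (_∈ rest) (fg z) m′) (∉rest (∈-++⁺ʳ xs m)) }) ]′ ]′ (locate (g z))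

-- The extremal families

below : ∀ {n} → ℕ → List (Fin n)
below m = filterᵇ (λ i → ⌊ toℕ i <? m ⌋) (allFin _)

between : ∀ {n} → ℕ → ℕ → List (Fin n)
between t ℓ = filterᵇ (λ i → ⌊ t ≤? toℕ i ⌋ ∧ ⌊ toℕ i <? ℓ ⌋) (allFin _)

∈-below⁺ : ∀ {n m} {i : Fin n} → toℕ i < m → i ∈ below m
∈-below⁺ {m = m} {i} h = ∈-filterᵇ⁺ {p = λ i → ⌊ toℕ i <? m ⌋} (∈-allFin i) (fromWitness {a? = toℕ i <? m} h)

∈-below⁻ : ∀ {n m} {i : Fin n} → i ∈ below m → toℕ i < m
∈-below⁻ {n} {m} {i} h = toWitness {a? = toℕ i <? m} (proj₂ (∈-filterᵇ⁻ {p = λ i → ⌊ toℕ i <? m ⌋} {xs = allFin n} h))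

∈-between⁺ : ∀ {n t ℓ} {i : Fin n} → t ≤ toℕ i → toℕ i < ℓ → i ∈ between t ℓ
∈-between⁺ {t = t} {ℓ} {i} h h′ = ∈-filterᵇ⁺ {p = λ i → ⌊ t ≤? toℕ i ⌋ ∧ ⌊ toℕ i <? ℓ ⌋} (∈-allFin i)
  (from (T-∧ {⌊ t ≤? toℕ i ⌋}) (fromWitness {a? = t ≤? toℕ i} h , fromWitness {a? = toℕ i <? ℓ} h′))

∈-between⁻ : ∀ {n t ℓ} {i : Fin n} → i ∈ between t ℓ → t ≤ toℕ i × toℕ i < ℓ
∈-between⁻ {n} {t} {ℓ} {i} h = let a , b = to (T-∧ {⌊ t ≤? toℕ i ⌋}) (proj₂ (∈-filterᵇ⁻ {p = λ i → ⌊ t ≤? toℕ i ⌋ ∧ ⌊ toℕ i <? ℓ ⌋} {xs = allFin n} h)) in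
  toWitness {a? = t ≤? toℕ i} a , toWitness {a? = toℕ i <? ℓ} b

below-unique : ∀ {n} m → Unique (below {n} m)
below-unique {n} m = filterᵇ-unique _ (Uniqueₚ.allFin⁺ n)

between-unique : ∀ {n} t ℓ → Unique (between {n} t ℓ)
between-unique {n} t ℓ = filterᵇ-unique _ (Uniqueₚ.allFin⁺ n)

below-length : ∀ {n m} → m ≤ n → length (below {n} m) ≡ m
below-length {n} {m} le = trans (unique-≡-length (below-unique m) (Uniqueₚ.map⁺ (Finₚ.inject≤-injective le le _ _) (Uniqueₚ.allFin⁺ m))
  (λ {i} h → subst (_∈ map (λ j → Fin.inject≤ j le) (allFin m)) (Finₚ.toℕ-injective (trans (Finₚ.toℕ-inject≤ _ le) (Finₚ.toℕ-fromℕ< (∈-below⁻ h))))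
    (∈-map⁺ (λ j → Fin.inject≤ j le) (∈-allFin (fromℕ< (∈-below⁻ h)))))
  (λ h → case ∈-map⁻ (λ j → Fin.inject≤ j le) h of λ { (j , _ , refl) → ∈-below⁺ (subst (_< m) (sym (Finₚ.toℕ-inject≤ j le)) (Finₚ.toℕ<n j)) }))
  (trans (Listₚ.length-map _ (allFin m)) (Listₚ.length-tabulate id))

below-between : ∀ {n} t ℓ → Unique (below {n} t ++ between t ℓ)
below-between t ℓ = Uniqueₚ.++⁺ (below-unique t) (between-unique t ℓ) λ { (m , m′) → <⇒≱ (∈-below⁻ m) (proj₁ (∈-between⁻ m′)) }

between-length : ∀ {n} t b → t + b ≤ n → length (between {n} t (t + b)) ≡ b
between-length {n} t b le = +-cancelˡ-≡ t _ b (begin-equality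
  t + length (between {n} t (t + b)) ≡⟨ cong (_+ length (between {n} t (t + b))) (sym (below-length (≤-trans (m≤m+n t b) le))) ⟩
  length (below {n} t) + length (between {n} t (t + b)) ≡⟨ sym (Listₚ.length-++ (below {n} t)) ⟩
  length (below {n} t ++ between t (t + b)) ≡⟨ unique-≡-length (below-between t (t + b)) (below-unique (t + b))
      (λ m → [ (λ m₁ → ∈-below⁺ (≤-trans (∈-below⁻ m₁) (m≤m+n t b))) , (λ m₂ → ∈-below⁺ (proj₂ (∈-between⁻ {t = t} m₂))) ]′ (∈-++⁻ (below t) m))
      (λ {i} m → split i (∈-below⁻ m) (t ≤? toℕ i)) ⟩
  length (below {n} (t + b)) ≡⟨ below-length le ⟩
  t + b ∎)
  where
  open ≤-Reasoning
  split : ∀ (i : Fin n) → toℕ i < t + b → Dec (t ≤ toℕ i) → i ∈ below t ++ between t (t + b)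
  split i lt (yes ge) = ∈-++⁺ʳ (below t) (∈-between⁺ ge lt)
  split i lt (no ¬ge) = ∈-++⁺ˡ (∈-below⁺ (≰⇒> ¬ge))

hits-singles : ∀ {n} (F : Part n) m → hits F (singles (below m)) ≡ count (λ i → ⌊ toℕ i <? m ⌋ ∧ isBlock F ⁅ i ⁆) (allFin n)
hits-singles {n} F m = trans (count-map (isBlock F) ⁅_⁆ (below m)) (go (allFin n))
  where
  go : ∀ is → count (λ i → isBlock F ⁅ i ⁆) (filterᵇ (λ i → ⌊ toℕ i <? m ⌋) is) ≡ count (λ i → ⌊ toℕ i <? m ⌋ ∧ isBlock F ⁅ i ⁆) is
  go [] = refl
  go (i ∷ is) with ⌊ toℕ i <? m ⌋
  ... | false = go is
  ... | true with isBlock F ⁅ i ⁆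
  ...   | true = cong suc (go is)
  ...   | false = go is

contains-singles⁺ : ∀ {n} {F : Part n} {m} → (∀ i → toℕ i < m → Blk F ⁅ i ⁆) → Contains F (singles (below m))
contains-singles⁺ h = mkContains λ B∈ → case ∈-map⁻ ⁅_⁆ B∈ of λ { (i , i∈ , refl) → h i (∈-below⁻ i∈) }

module Levels {n : ℕ} (k : ℕ) where

  f : ℕ → ℕ
  f j = S2 (n ∸ j) (k ∸ j)

  cnt-f : ∀ {xs : List (Fin n)} → Unique xs → length xs ≤ k → cnt (Πlist k) (singles xs) ≡ f (length xs)
  cnt-f = cnt-singles k

  hitAny : List (Fin n) → Part n → Bool
  hitAny zs F = anyL (λ z → isBlock F ⁅ z ⁆) zs

  -- The size of 𝓐 for the singletons of `xs` as X and those of `zs` as the rest of M. Both lists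
  -- vary because the recursion moves a point from `zs` to `xs`.
  countA : List (Fin n) → List (Fin n) → ℕ
  countA xs zs = count (λ F → hasAll (singles xs) F ∧ hitAny zs F) (Πlist k)

  private
    L : List (Part n)
    L = Πlist k

    pointwise : ∀ (p r s : Part n → Bool) M →
      count (λ F → p F ∧ (r F ∨ s F)) M + count (λ F → (r F ∧ p F) ∧ s F) M ≡ count (λ F → r F ∧ p F) M + count (λ F → p F ∧ s F) M
    pointwise p r s [] = refl
    pointwise p r s (F ∷ M) with p F | r F | s F
    ... | true  | true  | true  = cong suc (trans (+-suc _ _) (trans (cong suc (pointwise p r s M)) (sym (+-suc _ _))))
    ... | true  | true  | false = cong suc (pointwise p r s M)
    ... | true  | false | true  = trans (cong suc (pointwise p r s M)) (sym (+-suc _ _))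
    ... | true  | false | false = pointwise p r s M
    ... | false | true  | true  = pointwise p r s M
    ... | false | true  | false = pointwise p r s M
    ... | false | false | true  = pointwise p r s M
    ... | false | false | false = pointwise p r s M

  -- Inclusion and exclusion for two events: `⁅ z ⁆` is a block, and some singleton from `zs` is a
  -- block.
  countA-step : ∀ xs z zs → countA xs (z ∷ zs) + countA (z ∷ xs) zs ≡ cnt L (singles (z ∷ xs)) + countA xs zs
  countA-step xs z zs = pointwise (hasAll (singles xs)) (λ F → isBlock F ⁅ z ⁆) (hitAny zs) L

  countA-nil : ∀ xs → countA xs [] ≡ 0
  countA-nil xs = count-zero L λ {F} _ h → proj₂ (to (T-∧ {hasAll (singles xs) F}) h)

  move : ∀ {xs : List (Fin n)} {z zs} → Unique (xs ++ z ∷ zs) → Unique ((z ∷ xs) ++ zs) × Unique (xs ++ zs)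
  move {[]} (z# ∷ u) = (z# ∷ u) , u
  move {x ∷ xs} {z} {zs} (x# ∷ u) with move {xs} u
  ... | (z# ∷ u′) , v = (((λ e → All.lookup x# (∈-++⁺ʳ xs (here refl)) (sym e)) ∷ z#) ∷ (x#′ ∷ u′)) , x#′ ∷ v
    where
    x#′ : All (x ≢_) (xs ++ zs)
    x#′ = All.tabulate λ m → All.lookup x# ([ ∈-++⁺ˡ , (λ m′ → ∈-++⁺ʳ xs (there m′)) ]′ (∈-++⁻ xs m))

  unique-head : ∀ {z} (xs zs : List (Fin n)) → Unique ((z ∷ xs) ++ zs) → Unique (z ∷ xs)
  unique-head {z} xs zs u = take-unique (z ∷ xs) u
    where
    take-unique : ∀ ys → Unique (ys ++ zs) → Unique ys
    take-unique [] u = []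
    take-unique (y ∷ ys) (y# ∷ u) = ∷-unique (λ m → All.lookup y# (∈-++⁺ˡ m) refl) (take-unique ys u)

  module _ where
    open ≤-Reasoning

    countA-upper : ∀ xs zs → Unique (xs ++ zs) → length xs + length zs ≤ k → countA xs zs ≤ length zs * f (suc (length xs))
    countA-upper xs [] u le = ≤-reflexive (countA-nil xs)
    countA-upper xs (z ∷ zs) u le = begin
      countA xs (z ∷ zs) ≤⟨ m≤m+n _ (countA (z ∷ xs) zs) ⟩
      countA xs (z ∷ zs) + countA (z ∷ xs) zs ≡⟨ countA-step xs z zs ⟩
      cnt L (singles (z ∷ xs)) + countA xs zs ≤⟨ +-mono-≤ (≤-reflexive (cnt-f (unique-head xs zs u₁) (≤-trans (s≤s (m≤m+n (length xs) (length zs))) le′)))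
          (countA-upper xs zs u₂ (≤-trans (n≤1+n _) le′)) ⟩
      f (suc (length xs)) + length zs * f (suc (length xs)) ∎
      where
      u₁ = proj₁ (move {xs} u)
      u₂ = proj₂ (move {xs} u)
      le′ : suc (length xs + length zs) ≤ k
      le′ = subst (_≤ k) (+-suc (length xs) (length zs)) le

    -- Bonferroni's inequality, with the square of the number of points in place of the number of
    -- pairs.
    countA-lower : ∀ xs zs → Unique (xs ++ zs) → length xs + length zs ≤ k →
      length zs * f (suc (length xs)) ≤ countA xs zs + length zs * length zs * f (suc (suc (length xs)))
    countA-lower xs [] u le = z≤n
    countA-lower xs (z ∷ zs) u le = +-cancelʳ-≤ (countA (z ∷ xs) zs) _ _ (begin
      f₁ + m * f₁ + countA (z ∷ xs) zs ≤⟨ +-monoʳ-≤ (f₁ + m * f₁) (countA-upper (z ∷ xs) zs u₁ le′) ⟩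
      f₁ + m * f₁ + m * f₂ ≤⟨ +-monoˡ-≤ (m * f₂) (+-monoʳ-≤ f₁ (countA-lower xs zs u₂ (≤-trans (n≤1+n _) le′))) ⟩
      f₁ + (countA xs zs + m * m * f₂) + m * f₂ ≡⟨ l₁ f₁ (countA xs zs) (m * m * f₂) (m * f₂) ⟩
      (f₁ + countA xs zs) + (m * m * f₂ + m * f₂) ≡⟨ cong (_+ (m * m * f₂ + m * f₂)) (trans (cong (_+ countA xs zs) (sym head≡)) (sym (countA-step xs z zs))) ⟩
      (countA xs (z ∷ zs) + countA (z ∷ xs) zs) + (m * m * f₂ + m * f₂) ≤⟨ slack ((1 + m) * f₂) (l₂ (countA xs (z ∷ zs)) (countA (z ∷ xs) zs) m f₂) ⟩
      countA xs (z ∷ zs) + suc m * suc m * f₂ + countA (z ∷ xs) zs ∎)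
      where
      m = length zs
      f₁ = f (suc (length xs))
      f₂ = f (suc (suc (length xs)))
      u₁ = proj₁ (move {xs} u)
      u₂ = proj₂ (move {xs} u)
      le′ : suc (length xs + length zs) ≤ k
      le′ = subst (_≤ k) (+-suc (length xs) (length zs)) le
      head≡ : cnt L (singles (z ∷ xs)) ≡ f₁
      head≡ = cnt-f (unique-head xs zs u₁) (≤-trans (s≤s (m≤m+n (length xs) m)) le′)
      l₁ : ∀ a b c d → a + (b + c) + d ≡ (a + b) + (c + d)
      l₁ = solve-∀
      l₂ : ∀ a b m f → (a + b) + (m * m * f + m * f) + (1 + m) * f ≡ a + suc m * suc m * f + b
      l₂ = solve-∀

    -- Each of the m + 1 events meets the next one in a set of size `f₂`, so the sum of their sizes
    -- exceeds their union by at least m such intersections. This precision decides the tie between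
    -- (A, B) and (C, D).
    countA-second : ∀ xs z zs → Unique (xs ++ z ∷ zs) → length xs + suc (length zs) ≤ k →
      countA xs (z ∷ zs) + length zs * f (suc (suc (length xs))) ≤ suc (length zs) * f (suc (length xs))
    countA-second xs z [] u le = ≤-trans (≤-reflexive (+-identityʳ _)) (countA-upper xs (z ∷ []) u le)
    countA-second xs z (z′ ∷ zs) u le = begin
      countA xs (z ∷ z′ ∷ zs) + (f₂ + m * f₂) ≡⟨ sym (+-assoc (countA xs (z ∷ z′ ∷ zs)) f₂ (m * f₂)) ⟩
      countA xs (z ∷ z′ ∷ zs) + f₂ + m * f₂ ≤⟨ +-monoˡ-≤ (m * f₂) (+-monoʳ-≤ (countA xs (z ∷ z′ ∷ zs)) f₂≤) ⟩
      countA xs (z ∷ z′ ∷ zs) + countA (z ∷ xs) (z′ ∷ zs) + m * f₂ ≡⟨ cong (_+ m * f₂) (trans (countA-step xs z (z′ ∷ zs)) (cong (_+ countA xs (z′ ∷ zs)) head≡)) ⟩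
      f₁ + countA xs (z′ ∷ zs) + m * f₂ ≡⟨ +-assoc f₁ (countA xs (z′ ∷ zs)) (m * f₂) ⟩
      f₁ + (countA xs (z′ ∷ zs) + m * f₂) ≤⟨ +-monoʳ-≤ f₁ (countA-second xs z′ zs u₂ (≤-trans (n≤1+n _) le′)) ⟩
      f₁ + suc m * f₁ ∎
      where
      m = length zs
      f₁ = f (suc (length xs))
      f₂ = f (suc (suc (length xs)))
      u₁ = proj₁ (move {xs} u)
      u₂ = proj₂ (move {xs} u)
      u₃ = proj₁ (move {z ∷ xs} u₁)
      le′ : suc (length xs + suc m) ≤ k
      le′ = subst (_≤ k) (+-suc (length xs) (suc m)) le
      head≡ : cnt L (singles (z ∷ xs)) ≡ f₁
      head≡ = cnt-f (unique-head xs (z′ ∷ zs) u₁) (≤-trans (s≤s (m≤m+n (length xs) (suc m))) le′)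
      f₂≤ : f₂ ≤ countA (z ∷ xs) (z′ ∷ zs)
      f₂≤ = subst (_≤ countA (z ∷ xs) (z′ ∷ zs)) (cnt-f (unique-head (z ∷ xs) zs u₃)
          (≤-trans (s≤s (≤-trans (s≤s (m≤m+n (length xs) m)) (≤-reflexive (sym (+-suc (length xs) m))))) le′))
        (count-mono L λ {F} _ h → into (isBlock F ⁅ z′ ⁆) (hasAll (singles (z ∷ xs)) F) (hitAny zs F) h)
        where
        into : ∀ a b c → T (a ∧ b) → T (b ∧ (a ∨ c))
        into true true c _ = tt

  countD : List (Fin n) → List (Fin n) → ℕ
  countD hs ts = count (λ G → hasAll (singles hs) G ∧ ⌊ length ts ≤? suc (hits G (singles ts)) ⌋) L

  -- The members with `⁅ x ⁆` are counted by moving `x` from `ts` to `hs`; those without it have all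
  -- the other singletons of `ts`, which is `D′`. For empty `hs` this is the size of 𝓓, with the
  -- negative terms moved to the other side.
  countD-formula : ∀ hs ts → Unique (hs ++ ts) → length hs + length ts ≤ k →
    countD hs ts + length ts * f (length hs + length ts) ≡ length ts * f (length hs + length ts ∸ 1) + f (length hs + length ts)
  countD-formula hs [] u le = trans (+-identityʳ _) (trans (count-cong L
      (λ {F} _ h → proj₁ (to (T-∧ {hasAll (singles hs) F}) h)) (λ {F} _ h → from (T-∧ {hasAll (singles hs) F}) (h , tt)))
    (trans (cnt-f (subst Unique (Listₚ.++-identityʳ hs) u) (subst (_≤ k) (+-identityʳ _) le)) (cong f (sym (+-identityʳ (length hs))))))
  countD-formula hs (x ∷ ts) u le = begin-equality
    countD hs (x ∷ ts) + suc m * f (h + suc m) ≡⟨ cong₂ (λ a b → a + suc m * f b) split (+-suc h m) ⟩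
    (countD (x ∷ hs) ts + D′) + suc m * f (suc (h + m)) ≡⟨ l₁ (countD (x ∷ hs) ts) D′ m (f (suc (h + m))) ⟩
    (countD (x ∷ hs) ts + m * f (suc (h + m))) + (D′ + f (suc (h + m))) ≡⟨ cong₂ _+_ (countD-formula (x ∷ hs) ts u₁ le′) D′≡ ⟩
    (m * f (h + m) + f (suc (h + m))) + f (h + m) ≡⟨ l₂ m (f (h + m)) (f (suc (h + m))) ⟩
    suc m * f (h + m) + f (suc (h + m)) ≡⟨ sym (cong₂ (λ a b → suc m * f a + f b) (cong (_∸ 1) (+-suc h m)) (+-suc h m)) ⟩
    suc m * f (h + suc m ∸ 1) + f (h + suc m) ∎
    where
    open ≤-Reasoning
    h = length hs
    m = length ts
    u₁ = proj₁ (move {hs} u)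
    u₂ = proj₂ (move {hs} u)
    le′ : suc (h + m) ≤ k
    le′ = subst (_≤ k) (+-suc h m) le
    P : Part n → Bool
    P G = hasAll (singles hs) G ∧ ⌊ suc m ≤? suc (hits G (singles (x ∷ ts))) ⌋
    D′ : ℕ
    D′ = count (λ G → hasAll (singles (hs ++ ts)) G ∧ not (isBlock G ⁅ x ⁆)) L
    all-++⁺ : ∀ {G} → Contains G (singles hs) → Contains G (singles ts) → T (hasAll (singles (hs ++ ts)) G)
    all-++⁺ {G} c c′ = contains⁺ {F = G} (singles (hs ++ ts)) (subst (Contains G) (sym (Listₚ.map-++ ⁅_⁆ hs ts)) (contains-++ c c′))
    all-++⁻ : ∀ {G} → T (hasAll (singles (hs ++ ts)) G) → Contains G (singles hs ++ singles ts)
    all-++⁻ {G} p = subst (Contains G) (Listₚ.map-++ ⁅_⁆ hs ts) (contains⁻ {F = G} (singles (hs ++ ts)) p)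
    split : countD hs (x ∷ ts) ≡ countD (x ∷ hs) ts + D′
    split = trans (count-split P (λ G → isBlock G ⁅ x ⁆) L) (cong₂ _+_
      (count-cong L (λ {G} _ → yes⁺ G) (λ {G} _ → yes⁻ G)) (count-cong L (λ {G} _ → no⁺ G) (λ {G} _ → no⁻ G)))
      where
      yes⁺ : ∀ G → T (P G ∧ isBlock G ⁅ x ⁆) → T (hasAll (singles (x ∷ hs)) G ∧ ⌊ m ≤? suc (hits G (singles ts)) ⌋)
      yes⁺ G p = let a , b = to (T-∧ {P G}) p ; a₁ , a₂ = to (T-∧ {hasAll (singles hs) G}) a in
        from (T-∧ {hasAll (singles (x ∷ hs)) G}) (from (T-∧ {isBlock G ⁅ x ⁆}) (b , a₁) ,
          fromWitness {a? = m ≤? suc (hits G (singles ts))} (≤-trans (≤-pred (toWitness {a? = suc m ≤? suc (hits G (singles (x ∷ ts)))} a₂)) (hits-∷ G ⁅ x ⁆ (singles ts))))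
      yes⁻ : ∀ G → T (hasAll (singles (x ∷ hs)) G ∧ ⌊ m ≤? suc (hits G (singles ts)) ⌋) → T (P G ∧ isBlock G ⁅ x ⁆)
      yes⁻ G p = let a , b = to (T-∧ {hasAll (singles (x ∷ hs)) G}) p ; a₁ , a₂ = to (T-∧ {isBlock G ⁅ x ⁆}) a in
        from (T-∧ {P G}) (from (T-∧ {hasAll (singles hs) G}) (a₂ , fromWitness {a? = suc m ≤? suc (hits G (singles (x ∷ ts)))}
          (s≤s (subst (m ≤_) (sym (hits-yes G a₁)) (toWitness {a? = m ≤? suc (hits G (singles ts))} b)))) , a₁)
        where
        hits-yes : ∀ G → T (isBlock G ⁅ x ⁆) → hits G (singles (x ∷ ts)) ≡ suc (hits G (singles ts))
        hits-yes G p with isBlock G ⁅ x ⁆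
        ... | true = refl
      no⁺ : ∀ G → T (P G ∧ not (isBlock G ⁅ x ⁆)) → T (hasAll (singles (hs ++ ts)) G ∧ not (isBlock G ⁅ x ⁆))
      no⁺ G p = let a , b = to (T-∧ {P G}) p ; a₁ , a₂ = to (T-∧ {hasAll (singles hs) G}) a in
        from (T-∧ {hasAll (singles (hs ++ ts)) G}) (all-++⁺ {G} (contains⁻ {F = G} (singles hs) a₁) (hits-full {G = G} {singles ts}
          (≤-trans (≤-reflexive (Listₚ.length-map ⁅_⁆ ts)) (subst (m ≤_) (hits-∷-no G ⁅ x ⁆ (singles ts) (T-not⁻ b ∘ unBlk))
            (≤-pred (toWitness {a? = suc m ≤? suc (hits G (singles (x ∷ ts)))} a₂))))) , b)
      no⁻ : ∀ G → T (hasAll (singles (hs ++ ts)) G ∧ not (isBlock G ⁅ x ⁆)) → T (P G ∧ not (isBlock G ⁅ x ⁆))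
      no⁻ G p = let a , b = to (T-∧ {hasAll (singles (hs ++ ts)) G}) p ; c = all-++⁻ {G} a in
        from (T-∧ {P G}) (from (T-∧ {hasAll (singles hs) G}) (contains⁺ {F = G} (singles hs) (mkContains (λ m → blk c (∈-++⁺ˡ m))) ,
          fromWitness {a? = suc m ≤? suc (hits G (singles (x ∷ ts)))} (s≤s (subst (m ≤_) (sym (trans (hits-∷-no G ⁅ x ⁆ (singles ts) (T-not⁻ b ∘ unBlk))
            (trans (contains-hits {G = G} {singles ts} (mkContains (λ m → blk c (∈-++⁺ʳ (singles hs) m)))) (Listₚ.length-map ⁅_⁆ ts)))) ≤-refl))) , b)
    D′≡ : D′ + f (suc (h + m)) ≡ f (h + m)
    D′≡ = begin-equality
      D′ + f (suc (h + m)) ≡⟨ +-comm D′ _ ⟩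
      f (suc (h + m)) + D′ ≡⟨ cong (_+ D′) (sym both) ⟩
      count (λ G → hasAll (singles (hs ++ ts)) G ∧ isBlock G ⁅ x ⁆) L + D′ ≡⟨ sym (count-split (hasAll (singles (hs ++ ts))) (λ G → isBlock G ⁅ x ⁆) L) ⟩
      cnt L (singles (hs ++ ts)) ≡⟨ cnt-f u₂ (≤-trans (≤-reflexive (Listₚ.length-++ hs)) (≤-trans (n≤1+n _) le′)) ⟩
      f (length (hs ++ ts)) ≡⟨ cong f (Listₚ.length-++ hs) ⟩
      f (h + m) ∎
      where
      both : count (λ G → hasAll (singles (hs ++ ts)) G ∧ isBlock G ⁅ x ⁆) L ≡ f (suc (h + m))
      both = trans (count-cong L (λ {G} _ p → ∧-flip (hasAll (singles (hs ++ ts)) G) (isBlock G ⁅ x ⁆) p) (λ {G} _ p → ∧-flip (isBlock G ⁅ x ⁆) (hasAll (singles (hs ++ ts)) G) p))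
        (trans (cnt-f u₁ (≤-trans (≤-reflexive (cong suc (Listₚ.length-++ hs))) le′)) (cong (λ z → f (suc z)) (Listₚ.length-++ hs)))
        where
        ∧-flip : ∀ a b → T (a ∧ b) → T (b ∧ a)
        ∧-flip true true _ = tt
    l₁ : ∀ a b m f → (a + b) + suc m * f ≡ (a + m * f) + (b + f)
    l₁ = solve-∀
    l₂ : ∀ m f g → (m * f + g) + f ≡ suc m * f + g
    l₂ = solve-∀

module _ {n} {𝓕 L : List (Part n)} (σ : Permutation′ n) (u : Unique 𝓕) where

  side-≤ : (∀ {P} → P ∈ 𝓕 → act σ P ∈ L) → length 𝓕 ≤ length L
  side-≤ h = subst (_≤ length L) (Listₚ.length-map (act σ) 𝓕)
    (unique-⊆-length (Uniqueₚ.map⁺ (act-injective σ) u) (λ m → case ∈-map⁻ (act σ) m of λ { (P , P∈ , refl) → h P∈ }))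

  side-full : (∀ {P} → P ∈ 𝓕 → act σ P ∈ L) → length L ≤ length 𝓕 → ∀ {P} → act σ P ∈ L → P ∈ 𝓕
  side-full h le {P} m =
    let Q , Q∈ , e = ∈-map⁻ (act σ) (unique-⊆-complete _≡ᴾ?_ (Uniqueₚ.map⁺ (act-injective σ) u)
          (λ m → case ∈-map⁻ (act σ) m of λ { (P , P∈ , refl) → h P∈ }) (subst (length L ≤_) (sym (Listₚ.length-map (act σ) 𝓕)) le) m)
    in subst (_∈ 𝓕) (sym (act-injective σ e)) Q∈

  side-≡ : Unique L → (∀ P → P ∈ 𝓕 → act σ P ∈ L) → (∀ P → act σ P ∈ L → P ∈ 𝓕) → length 𝓕 ≡ length L
  side-≡ uL f g = ≤-antisym (side-≤ (λ {P} → f P)) (subst (length L ≤_) (Listₚ.length-map (act σ) 𝓕)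
    (unique-⊆-length uL (λ {Q} m → subst (_∈ map (act σ) 𝓕) (act-flip σ Q) (∈-map⁺ (act σ) (g (act (flip σ) Q) (subst (_∈ L) (sym (act-flip σ Q)) m))))))

-- The extremal families are predicates, while the given families are lists; a listing without
-- repetition makes their sizes comparable.
record Lists {n} (A : Part n → Set) : Set where
  field
    list  : List (Part n)
    uniq  : Unique list
    sound : ∀ {P} → P ∈ list → A P
    compl : ∀ {P} → A P → P ∈ list
open Lists

module _ {n} {𝓕₁ 𝓕₂ : List (Part n)} (u₁ : Unique 𝓕₁) (u₂ : Unique 𝓕₂) {A₁ A₂ : Part n → Set} (L₁ : Lists A₁) (L₂ : Lists A₂) where

  iso-lengths : Iso 𝓕₁ 𝓕₂ A₁ A₂ → length 𝓕₁ * length 𝓕₂ ≡ length (list L₁) * length (list L₂)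
  iso-lengths (σ , h₁ , h₂) = cong₂ _*_
    (side-≡ σ u₁ (uniq L₁) (λ P m → compl L₁ (to (h₁ P) m)) (λ P m → from (h₁ P) (sound L₁ m)))
    (side-≡ σ u₂ (uniq L₂) (λ P m → compl L₂ (to (h₂ P) m)) (λ P m → from (h₂ P) (sound L₂ m)))

  module Embedded (σ : Permutation′ n) (h₁ : ∀ {P} → P ∈ 𝓕₁ → A₁ (act σ P)) (h₂ : ∀ {P} → P ∈ 𝓕₂ → A₂ (act σ P)) where

    le₁ : length 𝓕₁ ≤ length (list L₁)
    le₁ = side-≤ σ u₁ (λ m → compl L₁ (h₁ m))

    le₂ : length 𝓕₂ ≤ length (list L₂)
    le₂ = side-≤ σ u₂ (λ m → compl L₂ (h₂ m))

    product-≤ : length 𝓕₁ * length 𝓕₂ ≤ length (list L₁) * length (list L₂)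
    product-≤ = *-mono-≤ le₁ le₂

    -- Each family injects into its model. Equal products with positive factors force both lengths
    -- to agree, and an injection between lists of equal length is onto.
    product-≡⇒iso : 1 ≤ length (list L₁) → 1 ≤ length (list L₂) →
      length 𝓕₁ * length 𝓕₂ ≡ length (list L₁) * length (list L₂) → Iso 𝓕₁ 𝓕₂ A₁ A₂
    product-≡⇒iso p₁ p₂ e = σ ,
      (λ P → mk⇔ h₁ (λ a → side-full σ u₁ (λ m → compl L₁ (h₁ m)) ge₁ (compl L₁ a))) ,
      (λ P → mk⇔ h₂ (λ a → side-full σ u₂ (λ m → compl L₂ (h₂ m)) ge₂ (compl L₂ a)))
      where
      open ≤-Reasoning
      ge₁ : length (list L₁) ≤ length 𝓕₁
      ge₁ = *-cancelʳ-≤ (length (list L₁)) (length 𝓕₁) (length (list L₂)) {{>-nonZero p₂}} (begin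
        length (list L₁) * length (list L₂) ≡⟨ sym e ⟩
        length 𝓕₁ * length 𝓕₂ ≤⟨ *-monoʳ-≤ (length 𝓕₁) le₂ ⟩
        length 𝓕₁ * length (list L₂) ∎)
      ge₂ : length (list L₂) ≤ length 𝓕₂
      ge₂ = *-cancelˡ-≤ (length (list L₁)) {{>-nonZero p₁}} (begin
        length (list L₁) * length (list L₂) ≡⟨ sym e ⟩
        length 𝓕₁ * length 𝓕₂ ≤⟨ *-monoˡ-≤ (length 𝓕₂) le₁ ⟩
        length (list L₁) * length 𝓕₂ ∎)

blk-below : ∀ {n m} {F : Part n} → Contains F (singles (below m)) → ∀ i → toℕ i < m → T (isBlock F ⁅ i ⁆)
blk-below c i h = unBlk (blk c (∈-map⁺ ⁅_⁆ (∈-below⁺ h)))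

module Standard (n : ℕ) where

  listC : ∀ k t → Lists (𝓒 {n} k t)
  listC k t = record
    { list = filterᵇ (hasAll (singles (below (suc t)))) (Πlist k)
    ; uniq = filterᵇ-unique _ (proj₁ (Πlist-fam k))
    ; sound = λ {F} m → let a , b = ∈-filterᵇ⁻ {p = hasAll (singles (below (suc t)))} {xs = Πlist k} m in
        IsΠ⇒InΠ (∈-Πlist⁻ a) , blk-below (contains⁻ {F = F} (singles (below (suc t))) b)
    ; compl = λ {F} (a , b) → ∈-filterᵇ⁺ {p = hasAll (singles (below (suc t)))} (∈-Πlist⁺ (InΠ⇒IsΠ a))
        (contains⁺ {F = F} (singles (below (suc t))) (contains-singles⁺ (λ i h → mkBlk (b i h)))) }

  listD : ∀ k t → Lists (𝓓 {n} k t)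
  listD k t = record
    { list = filterᵇ p (Πlist k)
    ; uniq = filterᵇ-unique p (proj₁ (Πlist-fam k))
    ; sound = λ {F} m → let a , b = ∈-filterᵇ⁻ {p = p} {xs = Πlist k} m in
        IsΠ⇒InΠ (∈-Πlist⁻ a) , subst (t ≤_) (hits-singles F (suc t)) (toWitness {a? = t ≤? hits F (singles (below (suc t)))} b)
    ; compl = λ {F} (a , b) → ∈-filterᵇ⁺ {p = p} (∈-Πlist⁺ (InΠ⇒IsΠ a))
        (fromWitness {a? = t ≤? hits F (singles (below (suc t)))} (subst (t ≤_) (sym (hits-singles F (suc t))) b)) }
    where
    p : Part n → Bool
    p F = ⌊ t ≤? hits F (singles (below (suc t))) ⌋

  listA : ∀ k ℓ t → Lists (𝓐 {n} k ℓ t)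
  listA k ℓ t = record
    { list = filterᵇ p (Πlist k)
    ; uniq = filterᵇ-unique p (proj₁ (Πlist-fam k))
    ; sound = λ {F} m → let a , b = ∈-filterᵇ⁻ {p = p} {xs = Πlist k} m
                            b₁ , b₂ = to (T-∧ {hasAll (singles (below t)) F}) b
                            z , z∈ , h = anyL⁻ {xs = between t ℓ} b₂ ; g , g′ = ∈-between⁻ {t = t} z∈ in
        IsΠ⇒InΠ (∈-Πlist⁻ a) , blk-below (contains⁻ {F = F} (singles (below t)) b₁) , z , g , g′ , h
    ; compl = λ {F} (a , b , z , g , g′ , h) → ∈-filterᵇ⁺ {p = p} (∈-Πlist⁺ (InΠ⇒IsΠ a)) (from (T-∧ {hasAll (singles (below t)) F})
        (contains⁺ {F = F} (singles (below t)) (contains-singles⁺ (λ i h → mkBlk (b i h))) , anyL⁺ (∈-between⁺ {t = t} g g′) h)) }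
    where
    p : Part n → Bool
    p F = hasAll (singles (below t)) F ∧ Levels.hitAny k (between t ℓ) F

  module ListB {ℓ t : ℕ} (t≤ℓ : t ≤ ℓ) (ℓ<n : ℓ < n) where

    -- A point beyond the first `ℓ`. It lies in each modified block, which is therefore not a
    -- singleton.
    far : Fin n
    far = fromℕ< ℓ<n

    bigTest : Fin n → Fin n → Bool
    bigTest b x = ⌊ x ≟ b ⌋ ∨ ⌊ ℓ ℕ.≤? toℕ x ⌋

    big⁺ : ∀ {b x : Fin n} → x ≡ b ⊎ ℓ ≤ toℕ x → bigBlock ℓ b ∋ x
    big⁺ {b} {x} h = mk∋ (subst T (sym (Vecₚ.lookup∘tabulate (bigTest b) x)) (from (T-∨ {⌊ x ≟ b ⌋}) ([ (λ e → inj₁ (fromWitness {a? = x ≟ b} e)) ,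
      (λ g → inj₂ (fromWitness {a? = ℓ ℕ.≤? toℕ x} g)) ]′ h)))

    big⁻ : ∀ {b x : Fin n} → bigBlock ℓ b ∋ x → x ≡ b ⊎ ℓ ≤ toℕ x
    big⁻ {b} {x} (mk∋ h) = [ (λ e → inj₁ (toWitness {a? = x ≟ b} e)) , (λ g → inj₂ (toWitness {a? = ℓ ℕ.≤? toℕ x} g)) ]′
      (to (T-∨ {⌊ x ≟ b ⌋}) (subst T (Vecₚ.lookup∘tabulate (bigTest b) x) h))

    far-big : ∀ {b} → bigBlock ℓ b ∋ far
    far-big {b} = big⁺ {b} (inj₂ (≤-reflexive (sym (Finₚ.toℕ-fromℕ< ℓ<n))))

    others : Fin n → List (Fin n)
    others b = filterᵇ (≢ᵇ b) (below ℓ)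

    others⁺ : ∀ {b i} → toℕ i < ℓ → i ≢ b → i ∈ others b
    others⁺ {b} lt ne = ∈-filterᵇ⁺ {p = ≢ᵇ b} (∈-below⁺ lt) (≢ᵇ⁺ ne)

    others⁻ : ∀ {b i} → i ∈ others b → toℕ i < ℓ × i ≢ b
    others⁻ {b} m = let a , h = ∈-filterᵇ⁻ {p = ≢ᵇ b} {xs = below ℓ} m in ∈-below⁻ a , ≢ᵇ⁻ h

    others-unique : ∀ b → Unique (others b)
    others-unique b = filterᵇ-unique (≢ᵇ b) (below-unique ℓ)

    parts : Fin n → List (Subset n)
    parts b = bigBlock ℓ b ∷ singles (others b)

    parts-good : ∀ b → Good (parts b)
    parts-good b = let ne , ds = singles-good (others-unique b) in
      (far , far-big {b}) ∷ ne , All.tabulate disj ∷ ds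
      where
      disj : ∀ {S} → S ∈ singles (others b) → Disj (bigBlock ℓ b) S
      disj m x p q with ∈-map⁻ ⁅_⁆ m
      ... | i , i∈ , refl with ∋-⁅⁆⁻ i x q
      ...   | refl = [ proj₂ (others⁻ {b} i∈) , (λ ge → <⇒≱ (proj₁ (others⁻ {b} i∈)) ge) ]′ (big⁻ {b} p)

    parts-cover : ∀ b i → Covers (parts b) i
    parts-cover b i = go (i ≟ b) (ℓ ≤? toℕ i)
      where
      go : Dec (i ≡ b) → Dec (ℓ ≤ toℕ i) → Covers (parts b) i
      go (yes e) _ = _ , here refl , big⁺ {b} (inj₁ e)
      go (no _) (yes ge) = _ , here refl , big⁺ {b} (inj₂ ge)
      go (no ne) (no ¬ge) = ⁅ i ⁆ , there (∈-map⁺ ⁅_⁆ (others⁺ (≰⇒> ¬ge) ne)) , ∋-⁅⁆⁺ i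

    modified : Fin n → Part n
    modified b = toPart (parts b)

    modified-equiv : ∀ b → Equiv (modified b)
    modified-equiv b = toPart-equiv (parts-good b) (parts-cover b)

    inModified⁺ : ∀ {b S} → S ∈ parts b → InModified ℓ b S
    inModified⁺ (here refl) = inj₂ refl
    inModified⁺ {b} (there m) with ∈-map⁻ ⁅_⁆ m
    ... | i , i∈ , refl = inj₁ (i , proj₁ (others⁻ {b} i∈) , ≢ᵇ⁺ (proj₂ (others⁻ {b} i∈)) , refl)

    inModified⁻ : ∀ {b S} → InModified ℓ b S → S ∈ parts b
    inModified⁻ (inj₂ refl) = here refl
    inModified⁻ {b} (inj₁ (i , lt , ne , refl)) = there (∈-map⁺ ⁅_⁆ (others⁺ lt (≢ᵇ⁻ ne)))

    not-single : ∀ {b} → toℕ b < ℓ → ¬ Blk (modified b) ⁅ b ⁆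
    not-single {b} b<ℓ h = go (toPart-block⁻ (parts-good b) h)
      where
      go : ⁅ b ⁆ ∉ parts b
      go (here e) = <⇒≱ b<ℓ (≤-reflexive (trans (sym (Finₚ.toℕ-fromℕ< ℓ<n)) (cong toℕ (∋-⁅⁆⁻ b far (subst (_∋ far) (sym e) (far-big {b}))))))
      go (there m) with ∈-map⁻ ⁅_⁆ m
      ... | i , i∈ , e = proj₂ (others⁻ {b} i∈) (sym (⁅⁆-injective e))

    private
      L₀ : List (Part n)
      L₀ = filterᵇ (hasAll (singles (below t))) (Πlist ℓ)

    listB : Lists (𝓑 {n} ℓ t)
    listB = record
      { list = L₀ ++ map modified (below t)
      ; uniq = Uniqueₚ.++⁺ (filterᵇ-unique _ (proj₁ (Πlist-fam ℓ))) (mods (below t) (below-unique t) (λ m → ≤-trans (∈-below⁻ m) t≤ℓ)) apart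
      ; sound = λ {P} m → [ sound₁ , sound₂ ]′ (∈-++⁻ L₀ m)
      ; compl = compl₀ }
      where
      mods : ∀ bs → Unique bs → (∀ {b} → b ∈ bs → toℕ b < ℓ) → Unique (map modified bs)
      mods [] _ _ = []
      mods (b ∷ bs) (b# ∷ u) lt = ∷-unique (λ m → case ∈-map⁻ modified m of λ { (b′ , b′∈ , e) →
          not-single (lt (there b′∈)) (subst (λ Q → Blk Q ⁅ b′ ⁆) e (toPart-block⁺ (parts-good b) (there (∈-map⁺ ⁅_⁆ (others⁺ (lt (there b′∈)) (λ e′ → All.lookup b# b′∈ (sym e′))))))) })
        (mods bs u (lt ∘ there))
      apart : ∀ {P} → (P ∈ L₀ × P ∈ map modified (below t)) → ⊥
      apart {P} (m , m′) with ∈-map⁻ modified m′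
      ... | b , b∈ , refl = not-single (≤-trans (∈-below⁻ b∈) t≤ℓ)
        (blk (contains⁻ {F = modified b} (singles (below t)) (proj₂ (∈-filterᵇ⁻ {p = hasAll (singles (below t))} {xs = Πlist ℓ} m))) (∈-map⁺ ⁅_⁆ b∈))
      sound₁ : ∀ {P} → P ∈ L₀ → 𝓑 ℓ t P
      sound₁ {P} m = let a , b = ∈-filterᵇ⁻ {p = hasAll (singles (below t))} {xs = Πlist ℓ} m in
        inj₁ (IsΠ⇒InΠ (∈-Πlist⁻ a) , blk-below (contains⁻ {F = P} (singles (below t)) b))
      sound₂ : ∀ {P} → P ∈ map modified (below t) → 𝓑 ℓ t P
      sound₂ m with ∈-map⁻ modified m
      ... | b , b∈ , refl = inj₂ (isPartition⁺ (modified-equiv b) , b , ∈-below⁻ b∈ ,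
        λ S → mk⇔ (λ h → inModified⁺ (toPart-block⁻ (parts-good b) (mkBlk h))) (λ h → unBlk (toPart-block⁺ (parts-good b) (inModified⁻ h))))
      compl₀ : ∀ {P} → 𝓑 ℓ t P → P ∈ L₀ ++ map modified (below t)
      compl₀ {P} (inj₁ (a , b)) = ∈-++⁺ˡ (∈-filterᵇ⁺ {p = hasAll (singles (below t))} (∈-Πlist⁺ (InΠ⇒IsΠ a))
        (contains⁺ {F = P} (singles (below t)) (contains-singles⁺ (λ i h → mkBlk (b i h)))))
      compl₀ {P} (inj₂ (a , b , b<t , h)) = ∈-++⁺ʳ L₀ (subst (_∈ map modified (below t))
        (sym (part-ext (isPartition⁻ a) (modified-equiv b) (λ S s → toPart-block⁺ (parts-good b) (inModified⁻ (to (h S) (unBlk s))))))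
        (∈-map⁺ modified (∈-below⁺ b<t)))

    -- R has ℓ blocks, of which ℓ - 1 are these singletons; the last one must be the modified block.
    recognise : ∀ {R b} → IsΠ ℓ R → toℕ b < ℓ → (∀ i → toℕ i < ℓ → i ≢ b → Blk R ⁅ i ⁆) → ¬ Blk R ⁅ b ⁆ →
      ∀ S → T (isBlock R S) ⇔ InModified ℓ b S
    recognise {R} {b} r b<ℓ single ¬b S = mk⇔ (λ h → forth (mkBlk h)) (λ h → unBlk (back h))
      where
      e = equiv r
      others-length : suc (length (others b)) ≡ ℓ
      others-length = trans (sym (trans (count-complement (λ i → ⌊ i ≟ b ⌋) (below ℓ)) (cong (_+ length (others b)) one))) (below-length (<⇒≤ ℓ<n))
        where
        one : count (λ i → ⌊ i ≟ b ⌋) (below ℓ) ≡ 1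
        one = unique-≡-length {ys = b ∷ []} (filterᵇ-unique (λ i → ⌊ i ≟ b ⌋) (below-unique ℓ)) ([] ∷ [])
          (λ {i} m → here (toWitness {a? = i ≟ b} (proj₂ (∈-filterᵇ⁻ {p = λ i → ⌊ i ≟ b ⌋} {xs = below ℓ} m))))
          (λ { (here refl) → ∈-filterᵇ⁺ {p = λ i → ⌊ i ≟ b ⌋} (∈-below⁺ b<ℓ) (fromWitness {a? = b ≟ b} refl) })
      row∉ : ∀ j → (toℕ j < ℓ → j ≡ b) → rowOf R j ∉ singles (others b)
      row∉ j h m with ∈-map⁻ ⁅_⁆ m
      ... | i , i∈ , eq with ∋-⁅⁆⁻ i j (subst (_∋ j) eq (row∋⁺ (r-refl e j)))
      ...   | refl = proj₂ (others⁻ {b} i∈) (h (proj₁ (others⁻ {b} i∈)))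
      same-row : ∀ j → ℓ ≤ toℕ j → rowOf R j ≡ rowOf R b
      same-row j ge = go (rowOf R j ≡? rowOf R b)
        where
        go : Dec (rowOf R j ≡ rowOf R b) → rowOf R j ≡ rowOf R b
        go (yes eq) = eq
        go (no ne) = ⊥-elim (<⇒≱ ≤-refl (≤-trans (unique-⊆-length
            (∷-unique (λ { (here eq) → ne eq ; (there m) → row∉ j (λ lt → ⊥-elim (<⇒≱ lt ge)) m })
              (∷-unique (row∉ b (λ _ → refl)) (good-unique (singles-good (others-unique b))))) sub)
            (≤-reflexive (trans (size r) (trans (sym others-length) (cong suc (sym (Listₚ.length-map ⁅_⁆ (others b)))))))))
          where
          sub : rowOf R j ∷ rowOf R b ∷ singles (others b) ⊆ blocks R
          sub (here refl) = ∈-blocks⁺ R (row-block e j)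
          sub (there (here refl)) = ∈-blocks⁺ R (row-block e b)
          sub (there (there m)) with ∈-map⁻ ⁅_⁆ m
          ... | i , i∈ , refl = ∈-blocks⁺ R (single i (proj₁ (others⁻ {b} i∈)) (proj₂ (others⁻ {b} i∈)))
      row-big : rowOf R b ≡ bigBlock ℓ b
      row-big = subset-ext λ x → T-ext
        (λ h → un∋ (big⁺ {b} (out x (mk∋ h) (x ≟ b) (ℓ ≤? toℕ x))))
        (λ h → un∋ ([ (λ eq → subst (rowOf R b ∋_) (sym eq) (row∋⁺ (r-refl e b))) , (λ ge → subst (_∋ x) (same-row x ge) (row∋⁺ (r-refl e x))) ]′ (big⁻ {b} {x} (mk∋ h))))
        where
        out : ∀ x → rowOf R b ∋ x → Dec (x ≡ b) → Dec (ℓ ≤ toℕ x) → x ≡ b ⊎ ℓ ≤ toℕ x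
        out x p (yes eq) _ = inj₁ eq
        out x p (no ne) (yes ge) = inj₂ ge
        out x p (no ne) (no ¬ge) = ⊥-elim (ne (sym (∋-⁅⁆⁻ x b
          (subst (_∋ b) (block-unique (row-block e b) (single x (≰⇒> ¬ge) ne) p (∋-⁅⁆⁺ x)) (row∋⁺ (r-refl e b))))))
      big-blk : Blk R (bigBlock ℓ b)
      big-blk = subst (Blk R) row-big (row-block e b)
      forth : Blk R S → InModified ℓ b S
      forth h = go (i ≟ b) (ℓ ≤? toℕ i)
        where
        i = proj₁ (block-nonempty h)
        p = proj₂ (block-nonempty h)
        go : Dec (i ≡ b) → Dec (ℓ ≤ toℕ i) → InModified ℓ b S
        go (yes eq) _ = inj₂ (block-unique h big-blk p (big⁺ {b} (inj₁ eq)))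
        go (no _) (yes ge) = inj₂ (block-unique h big-blk p (big⁺ {b} (inj₂ ge)))
        go (no ne) (no ¬ge) = inj₁ (i , ≰⇒> ¬ge , ≢ᵇ⁺ ne , block-unique h (single i (≰⇒> ¬ge) ne) p (∋-⁅⁆⁺ i))
      back : InModified ℓ b S → Blk R S
      back (inj₂ eq) = subst (Blk R) (sym eq) big-blk
      back (inj₁ (i , lt , ne , eq)) = subst (Blk R) (sym eq) (single i lt (≢ᵇ⁻ ne))

open import Data.Integer using (+_)

module _ {n : ℕ} where

  open Standard n

  length-C : ∀ k t → suc t ≤ n → suc t ≤ k → length (list (listC k t)) ≡ S2 (n ∸ suc t) (k ∸ suc t)
  length-C k t le le′ = trans (cnt-singles {n} k {below (suc t)} (below-unique (suc t)) (subst (_≤ k) (sym (below-length le)) le′))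
    (cong (λ z → S2 (n ∸ z) (k ∸ z)) (below-length le))

  length-D : ∀ k t → suc t ≤ n → suc t ≤ k →
    length (list (listD k t)) + t * S2 (n ∸ suc t) (k ∸ suc t) ≡ suc t * S2 (n ∸ t) (k ∸ t)
  length-D k t le le′ = +-cancelʳ-≡ (f (suc t)) _ _ (begin-equality
    D + t * f (suc t) + f (suc t) ≡⟨ l D t (f (suc t)) ⟩
    D + suc t * f (suc t) ≡⟨ cong (_+ suc t * f (suc t)) D≡ ⟩
    countD [] (below (suc t)) + suc t * f (suc t) ≡⟨ subst (λ m → countD [] (below (suc t)) + m * f m ≡ m * f (m ∸ 1) + f m) (below-length le)
        (countD-formula [] (below (suc t)) (below-unique (suc t)) (subst (_≤ k) (sym (below-length le)) le′)) ⟩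
    suc t * f t + f (suc t) ∎)
    where
    open ≤-Reasoning
    open Levels {n} k
    D = length (list (listD k t))
    D≡ : D ≡ countD [] (below (suc t))
    D≡ = count-cong {p = λ G → ⌊ t ≤? hits G (singles (below (suc t))) ⌋}
      {q = λ G → hasAll [] G ∧ ⌊ length (below {n} (suc t)) ≤? suc (hits G (singles (below (suc t)))) ⌋} (Πlist {n} k)
      (λ {G} _ h → fromWitness {a? = length (below {n} (suc t)) ≤? suc (hits G (singles (below (suc t))))}
        (≤-trans (≤-reflexive (below-length le)) (s≤s (toWitness {a? = t ≤? hits G (singles (below (suc t)))} h))))
      (λ {G} _ h → fromWitness {a? = t ≤? hits G (singles (below (suc t)))}
        (≤-pred (≤-trans (≤-reflexive (sym (below-length le))) (toWitness {a? = length (below {n} (suc t)) ≤? suc (hits G (singles (below (suc t))))} h))))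
    l : ∀ D t x → D + t * x + x ≡ D + suc t * x
    l = solve-∀

  length-B : ∀ {ℓ t} (t≤ℓ : t ≤ ℓ) (ℓ<n : ℓ < n) → length (list (ListB.listB t≤ℓ ℓ<n)) ≡ S2 (n ∸ t) (ℓ ∸ t) + t
  length-B {ℓ} {t} t≤ℓ ℓ<n = trans (Listₚ.length-++ (filterᵇ (hasAll (singles (below {n} t))) (Πlist {n} ℓ)) {map (ListB.modified t≤ℓ ℓ<n) (below t)}) (cong₂ _+_
    (trans (cnt-singles {n} ℓ {below t} (below-unique t) (subst (_≤ ℓ) (sym lenT) t≤ℓ)) (cong (λ z → S2 (n ∸ z) (ℓ ∸ z)) lenT))
    (trans (Listₚ.length-map (ListB.modified t≤ℓ ℓ<n) (below t)) lenT))
    where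
    lenT : length (below {n} t) ≡ t
    lenT = below-length (≤-trans t≤ℓ (<⇒≤ ℓ<n))

  embed-C : ∀ {k ℓ t} {𝓕 𝓖 : List (Part n)} → IsFam k 𝓕 → IsFam ℓ 𝓖 → TypeC t 𝓕 𝓖 →
    Σ (Permutation′ n) λ σ → (∀ {P} → P ∈ 𝓕 → 𝓒 k t (act σ P)) × (∀ {P} → P ∈ 𝓖 → 𝓓 ℓ t (act σ P))
  embed-C {k} {ℓ} {t} {𝓕} {𝓖} fam𝓕 fam𝓖 ty = σ , inF′ , inG′
    where
    open TypeC ty
    open Arrange {xs = ts} {zs = []} (subst Unique (sym (Listₚ.++-identityʳ ts)) ts-uniq)
    σ : Permutation′ n
    σ = arrange
    inF′ : ∀ {P} → P ∈ 𝓕 → 𝓒 k t (act σ P)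
    inF′ {P} m = IsΠ⇒InΠ (act-Π σ (proj₂ fam𝓕 m)) ,
      λ i lt → unBlk (act-single σ (blk (inF m) (∈-map⁺ ⁅_⁆ (at-xs i (subst (toℕ i <_) (sym ts-len) lt)))))
    inG′ : ∀ {P} → P ∈ 𝓖 → 𝓓 ℓ t (act σ P)
    inG′ {P} m = IsΠ⇒InΠ (act-Π σ (proj₂ fam𝓖 m)) , subst (t ≤_) (hits-singles (act σ P) (suc t)) (begin
      t ≤⟨ hit inG m ⟩
      hits P (singles ts) ≡⟨ count-map (isBlock P) ⁅_⁆ ts ⟩
      length (filterᵇ (λ i → isBlock P ⁅ i ⁆) ts) ≤⟨ unique-⊆-length (filterᵇ-unique _ ts-uniq) sub ⟩
      length (map (σ ⟨$⟩ʳ_) hitting) ≡⟨ Listₚ.length-map (σ ⟨$⟩ʳ_) hitting ⟩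
      length hitting ≡⟨ sym (count-map (isBlock (act σ P)) ⁅_⁆ (below (suc t))) ⟩
      hits (act σ P) (singles (below (suc t))) ∎)
      where
      open ≤-Reasoning
      hitting : List (Fin n)
      hitting = filterᵇ (λ i → isBlock (act σ P) ⁅ i ⁆) (below (suc t))
      sub : filterᵇ (λ i → isBlock P ⁅ i ⁆) ts ⊆ map (σ ⟨$⟩ʳ_) hitting
      sub {x} h = let x∈ , b = ∈-filterᵇ⁻ {p = λ i → isBlock P ⁅ i ⁆} {xs = ts} h ; i , lt , e = find-xs x∈ in
        subst (_∈ map (σ ⟨$⟩ʳ_) hitting) e (∈-map⁺ (σ ⟨$⟩ʳ_) (∈-filterᵇ⁺ {p = λ i → isBlock (act σ P) ⁅ i ⁆}
          (∈-below⁺ (subst (toℕ i <_) ts-len lt)) (unBlk (act-single σ (subst (λ z → Blk P ⁅ z ⁆) (sym e) (mkBlk b))))))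

  embed-A : ∀ {k t q} {𝓕 𝓖 : List (Part n)} → t + q < n → IsFam k 𝓕 → IsFam (t + q) 𝓖 → TypeA t q 𝓕 𝓖 →
    Σ (Permutation′ n) λ σ → (∀ {P} → P ∈ 𝓕 → 𝓐 k (t + q) t (act σ P)) × (∀ {P} → P ∈ 𝓖 → 𝓑 (t + q) t (act σ P))
  embed-A {k} {t} {q} {𝓕} {𝓖} ℓ<n fam𝓕 fam𝓖 ty = σ , inF′ , inG′
    where
    open TypeA ty
    open Arrange {xs = TypeA.xs ty} {zs = TypeA.zs ty} (TypeA.uniq ty)
    open ListB (m≤m+n t q) ℓ<n using (recognise)
    σ : Permutation′ n
    σ = arrange
    total : length xs + length zs ≡ t + q
    total = cong₂ _+_ xs-len zs-len
    xs-at : ∀ i → toℕ i < t → σ ⟨$⟩ʳ i ∈ xs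
    xs-at i lt = at-xs i (subst (toℕ i <_) (sym xs-len) lt)
    zs-at : ∀ i → t ≤ toℕ i → toℕ i < t + q → σ ⟨$⟩ʳ i ∈ zs
    zs-at i ge lt = at-zs i (subst (_≤ toℕ i) (sym xs-len) ge) (subst (toℕ i <_) (sym total) lt)
    standard : ∀ {P} → Contains P (singles xs) → ∀ (i : Fin n) → toℕ i < t → T (isBlock (act σ P) ⁅ i ⁆)
    standard c i lt = unBlk (act-single σ (blk c (∈-map⁺ ⁅_⁆ (xs-at i lt))))
    inF′ : ∀ {P} → P ∈ 𝓕 → 𝓐 k (t + q) t (act σ P)
    inF′ {P} m = let c , z , z∈ , b = inF m ; i , ge , lt , e = find-zs z∈ in
      IsΠ⇒InΠ (act-Π σ (proj₂ fam𝓕 m)) , standard c , i , subst (_≤ toℕ i) xs-len ge , subst (toℕ i <_) total lt ,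
      unBlk (act-single σ (subst (λ z → Blk P ⁅ z ⁆) (sym e) b))
    inG′ : ∀ {P} → P ∈ 𝓖 → 𝓑 (t + q) t (act σ P)
    inG′ {P} m = [ (λ c → inj₁ (IsΠ⇒InΠ p′ , standard c)) , (λ { (x , x∈ , ¬x , cz , cx) → inj₂ (isPartition⁺ (equiv p′) , away x x∈ ¬x cz cx) }) ]′ (inG m)
      where
      p′ : IsΠ (t + q) (act σ P)
      p′ = act-Π σ (proj₂ fam𝓖 m)
      -- All blocks but one are now known to be prescribed singletons, and `recognise` supplies the
      -- last one.
      away : ∀ x → x ∈ xs → ¬ Blk P ⁅ x ⁆ → Contains P (singles zs) → (∀ {y} → y ∈ xs → y ≢ x → Blk P ⁅ y ⁆) →
        Σ (Fin n) λ b → toℕ b < t × (∀ S → T (isBlock (act σ P) S) ⇔ InModified (t + q) b S)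
      away x x∈ ¬x cz cx = b , b<t , recognise p′ (≤-trans b<t (m≤m+n t q)) single (λ h → ¬x (subst (λ z → Blk P ⁅ z ⁆) e (act-single⁻ σ h)))
        where
        b = proj₁ (find-xs x∈)
        b<t : toℕ b < t
        b<t = subst (toℕ b <_) xs-len (proj₁ (proj₂ (find-xs x∈)))
        e : σ ⟨$⟩ʳ b ≡ x
        e = proj₂ (proj₂ (find-xs x∈))
        single : ∀ i → toℕ i < t + q → i ≢ b → Blk (act σ P) ⁅ i ⁆
        single i lt ne = act-single σ (go (t ≤? toℕ i))
          where
          go : Dec (t ≤ toℕ i) → Blk P ⁅ σ ⟨$⟩ʳ i ⁆
          go (yes ge) = blk cz (∈-map⁺ ⁅_⁆ (zs-at i ge lt))
          go (no ¬ge) = cx (xs-at i (≰⇒> ¬ge)) (λ e′ → ne (trans (sym (inverseˡ σ)) (trans (cong (σ ⟨$⟩ˡ_) (trans e′ (sym e))) (inverseˡ σ))))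

-- Alternating sums

sign : ℕ → ℤ
sign j = (ℤ.- + 1) ℤ.^ j

alternating : ℕ → ℕ → (ℕ → ℤ) → ℤ
alternating L m s = sumFrom1 L (λ j → sign (j ∸ 1) ℤ.* + (m C j) ℤ.* s j)

sumFrom1-cong : ∀ L {g h : ℕ → ℤ} → (∀ j → j < L → g (suc j) ≡ h (suc j)) → sumFrom1 L g ≡ sumFrom1 L h
sumFrom1-cong zero e = refl
sumFrom1-cong (suc L) e = cong₂ ℤ._+_ (sumFrom1-cong L (λ j lt → e j (m<n⇒m<1+n lt))) (e L ≤-refl)

-- Pascal's rule splits each coefficient. The part with the lower index is the same sum for the
-- shifted sequence with opposite sign, except for its first term. The number of terms is separate
-- from `m` so that it can carry the induction.
pascal-sum : ∀ L m s → alternating (suc L) (suc m) s ≡ alternating (suc L) m s ℤ.+ (s 1 ℤ.- alternating L m (s ∘ suc))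
pascal-sum zero m s = trans (cong (λ z → + 0 ℤ.+ sign 0 ℤ.* z ℤ.* s 1) e) (l (+ (m C 1)) (s 1))
  where
  e : + (suc m C 1) ≡ + 1 ℤ.+ + (m C 1)
  e = cong +_ (sym (nCk+nC[k+1]≡[n+1]C[k+1] m 0))
  l : ∀ c x → + 0 ℤ.+ + 1 ℤ.* (+ 1 ℤ.+ c) ℤ.* x ≡ (+ 0 ℤ.+ + 1 ℤ.* c ℤ.* x) ℤ.+ (x ℤ.- + 0)
  l = ℤ-Solver.solve-∀
pascal-sum (suc L) m s = trans (cong₂ (λ u v → u ℤ.+ sign (suc L) ℤ.* v ℤ.* s (suc (suc L))) (pascal-sum L m s) e)
  (l (alternating (suc L) m s) (s 1) (alternating L m (s ∘ suc)) (sign L) (+ (m C suc L)) (+ (m C suc (suc L))) (s (suc (suc L))))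
  where
  e : + (suc m C suc (suc L)) ≡ + (m C suc L) ℤ.+ + (m C suc (suc L))
  e = cong +_ (sym (nCk+nC[k+1]≡[n+1]C[k+1] m (suc L)))
  l : ∀ a x b g c d y → (a ℤ.+ (x ℤ.- b)) ℤ.+ ((ℤ.- + 1) ℤ.* g) ℤ.* (c ℤ.+ d) ℤ.* y
    ≡ (a ℤ.+ ((ℤ.- + 1) ℤ.* g) ℤ.* d ℤ.* y) ℤ.+ (x ℤ.- (b ℤ.+ g ℤ.* c ℤ.* y))
  l = ℤ-Solver.solve-∀

alternating-suc : ∀ m s → alternating (suc m) (suc m) s ≡ alternating m m s ℤ.+ (s 1 ℤ.- alternating m m (s ∘ suc))
alternating-suc m s = trans (pascal-sum m m s) (cong (ℤ._+ (s 1 ℤ.- alternating m m (s ∘ suc)))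
  (trans (cong (λ z → alternating m m s ℤ.+ sign m ℤ.* + z ℤ.* s (suc m)) (k>n⇒nCk≡0 (n<1+n m))) (l (alternating m m s) (sign m) (s (suc m)))))
  where
  l : ∀ a g x → a ℤ.+ g ℤ.* + 0 ℤ.* x ≡ a
  l = ℤ-Solver.solve-∀

module _ {n : ℕ} (k : ℕ) where

  open Levels {n} k

  -- `countA-step`, solved for its first term, is the recursion `alternating-suc`: moving a point to
  -- `xs` shifts the sequence by one.
  countA-alternating : ∀ xs zs → Unique (xs ++ zs) → length xs + length zs ≤ k →
    + countA xs zs ≡ alternating (length zs) (length zs) (λ j → + f (length xs + j))
  countA-alternating xs [] u le = cong +_ (countA-nil xs)
  countA-alternating xs (z ∷ zs) u le = trans (solve-for (+ countA xs (z ∷ zs)) (+ countA (z ∷ xs) zs) (+ cnt (Πlist k) (singles (z ∷ xs))) (+ countA xs zs) step)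
    (trans (cong₂ (λ u v → u ℤ.+ v) (countA-alternating xs zs u₂ (≤-trans (n≤1+n _) le′)) (cong₂ ℤ._-_ head≡ shifted)) (sym (alternating-suc (length zs) (λ j → + f (length xs + j)))))
    where
    u₁ = proj₁ (move {xs} u)
    u₂ = proj₂ (move {xs} u)
    le′ : suc (length xs + length zs) ≤ k
    le′ = subst (_≤ k) (+-suc (length xs) (length zs)) le
    step : + countA xs (z ∷ zs) ℤ.+ + countA (z ∷ xs) zs ≡ + cnt (Πlist k) (singles (z ∷ xs)) ℤ.+ + countA xs zs
    step = cong +_ (countA-step xs z zs)
    head≡ : + cnt (Πlist k) (singles (z ∷ xs)) ≡ + f (length xs + 1)
    head≡ = cong +_ (trans (cnt-f (unique-head xs zs u₁) (≤-trans (s≤s (m≤m+n (length xs) (length zs))) le′)) (cong f (+-comm 1 (length xs))))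
    shifted : + countA (z ∷ xs) zs ≡ alternating (length zs) (length zs) (λ j → + f (length xs + suc j))
    shifted = trans (countA-alternating (z ∷ xs) zs u₁ le′)
      (sumFrom1-cong (length zs) (λ j _ → cong (λ v → sign j ℤ.* + (length zs C suc j) ℤ.* + f v) (sym (+-suc (length xs) (suc j)))))
    solve-for : ∀ a b c d → a ℤ.+ b ≡ c ℤ.+ d → a ≡ d ℤ.+ (c ℤ.- b)
    solve-for a b c d e = trans (l₁ a b) (trans (cong (ℤ._- b) e) (l₂ b c d))
      where
      l₁ : ∀ a b → a ≡ (a ℤ.+ b) ℤ.- b
      l₁ = ℤ-Solver.solve-∀
      l₂ : ∀ b c d → (c ℤ.+ d) ℤ.- b ≡ d ℤ.+ (c ℤ.- b)
      l₂ = ℤ-Solver.solve-∀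

Stirling-S2 : ∀ m k → 1 ≤ m → Stirling m k ≡ S2 m k
Stirling-S2 (suc m) zero _ = refl
Stirling-S2 m (suc k) _ = Stirling≡S2 m k

empty-or-member : ∀ {A : Set} (xs : List A) → length xs ≡ 0 ⊎ ∃ λ x → x ∈ xs
empty-or-member [] = inj₁ refl
empty-or-member (x ∷ xs) = inj₂ (x , here refl)

bounded : ∀ {p B : ℕ} {bound : ℤ} {X : Set} → bound ≡ + B → p ≤ B → (p ≡ B → X) → (X → p ≡ B) →
  (+ p ℤ.≤ bound) × ((+ p ≡ bound) ⇔ X)
bounded refl le f g = ℤ.+≤+ le , mk⇔ (f ∘ ℤₚ.+-injective) (cong +_ ∘ g)

-- Sizes of the extremal families and the two inequalities

module Extremal (t a b M : ℕ) (1≤t : 1 ≤ t) (b≤a : b ≤ a) (2≤b : 2 ≤ b) (big : Big (suc t * suc a) (suc M) a)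
  {𝓕₁ 𝓕₂ : List (Part (t + suc (suc M)))} (fam₁ : IsFam (t + a) 𝓕₁) (fam₂ : IsFam (t + b) 𝓕₂)
  (cross : Cross t 𝓕₁ 𝓕₂)
  (nontrivial : ∀ {X} → Unique X → length X ≡ t → (∀ {F} → F ∈ 𝓕₁ → Contains F X) → (∀ {G} → G ∈ 𝓕₂ → Contains G X) → ⊥) where

  open ≤-Reasoning

  n : ℕ
  n = t + suc (suc M)

  2≤a : 2 ≤ a
  2≤a = ≤-trans 2≤b b≤a

  open Bounds {n} {t} {a} {M} refl 1≤t 2≤a big
  open Standard n

  k₁ k₂ prod φ φ₂ ψ₀ ψ₁ : ℕ
  k₁ = t + a
  k₂ = t + b
  prod = length 𝓕₁ * length 𝓕₂
  φ = S2 (suc M) (a ∸ 1)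
  φ₂ = S2 M (a ∸ 2)
  ψ₀ = S2 (suc (suc M)) b
  ψ₁ = S2 (suc M) (b ∸ 1)

  n∸t : n ∸ t ≡ suc (suc M)
  n∸t = m+n∸m≡n t (suc (suc M))

  shift : ∀ m j → (t + m) ∸ (t + j) ≡ m ∸ j
  shift m j = [m+n]∸[m+o]≡n∸o t m j

  shift₁ : ∀ m → (t + m) ∸ suc t ≡ m ∸ 1
  shift₁ m = trans (cong (t + m ∸_) (+-comm 1 t)) (shift m 1)

  t<n : suc t ≤ n
  t<n = ≤-trans (≤-reflexive (+-comm 1 t)) (+-monoʳ-≤ t (s≤s z≤n))

  t<k : ∀ {m} → 2 ≤ m → suc t ≤ t + m
  t<k 2≤m = ≤-trans (≤-reflexive (+-comm 1 t)) (+-monoʳ-≤ t (≤-trans (s≤s z≤n) 2≤m))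

  a<N : a < suc (suc M)
  a<N = ≤-trans a≤M (n≤1+n (suc M))

  k₂<n : k₂ < n
  k₂<n = +-monoʳ-< t (≤-trans (s≤s b≤a) a<N)

  LA : Lists (𝓐 {n} k₁ k₂ t)
  LA = listA k₁ k₂ t

  LB : Lists (𝓑 {n} k₂ t)
  LB = ListB.listB (m≤m+n t b) k₂<n

  LC : Lists (𝓒 {n} k₁ t)
  LC = listC k₁ t

  LD : Lists (𝓓 {n} k₂ t)
  LD = listD k₂ t

  B₁ B₂ : ℕ
  B₁ = length (list LA) * length (list LB)
  B₂ = length (list LC) * length (list LD)

  B-size : length (list LB) ≡ ψ₀ + t
  B-size = trans (length-B (m≤m+n t b) k₂<n) (cong (_+ t) (cong₂ S2 n∸t (m+n∸m≡n t b)))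

  C-size : length (list LC) ≡ φ
  C-size = trans (length-C k₁ t t<n (t<k 2≤a)) (cong₂ S2 (shift₁ (suc (suc M))) (shift₁ a))

  D-size : length (list LD) + t * ψ₁ ≡ suc t * ψ₀
  D-size = trans (cong (λ z → length (list LD) + t * z) (sym (cong₂ S2 (shift₁ (suc (suc M))) (shift₁ b))))
    (trans (length-D k₂ t t<n (t<k 2≤b)) (cong (suc t *_) (cong₂ S2 n∸t (m+n∸m≡n t b))))

  xs zs : List (Fin n)
  xs = below t
  zs = between t k₂

  xs-size : length xs ≡ t
  xs-size = below-length (≤-trans (n≤1+n t) t<n)

  zs-size : length zs ≡ b
  zs-size = between-length t b (<⇒≤ k₂<n)

  xz≤k : length xs + length zs ≤ k₁
  xz≤k = ≤-trans (≤-reflexive (cong₂ _+_ xs-size zs-size)) (+-monoʳ-≤ t b≤a)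

  f-at : ∀ j → Levels.f {n} k₁ (t + j) ≡ S2 (suc (suc M) ∸ j) (a ∸ j)
  f-at j = cong₂ S2 (shift (suc (suc M)) j) (shift a j)

  f-suc : Levels.f {n} k₁ (suc t) ≡ φ
  f-suc = cong₂ S2 (shift₁ (suc (suc M))) (shift₁ a)

  f-2+ : Levels.f {n} k₁ (suc (suc t)) ≡ φ₂
  f-2+ = trans (cong (Levels.f {n} k₁) (+-comm 2 t)) (f-at 2)

  A-lower : b * φ ≤ length (list LA) + b * b * φ₂
  A-lower = subst₂ (λ u v → b * u ≤ length (list LA) + b * b * v) f-suc f-2+
    (subst₂ (λ u v → u * Levels.f {n} k₁ (suc v) ≤ length (list LA) + u * u * Levels.f {n} k₁ (suc (suc v))) zs-size xs-size
      (Levels.countA-lower {n} k₁ xs zs (below-between t k₂) xz≤k))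

  A-alternating : + length (list LA) ≡ alternating b b (λ j → + Stirling (suc (suc M) ∸ j) (a ∸ j))
  A-alternating = trans (countA-alternating {n} k₁ xs zs (below-between t k₂) xz≤k)
    (trans (cong₂ (λ u v → alternating u u (λ j → + Levels.f {n} k₁ (v + j))) zs-size xs-size)
      (sumFrom1-cong b λ j lt → cong (λ z → sign j ℤ.* + (b C suc j) ℤ.* + z)
        (trans (f-at (suc j)) (sym (Stirling-S2 (suc (suc M) ∸ suc j) (a ∸ suc j) (m<n⇒0<n∸m (≤-trans (s≤s lt) (≤-trans (s≤s b≤a) a<N))))))))

  cong₃ : ∀ {A : Set} (g : ℕ → ℕ → ℕ → A) {x x′ y y′ z z′} → x ≡ x′ → y ≡ y′ → z ≡ z′ → g x y z ≡ g x′ y′ z′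
  cong₃ g refl refl refl = refl

  bound1≡ : bound1 n k₁ k₂ t ≡ + B₁
  bound1≡ = trans (cong₃ (λ b a N → alternating b b (λ j → + Stirling (N ∸ j) (a ∸ j)) ℤ.* (+ Stirling N b ℤ.+ + t)) (m+n∸m≡n t b) (m+n∸m≡n t a) n∸t)
    (trans (cong₂ ℤ._*_ (sym A-alternating) (trans (cong (λ z → + z ℤ.+ + t) (Stirling-S2 (suc (suc M)) b (s≤s z≤n))) (cong +_ (sym B-size))))
      (sym (ℤₚ.pos-* (length (list LA)) (length (list LB)))))

  bound2≡ : bound2 n k₁ k₂ t ≡ + B₂
  bound2≡ = trans (cong₃ (λ b a N → + Stirling (N ∸ 1) (a ∸ 1) ℤ.* (+ ((t + 1) * Stirling N b) ℤ.- + (t * Stirling (N ∸ 1) (b ∸ 1)))) (m+n∸m≡n t b) (m+n∸m≡n t a) n∸t)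
    (trans (cong₃ (λ u v w → + u ℤ.* (+ ((t + 1) * v) ℤ.- + (t * w))) (Stirling-S2 (suc M) (a ∸ 1) (s≤s z≤n)) (Stirling-S2 (suc (suc M)) b (s≤s z≤n)) (Stirling-S2 (suc M) (b ∸ 1) (s≤s z≤n)))
      (trans (cong₂ (λ u v → + u ℤ.* v) (sym C-size) diff) (sym (ℤₚ.pos-* (length (list LC)) (length (list LD))))))
    where
    l : ∀ x y → (x ℤ.+ y) ℤ.- y ≡ x
    l = ℤ-Solver.solve-∀
    diff : + ((t + 1) * ψ₀) ℤ.- + (t * ψ₁) ≡ + length (list LD)
    diff = trans (cong (λ z → + z ℤ.- + (t * ψ₁)) (trans (cong (_* ψ₀) (+-comm t 1)) (sym D-size))) (l (+ length (list LD)) (+ (t * ψ₁)))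

  1≤φ : 1 ≤ φ
  1≤φ = positive 2≤a ≤-refl

  1≤ψ₀ : 1 ≤ ψ₀
  1≤ψ₀ = ≤-trans (*-mono-≤ {1} {c * c} (*-mono-≤ 1≤c 1≤c) (positive 2≤b b≤a)) (top-ratio 2≤b b≤a)

  -- `next-ratio` starts at `a = 3`. For `a = 2` the left side vanishes, because `S2 M 0 = 0` for
  -- positive `M`.
  c-ratio : c * c * φ₂ ≤ φ
  c-ratio = go (3 ≤? a)
    where
    bnd≡ : ∀ {m} → 3 ≤ m → bnd M (m ∸ 2) ≡ S2 M (m ∸ 2)
    bnd≡ {suc (suc (suc m))} _ = refl
    bnd≡ {suc (suc zero)} (s≤s (s≤s ()))
    bnd≡ {suc zero} (s≤s ())
    Mpos : ∀ m → 1 ≤ m → S2 m 0 ≡ 0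
    Mpos (suc m) _ = refl
    go : Dec (3 ≤ a) → c * c * φ₂ ≤ φ
    go (yes 3≤a) = subst (λ z → c * c * z ≤ φ) (bnd≡ 3≤a) (next-ratio 3≤a ≤-refl)
    go (no ¬3) = ≤-trans (≤-reflexive (trans (cong (λ z → c * c * S2 M (z ∸ 2)) (≤-antisym (≤-pred (≰⇒> ¬3)) 2≤a))
      (trans (cong (c * c *_) (Mpos M (≤-pred (≤-trans (s≤s (≤-trans (s≤s z≤n) 2≤a)) a≤M)))) (*-zeroʳ (c * c))))) z≤n

  t≤c : ∀ {m} → m ≤ a → suc t * suc m ≤ c
  t≤c le = *-monoʳ-≤ (suc t) (s≤s le)

  below₁ : Small (length 𝓕₁) (length 𝓕₂) b 1 (φ * ψ₀) → prod < B₁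
  below₁ s = subst (λ z → prod < length (list LA) * z) (sym B-size) (below-A {φ₂ = φ₂} {c = c * c} t s A-lower
    (≤-trans (*-monoʳ-≤ 4 (*-mono-≤ (n≤1+n b) (n≤1+n b))) (four-squares 1≤t (t≤c b≤a))) c-ratio)

  lift₂ : ∀ {p} → p + φ * (t * ψ₁) < φ * (suc t * ψ₀) → p < B₂
  lift₂ {p} lt = +-cancelʳ-< (φ * (t * ψ₁)) _ _ (≤-trans lt (≤-reflexive (begin-equality
    φ * (suc t * ψ₀) ≡⟨ cong (φ *_) (sym D-size) ⟩
    φ * (length (list LD) + t * ψ₁) ≡⟨ *-distribˡ-+ φ (length (list LD)) (t * ψ₁) ⟩
    φ * length (list LD) + φ * (t * ψ₁) ≡⟨ cong (λ z → z * length (list LD) + φ * (t * ψ₁)) (sym C-size) ⟩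
    B₂ + φ * (t * ψ₁) ∎)))

  below₂ : Small (length 𝓕₁) (length 𝓕₂) (suc t) 1 (φ * ψ₀) → prod < B₂
  below₂ s = lift₂ (below-C {φ = φ} s (begin
    4 * (t * ψ₁) ≡⟨ sym (*-assoc 4 t ψ₁) ⟩
    4 * t * ψ₁ ≤⟨ *-monoˡ-≤ ψ₁ (≤-trans (*-monoˡ-≤ t (m≤m+n 4 12)) (≤-trans (*-monoʳ-≤ 16 (m≤m*n t b {{>-nonZero (≤-trans (s≤s z≤n) 2≤b)}})) (<⇒≤ (sixteen 1≤t 2≤b (t≤c b≤a))))) ⟩
    c * c * ψ₁ ≤⟨ top-ratio 2≤b b≤a ⟩
    ψ₀ ∎))

  1≤C : 1 ≤ length (list LC)
  1≤C = subst (1 ≤_) (sym C-size) 1≤φ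

  zero-small : ∀ {w} → 2 ≤ w → prod ≡ 0 → Small (length 𝓕₁) (length 𝓕₂) w 1 (φ * ψ₀)
  zero-small 2≤w e = small-≤ {φ = 1} {φ * ψ₀} (≤-trans (≤-reflexive e) z≤n) 2≤w ≤-refl (*-mono-≤ {1} {φ} 1≤φ 1≤ψ₀)

  1≤B : ∀ {x y z} → x < y * z → 1 ≤ y × 1 ≤ z
  1≤B {x} {zero} ()
  1≤B {x} {suc y} {zero} lt = ⊥-elim (n≮0 (subst (x <_) (*-zeroʳ (suc y)) lt))
  1≤B {x} {suc y} {suc z} _ = s≤s z≤n , s≤s z≤n

  -- An impossibly small "product" of 0 shows that both factors of each bound are positive.
  empty-small : ∀ {w} → 2 ≤ w → Small 0 0 w 1 (φ * ψ₀)
  empty-small 2≤w = small-≤ {φ = 1} {φ * ψ₀} z≤n 2≤w ≤-refl (*-mono-≤ {1} {φ} 1≤φ 1≤ψ₀)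

  pos₁ : 1 ≤ length (list LA) × 1 ≤ length (list LB)
  pos₁ = 1≤B (subst (λ z → 0 < length (list LA) * z) (sym B-size) (below-A {0} {0} {φ₂ = φ₂} {c = c * c} t (empty-small 2≤b) A-lower
    (≤-trans (*-monoʳ-≤ 4 (*-mono-≤ (n≤1+n b) (n≤1+n b))) (four-squares 1≤t (t≤c b≤a))) c-ratio))

  1≤D : 1 ≤ length (list LD)
  1≤D = go (length (list LD)) D-size
    where
    tψ₁≤ψ₀ : t * ψ₁ ≤ ψ₀
    tψ₁≤ψ₀ = ≤-trans (*-monoˡ-≤ ψ₁ (≤-trans (≤-trans (m≤m*n t b {{>-nonZero (≤-trans (s≤s z≤n) 2≤b)}}) (m≤n*m (t * b) 16)) (<⇒≤ (sixteen 1≤t 2≤b (t≤c b≤a))))) (top-ratio 2≤b b≤a)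
    go : ∀ D → D + t * ψ₁ ≡ suc t * ψ₀ → 1 ≤ D
    go zero e = ⊥-elim (<⇒≱ (m<m+n ψ₀ (*-mono-≤ {1} {t} 1≤t 1≤ψ₀)) (≤-trans (≤-reflexive (sym e)) tψ₁≤ψ₀))
    go (suc D) _ = s≤s z≤n

  IsoAB IsoBA IsoCD IsoDC : Set
  IsoAB = Iso 𝓕₁ 𝓕₂ (𝓐 k₁ k₂ t) (𝓑 k₂ t)
  IsoBA = k₁ ≡ k₂ × Iso 𝓕₁ 𝓕₂ (𝓑 k₁ t) (𝓐 k₂ k₁ t)
  IsoCD = Iso 𝓕₁ 𝓕₂ (𝓒 k₁ t) (𝓓 k₂ t)
  IsoDC = k₁ ≡ k₂ × Iso 𝓕₁ 𝓕₂ (𝓓 k₁ t) (𝓒 k₂ t)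

  iso-swap : ∀ {𝓕 𝓖 : List (Part n)} (A B : Part n → Set) → Iso 𝓕 𝓖 A B → Iso 𝓖 𝓕 B A
  iso-swap A B (σ , h , h′) = σ , h′ , h

  iso₁ : IsoAB ⊎ IsoBA → prod ≡ B₁
  iso₁ (inj₁ i) = iso-lengths (proj₁ fam₁) (proj₁ fam₂) LA LB i
  iso₁ (inj₂ (e , i)) = trans (*-comm (length 𝓕₁) (length 𝓕₂)) (iso-lengths (proj₁ fam₂) (proj₁ fam₁) LA LB
    (subst₂ (λ x y → Iso 𝓕₂ 𝓕₁ (𝓐 x y t) (𝓑 y t)) (sym e) e (iso-swap (𝓑 k₁ t) (𝓐 k₂ k₁ t) i)))

  iso₂ : IsoCD ⊎ IsoDC → prod ≡ B₂
  iso₂ (inj₁ i) = iso-lengths (proj₁ fam₁) (proj₁ fam₂) LC LD i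
  iso₂ (inj₂ (e , i)) = trans (*-comm (length 𝓕₁) (length 𝓕₂)) (iso-lengths (proj₁ fam₂) (proj₁ fam₁) LC LD
    (subst₂ (λ x y → Iso 𝓕₂ 𝓕₁ (𝓒 x t) (𝓓 y t)) (sym e) e (iso-swap (𝓓 k₁ t) (𝓒 k₂ t) i)))

  Attains : ℕ → Set → Set
  Attains B X = prod ≤ B × (prod ≡ B → X)

  strictly : ∀ {B X} → prod < B → Attains B X
  strictly lt = <⇒≤ lt , λ e → ⊥-elim (<⇒≱ lt (≤-reflexive (sym e)))

  from-AB : ∀ {m ℓ} {𝓕 𝓖 : List (Part n)} → m ≡ k₁ → ℓ ≡ b → IsFam m 𝓕 → IsFam (t + ℓ) 𝓖 → TypeA t ℓ 𝓕 𝓖 →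
    length 𝓕 * length 𝓖 ≤ B₁ × (length 𝓕 * length 𝓖 ≡ B₁ → Iso 𝓕 𝓖 (𝓐 k₁ k₂ t) (𝓑 k₂ t))
  from-AB refl refl fam fam′ ty = let σ , h , h′ = embed-A k₂<n fam fam′ ty in
    Embedded.product-≤ (proj₁ fam) (proj₁ fam′) LA LB σ h h′ , Embedded.product-≡⇒iso (proj₁ fam) (proj₁ fam′) LA LB σ h h′ (proj₁ pos₁) (proj₂ pos₁)

  from-CD : ∀ {m ℓ} {𝓕 𝓖 : List (Part n)} → m ≡ k₁ → ℓ ≡ k₂ → IsFam m 𝓕 → IsFam ℓ 𝓖 → TypeC t 𝓕 𝓖 →
    length 𝓕 * length 𝓖 ≤ B₂ × (length 𝓕 * length 𝓖 ≡ B₂ → Iso 𝓕 𝓖 (𝓒 k₁ t) (𝓓 k₂ t))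
  from-CD refl refl fam fam′ ty = let σ , h , h′ = embed-C fam fam′ ty in
    Embedded.product-≤ (proj₁ fam) (proj₁ fam′) LC LD σ h h′ , Embedded.product-≡⇒iso (proj₁ fam) (proj₁ fam′) LC LD σ h h′ 1≤C 1≤D

  module Nonempty {F₁ G₁} (F₁∈ : F₁ ∈ 𝓕₁) (G₁∈ : G₁ ∈ 𝓕₂) where

    case₁ : 2 + t ≤ b → Attains B₁ (IsoAB ⊎ IsoBA)
    case₁ t<b = read verdict
      where
      open Assemble 2≤b b≤a fam₁ fam₂ cross nontrivial F₁∈ G₁∈ {b} (≤-trans (n≤1+n _) t<b) ≤-refl (λ _ → ≤-trans (≤-trans (s≤s (s≤s 1≤t)) t<b) b≤a)
      read : Verdict → Attains B₁ (IsoAB ⊎ IsoBA)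
      read (below s) = strictly (below₁ s)
      read (isC le _) = ⊥-elim (<⇒≱ t<b le)
      read (isC′ _ le _) = ⊥-elim (<⇒≱ t<b le)
      read (isA _ ty) = let p , h = from-AB refl refl fam₁ fam₂ ty in p , inj₁ ∘ h
      read (isA′ a≡b _ ty) = let p , h = from-AB (cong (_+_ t) (sym a≡b)) refl fam₂ (subst (λ z → IsFam (t + z) 𝓕₁) a≡b fam₁) ty
                                 e = cong (_+_ t) a≡b in
        subst (_≤ B₁) (*-comm (length 𝓕₂) (length 𝓕₁)) p ,
        λ eq → inj₂ (e , subst₂ (λ x y → Iso 𝓕₁ 𝓕₂ (𝓑 x t) (𝓐 y x t)) (sym e) e (iso-swap (𝓐 k₁ k₂ t) (𝓑 k₂ t) (h (trans (*-comm (length 𝓕₂) (length 𝓕₁)) eq))))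

    case₂ : b ≤ suc t → ¬ (a ≡ suc t × b ≡ suc t) → ¬ (t ≡ 1 × a ≡ 3 × b ≡ 2) → Attains B₂ (IsoCD ⊎ IsoDC)
    case₂ b≤t a≢ ¬43 = read verdict
      where
      -- In the case of a tie, excluding k₁ = k₂ = 2t + 1 makes `a` strictly larger than `b`.
      a>b : suc t ≡ b → 2 + t ≤ a
      a>b e = ≤∧≢⇒< (subst (_≤ a) (sym e) b≤a) (λ e′ → a≢ (sym e′ , sym e))
      open Assemble 2≤b b≤a fam₁ fam₂ cross nontrivial F₁∈ G₁∈ {suc t} ≤-refl b≤t (λ e → ≤-trans (s≤s (s≤s 1≤t)) (a>b e))
      -- For `b = suc t` the pair (A, B) also reaches t + 1 units. Its first family is bounded to
      -- second order by `countA-second`, and `second-order` shows that the product stays below that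
      -- of (C, D).
      beaten : suc t ≡ b → TypeA t b 𝓕₁ 𝓕₂ → prod < B₂
      beaten e ty = lift₂ (+-cancelʳ-< (t * (φ₂ * (ψ₀ + t))) _ _ (begin-strict
        prod + φ * (t * ψ₁) + t * (φ₂ * (ψ₀ + t)) ≤⟨ +-monoˡ-≤ (t * (φ₂ * (ψ₀ + t))) (+-monoˡ-≤ (φ * (t * ψ₁)) (*-monoʳ-≤ (length 𝓕₁) size₂)) ⟩
        length 𝓕₁ * (ψ₀ + t) + φ * (t * ψ₁) + t * (φ₂ * (ψ₀ + t)) ≡⟨ l₁ (length 𝓕₁) (ψ₀ + t) (φ * (t * ψ₁)) t φ₂ ⟩
        (length 𝓕₁ + t * φ₂) * (ψ₀ + t) + φ * (t * ψ₁) ≤⟨ +-monoˡ-≤ (φ * (t * ψ₁)) (*-monoˡ-≤ (ψ₀ + t) size₁) ⟩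
        suc t * φ * (ψ₀ + t) + φ * (t * ψ₁) ≡⟨ l₂ t φ ψ₀ ψ₁ ⟩
        φ * (suc t * ψ₀) + t * (φ * (ψ₁ + suc t)) <⟨ +-monoʳ-< (φ * (suc t * ψ₀)) (*-monoʳ-< t {{>-nonZero 1≤t}} gap) ⟩
        φ * (suc t * ψ₀) + t * (φ₂ * (ψ₀ + t)) ∎))
        where
        t+2≤a : t + 2 ≤ a
        t+2≤a = ≤-trans (≤-reflexive (+-comm t 2)) (a>b e)
        4≤a : t ≡ 1 → 4 ≤ a
        4≤a t≡1 = ≤∧≢⇒< (subst (λ z → 2 + z ≤ a) t≡1 (a>b e)) (λ 3≡a → ¬43 (t≡1 , sym 3≡a , trans (sym e) (cong suc t≡1)))
        a+4≤c : a + 4 ≤ c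
        a+4≤c = ≤-trans (≤-trans (+-monoʳ-≤ a (s≤s (s≤s 2≤a))) (≤-reflexive (l a))) double≤c
          where
          l : ∀ a → a + suc (suc a) ≡ suc a + suc a
          l = solve-∀
        gap : φ * (ψ₁ + suc t) < φ₂ * (ψ₀ + t)
        gap = subst (λ z → φ * (S2 (suc M) (z ∸ 1) + suc t) < φ₂ * (S2 (suc (suc M)) z + t)) e
          (second-order t 1≤t t+2≤a 4≤a a+4≤c ≤-refl big)
        size₂ : length 𝓕₂ ≤ ψ₀ + t
        size₂ = let σ , h , h′ = embed-A k₂<n fam₁ fam₂ ty in subst (length 𝓕₂ ≤_) B-size (Embedded.le₂ (proj₁ fam₁) (proj₁ fam₂) LA LB σ h h′)
        open TypeA ty renaming (xs to us; zs to vs; uniq to uv-uniq)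
        in-A : length 𝓕₁ ≤ Levels.countA {n} k₁ us vs
        in-A = unique-⊆-length (proj₁ fam₁) λ {F} m → let cx , z , z∈ , bz = inF m in
          ∈-filterᵇ⁺ {p = λ F → hasAll (singles us) F ∧ Levels.hitAny {n} k₁ vs F} (∈-Πlist⁺ (proj₂ fam₁ m))
            (from (T-∧ {hasAll (singles us) F}) (contains⁺ {F = F} (singles us) cx , anyL⁺ z∈ (unBlk bz)))
        second : ∀ vs → length vs ≡ suc t → Unique (us ++ vs) → Levels.countA {n} k₁ us vs + t * φ₂ ≤ suc t * φ
        second (v ∷ vs) lv u = subst₂ (λ x y → Levels.countA {n} k₁ us (v ∷ vs) + t * x ≤ suc t * y) f-2+ f-suc
          (subst₂ (λ x y → Levels.countA {n} k₁ us (v ∷ vs) + x * Levels.f {n} k₁ (suc (suc y)) ≤ suc x * Levels.f {n} k₁ (suc y)) (suc-injective lv) xs-len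
            (Levels.countA-second {n} k₁ us v vs u (≤-trans (≤-reflexive (cong₂ _+_ xs-len lv)) (+-monoʳ-≤ t (≤-trans (n≤1+n _) (a>b e))))))
        size₁ : length 𝓕₁ + t * φ₂ ≤ suc t * φ
        size₁ = ≤-trans (+-monoˡ-≤ (t * φ₂) in-A) (second vs (trans zs-len (sym e)) uv-uniq)
        l₁ : ∀ F x y t g → F * x + y + t * (g * x) ≡ (F + t * g) * x + y
        l₁ = solve-∀
        l₂ : ∀ t φ ψ ψ′ → suc t * φ * (ψ + t) + φ * (t * ψ′) ≡ φ * (suc t * ψ) + t * (φ * (ψ′ + suc t))
        l₂ = solve-∀
      read : Verdict → Attains B₂ (IsoCD ⊎ IsoDC)
      read (below s) = strictly (below₂ s)
      read (isC _ ty) = let p , h = from-CD refl refl fam₁ fam₂ ty in p , inj₁ ∘ h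
      read (isC′ a≡b _ ty) = let e = cong (_+_ t) a≡b ; p , h = from-CD (sym e) e fam₂ fam₁ ty in
        subst (_≤ B₂) (*-comm (length 𝓕₂) (length 𝓕₁)) p ,
        λ eq → inj₂ (e , subst₂ (λ x y → Iso 𝓕₁ 𝓕₂ (𝓓 x t) (𝓒 y t)) (sym e) e (iso-swap (𝓒 k₁ t) (𝓓 k₂ t) (h (trans (*-comm (length 𝓕₂) (length 𝓕₁)) eq))))
      read (isA e ty) = strictly (beaten e ty)
      read (isA′ a≡b e _) = ⊥-elim (a≢ (trans a≡b (sym e) , sym e))

  -- The descent starts from a member of each family, so the product 0 is treated apart.
  by-members : ∀ {P : Set} → (prod ≡ 0 → P) → (∀ {F G} → F ∈ 𝓕₁ → G ∈ 𝓕₂ → P) → P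
  by-members z h = [ (λ e → z (cong (_* length 𝓕₂) e)) , (λ { (F , F∈) →
      [ (λ e → z (trans (cong (length 𝓕₁ *_) e) (*-zeroʳ (length 𝓕₁)))) , (λ { (G , G∈) → h F∈ G∈ }) ]′ (empty-or-member 𝓕₂) }) ]′ (empty-or-member 𝓕₁)

  part₁ : 2 + t ≤ b → (+ prod ℤ.≤ bound1 n k₁ k₂ t) × ((+ prod ≡ bound1 n k₁ k₂ t) ⇔ (IsoAB ⊎ IsoBA))
  part₁ t<b = let p , h = by-members (λ e → strictly (below₁ (zero-small 2≤b e))) (λ F∈ G∈ → Nonempty.case₁ F∈ G∈ t<b) in
    bounded bound1≡ p h iso₁

  part₂ : b ≤ suc t → ¬ (a ≡ suc t × b ≡ suc t) → ¬ (t ≡ 1 × a ≡ 3 × b ≡ 2) →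
    (+ prod ℤ.≤ bound2 n k₁ k₂ t) × ((+ prod ≡ bound2 n k₁ k₂ t) ⇔ (IsoCD ⊎ IsoDC))
  part₂ b≤t a≢ ¬43 = let p , h = by-members (λ e → strictly (below₂ (zero-small (s≤s 1≤t) e))) (λ F∈ G∈ → Nonempty.case₂ F∈ G∈ b≤t a≢ ¬43) in
    bounded bound2≡ p h iso₂

Conclusion : (n t k₁ k₂ : ℕ) → List (Part n) → List (Part n) → Set
Conclusion n t k₁ k₂ 𝓕₁ 𝓕₂ =
  ((2 * t + 2 ≤ k₂ → t + 1 + (k₁ ∸ t) * (k₂ ∸ t) ≤ n →
      (+ (length 𝓕₁ * length 𝓕₂) ℤ.≤ bound1 n k₁ k₂ t)
      × ((+ (length 𝓕₁ * length 𝓕₂) ≡ bound1 n k₁ k₂ t)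
         ⇔ (Iso 𝓕₁ 𝓕₂ (𝓐 k₁ k₂ t) (𝓑 k₂ t)
            ⊎ (k₁ ≡ k₂ × Iso 𝓕₁ 𝓕₂ (𝓑 k₁ t) (𝓐 k₂ k₁ t)))))
  × (k₂ ≤ 2 * t + 1 →
     ¬ (k₁ ≡ 2 * t + 1 × k₂ ≡ 2 * t + 1) → ¬ (k₁ ≡ 4 × k₂ ≡ 3) →
      (+ (length 𝓕₁ * length 𝓕₂) ℤ.≤ bound2 n k₁ k₂ t)
      × ((+ (length 𝓕₁ * length 𝓕₂) ≡ bound2 n k₁ k₂ t)
         ⇔ (Iso 𝓕₁ 𝓕₂ (𝓒 k₁ t) (𝓓 k₂ t)
            ⊎ (k₁ ≡ k₂ × Iso 𝓕₁ 𝓕₂ (𝓓 k₁ t) (𝓒 k₂ t))))))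

family⇒fam : ∀ {n k} {𝓕 : List (Part n)} → Family k 𝓕 → IsFam k 𝓕
family⇒fam (u , all) = u , λ m → InΠ⇒IsΠ (All.lookup all m)

nontrivial⇒ : ∀ {n t} (𝓕₁ 𝓕₂ : List (Part n)) → NonTrivial t 𝓕₁ 𝓕₂ → ∀ {X} → Unique X → length X ≡ t →
  (∀ {F} → F ∈ 𝓕₁ → Contains F X) → (∀ {G} → G ∈ 𝓕₂ → Contains G X) → ⊥
nontrivial⇒ {n} 𝓕₁ 𝓕₂ nt {X} u e h₁ h₂ = <⇒≱ nt (subst (_≤ commonAll 𝓕₁ 𝓕₂) e (unique-⊆-length {ys = filterᵇ p (allSubsets n)} u
  (λ {S} m → ∈-filterᵇ⁺ {p = p} (∈-allSubsets S) (allL⁺ {xs = 𝓕₁ ++ 𝓕₂} (λ F∈ → unBlk ([ (λ a → blk (h₁ a) m) , (λ a → blk (h₂ a) m) ]′ (∈-++⁻ 𝓕₁ F∈)))))))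
  where
  p : Subset n → Bool
  p S = allL (λ F → isBlock F S) (𝓕₁ ++ 𝓕₂)

-- The base and the exponent on the left are those of `Big` after rearrangement; on the right the
-- exponent n - 2(t + 1) is enlarged to n - (t + 1), which is M + 1.
large⇒big : ∀ t a M → LargeN (t + suc (suc M)) (t + a) t → Big (suc t * suc a) (suc M) a
large⇒big t a M (_ , h) = mkBig (begin
  (suc t * suc a) ^ (2 * suc a) ≡⟨ cong₂ (λ x y → (x * y) ^ (2 * y)) (+-comm 1 t) (trans (+-comm 1 a) (cong (_+ 1) (sym (m+n∸m≡n t a)))) ⟩
  ((t + 1) * (t + a ∸ t + 1)) ^ (2 * (t + a ∸ t + 1)) ≤⟨ h ⟩
  2 ^ (t + suc (suc M) ∸ 2 * (t + 1)) ≤⟨ ^-monoʳ-≤ 2 (∸-monoʳ-≤ (t + suc (suc M)) (m≤m+n (t + 1) (1 * (t + 1)))) ⟩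
  2 ^ (t + suc (suc M) ∸ (t + 1)) ≡⟨ cong (2 ^_) ([m+n]∸[m+o]≡n∸o t (suc (suc M)) 1) ⟩
  2 ^ suc M ∎)
  where open ≤-Reasoning

double-suc : ∀ t → 2 * t + 1 ≡ t + suc t
double-suc = solve-∀

double-2+ : ∀ t → 2 * t + 2 ≡ t + (2 + t)
double-2+ = solve-∀

-- Matching on the three equations writes `n`, `k₁` and `k₂` as sums with summand `t`, so that the
-- inequalities between them become inequalities between `a`, `b` and `t` by cancellation.
conclusion : ∀ t a b M {n k₁ k₂} → t + suc (suc M) ≡ n → t + a ≡ k₁ → t + b ≡ k₂ →
  1 ≤ t → k₂ ≤ k₁ → t + 2 ≤ k₂ → LargeN n k₁ t → (𝓕₁ 𝓕₂ : List (Part n)) → Family k₁ 𝓕₁ → Family k₂ 𝓕₂ →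
  CrossIntersecting t 𝓕₁ 𝓕₂ → NonTrivial t 𝓕₁ 𝓕₂ → Conclusion n t k₁ k₂ 𝓕₁ 𝓕₂
conclusion t a b M refl refl refl 1≤t k₂≤k₁ t+2≤k₂ large 𝓕₁ 𝓕₂ fam₁ fam₂ cross nt =
  (λ h _ → part₁ (+-cancelˡ-≤ t (2 + t) b (subst (_≤ t + b) (double-2+ t) h))) ,
  (λ h ≢₁ ≢₂ → part₂ (+-cancelˡ-≤ t b (suc t) (subst (t + b ≤_) (double-suc t) h))
    (λ { (e , e′) → ≢₁ (trans (cong (_+_ t) e) (sym (double-suc t)) , trans (cong (_+_ t) e′) (sym (double-suc t))) })
    (λ { (refl , refl , refl) → ≢₂ (refl , refl) }))
  where
  open Extremal t a b M 1≤t (+-cancelˡ-≤ t b a k₂≤k₁) (+-cancelˡ-≤ t 2 b t+2≤k₂) (large⇒big t a M large)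
    {𝓕₁} {𝓕₂} (family⇒fam fam₁) (family⇒fam fam₂) cross (nontrivial⇒ 𝓕₁ 𝓕₂ nt) using (part₁; part₂)

theorem1p5 : ∀ (n t k₁ k₂ : ℕ) →
    1 ≤ t → k₂ ≤ k₁ → t + 2 ≤ k₂ → LargeN n k₁ t →
    (𝓕₁ 𝓕₂ : List (Part n)) →
    Family k₁ 𝓕₁ → Family k₂ 𝓕₂ →
    CrossIntersecting t 𝓕₁ 𝓕₂ → NonTrivial t 𝓕₁ 𝓕₂ →
    ((2 * t + 2 ≤ k₂ → t + 1 + (k₁ ∸ t) * (k₂ ∸ t) ≤ n →
    (+ (length 𝓕₁ * length 𝓕₂) ℤ.≤ bound1 n k₁ k₂ t)
    × ((+ (length 𝓕₁ * length 𝓕₂) ≡ bound1 n k₁ k₂ t)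
    ⇔ (Iso 𝓕₁ 𝓕₂ (𝓐 k₁ k₂ t) (𝓑 k₂ t)
    ⊎ (k₁ ≡ k₂ × Iso 𝓕₁ 𝓕₂ (𝓑 k₁ t) (𝓐 k₂ k₁ t)))))
    × (k₂ ≤ 2 * t + 1 →
    ¬ (k₁ ≡ 2 * t + 1 × k₂ ≡ 2 * t + 1) → ¬ (k₁ ≡ 4 × k₂ ≡ 3) →
    (+ (length 𝓕₁ * length 𝓕₂) ℤ.≤ bound2 n k₁ k₂ t)
    × ((+ (length 𝓕₁ * length 𝓕₂) ≡ bound2 n k₁ k₂ t)
    ⇔ (Iso 𝓕₁ 𝓕₂ (𝓒 k₁ t) (𝓓 k₂ t)
    ⊎ (k₁ ≡ k₂ × Iso 𝓕₁ 𝓕₂ (𝓓 k₁ t) (𝓒 k₂ t))))))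
theorem1p5 n t k₁ k₂ 1≤t k₂≤k₁ t+2≤k₂ large =
  conclusion t (k₁ ∸ t) (k₂ ∸ t) (n ∸ (2 + t)) n≡ (m+[n∸m]≡n (≤-trans t≤k₂ k₂≤k₁)) (m+[n∸m]≡n t≤k₂) 1≤t k₂≤k₁ t+2≤k₂ large
  where
  t≤k₂ : t ≤ k₂
  t≤k₂ = ≤-trans (m≤m+n t 2) t+2≤k₂
  2+t≤n : 2 + t ≤ n
  2+t≤n = ≤-trans (slack t (l t)) (proj₁ large)
    where
    l : ∀ t → 2 + t + t ≡ 2 * (t + 1)
    l = solve-∀
  n≡ : t + suc (suc (n ∸ (2 + t))) ≡ n
  n≡ = trans (trans (+-suc t (suc (n ∸ (2 + t)))) (cong suc (+-suc t (n ∸ (2 + t))))) (m+[n∸m]≡n 2+t≤n)
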